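{- Fix a positive integer $\ell$. For all $k\ge 1$ and all $\mu\in\mathrm{Par}^k_\ell$ the Catalan functions $\mathfrak{s}^{(k)}_\mu:=H(\Delta^k(\mu);\mu)$ satisfy: (1) (horizontal dual Pieri rule) for all $d\ge 0$, $h_d^\perp \mathfrak{s}^{(k)}_\mu=\sum_{T\in \mathrm{SMT}^k_{(d)}(\mu)} t^{\mathrm{spin}(T)}\,\mathfrak{s}^{(k)}_{\mathrm{inside}(T)}$; (2) (vertical dual Pieri rule) for all $d\ge 0$, $e_d^\perp \mathfrak{s}^{(k)}_\mu=\sum_{T\in \mathrm{VSMT}^k_{(d)}(\mu)} t^{\mathrm{spin}(T)}\,\mathfrak{s}^{(k)}_{\mathrm{inside}(T)}$; (3) (shift invariance) $\mathfrak{s}^{(k)}_\mu=e_\ell^\perp\,\mathfrak{s}^{(k+1)}_{\mu+1^\ell}$, where $1^\ell=(1,\dots,1)\in\mathbb Z^\ell$; (4) (Schur function stability) if $k\ge|\mu|$, then $\mathfrak{s}^{(k)}_\mu=s_\mu$.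
   Context: $\Lambda$ is the ring of symmetric functions over $\mathbb{Q}(t)$ in $x=(x_1,x_2,\dots)$; $h_d,e_d$ are the complete homogeneous and elementary symmetric functions ($h_0=e_0=1$, $h_d=0$ for $d<0$). For $f\in\Lambda$, $f^\perp$ is the linear operator adjoint to multiplication by $f$ under the Hall inner product (for which Schur functions are orthonormal). For $\gamma\in\mathbb Z^\ell$, $s_\gamma:=\det(h_{\gamma_i+j-i})_{1\le i,j\le \ell}$. Let $\Delta^+_\ell=\{(i,j):1\le i<j\le\ell\}$. For $\Psi\subset\Delta^+_\ell$ and $\gamma\in\mathbb Z^\ell$ the Catalan function $H(\Psi;\gamma)=\prod_{(i,j)\in\Psi}(1-tR_{ij})^{ -1}s_\gamma$ is defined by expanding $\prod_{(i,j)\in\Psi}(1-tz_i/z_j)^{ -1}z^\gamma$ as a power series in $t$ with Laurent polynomial coefficients and applying coefficientwise the linear map $z^\beta\mapsto s_\beta$; the result lies in $\Lambda$. $\mathrm{Par}^k_\ell=\{\mu\in\mathbb Z^\ell: k\ge\mu_1\ge\dots\ge\mu_\ell\ge0\}$; $\mathrm{Par}^k$ is the set of partitions with largest part $\le k$, and a partition with at most $\ell$ nonzero parts is identified with an element of $\mathbb Z^\ell$ by appending zeros. For $\mu\in\mathbb Z^\ell$, $\Delta^k(\mu)=\{(i,j)\in\Delta^+_\ell: k-\mu_i+i<j\}$. Strong marked tableaux: partitions are drawn in English notation; the hook length of a box counts the boxes below it in its column and weakly right of it in its row. A $(k+1)$-core is a partition with no box of hook length $k+1$. For a $(k+1)$-core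 $\kappa$, $\mathfrak p(\kappa)$ is the partition whose $r$-th part is the number of boxes in row $r$ of $\kappa$ with hook length $\le k$; $\mathfrak p$ is a bijection from $(k+1)$-cores to $\mathrm{Par}^k$. A strong cover $\tau\Rightarrow\kappa$ is a pair of $(k+1)$-cores with $\tau\subset\kappa$ and $|\mathfrak p(\tau)|+1=|\mathfrak p(\kappa)|$. A strong marked cover $\tau\xRightarrow{r}\kappa$ is a strong cover together with a positive integer $r$ which is the smallest row index of some connected component of $\kappa/\tau$. Its spin is $c(h-1)+N$, where $c$ is the number of connected components of $\kappa/\tau$, $h$ the number of rows of each component (all components have the same height), and $N$ the number of components entirely contained in rows $>r$. For $\eta\in\mathbb Z^\infty_{\ge0}$ with $m=|\eta|$ finite, a strong marked tableau of weight $\eta$ is a sequence $T=(\kappa^{(0)}\xRightarrow{r_1}\kappa^{(1)}\xRightarrow{r_2}\cdots\xRightarrow{r_m}\kappa^{(m)})$ of strong marked covers with $r_{v_i+1}\ge r_{v_i+2}\ge\dots\ge r_{v_i+\eta_i}$ for all $i$, where $v_i=\eta_1+\dots+\eta_{i-1}$; a vertical strong marked tableau is defined the same way but with $r_{v_i+1}<r_{v_i+2}<\dots<r_{v_i+\eta_i}$. Set $\mathrm{inside}(T)=\mathfrak p(\kappa^{(0)})$, $\mathrm{outside}(T)=\mathfrak p(\kappa^{(m)})$, $\mathrm{spin}(T)$ = sum of spins of its covers. $\mathrm{SMT}^k_\eta(\mu)$ (resp. $\mathrm{VSMT}^k_\eta(\mu)$) is the set of strong marked tableaux (resp. vertical strong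 marked tableaux) of weight $\eta$ with $\mathrm{outside}(T)=\mu$. -}

module Defs where

open import Data.Nat using (ℕ; zero; suc; _+_; _*_; _∸_; _≡ᵇ_; _<ᵇ_; _≤ᵇ_; _⊓_; _⊔_; _%_)
open import Relation.Nullary.Decidable using (does)
open import Data.Integer as ℤ using (ℤ; +_; -[1+_])
open import Data.Bool using (Bool; true; false; _∧_; _∨_; not; if_then_else_)
open import Data.List using (List; []; _∷_; _++_; map; concatMap; length; foldr; replicate; upTo; zipWith)
open import Data.Product using (_×_; _,_; proj₁; proj₂)

-- The ring Λ_ℤ = ℤ[h₁,h₂,…] (free polynomial ring in the h_d).
-- Elements are represented by formal expressions; they are only ever
-- compared through the Hall inner product (which is nondegenerate), so
-- no normal form is needed.

data Sym : Set where
  hh  : ℤ → Sym            -- h_d  (h₀ = 1, h_d = 0 for d < 0)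
  lit : ℤ → Sym
  _⊕_ : Sym → Sym → Sym
  _⊗_ : Sym → Sym → Sym

infixl 6 _⊕_
infixl 7 _⊗_

sum : List ℕ → ℕ
sum = foldr _+_ 0

all : {A : Set} → (A → Bool) → List A → Bool
all p = foldr (λ x b → p x ∧ b) true

any : {A : Set} → (A → Bool) → List A → Bool
any p = foldr (λ x b → p x ∨ b) false

sumSym : List Sym → Sym
sumSym = foldr _⊕_ (lit (+ 0))

expand : Sym → List (ℤ × List ℕ)
expand (hh (+ zero))  = (+ 1 , []) ∷ []
expand (hh (+ suc n)) = (+ 1 , suc n ∷ []) ∷ []
expand (hh -[1+ n ])  = []
expand (lit a)        = (a , []) ∷ []
expand (x ⊕ y)        = expand x ++ expand y
expand (x ⊗ y)        =
  concatMap (λ p → map (λ q → (proj₁ p ℤ.* proj₁ q , proj₂ p ++ proj₂ q)) (expand y)) (expand x)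

bounded : ℕ → List ℕ → List (List ℕ)
bounded r []       = if r ≡ᵇ 0 then [] ∷ [] else []
bounded r (v ∷ vs) = concatMap (λ a → map (a ∷_) (bounded (r ∸ a) vs)) (upTo (suc (r ⊓ v)))

matCount : List ℕ → List ℕ → ℕ
matCount []      ν = if all (λ v → v ≡ᵇ 0) ν then 1 else 0
matCount (r ∷ λ') ν = sum (map (λ c → matCount λ' (zipWith _∸_ ν c)) (bounded r ν))

-- Hall inner product:  ⟨h_λ , h_ν⟩ = #{ℕ-matrices with row sums λ, column sums ν}
-- (equivalently ⟨h_λ, m_ν⟩ = δ; Schur functions are orthonormal for it)
⟪_,_⟫ : Sym → Sym → ℤ
⟪ f , g ⟫ = foldr ℤ._+_ (+ 0)
  (concatMap (λ p → map (λ q → proj₁ p ℤ.* proj₁ q ℤ.* (+ matCount (proj₂ p) (proj₂ q))) (expand g)) (expand f))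

-- Jacobi–Trudi:  s_γ = det (h_{γ_i + j - i})  for γ ∈ ℤ^ℓ

removeAt : {A : Set} → ℕ → List A → List A
removeAt _       []       = []
removeAt zero    (x ∷ xs) = xs
removeAt (suc n) (x ∷ xs) = x ∷ removeAt n xs

indexed : {A : Set} → List A → List (ℕ × A)
indexed = go 0
  where
    go : {A : Set} → ℕ → List A → List (ℕ × A)
    go n []       = []
    go n (x ∷ xs) = (n , x) ∷ go (suc n) xs

sgn : ℕ → ℤ
sgn n = if (n % 2) ≡ᵇ 0 then + 1 else ℤ.- (+ 1)

detN : ℕ → List (List Sym) → Sym
detN zero    _            = lit (+ 1)
detN (suc n) []           = lit (+ 1)
detN (suc n) (row ∷ rows) = sumSym (map (λ p → lit (sgn (proj₁ p)) ⊗ proj₂ p ⊗ detN n (map (removeAt (proj₁ p)) rows)) (indexed row))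

det : List (List Sym) → Sym
det m = detN (length m) m

schur : List ℤ → Sym
schur γ = det (map (λ p → map (λ j → hh (proj₂ p ℤ.+ (+ j) ℤ.- (+ proj₁ p))) (upTo (length γ))) (indexed γ))

eSym : ℕ → Sym
eSym d = schur (replicate d (+ 1))

-- Catalan functions  H(Ψ;γ) = ∏_{(i,j)∈Ψ} (1 - t R_ij)^{-1} s_γ,
-- described by their coefficient of t^m (an element of Λ_ℤ).
-- Roots (i,j) are 1-indexed.

distrib : ℕ → ℕ → List (List ℕ)
distrib zero    m = if m ≡ᵇ 0 then [] ∷ [] else []
distrib (suc n) m = concatMap (λ a → map (a ∷_) (distrib n (m ∸ a))) (upTo (suc m))

addAt : ℕ → ℤ → List ℤ → List ℤ
addAt _       a []       = []
addAt zero    a (x ∷ xs) = (x ℤ.+ a) ∷ xs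
addAt (suc n) a (x ∷ xs) = x ∷ addAt n a xs

raise : ℕ × ℕ → ℕ → List ℤ → List ℤ
raise (i , j) a γ = addAt (j ∸ 1) (ℤ.- (+ a)) (addAt (i ∸ 1) (+ a) γ)

raiseAll : List (ℕ × ℕ) → List ℕ → List ℤ → List ℤ
raiseAll (r ∷ rs) (a ∷ as) γ = raiseAll rs as (raise r a γ)
raiseAll _        _        γ = γ

catalanCoeff : List (ℕ × ℕ) → List ℤ → ℕ → Sym
catalanCoeff Ψ γ m = sumSym (map (λ ns → schur (raiseAll Ψ ns γ)) (distrib (length Ψ) m))

nth : List ℕ → ℕ → ℕ
nth []       _       = 0
nth (x ∷ xs) zero    = x
nth (x ∷ xs) (suc n) = nth xs n

Delta : ℕ → List ℕ → List (ℕ × ℕ)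
Delta k μ = concatMap (λ i → concatMap (λ j →
    if (i <ᵇ j) ∧ does (((+ k) ℤ.- (+ nth μ (i ∸ 1)) ℤ.+ (+ i)) ℤ.<? (+ j))
    then (i , j) ∷ [] else []) range) range
  where
    range = map suc (upTo (length μ))

kschurCoeff : ℕ → List ℕ → ℕ → Sym
kschurCoeff k μ m = catalanCoeff (Delta k μ) (map +_ μ) m

-- Partitions, hooks, cores, the map 𝔭
-- Partitions are lists of positive parts; rows/columns are 0-indexed
-- internally, row indices in markings are 1-indexed as in the paper.

isPartitionB : List ℕ → Bool
isPartitionB []           = true
isPartitionB (a ∷ [])     = not (a ≡ᵇ 0)
isPartitionB (a ∷ b ∷ xs) = (b ≤ᵇ a) ∧ isPartitionB (b ∷ xs)

filterB : {A : Set} → (A → Bool) → List A → List A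
filterB p = foldr (λ x ys → if p x then x ∷ ys else ys) []

count : {A : Set} → (A → Bool) → List A → ℕ
count p xs = foldr (λ x n → if p x then suc n else n) 0 xs

hook : List ℕ → ℕ → ℕ → ℕ
hook λ' r c = suc ((nth λ' r ∸ suc c) + count (λ p → (r <ᵇ proj₁ p) ∧ (c <ᵇ proj₂ p)) (indexed λ'))

boxes : List ℕ → List (ℕ × ℕ)
boxes λ' = concatMap (λ p → map (λ c → (proj₁ p , c)) (upTo (proj₂ p))) (indexed λ')

isCoreB : ℕ → List ℕ → Bool
isCoreB n κ = isPartitionB κ ∧ all (λ b → not (hook κ (proj₁ b) (proj₂ b) ≡ᵇ n)) (boxes κ)

𝔭 : ℕ → List ℕ → List ℕ
𝔭 k κ = map (λ p → count (λ c → hook κ (proj₁ p) c ≤ᵇ k) (upTo (proj₂ p))) (indexed κ)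

size : List ℕ → ℕ
size = sum

-- append zeros up to length ℓ (identification of partitions with ℤ^ℓ / ℕ^ℓ)
pad : ℕ → List ℕ → List ℕ
pad ℓ xs = xs ++ replicate (ℓ ∸ length xs) 0

stripZeros : List ℕ → List ℕ
stripZeros xs = foldr (λ a ys → if a ≡ᵇ 0 then ys else a ∷ ys) [] xs

boundedVecs : List ℕ → List (List ℕ)
boundedVecs []       = [] ∷ []
boundedVecs (a ∷ as) = concatMap (λ b → map (b ∷_) (boundedVecs as)) (upTo (suc a))

weaklyDecB : List ℕ → Bool
weaklyDecB []           = true
weaklyDecB (a ∷ [])     = true
weaklyDecB (a ∷ b ∷ xs) = (b ≤ᵇ a) ∧ weaklyDecB (b ∷ xs)

strictlyIncB : List ℕ → Bool
strictlyIncB []           = true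
strictlyIncB (a ∷ [])     = true
strictlyIncB (a ∷ b ∷ xs) = (a <ᵇ b) ∧ strictlyIncB (b ∷ xs)

subPartitions : List ℕ → List (List ℕ)
subPartitions κ = map stripZeros (filterB weaklyDecB (boundedVecs κ))

-- strong cover τ ⇒ κ (τ ⊂ κ assumed): both (k+1)-cores and |𝔭 τ| + 1 = |𝔭 κ|
isStrongCoverB : ℕ → List ℕ → List ℕ → Bool
isStrongCoverB k τ κ = isCoreB (suc k) τ ∧ isCoreB (suc k) κ ∧ (suc (size (𝔭 k τ)) ≡ᵇ size (𝔭 k κ))

skewCells : List ℕ → List ℕ → List (ℕ × ℕ)
skewCells κ τ = filterB (λ b → nth τ (proj₁ b) ≤ᵇ proj₂ b) (boxes κ)

absDiff : ℕ → ℕ → ℕ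
absDiff a b = (a ∸ b) + (b ∸ a)

adjacentB : ℕ × ℕ → ℕ × ℕ → Bool
adjacentB (r , c) (r' , c') =
  ((r ≡ᵇ r') ∧ (absDiff c c' ≡ᵇ 1)) ∨ ((c ≡ᵇ c') ∧ (absDiff r r' ≡ᵇ 1))

closure : ℕ → List (ℕ × ℕ) → List (ℕ × ℕ) → List (ℕ × ℕ) × List (ℕ × ℕ)
closure zero    comp rest = comp , rest
closure (suc n) comp rest =
  closure n (comp ++ filterB (λ x → any (adjacentB x) comp) rest)
            (filterB (λ x → not (any (adjacentB x) comp)) rest)

componentsN : ℕ → List (ℕ × ℕ) → List (List (ℕ × ℕ))
componentsN zero    _        = []
componentsN (suc n) []       = []
componentsN (suc n) (x ∷ xs) =
  proj₁ (closure (length xs) (x ∷ []) xs) ∷ componentsN n (proj₂ (closure (length xs) (x ∷ []) xs))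

components : List ℕ → List ℕ → List (List (ℕ × ℕ))
components κ τ = componentsN (length (skewCells κ τ)) (skewCells κ τ)

minimum : List ℕ → ℕ
minimum []       = 0
minimum (x ∷ xs) = foldr _⊓_ x xs

maximum : List ℕ → ℕ
maximum = foldr _⊔_ 0

topRow : List (ℕ × ℕ) → ℕ
topRow C = suc (minimum (map proj₁ C))

height : List (ℕ × ℕ) → ℕ
height C = suc (maximum (map proj₁ C) ∸ minimum (map proj₁ C))

spin : List ℕ → List ℕ → ℕ → ℕ
spin κ τ r = go (components κ τ)
  where
    go : List (List (ℕ × ℕ)) → ℕ
    go []        = 0
    go (C ∷ Cs)  = length (C ∷ Cs) * (height C ∸ 1) + count (λ D → r <ᵇ topRow D) (C ∷ Cs)

markedCovers : ℕ → List ℕ → List (List ℕ × ℕ × ℕ)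
markedCovers k κ =
  concatMap (λ τ → map (λ C → τ , topRow C , spin κ τ (topRow C)) (components κ τ))
    (filterB (λ τ → isStrongCoverB k τ κ) (subPartitions κ))

-- all chains κ⁽⁰⁾ ⇒_{r₁} ⋯ ⇒_{r_d} κ⁽ᵈ⁾ = κ of strong marked covers,
-- recorded as (κ⁽⁰⁾ , (r₁ , … , r_d) , total spin)
Tableau : Set
Tableau = List ℕ × List ℕ × ℕ

chains : ℕ → ℕ → List ℕ → List Tableau
chains k zero    κ = (κ , [] , 0) ∷ []
chains k (suc d) κ =
  concatMap (λ c → map (λ T → proj₁ T , proj₁ (proj₂ T) ++ (proj₁ (proj₂ c) ∷ []) , proj₂ (proj₂ T) + proj₂ (proj₂ c))
                       (chains k d (proj₁ c)))
    (markedCovers k κ)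

-- SMT^k_{(d)}(κ) : weight (d) means r₁ ≥ r₂ ≥ ⋯ ≥ r_d
SMT : ℕ → ℕ → List ℕ → List Tableau
SMT k d κ = filterB (λ T → weaklyDecB (proj₁ (proj₂ T))) (chains k d κ)

VSMT : ℕ → ℕ → List ℕ → List Tableau
VSMT k d κ = filterB (λ T → strictlyIncB (proj₁ (proj₂ T))) (chains k d κ)

inside : ℕ → Tableau → List ℕ
inside k T = 𝔭 k (proj₁ T)

spinT : Tableau → ℕ
spinT T = proj₂ (proj₂ T)

-- ⟨ [t^m] Σ_T t^{spin T} 𝔰^{(k)}_{inside T} , x ⟩   (inside padded to length ℓ)
pieriRHS : ℕ → ℕ → List Tableau → ℕ → Sym → ℤ
pieriRHS ℓ k Ts m x = foldr ℤ._+_ (+ 0)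
  (map (λ T → if spinT T ≤ᵇ m then ⟪ kschurCoeff k (pad ℓ (inside k T)) (m ∸ spinT T) , x ⟫ else + 0) Ts)

InParB : ℕ → ℕ → List ℕ → Bool
InParB k ℓ μ = (length μ ≡ᵇ ℓ) ∧ weaklyDecB μ ∧ all (λ a → a ≤ᵇ k) μ

-- Pairing with x turns e_d^⊥ s_γ into the sum of s_{γ - ε_S} over the d-element sets S of rows, so e_d^⊥ acts on a
-- Catalan function by lowering its weight.  When the weight is lowered in row z, the relation s_γ' = - s_γ for
-- γ' = (…, γ_{a+1} - 1, γ_a + 1, …) and the recursion on the root (i , i + k + 1 - μ_i) move the missing box along
-- the rows w → w + k + 1 - μ_w; what survives is, for every row w from which h boxes can be removed consistently, the
-- k-Schur function of the residue of the core obtained by removing ribbons of height h, one in each row of the orbit of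
-- w, and the power of t is the spin.  That these removals are exactly the strong covers is seen on Maya diagrams.
-- The vertical rule follows by peeling off the marks from the last one on.  The horizontal rule follows from it by
-- Σ (-1)^i e_{d-i} h_i = 0, because the words that decrease weakly and then increase strictly cancel in pairs.
module Submission where

-- For a fixed `x` everything happens in functionals of the weight such as `⟪ s_γ , x ⟫`; they
-- change sign under straightening and vanish when a tail of γ has negative sum, which disposes of
-- empty rows. The obstacle is that exchanging two neighbouring rows is incompatible with having
-- lowered only one of them. The subsets S are therefore sorted by their largest row z: the weight
-- is lowered at z, while the rest of S, a subset of [0, z), is absorbed into the functional. The
-- new functional still alternates at every pair of rows except (z - 1, z), and the straightening
-- avoids that pair: its pairs start at w or later, or lie strictly between two consecutive rows of
-- the orbit of w, and z belongs to this orbit. The same recursion over z yields the marks: z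
-- becomes the last one, and the rest of S can only produce smaller ones. That there are no other
-- strong covers amounts to this: of two nested cores, the larger always has a removal that still
-- contains the smaller. It is proved by counting beads in translates by multiples of k + 1; since a
-- removal lowers the size of the residue by exactly one, nothing fits in between.

open import Defs
open import Data.Bool using (Bool; true; false; _∧_; if_then_else_; not; T)
open import Data.Bool.Properties using (T-∨; ∧-identityʳ; ∧-assoc)
open import Data.Empty using (⊥-elim; ⊥)
open import Data.Integer as ℤ using (ℤ; +_; -[1+_])
open import Data.List as List using (List; []; _∷_; _++_; map; concatMap; foldr; upTo; applyUpTo; zipWith; length; replicate; filter; cartesianProduct; take)
open import Data.List.Membership.Propositional using (_∈_; _∉_; find; lose)
open import Data.List.Membership.Propositional.Properties using (∈-filter⁺; ∈-filter⁻; ∈-cartesianProduct⁺; ∈-cartesianProduct⁻; ∈-upTo⁺; ∈-upTo⁻; ∈-map⁺; ∈-map⁻; ∈-++⁺ˡ; ∈-++⁺ʳ; ∈-++⁻; ∈-concatMap⁺; ∈-concatMap⁻)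
open import Data.List.Membership.Propositional.Properties.WithK using (unique∧set⇒bag)
open import Data.List.Properties using (map-∘; map-cong; length-map; ++-assoc; length-++; length-replicate; ++-identityʳ; ∷-injectiveˡ; ∷-injectiveʳ; ≡-dec; map-++; filter-++)
open import Data.List.Relation.Binary.BagAndSetEquality using (∼bag⇒↭)
open import Data.List.Relation.Binary.Permutation.Propositional using (_↭_; prep; swap; ↭-refl; ↭-sym; ↭⇒↭ₛ; ↭-trans)
open import Data.List.Relation.Binary.Pointwise using (Pointwise; []; _∷_)
open import Data.List.Relation.Binary.Sublist.Propositional using (_⊆_; []; _∷_; _∷ʳ_; ⊆-refl; ⊆-trans)
open import Data.List.Relation.Unary.All as All using (All; []; _∷_)
open import Data.List.Relation.Unary.AllPairs as AllPairs using ([]; _∷_; AllPairs)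
open import Data.List.Relation.Unary.Any using (here; there)
open import Data.List.Relation.Unary.Unique.Propositional using (Unique)
open import Data.Nat as ℕ using (ℕ; zero; suc; _+_; _∸_; _⊓_; _≡ᵇ_; z≤n; s≤s; _≤_; _<_; _<?_; _≤?_; _≟_; _*_; _⊔_; _<ᵇ_; _≤ᵇ_; _>_)
open import Data.Product using (_×_; _,_; proj₁; proj₂; ∃; Σ)
open import Data.Sum using (_⊎_; inj₁; inj₂; [_,_]′)
open import Data.Unit using (⊤; tt)
open import Function using (_∘_; id; mk⇔; _⟨_⟩_)
open import Function.Bundles using (Equivalence)
open import Relation.Binary.Definitions using (tri<; tri≈; tri>)
open import Relation.Binary.PropositionalEquality
open import Relation.Nullary using (yes; no; ¬_; Dec)
open import Relation.Nullary.Decidable using (_×-dec_; does; does-⇔; T?)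
open import Data.List.Membership.DecPropositional (≡-dec _≟_) using (_∈?_)
open import Data.Nat.Properties as ℕ using (*-suc; *-zeroʳ; +-assoc; +-comm; +-identityʳ; +-mono-<-≤; +-mono-≤; +-mono-≤-<; +-monoʳ-<; +-monoʳ-≤; +-monoˡ-<; +-monoˡ-≤; +-suc; +-∸-assoc; 0∸n≡0; 1+n≢n; <-asym; <-cmp; <-irrefl; <-trans; <-≤-connex; <-≤-trans; <ᵇ⇒<; <⇒<ᵇ; <⇒≢; <⇒≤; <⇒≱; >⇒≢; m+[n∸m]≡n; m+n∸m≡n; m+n∸n≡m; m<m+n; m<n⇒0<n∸m; m<n⇒m<1+n; m∸n+n≡m; m∸n≤m; m≤m*n; m≤m+n; m≤n+m; m≤n⇒m<n∨m≡n; m≤n⇒m∸n≡0; m≤n⇒m≤1+n; m≤n⇒m⊓n≡m; m≤n⇒m⊔n≡n; m≥n⇒m⊓n≡n; m≥n⇒m⊔n≡m; n<1+n; n∸n≡0; n≢0⇒n>0; n≤0⇒n≡0; n≤1+n; suc-injective; ∸-+-assoc; ∸-monoʳ-≤; ≡ᵇ⇒≡; ≡⇒≡ᵇ; ≤-<-trans; ≤-antisym; ≤-pred; ≤-refl; ≤-reflexive; ≤-total; ≤-trans; ≤ᵇ⇒≤; ≤⇒≤ᵇ; ≤∧≢⇒<; ≮⇒≥; ≰⇒>; ⊓-zeroʳ)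
import Data.Integer.Properties as ℤ
import Data.List.Relation.Unary.Unique.Propositional.Properties as Uniqueₚ
import Data.List.Relation.Binary.Permutation.Propositional.Properties as ↭ₚ
import Algebra.Properties.CommutativeSemigroup as CommutativeSemigroupProperties
open CommutativeSemigroupProperties ℤ.+-commutativeSemigroup using () renaming (interchange to ℤ-interchange; x∙yz≈y∙xz to +-left-comm)
open ≡-Reasoning

-- Linear arithmetic

module LinearArithmetic where
  open import Data.Fin using (Fin; zero; suc)
  open import Data.Vec as Vec using (Vec; []; _∷_; lookup)
  open import Data.Maybe using (Maybe; just; nothing)

  -- A linear form is the list of its coefficients, the constant first; it is
  -- evaluated against + 1 ∷ values of the variables.
  Lin : Set
  Lin = List ℤ

  dot : Lin → List ℤ → ℤ
  dot (c ∷ cs) (v ∷ vs) = c ℤ.* v ℤ.+ dot cs vs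
  dot _        _        = + 0

  addL : Lin → Lin → Lin
  addL []       ys       = ys
  addL xs       []       = xs
  addL (x ∷ xs) (y ∷ ys) = x ℤ.+ y ∷ addL xs ys

  scaleL : ℤ → Lin → Lin
  scaleL k = map (k ℤ.*_)

  dot-addL : ∀ xs ys vs → dot (addL xs ys) vs ≡ dot xs vs ℤ.+ dot ys vs
  dot-addL []       ys       vs       = sym (ℤ.+-identityˡ _)
  dot-addL (x ∷ xs) []       []       = refl
  dot-addL (x ∷ xs) []       (v ∷ vs) = sym (ℤ.+-identityʳ _)
  dot-addL (x ∷ xs) (y ∷ ys) []       = refl
  dot-addL (x ∷ xs) (y ∷ ys) (v ∷ vs) rewrite dot-addL xs ys vs =
    trans (cong (ℤ._+ (dot xs vs ℤ.+ dot ys vs)) (ℤ.*-distribʳ-+ v x y)) (ℤ-interchange (x ℤ.* v) (y ℤ.* v) (dot xs vs) (dot ys vs))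

  dot-scaleL : ∀ k xs vs → dot (scaleL k xs) vs ≡ k ℤ.* dot xs vs
  dot-scaleL k []       vs       = sym (ℤ.*-zeroʳ k)
  dot-scaleL k (x ∷ xs) []       = sym (ℤ.*-zeroʳ k)
  dot-scaleL k (x ∷ xs) (v ∷ vs) rewrite dot-scaleL k xs vs =
    trans (cong (ℤ._+ k ℤ.* dot xs vs) (ℤ.*-assoc k x v)) (sym (ℤ.*-distribˡ-+ k (x ℤ.* v) (dot xs vs)))

  data Rel : Set where
    eqz nonneg : Rel

  Row : Set
  Row = Rel × Lin

  Holds : List ℤ → Row → Set
  Holds vs (eqz    , l) = dot l vs ≡ + 0
  Holds vs (nonneg , l) = + 0 ℤ.≤ dot l vs

  combine : List Row → List ℤ → Lin
  combine ((_ , l) ∷ rs) (k ∷ ks) = addL (scaleL k l) (combine rs ks)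
  combine _              _        = []

  isNonneg : ℤ → Bool
  isNonneg (+ _)      = true
  isNonneg (-[1+ _ ]) = false

  okMultipliers : List Row → List ℤ → Bool
  okMultipliers ((eqz , _) ∷ rs)    (k ∷ ks) = okMultipliers rs ks
  okMultipliers ((nonneg , _) ∷ rs) (k ∷ ks) = isNonneg k ∧ okMultipliers rs ks
  okMultipliers _                   _        = true

  allZero : Lin → Bool
  allZero []               = true
  allZero (+ zero ∷ l)     = allZero l
  allZero _                = false

  isAbsurd : Lin → Bool
  isAbsurd (-[1+ _ ] ∷ l) = allZero l
  isAbsurd _              = false

  AllHold : List ℤ → List Row → Set
  AllHold vs []       = ⊤
  AllHold vs (r ∷ rs) = Holds vs r × AllHold vs rs

  ∧-fst : ∀ {a b} → T (a ∧ b) → T a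
  ∧-fst {true} {true} _ = tt

  ∧-snd : ∀ {a b} → T (a ∧ b) → T b
  ∧-snd {true} {true} _ = tt

  0≤* : ∀ k {x} → + 0 ℤ.≤ x → + 0 ℤ.≤ + k ℤ.* x
  0≤* k (ℤ.+≤+ {n = n} _) = subst (+ 0 ℤ.≤_) (ℤ.pos-* k n) (ℤ.+≤+ ℕ.z≤n)

  0≤+ : ∀ {x y} → + 0 ℤ.≤ x → + 0 ℤ.≤ y → + 0 ℤ.≤ x ℤ.+ y
  0≤+ (ℤ.+≤+ _) (ℤ.+≤+ _) = ℤ.+≤+ ℕ.z≤n

  -- The sound half of Farkas' lemma: inequalities may be scaled by nonnegative multipliers only,
  -- equations by arbitrary ones. A combination that comes out as a negative constant is then
  -- contradictory.
  combine-nonneg : ∀ vs rs ks → T (okMultipliers rs ks) → AllHold vs rs → + 0 ℤ.≤ dot (combine rs ks) vs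
  combine-nonneg vs []       ks       _  _        = ℤ.≤-refl
  combine-nonneg vs (_ ∷ _)  []       _  _        = ℤ.≤-refl
  combine-nonneg vs ((eqz , l) ∷ rs) (k ∷ ks) ok (h , hs)
    rewrite dot-addL (scaleL k l) (combine rs ks) vs | dot-scaleL k l vs | h | ℤ.*-zeroʳ k
          | ℤ.+-identityˡ (dot (combine rs ks) vs) = combine-nonneg vs rs ks ok hs
  combine-nonneg vs ((nonneg , l) ∷ rs) (+ k ∷ ks) ok (h , hs)
    rewrite dot-addL (scaleL (+ k) l) (combine rs ks) vs | dot-scaleL (+ k) l vs =
    0≤+ (0≤* k h) (combine-nonneg vs rs ks ok hs)
  combine-nonneg vs ((nonneg , l) ∷ rs) (-[1+ k ] ∷ ks) () hs

  allZero-dot : ∀ l vs → T (allZero l) → dot l vs ≡ + 0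
  allZero-dot []           vs       _ = refl
  allZero-dot (+ zero ∷ l) []       _ = refl
  allZero-dot (+ zero ∷ l) (v ∷ vs) z rewrite allZero-dot l vs z = refl
  allZero-dot (+ suc n ∷ l) _ ()
  allZero-dot (-[1+ n ] ∷ l) _ ()

  absurd-neg : ∀ l vs → T (isAbsurd l) → ¬ (+ 0 ℤ.≤ dot l (+ 1 ∷ vs))
  absurd-neg (-[1+ n ] ∷ l) vs z p rewrite allZero-dot l vs z with p
  ... | ()
  absurd-neg [] vs () p
  absurd-neg (+ n ∷ l) vs () p

  -- Fourier–Motzkin elimination; the tail of a traced row records the multipliers
  -- of the original rows, so that the outcome can be checked independently.
  Traced : Set
  Traced = Rel × Lin × List ℤ

  coeff : ℕ → Lin → ℤ
  coeff _       []       = + 0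
  coeff zero    (x ∷ _)  = x
  coeff (suc n) (_ ∷ xs) = coeff n xs

  isZero : ℤ → Bool
  isZero (+ zero) = true
  isZero _        = false

  comb : ℤ → ℤ → Rel → Traced → Traced → Traced
  comb a b r (_ , l , t) (_ , l' , t') = r , addL (scaleL a l) (scaleL b l') , addL (scaleL a t) (scaleL b t')

  findEq : ℕ → List Traced → Maybe (Traced × List Traced)
  findEq i [] = nothing
  findEq i (r@(eqz , l , _) ∷ rs) with isZero (coeff i l)
  ... | false = just (r , rs)
  ... | true with findEq i rs
  ...   | nothing        = nothing
  ...   | just (e , rs') = just (e , r ∷ rs')
  findEq i (r@(nonneg , _) ∷ rs) with findEq i rs
  ... | nothing        = nothing
  ... | just (e , rs') = just (e , r ∷ rs')

  -- The row is scaled by the absolute value of the pivot, so that an inequality keeps its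
  -- direction; the sign goes into the multiplier of the equation.
  substEq : ℕ → Traced → Traced → Traced
  substEq i e@(_ , le , _) r@(k , l , _) with coeff i le | coeff i l
  ... | _          | + zero = r
  ... | + n        | c      = comb (+ n) (ℤ.- c) k r e
  ... | -[1+ n ]   | c      = comb (+ suc n) c k r e

  split : ℕ → List Traced → List Traced × List Traced × List Traced
  split i [] = [] , [] , []
  split i (r@(_ , l , _) ∷ rs) with coeff i l | split i rs
  ... | + zero   | z , p , n = r ∷ z , p , n
  ... | + suc _  | z , p , n = z , r ∷ p , n
  ... | -[1+ _ ] | z , p , n = z , p , r ∷ n

  cross : ℕ → Traced → Traced → Traced
  cross i p@(_ , lp , _) n@(_ , ln , _) = comb (ℤ.- coeff i ln) (coeff i lp) nonneg p n

  eliminate : ℕ → List Traced → List Traced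
  eliminate i rs with findEq i rs
  ... | just (e , rs') = map (substEq i e) rs'
  ... | nothing with split i rs
  ...   | z , p , n = z ++ concatMap (λ a → map (cross i a) n) p

  negateT : Traced → List ℤ
  negateT (_ , _ , t) = scaleL (ℤ.- (+ 1)) t

  constOf : Lin → ℤ
  constOf []      = + 0
  constOf (c ∷ _) = c

  findAbsurd : List Traced → List ℤ
  findAbsurd [] = []
  findAbsurd (r@(k , l , t) ∷ rs) with allZero (List.drop 1 l) | constOf l | k
  ... | true  | -[1+ _ ] | _   = t
  -- An equation reduced to a positive constant is contradictory as well; negated multipliers turn
  -- it into the negative constant that `isAbsurd` expects.
  ... | true  | + suc _  | eqz = negateT r
  ... | _     | _        | _   = findAbsurd rs

  tracedRows : List ℤ → List Row → List Traced
  tracedRows _   []             = []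
  tracedRows pre ((k , l) ∷ rs) = (k , l , pre ++ (+ 1 ∷ [])) ∷ tracedRows (+ 0 ∷ pre) rs

  eliminateAll : ℕ → List Traced → List Traced
  eliminateAll zero    rs = rs
  eliminateAll (suc n) rs = eliminateAll n (eliminate (suc n) rs)

  certificate : ℕ → List Row → List ℤ
  certificate n rs = findAbsurd (eliminateAll n (tracedRows [] rs))

  checkCert : List Row → List ℤ → Bool
  checkCert rs ks = okMultipliers rs ks ∧ isAbsurd (combine rs ks)

  refute : ℕ → List Row → Bool
  refute n rs = checkCert rs (certificate n rs)

  refute-sound : ∀ n rs vs → T (refute n rs) → ¬ AllHold (+ 1 ∷ vs) rs
  refute-sound n rs vs ok hs =
    absurd-neg (combine rs (certificate n rs)) vs (∧-snd {okMultipliers rs (certificate n rs)} ok)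
      (combine-nonneg (+ 1 ∷ vs) rs (certificate n rs) (∧-fst ok) hs)

  data Sort : Set where
    nat int : Sort

  Val : Sort → Set
  Val nat = ℕ
  Val int = ℤ

  infixl 7 _:+_ _:-_
  infix  8 ♯_ ↑_ :-_
  infix  6 _:≤_ _:<_ _:=_
  infixr 5 _⇒_

  data Expr (m n : ℕ) : Sort → Set where
    nvar : Fin m → Expr m n nat
    zvar : Fin n → Expr m n int
    ♯_   : ∀ {s} → ℕ → Expr m n s
    _:+_ : ∀ {s} → Expr m n s → Expr m n s → Expr m n s
    _:-_ : Expr m n int → Expr m n int → Expr m n int
    :-_  : Expr m n int → Expr m n int
    ↑_   : Expr m n nat → Expr m n int

  data Form (m n : ℕ) : Set where
    _:≤_ _:<_ _:=_ : ∀ {s} → Expr m n s → Expr m n s → Form m n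
    :⊥             : Form m n
    _⇒_            : Form m n → Form m n → Form m n

  ⟦_⟧ : ∀ {m n s} → Expr m n s → Vec ℕ m → Vec ℤ n → Val s
  ⟦ nvar i ⟧ ρ σ = lookup ρ i
  ⟦ zvar i ⟧ ρ σ = lookup σ i
  ⟦ ♯_ {nat} k ⟧ ρ σ = k
  ⟦ ♯_ {int} k ⟧ ρ σ = + k
  ⟦ _:+_ {nat} a b ⟧ ρ σ = ⟦ a ⟧ ρ σ ℕ.+ ⟦ b ⟧ ρ σ
  ⟦ _:+_ {int} a b ⟧ ρ σ = ⟦ a ⟧ ρ σ ℤ.+ ⟦ b ⟧ ρ σ
  ⟦ a :- b ⟧ ρ σ = ⟦ a ⟧ ρ σ ℤ.- ⟦ b ⟧ ρ σ
  ⟦ :- a ⟧ ρ σ = ℤ.- ⟦ a ⟧ ρ σ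
  ⟦ ↑ a ⟧ ρ σ = + ⟦ a ⟧ ρ σ

  ⟦_⟧F : ∀ {m n} → Form m n → Vec ℕ m → Vec ℤ n → Set
  ⟦ _:≤_ {nat} a b ⟧F ρ σ = ⟦ a ⟧ ρ σ ℕ.≤ ⟦ b ⟧ ρ σ
  ⟦ _:≤_ {int} a b ⟧F ρ σ = ⟦ a ⟧ ρ σ ℤ.≤ ⟦ b ⟧ ρ σ
  ⟦ _:<_ {nat} a b ⟧F ρ σ = ⟦ a ⟧ ρ σ ℕ.< ⟦ b ⟧ ρ σ
  ⟦ _:<_ {int} a b ⟧F ρ σ = ⟦ a ⟧ ρ σ ℤ.< ⟦ b ⟧ ρ σ
  ⟦ a :=  b ⟧F ρ σ = ⟦ a ⟧ ρ σ ≡ ⟦ b ⟧ ρ σ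
  ⟦ :⊥ ⟧F ρ σ = ⊥
  ⟦ a ⇒ b ⟧F ρ σ = ⟦ a ⟧F ρ σ → ⟦ b ⟧F ρ σ

  toℤ : ∀ s → Val s → ℤ
  toℤ nat k = + k
  toℤ int k = k

  unitL : ℕ → Lin
  unitL zero    = + 1 ∷ []
  unitL (suc i) = + 0 ∷ unitL i

  fin : ∀ {n} → Fin n → ℕ
  fin zero    = 0
  fin (suc i) = suc (fin i)

  lin : ∀ {m n s} → Expr m n s → Lin
  lin (nvar i)         = unitL (suc (fin i))
  lin {m} (zvar i)     = unitL (suc (m ℕ.+ fin i))
  lin (♯ k)            = + k ∷ []
  lin (a :+ b)         = addL (lin a) (lin b)
  lin (a :- b)         = addL (lin a) (scaleL (ℤ.- (+ 1)) (lin b))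
  lin (:- a)           = scaleL (ℤ.- (+ 1)) (lin a)
  lin (↑ a)            = lin a

  env : ∀ {m n} → Vec ℕ m → Vec ℤ n → List ℤ
  env []      σ = Vec.toList σ
  env (x ∷ ρ) σ = + x ∷ env ρ σ

  dot-unitL-zvar : ∀ {n} (i : Fin n) (σ : Vec ℤ n) → dot (unitL (fin i)) (Vec.toList σ) ≡ lookup σ i
  dot-unitL-zvar zero    (v ∷ σ) = trans (ℤ.+-identityʳ _) (ℤ.*-identityˡ v)
  dot-unitL-zvar (suc i) (v ∷ σ) = trans (ℤ.+-identityˡ _) (dot-unitL-zvar i σ)

  dot-unitL-env : ∀ {m n} (i : Fin n) (ρ : Vec ℕ m) (σ : Vec ℤ n) → dot (unitL (m ℕ.+ fin i)) (env ρ σ) ≡ lookup σ i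
  dot-unitL-env i []      σ = dot-unitL-zvar i σ
  dot-unitL-env i (x ∷ ρ) σ = trans (ℤ.+-identityˡ _) (dot-unitL-env i ρ σ)

  dot-unitL-nvar : ∀ {m n} (i : Fin m) (ρ : Vec ℕ m) (σ : Vec ℤ n) → dot (unitL (fin i)) (env ρ σ) ≡ + lookup ρ i
  dot-unitL-nvar zero    (v ∷ ρ) σ = trans (ℤ.+-identityʳ _) (ℤ.*-identityˡ (+ v))
  dot-unitL-nvar (suc i) (v ∷ ρ) σ = trans (ℤ.+-identityˡ _) (dot-unitL-nvar i ρ σ)

  lin-sound : ∀ {m n s} (e : Expr m n s) ρ σ → dot (lin e) (+ 1 ∷ env ρ σ) ≡ toℤ s (⟦ e ⟧ ρ σ)
  lin-sound (nvar i) ρ σ = trans (ℤ.+-identityˡ _) (dot-unitL-nvar i ρ σ)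
  lin-sound (zvar i) ρ σ = trans (ℤ.+-identityˡ _) (dot-unitL-env i ρ σ)
  lin-sound (♯_ {nat} k) ρ σ = trans (ℤ.+-identityʳ _) (ℤ.*-identityʳ (+ k))
  lin-sound (♯_ {int} k) ρ σ = trans (ℤ.+-identityʳ _) (ℤ.*-identityʳ (+ k))
  lin-sound (_:+_ {nat} a b) ρ σ
    rewrite dot-addL (lin a) (lin b) (+ 1 ∷ env ρ σ) | lin-sound a ρ σ | lin-sound b ρ σ = refl
  lin-sound (_:+_ {int} a b) ρ σ
    rewrite dot-addL (lin a) (lin b) (+ 1 ∷ env ρ σ) | lin-sound a ρ σ | lin-sound b ρ σ = refl
  lin-sound (a :- b) ρ σ
    rewrite dot-addL (lin a) (scaleL (ℤ.- (+ 1)) (lin b)) (+ 1 ∷ env ρ σ) | dot-scaleL (ℤ.- (+ 1)) (lin b) (+ 1 ∷ env ρ σ)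
          | lin-sound a ρ σ | lin-sound b ρ σ = cong (λ z → ⟦ a ⟧ ρ σ ℤ.+ z) (ℤ.-1*i≡-i _)
  lin-sound (:- a) ρ σ
    rewrite dot-scaleL (ℤ.- (+ 1)) (lin a) (+ 1 ∷ env ρ σ) | lin-sound a ρ σ = ℤ.-1*i≡-i _
  lin-sound (↑ a) ρ σ = lin-sound a ρ σ

  subL : Lin → Lin → Lin
  subL a b = addL a (scaleL (ℤ.- (+ 1)) b)

  dot-subL : ∀ a b vs → dot (subL a b) vs ≡ dot a vs ℤ.- dot b vs
  dot-subL a b vs rewrite dot-addL a (scaleL (ℤ.- (+ 1)) b) vs | dot-scaleL (ℤ.- (+ 1)) b vs = cong (λ z → dot a vs ℤ.+ z) (ℤ.-1*i≡-i _)

  -- Integrality closes up strict inequalities: a < b becomes 0 ≤ b - (1 + a), so that every row is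
  -- an equation or a weak inequality.
  leRow ltRow eqRow : ∀ {m n s} → Expr m n s → Expr m n s → Row
  leRow a b = nonneg , subL (lin b) (lin a)
  ltRow a b = nonneg , subL (lin b) (addL (+ 1 ∷ []) (lin a))
  eqRow a b = eqz , subL (lin b) (lin a)

  module _ {m n} (ρ : Vec ℕ m) (σ : Vec ℤ n) where
    private
      vs : List ℤ
      vs = + 1 ∷ env ρ σ
      val : ∀ {s} → Expr m n s → ℤ
      val {s} e = toℤ s (⟦ e ⟧ ρ σ)

    leRow-holds : ∀ {s} (a b : Expr m n s) → val a ℤ.≤ val b → Holds vs (leRow a b)
    leRow-holds a b h rewrite dot-subL (lin b) (lin a) vs | lin-sound a ρ σ | lin-sound b ρ σ = ℤ.i≤j⇒0≤j-i h

    eqRow-holds : ∀ {s} (a b : Expr m n s) → val a ≡ val b → Holds vs (eqRow a b)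
    eqRow-holds a b h rewrite dot-subL (lin b) (lin a) vs | lin-sound a ρ σ | lin-sound b ρ σ = ℤ.i≡j⇒i-j≡0 (sym h)

    ltRow-holds : ∀ {s} (a b : Expr m n s) → val a ℤ.< val b → Holds vs (ltRow a b)
    ltRow-holds a b h
      rewrite dot-subL (lin b) (addL (+ 1 ∷ []) (lin a)) vs | dot-addL (+ 1 ∷ []) (lin a) vs
            | lin-sound a ρ σ | lin-sound b ρ σ = ℤ.i≤j⇒0≤j-i (ℤ.i<j⇒suc[i]≤j h)

  nonnegRows : ℕ → List Row
  nonnegRows zero    = []
  nonnegRows (suc m) = (nonneg , unitL (suc m)) ∷ nonnegRows m

  dot-unitL-nonneg : ∀ {m n} i (ρ : Vec ℕ m) (σ : Vec ℤ n) → i ℕ.< m → + 0 ℤ.≤ dot (unitL i) (env ρ σ)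
  dot-unitL-nonneg zero    (v ∷ ρ) σ _ rewrite ℤ.+-identityʳ (+ 1 ℤ.* + v) | ℤ.*-identityˡ (+ v) = ℤ.+≤+ ℕ.z≤n
  dot-unitL-nonneg (suc i) (v ∷ ρ) σ (ℕ.s≤s p) rewrite ℤ.+-identityˡ (dot (unitL i) (env ρ σ)) = dot-unitL-nonneg i ρ σ p

  nonnegRows-hold : ∀ {m n} (ρ : Vec ℕ m) (σ : Vec ℤ n) k → k ℕ.≤ m → AllHold (+ 1 ∷ env ρ σ) (nonnegRows k)
  nonnegRows-hold ρ σ zero    _ = tt
  nonnegRows-hold ρ σ (suc k) p =
    subst (+ 0 ℤ.≤_) (sym (ℤ.+-identityˡ _)) (dot-unitL-nonneg k ρ σ p) , nonnegRows-hold ρ σ k (<⇒≤ p)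

  -- The goal is negated and refuted together with the hypotheses; the negation of an equality is a
  -- disjunction and costs two refutations. A hypothesis that is itself an implication is answered
  -- by `false`.
  decide : ∀ {m n} → List Row → Form m n → Bool
  decide {m} {n} rs (a :≤ b)      = refute (m ℕ.+ n) (ltRow b a ∷ rs)
  decide {m} {n} rs (a :< b)      = refute (m ℕ.+ n) (leRow b a ∷ rs)
  decide {m} {n} rs (a := b)      = refute (m ℕ.+ n) (ltRow b a ∷ rs) ∧ refute (m ℕ.+ n) (ltRow a b ∷ rs)
  decide {m} {n} rs :⊥            = refute (m ℕ.+ n) rs
  decide rs ((a :≤ b) ⇒ f)        = decide (leRow a b ∷ rs) f
  decide rs ((a :< b) ⇒ f)        = decide (ltRow a b ∷ rs) f
  decide rs ((a := b) ⇒ f)        = decide (eqRow a b ∷ rs) f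
  decide rs (:⊥ ⇒ f)              = true
  decide rs ((_ ⇒ _) ⇒ f)         = false

  toℤ-inj : ∀ s {a b : Val s} → toℤ s a ≡ toℤ s b → a ≡ b
  toℤ-inj nat = ℤ.+-injective
  toℤ-inj int h = h

  decide-sound : ∀ {m n} (rs : List Row) (f : Form m n) → T (decide rs f) →
    ∀ ρ σ → AllHold (+ 1 ∷ env ρ σ) rs → ⟦ f ⟧F ρ σ
  decide-sound {m} {n} rs (_:≤_ {nat} a b) ok ρ σ hs with ⟦ a ⟧ ρ σ ℕ.≤? ⟦ b ⟧ ρ σ
  ... | yes p = p
  ... | no ¬p = ⊥-elim (refute-sound (m ℕ.+ n) (ltRow b a ∷ rs) _ ok (ltRow-holds ρ σ b a (ℤ.+<+ (≰⇒> ¬p)) , hs))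
  decide-sound {m} {n} rs (_:≤_ {int} a b) ok ρ σ hs with ⟦ a ⟧ ρ σ ℤ.≤? ⟦ b ⟧ ρ σ
  ... | yes p = p
  ... | no ¬p = ⊥-elim (refute-sound (m ℕ.+ n) (ltRow b a ∷ rs) _ ok (ltRow-holds ρ σ b a (ℤ.≰⇒> ¬p) , hs))
  decide-sound {m} {n} rs (_:<_ {nat} a b) ok ρ σ hs with ⟦ a ⟧ ρ σ ℕ.<? ⟦ b ⟧ ρ σ
  ... | yes p = p
  ... | no ¬p = ⊥-elim (refute-sound (m ℕ.+ n) (leRow b a ∷ rs) _ ok (leRow-holds ρ σ b a (ℤ.+≤+ (≮⇒≥ ¬p)) , hs))
  decide-sound {m} {n} rs (_:<_ {int} a b) ok ρ σ hs with ⟦ a ⟧ ρ σ ℤ.<? ⟦ b ⟧ ρ σ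
  ... | yes p = p
  ... | no ¬p = ⊥-elim (refute-sound (m ℕ.+ n) (leRow b a ∷ rs) _ ok (leRow-holds ρ σ b a (ℤ.≮⇒≥ ¬p) , hs))
  decide-sound {m} {n} rs (_:=_ {s} a b) ok ρ σ hs = toℤ-inj s (ℤ.≤-antisym left right)
    where
      left : toℤ s (⟦ a ⟧ ρ σ) ℤ.≤ toℤ s (⟦ b ⟧ ρ σ)
      left with toℤ s (⟦ a ⟧ ρ σ) ℤ.≤? toℤ s (⟦ b ⟧ ρ σ)
      ... | yes p = p
      ... | no ¬p = ⊥-elim (refute-sound (m ℕ.+ n) (ltRow b a ∷ rs) _ (∧-fst ok) (ltRow-holds ρ σ b a (ℤ.≰⇒> ¬p) , hs))
      right : toℤ s (⟦ b ⟧ ρ σ) ℤ.≤ toℤ s (⟦ a ⟧ ρ σ)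
      right with toℤ s (⟦ b ⟧ ρ σ) ℤ.≤? toℤ s (⟦ a ⟧ ρ σ)
      ... | yes p = p
      ... | no ¬p = ⊥-elim (refute-sound (m ℕ.+ n) (ltRow a b ∷ rs) _ (∧-snd {refute (m ℕ.+ n) (ltRow b a ∷ rs)} ok)
                      (ltRow-holds ρ σ a b (ℤ.≰⇒> ¬p) , hs))
  decide-sound {m} {n} rs :⊥ ok ρ σ hs = refute-sound (m ℕ.+ n) rs _ ok hs
  decide-sound rs (_:≤_ {nat} a b ⇒ f) ok ρ σ hs h = decide-sound (leRow a b ∷ rs) f ok ρ σ (leRow-holds ρ σ a b (ℤ.+≤+ h) , hs)
  decide-sound rs (_:≤_ {int} a b ⇒ f) ok ρ σ hs h = decide-sound (leRow a b ∷ rs) f ok ρ σ (leRow-holds ρ σ a b h , hs)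
  decide-sound rs (_:<_ {nat} a b ⇒ f) ok ρ σ hs h = decide-sound (ltRow a b ∷ rs) f ok ρ σ (ltRow-holds ρ σ a b (ℤ.+<+ h) , hs)
  decide-sound rs (_:<_ {int} a b ⇒ f) ok ρ σ hs h = decide-sound (ltRow a b ∷ rs) f ok ρ σ (ltRow-holds ρ σ a b h , hs)
  decide-sound rs (_:=_ {s} a b ⇒ f) ok ρ σ hs h = decide-sound (eqRow a b ∷ rs) f ok ρ σ (eqRow-holds ρ σ a b (cong (toℤ s) h) , hs)
  decide-sound rs (:⊥ ⇒ f) ok ρ σ hs ()
  decide-sound rs ((_ ⇒ _) ⇒ f) () ρ σ hs

  Fun : ℕ → Set → Set → Set
  Fun zero    A B = B
  Fun (suc n) A B = A → Fun n A B

  applyFun : ∀ {n A B} → Fun n A B → Vec A n → B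
  applyFun f []       = f
  applyFun f (x ∷ xs) = applyFun (f x) xs

  Schema : ℕ → ℕ → Set
  Schema m n = Fun m (Expr m n nat) (Fun n (Expr m n int) (Form m n))

  instantiate : ∀ {m n : ℕ} → Schema m n → Form m n
  instantiate {m} {n} f = applyFun {n} (applyFun {m} f (Vec.tabulate nvar)) (Vec.tabulate zvar)

  Curried : ∀ m n → (Vec ℕ m → Vec ℤ n → Set) → Set
  Curried zero    zero    P = P [] []
  Curried zero    (suc n) P = ∀ z → Curried zero n (λ ρ σ → P ρ (z ∷ σ))
  Curried (suc m) n       P = ∀ x → Curried m n (λ ρ σ → P (x ∷ ρ) σ)

  curried : ∀ m n {P : Vec ℕ m → Vec ℤ n → Set} → (∀ ρ σ → P ρ σ) → Curried m n P
  curried zero    zero    h = h [] []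
  curried zero    (suc n) h = λ z → curried zero n (λ ρ σ → h ρ (z ∷ σ))
  curried (suc m) n       h = λ x → curried m n (λ ρ σ → h (x ∷ ρ) σ)

  -- lia m n φ proves the linear arithmetic statement φ about m naturals and n integers.
  lia : ∀ m n (f : Schema m n) → {T (decide (nonnegRows m) (instantiate {m} {n} f))} → Curried m n ⟦ instantiate {m} {n} f ⟧F
  lia m n f {ok} = curried m n (λ ρ σ → decide-sound (nonnegRows m) (instantiate {m} {n} f) ok ρ σ (nonnegRows-hold ρ σ m ≤-refl))

open LinearArithmetic

private variable
  Elem Elem′ : Set

-- Finite sums and the Hall inner product

sumℤ : List ℤ → ℤ
sumℤ = foldr ℤ._+_ (+ 0)

∑ : {Elem : Set} → List Elem → (Elem → ℤ) → ℤ
∑ []       f = + 0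
∑ (x ∷ xs) f = f x ℤ.+ ∑ xs f

sumℤ-map : (f : Elem → ℤ) (xs : List Elem) → sumℤ (map f xs) ≡ ∑ xs f
sumℤ-map f []       = refl
sumℤ-map f (x ∷ xs) = cong (ℤ._+_ (f x)) (sumℤ-map f xs)

∑-cong : {f g : Elem → ℤ} (xs : List Elem) → (∀ x → f x ≡ g x) → ∑ xs f ≡ ∑ xs g
∑-cong []       h = refl
∑-cong (x ∷ xs) h = cong₂ ℤ._+_ (h x) (∑-cong xs h)

∑-++ : (xs ys : List Elem) (f : Elem → ℤ) → ∑ (xs ++ ys) f ≡ ∑ xs f ℤ.+ ∑ ys f
∑-++ []       ys f = sym (ℤ.+-identityˡ _)
∑-++ (x ∷ xs) ys f = trans (cong (ℤ._+_ (f x)) (∑-++ xs ys f)) (sym (ℤ.+-assoc (f x) _ _))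

∑-map : (g : Elem → Elem′) (xs : List Elem) (f : Elem′ → ℤ) → ∑ (map g xs) f ≡ ∑ xs (f ∘ g)
∑-map g []       f = refl
∑-map g (x ∷ xs) f = cong (ℤ._+_ (f (g x))) (∑-map g xs f)

∑-concatMap : (g : Elem → List Elem′) (xs : List Elem) (f : Elem′ → ℤ) → ∑ (concatMap g xs) f ≡ ∑ xs (λ x → ∑ (g x) f)
∑-concatMap g []       f = refl
∑-concatMap g (x ∷ xs) f = trans (∑-++ (g x) _ f) (cong (ℤ._+_ (∑ (g x) f)) (∑-concatMap g xs f))

∑-+ : (f g : Elem → ℤ) (xs : List Elem) → ∑ xs (λ x → f x ℤ.+ g x) ≡ ∑ xs f ℤ.+ ∑ xs g
∑-+ f g []       = refl
∑-+ f g (x ∷ xs) = trans (cong (ℤ._+_ (f x ℤ.+ g x)) (∑-+ f g xs)) (ℤ-interchange (f x) (g x) (∑ xs f) (∑ xs g))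

∑-0 : (xs : List Elem) → ∑ xs (λ _ → + 0) ≡ + 0
∑-0 []       = refl
∑-0 (x ∷ xs) = trans (ℤ.+-identityˡ _) (∑-0 xs)

∑-zero : {f : Elem → ℤ} (xs : List Elem) → (∀ x → f x ≡ + 0) → ∑ xs f ≡ + 0
∑-zero xs h = trans (∑-cong xs h) (∑-0 xs)

∑-* : (c : ℤ) (f : Elem → ℤ) (xs : List Elem) → ∑ xs (λ x → c ℤ.* f x) ≡ c ℤ.* ∑ xs f
∑-* c f []       = sym (ℤ.*-zeroʳ c)
∑-* c f (x ∷ xs) = trans (cong (ℤ._+_ (c ℤ.* f x)) (∑-* c f xs)) (sym (ℤ.*-distribˡ-+ c (f x) (∑ xs f)))

∑-neg : (f : Elem → ℤ) (xs : List Elem) → ∑ xs (λ x → ℤ.- f x) ≡ ℤ.- ∑ xs f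
∑-neg f []       = refl
∑-neg f (x ∷ xs) = trans (cong (ℤ._+_ (ℤ.- f x)) (∑-neg f xs)) (sym (ℤ.neg-distrib-+ (f x) (∑ xs f)))

∑-swap : (f : Elem → Elem′ → ℤ) (xs : List Elem) (ys : List Elem′) → ∑ xs (λ x → ∑ ys (f x)) ≡ ∑ ys (λ y → ∑ xs (λ x → f x y))
∑-swap f []       ys = sym (∑-0 ys)
∑-swap f (x ∷ xs) ys = trans (cong (ℤ._+_ (∑ ys (f x))) (∑-swap f xs ys)) (sym (∑-+ (f x) _ ys))

∑-applyUpTo : (g : ℕ → Elem) (n : ℕ) (f : Elem → ℤ) → ∑ (applyUpTo g n) f ≡ ∑ (upTo n) (f ∘ g)
∑-applyUpTo g zero    f = refl
∑-applyUpTo g (suc n) f = cong (ℤ._+_ (f (g 0)))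
  (trans (∑-applyUpTo (g ∘ suc) n f) (sym (∑-applyUpTo suc n (f ∘ g))))

∑-upTo-suc : (n : ℕ) (f : ℕ → ℤ) → ∑ (upTo (suc n)) f ≡ f 0 ℤ.+ ∑ (upTo n) (f ∘ suc)
∑-upTo-suc n f = cong (ℤ._+_ (f 0)) (∑-applyUpTo suc n f)

∑-upTo-last : (n : ℕ) (f : ℕ → ℤ) → ∑ (upTo (suc n)) f ≡ ∑ (upTo n) f ℤ.+ f n
∑-upTo-last zero    f = trans (ℤ.+-identityʳ (f 0)) (sym (ℤ.+-identityˡ (f 0)))
∑-upTo-last (suc n) f = begin
  ∑ (upTo (suc (suc n))) f                          ≡⟨ ∑-upTo-suc (suc n) f ⟩
  f 0 ℤ.+ ∑ (upTo (suc n)) (f ∘ suc)                ≡⟨ cong (ℤ._+_ (f 0)) (∑-upTo-last n (f ∘ suc)) ⟩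
  f 0 ℤ.+ (∑ (upTo n) (f ∘ suc) ℤ.+ f (suc n))      ≡⟨ sym (ℤ.+-assoc (f 0) _ _) ⟩
  f 0 ℤ.+ ∑ (upTo n) (f ∘ suc) ℤ.+ f (suc n)        ≡⟨ cong (ℤ._+ f (suc n)) (sym (∑-upTo-suc n f)) ⟩
  ∑ (upTo (suc n)) f ℤ.+ f (suc n)                  ∎

∑-upTo-cong : (n : ℕ) {f g : ℕ → ℤ} → (∀ i → i < n → f i ≡ g i) → ∑ (upTo n) f ≡ ∑ (upTo n) g
∑-upTo-cong zero    h = refl
∑-upTo-cong (suc n) {f} {g} h = begin
  ∑ (upTo (suc n)) f        ≡⟨ ∑-upTo-last n f ⟩
  ∑ (upTo n) f ℤ.+ f n      ≡⟨ cong₂ ℤ._+_ (∑-upTo-cong n (λ i p → h i (m<n⇒m<1+n p))) (h n ≤-refl) ⟩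
  ∑ (upTo n) g ℤ.+ g n      ≡⟨ sym (∑-upTo-last n g) ⟩
  ∑ (upTo (suc n)) g        ∎

∑-upTo-extend : (m n : ℕ) (f : ℕ → ℤ) → m ≤ n → (∀ i → m ≤ i → f i ≡ + 0) → ∑ (upTo m) f ≡ ∑ (upTo n) f
∑-upTo-extend zero    n       f _       h = sym (∑-zero' n f (λ i → h i z≤n))
  where
    ∑-zero' : ∀ n f → (∀ i → f i ≡ + 0) → ∑ (upTo n) f ≡ + 0
    ∑-zero' n f h = ∑-zero (upTo n) h
∑-upTo-extend (suc m) (suc n) f (s≤s p) h = begin
  ∑ (upTo (suc m)) f                    ≡⟨ ∑-upTo-suc m f ⟩
  f 0 ℤ.+ ∑ (upTo m) (f ∘ suc)          ≡⟨ cong (ℤ._+_ (f 0)) (∑-upTo-extend m n (f ∘ suc) p (λ i q → h (suc i) (s≤s q))) ⟩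
  f 0 ℤ.+ ∑ (upTo n) (f ∘ suc)          ≡⟨ sym (∑-upTo-suc n f) ⟩
  ∑ (upTo (suc n)) f                    ∎

-- Both sides run over the pairs with i + j ≤ a. This exchange is what makes `Kz` at two degrees
-- commute on a single letter.
∑-triangle : (a : ℕ) (g : ℕ → ℕ → ℤ) →
  ∑ (upTo (suc a)) (λ i → ∑ (upTo (suc (a ∸ i))) (λ j → g i j)) ≡ ∑ (upTo (suc a)) (λ i → ∑ (upTo (suc (a ∸ i))) (λ j → g j i))
∑-triangle zero    g = refl
∑-triangle (suc a) g = begin
  ∑ (upTo (suc (suc a))) (λ i → ∑ (upTo (suc (suc a ∸ i))) (g i))
    ≡⟨ ∑-cong (upTo (suc (suc a))) (λ i → ∑-upTo-suc (suc a ∸ i) (g i)) ⟩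
  ∑ (upTo (suc (suc a))) (λ i → g i 0 ℤ.+ ∑ (upTo (suc a ∸ i)) (g i ∘ suc))
    ≡⟨ ∑-+ (λ i → g i 0) (λ i → ∑ (upTo (suc a ∸ i)) (g i ∘ suc)) (upTo (suc (suc a))) ⟩
  ∑ (upTo (suc (suc a))) (λ i → g i 0) ℤ.+ ∑ (upTo (suc (suc a))) (λ i → ∑ (upTo (suc a ∸ i)) (g i ∘ suc))
    ≡⟨ cong (ℤ._+_ (∑ (upTo (suc (suc a))) (λ i → g i 0))) rest ⟩
  ∑ (upTo (suc (suc a))) (λ i → g i 0) ℤ.+ ∑ (upTo (suc a)) (λ i → ∑ (upTo (suc (a ∸ i))) (λ j → g j (suc i)))
    ≡⟨ sym (∑-upTo-suc (suc a) (λ i → ∑ (upTo (suc (suc a ∸ i))) (λ j → g j i))) ⟩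
  ∑ (upTo (suc (suc a))) (λ i → ∑ (upTo (suc (suc a ∸ i))) (λ j → g j i)) ∎
  where
    rest : ∑ (upTo (suc (suc a))) (λ i → ∑ (upTo (suc a ∸ i)) (g i ∘ suc)) ≡
           ∑ (upTo (suc a)) (λ i → ∑ (upTo (suc (a ∸ i))) (λ j → g j (suc i)))
    rest = begin
      ∑ (upTo (suc (suc a))) (λ i → ∑ (upTo (suc a ∸ i)) (g i ∘ suc))
        ≡⟨ ∑-upTo-last (suc a) (λ i → ∑ (upTo (suc a ∸ i)) (g i ∘ suc)) ⟩
      ∑ (upTo (suc a)) (λ i → ∑ (upTo (suc a ∸ i)) (g i ∘ suc)) ℤ.+ ∑ (upTo (a ∸ a)) (g (suc a) ∘ suc)
        ≡⟨ cong (λ n → ∑ (upTo (suc a)) (λ i → ∑ (upTo (suc a ∸ i)) (g i ∘ suc)) ℤ.+ ∑ (upTo n) (g (suc a) ∘ suc)) (n∸n≡0 a) ⟩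
      ∑ (upTo (suc a)) (λ i → ∑ (upTo (suc a ∸ i)) (g i ∘ suc)) ℤ.+ + 0
        ≡⟨ ℤ.+-identityʳ _ ⟩
      ∑ (upTo (suc a)) (λ i → ∑ (upTo (suc a ∸ i)) (g i ∘ suc))
        ≡⟨ ∑-upTo-cong (suc a) (λ i p → cong (λ n → ∑ (upTo n) (g i ∘ suc)) (+-∸-assoc 1 (≤-pred p))) ⟩
      ∑ (upTo (suc a)) (λ i → ∑ (upTo (suc (a ∸ i))) (λ j → g i (suc j)))
        ≡⟨ ∑-triangle a (λ i j → g i (suc j)) ⟩
      ∑ (upTo (suc a)) (λ i → ∑ (upTo (suc (a ∸ i))) (λ j → g j (suc i))) ∎

-- Linear functionals on ℤ[h₁,h₂,…] are given by their values on the monomials h_p.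
Fn : Set
Fn = List ℕ → ℤ

ev : Sym → Fn → ℤ
ev f F = ∑ (expand f) (λ p → proj₁ p ℤ.* F (proj₂ p))

ev-cong : ∀ f {F G : Fn} → (∀ p → F p ≡ G p) → ev f F ≡ ev f G
ev-cong f h = ∑-cong (expand f) (λ p → cong (proj₁ p ℤ.*_) (h (proj₂ p)))

ev-⊕ : ∀ f g F → ev (f ⊕ g) F ≡ ev f F ℤ.+ ev g F
ev-⊕ f g F = ∑-++ (expand f) (expand g) _

ev-∑ : ∀ f (xs : List Elem) (G : Elem → Fn) → ev f (λ p → ∑ xs (λ a → G a p)) ≡ ∑ xs (λ a → ev f (G a))
ev-∑ f xs G = trans (∑-cong (expand f) (λ p → sym (∑-* (proj₁ p) (λ a → G a (proj₂ p)) xs)))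
  (∑-swap (λ p a → proj₁ p ℤ.* G a (proj₂ p)) (expand f) xs)

ev-scale : ∀ f c F → ev f (λ p → c ℤ.* F p) ≡ c ℤ.* ev f F
ev-scale f c F = trans (∑-cong (expand f) (λ p → begin
  proj₁ p ℤ.* (c ℤ.* F (proj₂ p))   ≡⟨ sym (ℤ.*-assoc (proj₁ p) c _) ⟩
  proj₁ p ℤ.* c ℤ.* F (proj₂ p)     ≡⟨ cong (ℤ._* F (proj₂ p)) (ℤ.*-comm (proj₁ p) c) ⟩
  c ℤ.* proj₁ p ℤ.* F (proj₂ p)     ≡⟨ ℤ.*-assoc c (proj₁ p) _ ⟩
  c ℤ.* (proj₁ p ℤ.* F (proj₂ p))   ∎)) (∑-* c _ (expand f))

ev-⊗ : ∀ f g F → ev (f ⊗ g) F ≡ ev f (λ p → ev g (λ q → F (p ++ q)))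
ev-⊗ f g F = trans (∑-concatMap _ (expand f) _) (∑-cong (expand f) (λ p → begin
  ∑ (map (λ q → (proj₁ p ℤ.* proj₁ q , proj₂ p ++ proj₂ q)) (expand g)) (λ r → proj₁ r ℤ.* F (proj₂ r))
    ≡⟨ ∑-map _ (expand g) _ ⟩
  ∑ (expand g) (λ q → proj₁ p ℤ.* proj₁ q ℤ.* F (proj₂ p ++ proj₂ q))
    ≡⟨ ∑-cong (expand g) (λ q → ℤ.*-assoc (proj₁ p) (proj₁ q) _) ⟩
  ∑ (expand g) (λ q → proj₁ p ℤ.* (proj₁ q ℤ.* F (proj₂ p ++ proj₂ q)))
    ≡⟨ ∑-* (proj₁ p) _ (expand g) ⟩
  proj₁ p ℤ.* ev g (λ q → F (proj₂ p ++ q)) ∎))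

ev-lit : ∀ a F → ev (lit a) F ≡ a ℤ.* F []
ev-lit a F = ℤ.+-identityʳ _

ev-swap : ∀ f g (F : List ℕ → List ℕ → ℤ) → ev f (λ p → ev g (F p)) ≡ ev g (λ q → ev f (λ p → F p q))
ev-swap f g F = begin
  ev f (λ p → ∑ (expand g) (λ q → proj₁ q ℤ.* F p (proj₂ q)))
    ≡⟨ ev-∑ f (expand g) (λ q p → proj₁ q ℤ.* F p (proj₂ q)) ⟩
  ∑ (expand g) (λ q → ev f (λ p → proj₁ q ℤ.* F p (proj₂ q)))
    ≡⟨ ∑-cong (expand g) (λ q → ev-scale f (proj₁ q) (λ p → F p (proj₂ q))) ⟩
  ev g (λ q → ev f (λ p → F p q)) ∎

ev-sumSym : ∀ xs F → ev (sumSym xs) F ≡ ∑ xs (λ f → ev f F)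
ev-sumSym []       F = refl
ev-sumSym (x ∷ xs) F = trans (ev-⊕ x (sumSym xs) F) (cong (ℤ._+_ (ev x F)) (ev-sumSym xs F))

mc : List ℕ → List ℕ → ℤ
mc p q = + matCount p q

pairing≡ev : ∀ f g → ⟪ f , g ⟫ ≡ ev f (λ p → ev g (mc p))
pairing≡ev f g = begin
  ⟪ f , g ⟫ ≡⟨ sumℤ≡∑ (concatMap (λ p → map (term p) (expand g)) (expand f)) ⟩
  ∑ (concatMap (λ p → map (term p) (expand g)) (expand f)) id
    ≡⟨ ∑-concatMap _ (expand f) id ⟩
  ∑ (expand f) (λ p → ∑ (map (term p) (expand g)) id)
    ≡⟨ ∑-cong (expand f) (λ p → trans (∑-map (term p) (expand g) id)
         (trans (∑-cong (expand g) (λ q → ℤ.*-assoc (proj₁ p) (proj₁ q) _)) (∑-* (proj₁ p) _ (expand g)))) ⟩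
  ev f (λ p → ev g (mc p)) ∎
  where
    term : ℤ × List ℕ → ℤ × List ℕ → ℤ
    term p q = proj₁ p ℤ.* proj₁ q ℤ.* (+ matCount (proj₂ p) (proj₂ q))
    sumℤ≡∑ : ∀ xs → sumℤ xs ≡ ∑ xs id
    sumℤ≡∑ []       = refl
    sumℤ≡∑ (x ∷ xs) = cong (ℤ._+_ x) (sumℤ≡∑ xs)

-- K d is the transpose of multiplication by h_d.
K : ℕ → Fn → Fn
K d F p = ∑ (bounded d p) (λ c → F (zipWith _∸_ p c))

-- `K` with an integer degree. Negative degrees contribute zero, so the amount taken from a letter a
-- ranges over all of 0, ..., a instead of being cut off at the degree; the commutation proof then
-- needs no case distinction on the range.
Kz : ℤ → Fn → Fn
Kz (+ zero)   F []      = F []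
Kz (+ suc _)  F []      = + 0
Kz -[1+ _ ]   F []      = + 0
Kz z          F (a ∷ p) = ∑ (upTo (suc a)) (λ i → Kz (z ℤ.- + i) (λ q → F ((a ∸ i) ∷ q)) p)

Kz-cong : ∀ z {F G : Fn} → (∀ p → F p ≡ G p) → ∀ p → Kz z F p ≡ Kz z G p
Kz-cong (+ zero)  h []      = h []
Kz-cong (+ suc _) h []      = refl
Kz-cong -[1+ _ ]  h []      = refl
Kz-cong (+ zero)  h (a ∷ p) = ∑-cong (upTo (suc a)) (λ i → Kz-cong (+ 0 ℤ.- + i) (λ q → h _) p)
Kz-cong (+ suc n) h (a ∷ p) = ∑-cong (upTo (suc a)) (λ i → Kz-cong (+ suc n ℤ.- + i) (λ q → h _) p)
Kz-cong -[1+ n ]  h (a ∷ p) = ∑-cong (upTo (suc a)) (λ i → Kz-cong (-[1+ n ] ℤ.- + i) (λ q → h _) p)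

Kz-cons : ∀ z F a p → Kz z F (a ∷ p) ≡ ∑ (upTo (suc a)) (λ i → Kz (z ℤ.- + i) (λ q → F ((a ∸ i) ∷ q)) p)
Kz-cons (+ zero)  F a p = refl
Kz-cons (+ suc n) F a p = refl
Kz-cons -[1+ n ]  F a p = refl

negsuc-sub : ∀ n i → -[1+ n ] ℤ.- + i ≡ -[1+ n + i ]
negsuc-sub n zero    = cong -[1+_] (sym (+-identityʳ n))
negsuc-sub n (suc i) = cong -[1+_] (sym (+-suc n i))

Kz-negative : ∀ n F p → Kz -[1+ n ] F p ≡ + 0
Kz-negative n F []      = refl
Kz-negative n F (a ∷ p) = ∑-zero (upTo (suc a)) (λ i →
  trans (cong (λ z → Kz z (λ q → F ((a ∸ i) ∷ q)) p) (negsuc-sub n i)) (Kz-negative (n + i) _ p))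

pos-sub : ∀ d i → i ≤ d → + d ℤ.- + i ≡ + (d ∸ i)
pos-sub d i p = trans (ℤ.m-n≡m⊖n d i) (ℤ.⊖-≥ p)

pos-sub-neg : ∀ d i → d < i → + d ℤ.- + i ≡ -[1+ (i ∸ suc d) ]
pos-sub-neg d (suc i) (s≤s p) = trans (ℤ.⊖-< {d} {suc i} (s≤s p)) (cong (λ n → ℤ.- + n) (+-∸-assoc 1 p))

K-cons : ∀ d F a p → K d F (a ∷ p) ≡ ∑ (upTo (suc (d ⊓ a))) (λ i → K (d ∸ i) (λ q → F ((a ∸ i) ∷ q)) p)
K-cons d F a p = trans (∑-concatMap (λ i → map (i ∷_) (bounded (d ∸ i) p)) (upTo (suc (d ⊓ a))) G)
  (∑-cong (upTo (suc (d ⊓ a))) (λ i → ∑-map (i ∷_) (bounded (d ∸ i) p) G))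
  where
    G : Fn
    G c = F (zipWith _∸_ (a ∷ p) c)

K≡Kz : ∀ d F p → K d F p ≡ Kz (+ d) F p
K≡Kz zero    F []      = ℤ.+-identityʳ _
K≡Kz (suc d) F []      = refl
K≡Kz d       F (a ∷ p) = begin
  K d F (a ∷ p)
    ≡⟨ K-cons d F a p ⟩
  ∑ (upTo (suc (d ⊓ a))) (λ i → K (d ∸ i) (λ q → F ((a ∸ i) ∷ q)) p)
    ≡⟨ ∑-upTo-cong (suc (d ⊓ a)) (λ i i≤ → trans (K≡Kz (d ∸ i) _ p)
         (cong (λ z → Kz z (λ q → F ((a ∸ i) ∷ q)) p) (sym (pos-sub d i (≤-trans (≤-pred i≤) (ℕ.m⊓n≤m d a)))))) ⟩
  ∑ (upTo (suc (d ⊓ a))) f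
    ≡⟨ trunc ⟩
  ∑ (upTo (suc a)) f
    ≡⟨ sym (Kz-cons (+ d) F a p) ⟩
  Kz (+ d) F (a ∷ p) ∎
  where
    f : ℕ → ℤ
    f i = Kz (+ d ℤ.- + i) (λ q → F ((a ∸ i) ∷ q)) p
    trunc : ∑ (upTo (suc (d ⊓ a))) f ≡ ∑ (upTo (suc a)) f
    trunc with ≤-total d a
    ... | inj₁ d≤a rewrite m≤n⇒m⊓n≡m d≤a = ∑-upTo-extend (suc d) (suc a) f (s≤s d≤a) (λ i d<i →
            trans (cong (λ z → Kz z (λ q → F ((a ∸ i) ∷ q)) p) (pos-sub-neg d i d<i)) (Kz-negative _ _ p))
    ... | inj₂ a≤d rewrite m≥n⇒m⊓n≡n a≤d = refl

Kz-∑ : ∀ z (xs : List Elem) (G : Elem → Fn) p → Kz z (λ q → ∑ xs (λ x → G x q)) p ≡ ∑ xs (λ x → Kz z (G x) p)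
Kz-∑ (+ zero)  xs G [] = refl
Kz-∑ (+ suc n) xs G [] = sym (∑-0 xs)
Kz-∑ -[1+ n ]  xs G [] = sym (∑-0 xs)
Kz-∑ z xs G (a ∷ p) = begin
  Kz z (λ q → ∑ xs (λ x → G x q)) (a ∷ p)
    ≡⟨ Kz-cons z _ a p ⟩
  ∑ (upTo (suc a)) (λ i → Kz (z ℤ.- + i) (λ q → ∑ xs (λ x → G x ((a ∸ i) ∷ q))) p)
    ≡⟨ ∑-cong (upTo (suc a)) (λ i → Kz-∑ (z ℤ.- + i) xs (λ x q → G x ((a ∸ i) ∷ q)) p) ⟩
  ∑ (upTo (suc a)) (λ i → ∑ xs (λ x → Kz (z ℤ.- + i) (λ q → G x ((a ∸ i) ∷ q)) p))
    ≡⟨ ∑-swap _ (upTo (suc a)) xs ⟩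
  ∑ xs (λ x → ∑ (upTo (suc a)) (λ i → Kz (z ℤ.- + i) (λ q → G x ((a ∸ i) ∷ q)) p))
    ≡⟨ ∑-cong xs (λ x → sym (Kz-cons z (G x) a p)) ⟩
  ∑ xs (λ x → Kz z (G x) (a ∷ p)) ∎

Kz-comm : ∀ z z' F p → Kz z (Kz z' F) p ≡ Kz z' (Kz z F) p
Kz-comm (+ zero)  (+ zero)  F [] = refl
Kz-comm (+ zero)  (+ suc _) F [] = refl
Kz-comm (+ zero)  -[1+ _ ]  F [] = refl
Kz-comm (+ suc _) (+ zero)  F [] = refl
Kz-comm (+ suc _) (+ suc _) F [] = refl
Kz-comm (+ suc _) -[1+ _ ]  F [] = refl
Kz-comm -[1+ _ ]  (+ zero)  F [] = refl
Kz-comm -[1+ _ ]  (+ suc _) F [] = refl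
Kz-comm -[1+ _ ]  -[1+ _ ]  F [] = refl
Kz-comm z z' F (a ∷ p) = begin
  Kz z (Kz z' F) (a ∷ p)
    ≡⟨ double z z' ⟩
  ∑ (upTo (suc a)) (λ i → ∑ (upTo (suc (a ∸ i))) (λ j → Kz (z ℤ.- + i) (Kz (z' ℤ.- + j) (λ q → F ((a ∸ i ∸ j) ∷ q))) p))
    ≡⟨ ∑-triangle a (λ i j → Kz (z ℤ.- + i) (Kz (z' ℤ.- + j) (λ q → F ((a ∸ i ∸ j) ∷ q))) p) ⟩
  ∑ (upTo (suc a)) (λ i → ∑ (upTo (suc (a ∸ i))) (λ j → Kz (z ℤ.- + j) (Kz (z' ℤ.- + i) (λ q → F ((a ∸ j ∸ i) ∷ q))) p))
    ≡⟨ ∑-cong (upTo (suc a)) (λ i → ∑-cong (upTo (suc (a ∸ i))) (λ j →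
         trans (Kz-comm (z ℤ.- + j) (z' ℤ.- + i) _ p)
           (Kz-cong (z' ℤ.- + i) (Kz-cong (z ℤ.- + j) (λ q → cong (λ n → F (n ∷ q)) (∸-comm a j i))) p))) ⟩
  ∑ (upTo (suc a)) (λ i → ∑ (upTo (suc (a ∸ i))) (λ j → Kz (z' ℤ.- + i) (Kz (z ℤ.- + j) (λ q → F ((a ∸ i ∸ j) ∷ q))) p))
    ≡⟨ sym (double z' z) ⟩
  Kz z' (Kz z F) (a ∷ p) ∎
  where
    ∸-comm : ∀ a i j → a ∸ i ∸ j ≡ a ∸ j ∸ i
    ∸-comm a i j = trans (∸-+-assoc a i j) (trans (cong (a ∸_) (+-comm i j)) (sym (∸-+-assoc a j i)))
    double : ∀ z z' → Kz z (Kz z' F) (a ∷ p) ≡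
      ∑ (upTo (suc a)) (λ i → ∑ (upTo (suc (a ∸ i))) (λ j → Kz (z ℤ.- + i) (Kz (z' ℤ.- + j) (λ q → F ((a ∸ i ∸ j) ∷ q))) p))
    double z z' = trans (Kz-cons z (Kz z' F) a p) (∑-cong (upTo (suc a)) (λ i →
      trans (Kz-cong (z ℤ.- + i) (λ q → Kz-cons z' F (a ∸ i) q) p)
        (Kz-∑ (z ℤ.- + i) (upTo (suc (a ∸ i))) (λ j q → Kz (z' ℤ.- + j) (λ q → F ((a ∸ i ∸ j) ∷ q)) q) p)))

K-cong : ∀ d {F G : Fn} → (∀ p → F p ≡ G p) → ∀ p → K d F p ≡ K d G p
K-cong d h p = ∑-cong (bounded d p) (λ c → h _)

K-comm : ∀ d d' F p → K d (K d' F) p ≡ K d' (K d F) p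
K-comm d d' F p = begin
  K d (K d' F) p         ≡⟨ K-cong d (K≡Kz d' F) p ⟩
  K d (Kz (+ d') F) p    ≡⟨ K≡Kz d (Kz (+ d') F) p ⟩
  Kz (+ d) (Kz (+ d') F) p ≡⟨ Kz-comm (+ d) (+ d') F p ⟩
  Kz (+ d') (Kz (+ d) F) p ≡⟨ sym (K≡Kz d' (Kz (+ d) F) p) ⟩
  K d' (Kz (+ d) F) p    ≡⟨ K-cong d' (λ q → sym (K≡Kz d F q)) p ⟩
  K d' (K d F) p         ∎

pos-sum : (f : Elem → ℕ) (xs : List Elem) → + sum (map f xs) ≡ ∑ xs (λ x → + f x)
pos-sum f []       = refl
pos-sum f (x ∷ xs) = cong (ℤ._+_ (+ f x)) (pos-sum f xs)

mc-row : ∀ r p q → mc (r ∷ p) q ≡ K r (mc p) q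
mc-row r p q = pos-sum (λ c → matCount p (zipWith _∸_ q c)) (bounded r q)

-- The matrix count is defined by peeling rows; this is the counterpart for columns. Once the corner
-- entry i is split off, the rest of the first row and the rest of the first column are chosen
-- independently, so the two sums may be exchanged.
mc-col : ∀ p d q → mc p (d ∷ q) ≡ K d (λ p' → mc p' q) p
mc-col []      zero    q = sym (ℤ.+-identityʳ _)
mc-col []      (suc d) q = refl
mc-col (r ∷ p) d       q = begin
  mc (r ∷ p) (d ∷ q)
    ≡⟨ mc-row r p (d ∷ q) ⟩
  K r (mc p) (d ∷ q)
    ≡⟨ K-cons r (mc p) d q ⟩
  ∑ (upTo (suc (r ⊓ d))) (λ i → K (r ∸ i) (λ q' → mc p ((d ∸ i) ∷ q')) q)
    ≡⟨ ∑-cong (upTo (suc (r ⊓ d))) (λ i → K-cong (r ∸ i) (λ q' → mc-col p (d ∸ i) q') q) ⟩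
  ∑ (upTo (suc (r ⊓ d))) (λ i → K (r ∸ i) (λ q' → K (d ∸ i) (λ p' → mc p' q') p) q)
    ≡⟨ ∑-cong (upTo (suc (r ⊓ d))) (λ i → ∑-swap _ (bounded (r ∸ i) q) (bounded (d ∸ i) p)) ⟩
  ∑ (upTo (suc (r ⊓ d))) (λ i → K (d ∸ i) (λ p' → K (r ∸ i) (mc p') q) p)
    ≡⟨ ∑-cong (upTo (suc (r ⊓ d))) (λ i → K-cong (d ∸ i) (λ p' → sym (mc-row (r ∸ i) p' q)) p) ⟩
  ∑ (upTo (suc (r ⊓ d))) (λ i → K (d ∸ i) (λ p' → mc ((r ∸ i) ∷ p') q) p)
    ≡⟨ cong (λ n → ∑ (upTo (suc n)) (λ i → K (d ∸ i) (λ p' → mc ((r ∸ i) ∷ p') q) p)) (ℕ.⊓-comm r d) ⟩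
  ∑ (upTo (suc (d ⊓ r))) (λ i → K (d ∸ i) (λ p' → mc ((r ∸ i) ∷ p') q) p)
    ≡⟨ sym (K-cons d (λ p' → mc p' q) r p) ⟩
  K d (λ p' → mc p' q) (r ∷ p) ∎

-- `expand` yields words rather than monomials and writes h₀ as the empty word, whereas `hv (+ 0)`
-- prepends a letter 0. The functionals with `Inv` do not see these differences: they are the ones
-- that descend to the polynomial ring.
record Inv (F : Fn) : Set where
  field
    inv-perm : ∀ {p q} → p ↭ q → F p ≡ F q
    inv-unit : ∀ q → F (0 ∷ q) ≡ F q
open Inv public

K-zero : ∀ F p → K 0 F p ≡ F p
K-zero F []      = ℤ.+-identityʳ _
K-zero F (a ∷ p) = trans (K-cons 0 F a p) (trans (ℤ.+-identityʳ _) (K-zero (λ q → F (a ∷ q)) p))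

mc-rows : ∀ q → Inv (λ p → mc p q)
mc-rows q .inv-unit p = trans (mc-row 0 p q) (K-zero (mc p) q)
mc-rows q .inv-perm = go q
  where
    go : ∀ {p p'} q → p ↭ p' → mc p q ≡ mc p' q
    go q _↭_.refl        = refl
    go q (prep {p} {p'} r h) = trans (mc-row r p q) (trans (K-cong r (λ q' → go q' h) q) (sym (mc-row r p' q)))
    go q (swap {p} {p'} r s h) = begin
      mc (r ∷ s ∷ p) q       ≡⟨ mc-row r (s ∷ p) q ⟩
      K r (mc (s ∷ p)) q     ≡⟨ K-cong r (mc-row s p) q ⟩
      K r (K s (mc p)) q     ≡⟨ K-comm r s (mc p) q ⟩
      K s (K r (mc p)) q     ≡⟨ K-cong s (K-cong r (λ q' → go q' h)) q ⟩
      K s (K r (mc p')) q    ≡⟨ K-cong s (λ q' → sym (mc-row r p' q')) q ⟩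
      K s (mc (r ∷ p')) q    ≡⟨ sym (mc-row s (r ∷ p') q) ⟩
      mc (s ∷ r ∷ p') q      ∎
    go q (_↭_.trans h h') = trans (go q h) (go q h')

mc-cols : ∀ p → Inv (mc p)
mc-cols p .inv-unit q = trans (mc-col p 0 q) (K-zero (λ p' → mc p' q) p)
mc-cols p .inv-perm = go p
  where
    go : ∀ {q q'} p → q ↭ q' → mc p q ≡ mc p q'
    go p _↭_.refl        = refl
    go p (prep {q} {q'} r h) = trans (mc-col p r q) (trans (K-cong r (λ p' → go p' h) p) (sym (mc-col p r q')))
    go p (swap {q} {q'} r s h) = begin
      mc p (r ∷ s ∷ q)                      ≡⟨ mc-col p r (s ∷ q) ⟩
      K r (λ p' → mc p' (s ∷ q)) p          ≡⟨ K-cong r (λ p' → mc-col p' s q) p ⟩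
      K r (K s (λ p' → mc p' q)) p          ≡⟨ K-comm r s (λ p' → mc p' q) p ⟩
      K s (K r (λ p' → mc p' q)) p          ≡⟨ K-cong s (K-cong r (λ p' → go p' h)) p ⟩
      K s (K r (λ p' → mc p' q')) p         ≡⟨ K-cong s (λ p' → sym (mc-col p' r q')) p ⟩
      K s (λ p' → mc p' (r ∷ q')) p         ≡⟨ sym (mc-col p s (r ∷ q')) ⟩
      mc p (s ∷ r ∷ q')                     ∎
    go p (_↭_.trans h h') = trans (go p h) (go p h')

-- Jacobi–Trudi determinants

enumFrom : ℕ → List Elem → List (ℕ × Elem)
enumFrom n []       = []
enumFrom n (x ∷ xs) = (n , x) ∷ enumFrom (suc n) xs

-- The local function of the definition of indexed has no name outside it; its
-- value is left to unification, which the abstraction over zero makes possible.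
indexed-go≡enumFrom : (n : ℕ) (xs : List Elem) → _ ≡ enumFrom n xs
indexed≡enumFrom : (xs : List Elem) → indexed xs ≡ enumFrom 0 xs

indexed≡enumFrom xs with zero
... | n = indexed-go≡enumFrom n xs

indexed-go≡enumFrom n []       = refl
indexed-go≡enumFrom n (x ∷ xs) = cong ((n , x) ∷_) (indexed-go≡enumFrom (suc n) xs)

-- Multiplication by h_z, transposed.
hv : ℤ → Fn → Fn
hv (+ a)    F q = F (a ∷ q)
hv -[1+ _ ] F q = + 0

hv-cong : ∀ z {F G : Fn} → (∀ q → F q ≡ G q) → ∀ q → hv z F q ≡ hv z G q
hv-cong (+ a)    h q = h (a ∷ q)
hv-cong -[1+ _ ] h q = refl

hv-comm : ∀ {F} → Inv F → ∀ y z q → hv y (hv z F) q ≡ hv z (hv y F) q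
hv-comm i (+ a)    (+ b)    q = inv-perm i (swap b a ↭-refl)
hv-comm i (+ a)    -[1+ _ ] q = refl
hv-comm i -[1+ _ ] (+ b)    q = refl
hv-comm i -[1+ _ ] -[1+ _ ] q = refl

hv-inv : ∀ {F} → Inv F → ∀ z → Inv (hv z F)
hv-inv i (+ a)    .inv-perm h = inv-perm i (prep a h)
hv-inv i (+ a)    .inv-unit q = trans (inv-perm i (swap a 0 ↭-refl)) (inv-unit i (a ∷ q))
hv-inv i -[1+ _ ] .inv-perm h = refl
hv-inv i -[1+ _ ] .inv-unit q = refl

hv-+ : ∀ z (F G : Fn) q → hv z (λ p → F p ℤ.+ G p) q ≡ hv z F q ℤ.+ hv z G q
hv-+ (+ a)    F G q = refl
hv-+ -[1+ _ ] F G q = refl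

-- Determinants of matrices (h_{a+c}) with rows a and columns c, expanded along the first
-- row.  Treating the column list recursively makes the alternation in the rows a short
-- induction: lap a f is a wedge product of the row a with f.
lap : ℤ → (List ℤ → Fn → ℤ) → List ℤ → Fn → ℤ
lap a f []       F = + 0
lap a f (c ∷ cs) F = f cs (hv (a ℤ.+ c) F) ℤ.- lap a (λ cs' → f (c ∷ cs')) cs F

minor : List ℤ → List ℤ → Fn → ℤ
minor []       []      F = F []
minor []       (_ ∷ _) F = + 0
minor (a ∷ as) cs      F = lap a (minor as) cs F

record Linear (f : List ℤ → Fn → ℤ) : Set where
  field
    linear-ext : ∀ cs {F G} → (∀ q → F q ≡ G q) → f cs F ≡ f cs G
    linear-add : ∀ cs F G → f cs (λ q → F q ℤ.+ G q) ≡ f cs F ℤ.+ f cs G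
open Linear

cons-linear : ∀ {f} c → Linear f → Linear (λ cs → f (c ∷ cs))
cons-linear c l .linear-ext cs = linear-ext l (c ∷ cs)
cons-linear c l .linear-add cs = linear-add l (c ∷ cs)

lap-linear : ∀ a {f} → Linear f → Linear (lap a f)
lap-linear a l .linear-ext []       h = refl
lap-linear a l .linear-ext (c ∷ cs) h =
  cong₂ ℤ._-_ (linear-ext l cs (hv-cong (a ℤ.+ c) h)) (lap-linear a (cons-linear c l) .linear-ext cs h)
lap-linear a {f} l .linear-add []       F G = refl
lap-linear a {f} l .linear-add (c ∷ cs) F G = begin
  f cs (hv (a ℤ.+ c) (λ q → F q ℤ.+ G q)) ℤ.- lap a f' cs (λ q → F q ℤ.+ G q)
    ≡⟨ cong₂ ℤ._-_ (trans (linear-ext l cs (hv-+ (a ℤ.+ c) F G)) (linear-add l cs (hv (a ℤ.+ c) F) (hv (a ℤ.+ c) G))) (lap-linear a (cons-linear c l) .linear-add cs F G) ⟩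
  (f cs (hv (a ℤ.+ c) F) ℤ.+ f cs (hv (a ℤ.+ c) G)) ℤ.- (lap a f' cs F ℤ.+ lap a f' cs G)
    ≡⟨ lia 0 4 (λ x y u v → (x :+ y) :- (u :+ v) := (x :- u) :+ (y :- v)) (f cs (hv (a ℤ.+ c) F)) (f cs (hv (a ℤ.+ c) G)) (lap a f' cs F) (lap a f' cs G) ⟩
  (f cs (hv (a ℤ.+ c) F) ℤ.- lap a f' cs F) ℤ.+ (f cs (hv (a ℤ.+ c) G) ℤ.- lap a f' cs G) ∎
  where
    f' : List ℤ → Fn → ℤ
    f' cs' = f (c ∷ cs')

minor-linear : ∀ as → Linear (minor as)
minor-linear []       .linear-ext []      h = h []
minor-linear []       .linear-ext (_ ∷ _) h = refl
minor-linear []       .linear-add []      F G = refl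
minor-linear []       .linear-add (_ ∷ _) F G = refl
minor-linear (a ∷ as) = lap-linear a (minor-linear as)

linear-zero : ∀ {f} → Linear f → ∀ cs → f cs (λ _ → + 0) ≡ + 0
linear-zero {f} l cs = lia 0 1 (λ x → x := x :+ x ⇒ x := ♯ 0) (f cs (λ _ → + 0)) (linear-add l cs (λ _ → + 0) (λ _ → + 0))

linear-∑ : ∀ {f} → Linear f → ∀ cs (xs : List Elem) (G : Elem → Fn) → f cs (λ q → ∑ xs (λ x → G x q)) ≡ ∑ xs (λ x → f cs (G x))
linear-∑ l cs []       G = linear-zero l cs
linear-∑ {f = f} l cs (x ∷ xs) G = trans (linear-add l cs (G x) (λ q → ∑ xs (λ y → G y q))) (cong (ℤ._+_ (f cs (G x))) (linear-∑ l cs xs G))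

lap-cong : ∀ a {f g : List ℤ → Fn → ℤ} → (∀ cs F → f cs F ≡ g cs F) → ∀ cs F → lap a f cs F ≡ lap a g cs F
lap-cong a h []       F = refl
lap-cong a h (c ∷ cs) F = cong₂ ℤ._-_ (h cs (hv (a ℤ.+ c) F)) (lap-cong a (λ cs' → h (c ∷ cs')) cs F)

lap-neg : ∀ a {f g : List ℤ → Fn → ℤ} → (∀ cs {F} → Inv F → f cs F ≡ ℤ.- g cs F) →
  ∀ cs {F} → Inv F → lap a f cs F ≡ ℤ.- lap a g cs F
lap-neg a h []       i = refl
lap-neg a {f} {g} h (c ∷ cs) {F} i = lia 0 4 (λ x y u v → x := :- y ⇒ u := :- v ⇒ x :- u := :- (y :- v))
  _ (g cs (hv (a ℤ.+ c) F)) _ (lap a (λ cs' → g (c ∷ cs')) cs F) (h cs (hv-inv i (a ℤ.+ c))) (lap-neg a {λ cs' → f (c ∷ cs')} {λ cs' → g (c ∷ cs')} (λ cs' → h (c ∷ cs')) cs i)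

lap-sub : ∀ a (f g : List ℤ → Fn → ℤ) cs F → lap a (λ cs' F' → f cs' F' ℤ.- g cs' F') cs F ≡ lap a f cs F ℤ.- lap a g cs F
lap-sub a f g []       F = refl
lap-sub a f g (c ∷ cs) F = lia 0 5 (λ x y u v w → w := u :- v ⇒ (x :- y) :- w := (x :- u) :- (y :- v))
  (f cs (hv (a ℤ.+ c) F)) (g cs (hv (a ℤ.+ c) F)) (lap a (λ cs' → f (c ∷ cs')) cs F) (lap a (λ cs' → g (c ∷ cs')) cs F) _
  (lap-sub a (λ cs' → f (c ∷ cs')) (λ cs' → g (c ∷ cs')) cs F)

lap-hv : ∀ a z {f} → Linear f → ∀ cs {F} → Inv F → lap a (λ cs' F' → f cs' (hv z F')) cs F ≡ lap a f cs (hv z F)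
lap-hv a z l []       i = refl
lap-hv a z l (c ∷ cs) i = cong₂ ℤ._-_ (linear-ext l cs (hv-comm i z (a ℤ.+ c))) (lap-hv a z (cons-linear c l) cs i)

-- In the expansion by the first column c, the terms in which one of the two rows uses c occur on
-- both sides with opposite signs, and the terms in which neither does are antisymmetric by
-- induction. `Inv` enters because the factors of the two rows are collected in different orders.
lap-anti : ∀ a b {f} → Linear f → ∀ cs {F} → Inv F → lap a (lap b f) cs F ≡ ℤ.- lap b (lap a f) cs F
lap-anti a b l []       i = refl
lap-anti a b {f} l (c ∷ cs) {F} i =
  lia 0 6 (λ xb xa u v ab ba → u := xa :- ab ⇒ v := xb :- ba ⇒ ab := :- ba ⇒ xb :- u := :- (xa :- v))
    (lap b f cs (hv (a ℤ.+ c) F)) (lap a f cs (hv (b ℤ.+ c) F)) _ _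
    (lap a (lap b (λ cs' → f (c ∷ cs'))) cs F) (lap b (lap a (λ cs' → f (c ∷ cs'))) cs F)
    (inner a b) (inner b a) (lap-anti a b (cons-linear c l) cs i)
  where
    inner : ∀ a b → lap a (λ cs' → lap b f (c ∷ cs')) cs F ≡ lap a f cs (hv (b ℤ.+ c) F) ℤ.- lap a (lap b (λ cs' → f (c ∷ cs'))) cs F
    inner a b = trans (lap-sub a (λ cs' F' → f cs' (hv (b ℤ.+ c) F')) (lap b (λ cs' → f (c ∷ cs'))) cs F)
      (cong (ℤ._- lap a (lap b (λ cs' → f (c ∷ cs'))) cs F) (lap-hv a (b ℤ.+ c) l cs i))

lap-vanish : ∀ a {f : List ℤ → Fn → ℤ} cs → (∀ {zs} → zs ⊆ cs → ∀ F → f zs F ≡ + 0) → ∀ F → lap a f cs F ≡ + 0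
lap-vanish a []       h F = refl
lap-vanish a {f} (c ∷ cs) h F = lia 0 2 (λ x y → x := ♯ 0 ⇒ y := ♯ 0 ⇒ x :- y := ♯ 0) (f cs (hv (a ℤ.+ c) F)) (lap a (λ cs' → f (c ∷ cs')) cs F)
  (h (c ∷ʳ ⊆-refl) (hv (a ℤ.+ c) F)) (lap-vanish a {λ cs' → f (c ∷ cs')} cs (λ s → h (refl ∷ s)) F)
  where
    open import Data.List.Relation.Binary.Sublist.Propositional using (⊆-refl)

sgn-suc : ∀ n → sgn (suc n) ≡ ℤ.- sgn n
sgn-suc zero          = refl
sgn-suc (suc zero)    = refl
sgn-suc (suc (suc n)) = sgn-suc n

∑-enumFrom-suc : ∀ s (xs : List Elem) (f : ℕ × Elem → ℤ) → ∑ (enumFrom (suc s) xs) f ≡ ∑ (enumFrom s xs) (λ p → f (suc (proj₁ p) , proj₂ p))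
∑-enumFrom-suc s []       f = refl
∑-enumFrom-suc s (x ∷ xs) f = cong (ℤ._+_ (f (suc s , x))) (∑-enumFrom-suc (suc s) xs f)

∑-enumFrom-cong : ∀ s (xs : List Elem) {f g : ℕ × Elem → ℤ} → (∀ k x → k < s + length xs → f (k , x) ≡ g (k , x)) →
  ∑ (enumFrom s xs) f ≡ ∑ (enumFrom s xs) g
∑-enumFrom-cong s []       h = refl
∑-enumFrom-cong s (x ∷ xs) h = cong₂ ℤ._+_ (h s x (m<m+n s (s≤s z≤n)))
  (∑-enumFrom-cong (suc s) xs (λ k y p → h k y (subst (k <_) (sym (+-suc s (length xs))) p)))

enumFrom-map : ∀ {Elem′ : Set} s (f : Elem → Elem′) (xs : List Elem) → enumFrom s (map f xs) ≡ map (λ p → (proj₁ p , f (proj₂ p))) (enumFrom s xs)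
enumFrom-map s f []       = refl
enumFrom-map s f (x ∷ xs) = cong ((s , f x) ∷_) (enumFrom-map (suc s) f xs)

lap≡∑ : ∀ a (f : List ℤ → Fn → ℤ) cs F →
  lap a f cs F ≡ ∑ (enumFrom 0 cs) (λ p → sgn (proj₁ p) ℤ.* f (removeAt (proj₁ p) cs) (hv (a ℤ.+ proj₂ p) F))
lap≡∑ a f []       F = refl
lap≡∑ a f (c ∷ cs) F = begin
  f cs (hv (a ℤ.+ c) F) ℤ.- lap a (λ cs' → f (c ∷ cs')) cs F
    ≡⟨ cong₂ ℤ._+_ (sym (ℤ.*-identityˡ (f cs (hv (a ℤ.+ c) F)))) (trans (cong ℤ.-_ (lap≡∑ a (λ cs' → f (c ∷ cs')) cs F)) (sym (∑-neg _ (enumFrom 0 cs)))) ⟩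
  + 1 ℤ.* f cs (hv (a ℤ.+ c) F) ℤ.+
    ∑ (enumFrom 0 cs) (λ p → ℤ.- (sgn (proj₁ p) ℤ.* f (c ∷ removeAt (proj₁ p) cs) (hv (a ℤ.+ proj₂ p) F)))
    ≡⟨ cong (ℤ._+_ (+ 1 ℤ.* f cs (hv (a ℤ.+ c) F))) (trans (∑-cong (enumFrom 0 cs) (λ p → trans (ℤ.neg-distribˡ-* (sgn (proj₁ p)) _)
         (cong (ℤ._* f (c ∷ removeAt (proj₁ p) cs) (hv (a ℤ.+ proj₂ p) F)) (sym (sgn-suc (proj₁ p)))))) (sym (∑-enumFrom-suc 0 cs term))) ⟩
  ∑ (enumFrom 0 (c ∷ cs)) term ∎
  where
    term : ℕ × ℤ → ℤ
    term p = sgn (proj₁ p) ℤ.* f (removeAt (proj₁ p) (c ∷ cs)) (hv (a ℤ.+ proj₂ p) F)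

removeAt-map : ∀ {Elem′ : Set} k (f : Elem → Elem′) (xs : List Elem) → removeAt k (map f xs) ≡ map f (removeAt k xs)
removeAt-map k       f []       = refl
removeAt-map zero    f (x ∷ xs) = refl
removeAt-map (suc k) f (x ∷ xs) = cong (f x ∷_) (removeAt-map k f xs)

length-removeAt : ∀ k (xs : List Elem) → k < length xs → suc (length (removeAt k xs)) ≡ length xs
length-removeAt zero    (x ∷ xs) p       = refl
length-removeAt (suc k) (x ∷ xs) (s≤s p) = cong suc (length-removeAt k xs p)

ev-lit-hh-⊗ : ∀ s z g {F} → Inv F → ev (lit s ⊗ hh z ⊗ g) F ≡ s ℤ.* ev g (hv z F)
ev-lit-hh-⊗ s z g {F} i = begin
  ev (lit s ⊗ hh z ⊗ g) F
    ≡⟨ trans (ev-⊗ (lit s ⊗ hh z) g F) (trans (ev-⊗ (lit s) (hh z) (λ p → ev g (λ q → F (p ++ q))))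
         (ev-lit s (λ p → ev (hh z) (λ p' → ev g (λ q → F ((p ++ p') ++ q)))))) ⟩
  s ℤ.* ev (hh z) (λ p → ev g (λ q → F (p ++ q)))
    ≡⟨ cong (s ℤ.*_) (ev-hh z) ⟩
  s ℤ.* ev g (hv z F) ∎
  where
    ev-hh : ∀ z → ev (hh z) (λ p → ev g (λ q → F (p ++ q))) ≡ ev g (hv z F)
    ev-hh (+ zero)  = trans (trans (ℤ.+-identityʳ _) (ℤ.*-identityˡ _)) (ev-cong g (λ q → sym (inv-unit i q)))
    ev-hh (+ suc n) = trans (ℤ.+-identityʳ _) (ℤ.*-identityˡ _)
    ev-hh -[1+ n ]  = sym (∑-zero (expand g) (λ p → ℤ.*-zeroʳ (proj₁ p)))

-- `detN` carries along the matrix entries, `minor` only the row values γ_s - s and the column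
-- values j. The equality of lengths makes both recursions end at the empty matrix; for leftover
-- columns `minor` would give 0 where `detN` gives 1.
ev-detN : ∀ (rs : List (ℕ × ℤ)) (cs : List ℕ) → length rs ≡ length cs → ∀ {F} → Inv F →
  ev (detN (length rs) (map (λ p → map (λ j → hh (proj₂ p ℤ.+ (+ j) ℤ.- (+ proj₁ p))) cs) rs)) F ≡
  minor (map (λ p → proj₂ p ℤ.- + proj₁ p) rs) (map +_ cs) F
ev-detN []            []       eq {F} i = trans (ℤ.+-identityʳ _) (ℤ.*-identityˡ (F []))
ev-detN ((s , g) ∷ rs) cs eq {F} i = begin
  ev (sumSym (map (λ p → lit (sgn (proj₁ p)) ⊗ proj₂ p ⊗ det' (proj₁ p)) (indexed (map entry cs)))) F
    ≡⟨ trans (ev-sumSym (map (λ p → lit (sgn (proj₁ p)) ⊗ proj₂ p ⊗ det' (proj₁ p)) (indexed (map entry cs))) F) (trans (∑-map _ (indexed (map entry cs)) _)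
         (trans (cong (λ l → ∑ l (λ p → ev (lit (sgn (proj₁ p)) ⊗ proj₂ p ⊗ det' (proj₁ p)) F)) (trans (indexed≡enumFrom (map entry cs)) (enumFrom-map 0 entry cs)))
           (∑-map _ (enumFrom 0 cs) _))) ⟩
  ∑ (enumFrom 0 cs) (λ p → ev (lit (sgn (proj₁ p)) ⊗ entry (proj₂ p) ⊗ det' (proj₁ p)) F)
    ≡⟨ ∑-enumFrom-cong 0 cs (λ k c k< → trans (ev-lit-hh-⊗ (sgn k) (g ℤ.+ (+ c) ℤ.- (+ s)) (det' k) i) (cong (sgn k ℤ.*_) (minors k c k<))) ⟩
  ∑ (enumFrom 0 cs) (λ p → sgn (proj₁ p) ℤ.* minor as (removeAt (proj₁ p) (map +_ cs)) (hv ((g ℤ.- + s) ℤ.+ + proj₂ p) F))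
    ≡⟨ sym (trans (cong (λ l → ∑ l (λ p → sgn (proj₁ p) ℤ.* minor as (removeAt (proj₁ p) (map +_ cs)) (hv ((g ℤ.- + s) ℤ.+ proj₂ p) F))) (enumFrom-map 0 +_ cs))
         (∑-map _ (enumFrom 0 cs) _)) ⟩
  ∑ (enumFrom 0 (map +_ cs)) (λ p → sgn (proj₁ p) ℤ.* minor as (removeAt (proj₁ p) (map +_ cs)) (hv ((g ℤ.- + s) ℤ.+ proj₂ p) F))
    ≡⟨ sym (lap≡∑ (g ℤ.- + s) (minor as) (map +_ cs) F) ⟩
  lap (g ℤ.- + s) (minor as) (map +_ cs) F ∎
  where
    as : List ℤ
    as = map (λ p → proj₂ p ℤ.- + proj₁ p) rs
    entry : ℕ → Sym
    entry j = hh (g ℤ.+ (+ j) ℤ.- (+ s))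
    row : List ℕ → ℕ × ℤ → List Sym
    row cs p = map (λ j → hh (proj₂ p ℤ.+ (+ j) ℤ.- (+ proj₁ p))) cs
    det' : ℕ → Sym
    det' k = detN (length rs) (map (removeAt k) (map (row cs) rs))
    rows-eq : ∀ k → map (removeAt k) (map (row cs) rs) ≡ map (row (removeAt k cs)) rs
    rows-eq k = trans (sym (map-∘ rs)) (map-cong (λ p → removeAt-map k _ cs) rs)
    minors : ∀ k c → k < length cs → ev (det' k) (hv (g ℤ.+ (+ c) ℤ.- (+ s)) F) ≡ minor as (removeAt k (map +_ cs)) (hv ((g ℤ.- + s) ℤ.+ + c) F)
    minors k c k< = begin
      ev (det' k) (hv (g ℤ.+ (+ c) ℤ.- (+ s)) F)
        ≡⟨ cong₂ ev (cong (detN (length rs)) (rows-eq k)) (cong (λ z → hv z F)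
             (lia 2 1 (λ c s g → g :+ ↑ c :- ↑ s := (g :- ↑ s) :+ ↑ c) c s g)) ⟩
      ev (detN (length rs) (map (row (removeAt k cs)) rs)) (hv ((g ℤ.- + s) ℤ.+ + c) F)
        ≡⟨ ev-detN rs (removeAt k cs) (suc-injective (trans eq (sym (length-removeAt k cs k<)))) (hv-inv i ((g ℤ.- + s) ℤ.+ + c)) ⟩
      minor as (map +_ (removeAt k cs)) (hv ((g ℤ.- + s) ℤ.+ + c) F)
        ≡⟨ cong (λ l → minor as l (hv ((g ℤ.- + s) ℤ.+ + c) F)) (sym (removeAt-map k +_ cs)) ⟩
      minor as (removeAt k (map +_ cs)) (hv ((g ℤ.- + s) ℤ.+ + c) F) ∎

tab : ℕ → ℕ → (ℕ → ℤ) → List ℤ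
tab s zero    γ = []
tab s (suc n) γ = γ s ∷ tab (suc s) n γ

rowEnds : ℕ → ℕ → (ℕ → ℤ) → List ℤ
rowEnds s zero    γ = []
rowEnds s (suc n) γ = γ s ℤ.- + s ∷ rowEnds (suc s) n γ

cols : ℕ → ℕ → List ℤ
cols s zero    = []
cols s (suc n) = + s ∷ cols (suc s) n

length-tab : ∀ s n γ → length (tab s n γ) ≡ n
length-tab s zero    γ = refl
length-tab s (suc n) γ = cong suc (length-tab (suc s) n γ)

length-enumFrom : ∀ s (xs : List Elem) → length (enumFrom s xs) ≡ length xs
length-enumFrom s []       = refl
length-enumFrom s (x ∷ xs) = cong suc (length-enumFrom (suc s) xs)

map-enumFrom-tab : ∀ s n γ → map (λ p → proj₂ p ℤ.- + proj₁ p) (enumFrom s (tab s n γ)) ≡ rowEnds s n γ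
map-enumFrom-tab s zero    γ = refl
map-enumFrom-tab s (suc n) γ = cong (γ s ℤ.- + s ∷_) (map-enumFrom-tab (suc s) n γ)

map-applyUpTo : ∀ (f g : ℕ → ℕ) s n → (∀ i → g i ≡ s + i) → map +_ (applyUpTo g n) ≡ cols s n
map-applyUpTo f g s zero    h = refl
map-applyUpTo f g s (suc n) h = cong₂ _∷_ (cong +_ (trans (h 0) (+-identityʳ s)))
  (map-applyUpTo f (g ∘ suc) (suc s) n (λ i → trans (h (suc i)) (+-suc s i)))

length-upTo : ∀ (f : ℕ → ℕ) n → length (applyUpTo f n) ≡ n
length-upTo f zero    = refl
length-upTo f (suc n) = cong suc (length-upTo (f ∘ suc) n)

sdet : ℕ → (ℕ → ℤ) → Fn → ℤ
sdet n γ = minor (rowEnds 0 n γ) (cols 0 n)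

ev-schur : ∀ n γ {F} → Inv F → ev (schur (tab 0 n γ)) F ≡ sdet n γ F
ev-schur n γ {F} i = begin
  ev (schur (tab 0 n γ)) F
    ≡⟨ cong (λ m → ev m F) (cong₂ (λ r l → det (map (λ p → map (λ j → hh (proj₂ p ℤ.+ (+ j) ℤ.- (+ proj₁ p))) (upTo l)) r)) (indexed≡enumFrom (tab 0 n γ)) (length-tab 0 n γ)) ⟩
  ev (det (map (λ p → map (λ j → hh (proj₂ p ℤ.+ (+ j) ℤ.- (+ proj₁ p))) (upTo n)) (enumFrom 0 (tab 0 n γ)))) F
    ≡⟨ cong (λ m → ev (detN m (map (λ p → map (λ j → hh (proj₂ p ℤ.+ (+ j) ℤ.- (+ proj₁ p))) (upTo n)) (enumFrom 0 (tab 0 n γ)))) F) (length-map _ (enumFrom 0 (tab 0 n γ))) ⟩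
  ev (detN (length (enumFrom 0 (tab 0 n γ))) (map (λ p → map (λ j → hh (proj₂ p ℤ.+ (+ j) ℤ.- (+ proj₁ p))) (upTo n)) (enumFrom 0 (tab 0 n γ)))) F
    ≡⟨ ev-detN (enumFrom 0 (tab 0 n γ)) (upTo n) (trans (length-enumFrom 0 (tab 0 n γ)) (trans (length-tab 0 n γ) (sym (length-upTo id n)))) i ⟩
  minor (map (λ p → proj₂ p ℤ.- + proj₁ p) (enumFrom 0 (tab 0 n γ))) (map +_ (upTo n)) F
    ≡⟨ cong₂ (λ a c → minor a c F) (map-enumFrom-tab 0 n γ) (map-applyUpTo id id 0 n (λ _ → refl)) ⟩
  sdet n γ F ∎

Weight : Set
Weight = ℕ → ℤ

ε : ℕ → Weight
ε zero    zero    = + 1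
ε zero    (suc _) = + 0
ε (suc _) zero    = + 0
ε (suc i) (suc j) = ε i j

ε-diag : ∀ i → ε i i ≡ + 1
ε-diag zero    = refl
ε-diag (suc i) = ε-diag i

ε-off : ∀ i j → i ≢ j → ε i j ≡ + 0
ε-off zero    zero    h = ⊥-elim (h refl)
ε-off zero    (suc j) h = refl
ε-off (suc i) zero    h = refl
ε-off (suc i) (suc j) h = ε-off i j (h ∘ cong suc)

lower : ℕ → Weight → Weight
lower i γ j = γ j ℤ.- ε i j

rows-cong : ∀ s n {γ γ' : Weight} → (∀ j → s ≤ j → j < s + n → γ j ≡ γ' j) → rowEnds s n γ ≡ rowEnds s n γ'
rows-cong s zero    h = refl
rows-cong s (suc n) h = cong₂ _∷_ (cong (ℤ._- + s) (h s ≤-refl (m<m+n s (s≤s z≤n))))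
  (rows-cong (suc s) n (λ j p q → h j (<⇒≤ p) (subst (j <_) (sym (+-suc s n)) q)))

-- The entries of row i depend on γ only through γ_i - i, and the two equations say that these
-- values are exchanged between the rows a and a + 1.
minor-anti : ∀ s n a {γ γ' : Weight} → s ≤ a → suc a < s + n → γ' a ≡ γ (suc a) ℤ.- + 1 → γ' (suc a) ≡ γ a ℤ.+ + 1 →
  (∀ j → j ≢ a → j ≢ suc a → γ' j ≡ γ j) → ∀ cs {F} → Inv F → minor (rowEnds s n γ') cs F ≡ ℤ.- minor (rowEnds s n γ) cs F
minor-anti s zero a p q = ⊥-elim (lia 2 0 (λ s a → s :≤ a ⇒ ♯ 2 :+ a :≤ s :+ ♯ 0 ⇒ :⊥) s a p q)
minor-anti s (suc n) a {γ} {γ'} p q h h' k cs {F} i with m≤n⇒m<n∨m≡n p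
minor-anti s (suc n) a {γ} {γ'} p q h h' k cs {F} i | inj₁ s<a = trans
  (lap-neg (γ' s ℤ.- + s) {minor (rowEnds (suc s) n γ')} {minor (rowEnds (suc s) n γ)}
    (minor-anti (suc s) n a s<a (subst (suc a <_) (+-suc s n) q) h h' k) cs i)
  (cong (λ x → ℤ.- lap (x ℤ.- + s) (minor (rowEnds (suc s) n γ)) cs F)
    (k s (<⇒≢ s<a) (<⇒≢ (m<n⇒m<1+n s<a))))
minor-anti s (suc zero) a p q h h' k cs i | inj₂ refl = ⊥-elim (lia 1 0 (λ s → ♯ 2 :+ s :≤ s :+ ♯ 1 ⇒ :⊥) s q)
minor-anti s (suc (suc n)) a {γ} {γ'} p q h h' k cs {F} i | inj₂ refl = begin
  lap (γ' s ℤ.- + s) (lap (γ' (suc s) ℤ.- + suc s) (minor (rowEnds (suc (suc s)) n γ'))) cs F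
    ≡⟨ cong₂ (λ x r → lap x (lap (γ' (suc s) ℤ.- + suc s) (minor r)) cs F) eq₁
         (rows-cong (suc (suc s)) n (λ j s<j _ → k j (>⇒≢ (<⇒≤ s<j)) (>⇒≢ s<j))) ⟩
  lap b (lap (γ' (suc s) ℤ.- + suc s) (minor r)) cs F
    ≡⟨ cong (λ x → lap b (lap x (minor r)) cs F) eq₂ ⟩
  lap b (lap a' (minor r)) cs F
    ≡⟨ lap-anti b a' (minor-linear r) cs i ⟩
  ℤ.- lap a' (lap b (minor r)) cs F ∎
  where
    r : List ℤ
    r = rowEnds (suc (suc s)) n γ
    a' b : ℤ
    a' = γ s ℤ.- + s
    b = γ (suc s) ℤ.- + suc s
    eq₁ : γ' s ℤ.- + s ≡ b
    eq₁ = lia 1 2 (λ s x y → x := y :- ♯ 1 ⇒ x :- ↑ s := y :- ↑ (♯ 1 :+ s)) s (γ' s) (γ (suc s)) h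
    eq₂ : γ' (suc s) ℤ.- + suc s ≡ a'
    eq₂ = lia 1 2 (λ s x y → x := y :+ ♯ 1 ⇒ x :- ↑ (♯ 1 :+ s) := y :- ↑ s) s (γ' (suc s)) (γ s) h'

sdet-anti : ∀ n a {γ γ' : Weight} → suc a < n → γ' a ≡ γ (suc a) ℤ.- + 1 → γ' (suc a) ≡ γ a ℤ.+ + 1 →
  (∀ j → j ≢ a → j ≢ suc a → γ' j ≡ γ j) → ∀ {F} → Inv F → sdet n γ' F ≡ ℤ.- sdet n γ F
sdet-anti n a p h h' k i = minor-anti 0 n a z≤n p h h' k (cols 0 n) i

-- Vanishing of determinants whose weight has a negative tail

tailSum : Weight → ℕ → ℕ → ℤ
tailSum γ j zero    = + 0
tailSum γ j (suc r) = γ j ℤ.+ tailSum γ (suc j) r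

-- Every term of the expansion contains a factor h_d with d < 0, since the indices add up to a negative number.
lap-neg-degree : ∀ a A m {f} → Linear f → ∀ p → (∀ zs F → (length zs + p ≡ m → A ℤ.+ sumℤ zs ℤ.< + 0) → f zs F ≡ + 0) →
  ∀ zs F → (length zs + p ≡ suc m → (a ℤ.+ A) ℤ.+ sumℤ zs ℤ.< + 0) → lap a f zs F ≡ + 0
lap-neg-degree a A m l p h []       F k = refl
lap-neg-degree a A m {f} l p h (c ∷ cs) F k = lia 0 2 (λ x y → x := ♯ 0 ⇒ y := ♯ 0 ⇒ x :- y := ♯ 0) _ _ first
  (lap-neg-degree a (c ℤ.+ A) m {λ zs → f (c ∷ zs)} (cons-linear c l) (suc p)
    (λ zs F e → h (c ∷ zs) F (λ e' → lia 0 3 (λ A c s → c :+ A :+ s :< ♯ 0 ⇒ A :+ (c :+ s) :< ♯ 0) A c (sumℤ zs)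
       (e (trans (+-suc (length zs) p) e')))) cs F
    (λ e → lia 0 4 (λ a A c s → a :+ A :+ (c :+ s) :< ♯ 0 ⇒ a :+ (c :+ A) :+ s :< ♯ 0) a A c (sumℤ cs)
       (k (trans (sym (+-suc (length cs) p)) e))))
  where
    first : f cs (hv (a ℤ.+ c) F) ≡ + 0
    first with a ℤ.+ c in eq
    ... | -[1+ n ] = linear-zero l cs
    ... | + n = h cs (hv (+ n) F) (λ e → lia 1 4 (λ n a A c s → a :+ c := ↑ n ⇒ a :+ A :+ (c :+ s) :< ♯ 0 ⇒ A :+ s :< ♯ 0)
                  n a A c (sumℤ cs) eq (k (cong suc e)))

minor-neg-degree : ∀ as zs F → (length zs ≡ length as → sumℤ as ℤ.+ sumℤ zs ℤ.< + 0) → minor as zs F ≡ + 0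
minor-neg-degree []       []       F k = ⊥-elim (ℤ.<-irrefl refl (k refl))
minor-neg-degree []       (z ∷ zs) F k = refl
minor-neg-degree (a ∷ as) zs       F k = lap-neg-degree a (sumℤ as) (length as) (minor-linear as) 0
  (λ zs F e → minor-neg-degree as zs F (λ e' → e (trans (+-identityʳ _) e'))) zs F
  (λ e → k (trans (sym (+-identityʳ _)) e))

run : ℕ → ℕ → ℤ
run s zero    = + 0
run s (suc r) = + s ℤ.+ run (suc s) r

⊆-length : ∀ {zs : List ℤ} s n → zs ⊆ cols s n → length zs ≤ n
⊆-length s zero    []       = z≤n
⊆-length s (suc n) (_ ∷ʳ p) = m≤n⇒m≤1+n (⊆-length (suc s) n p)
⊆-length s (suc n) (refl ∷ p) = s≤s (⊆-length (suc s) n p)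

-- k is the number of omitted columns, so the bound is the sum of the last `length zs` columns, the
-- largest possible choice.
sum-⊆-cols : ∀ {zs} s n k → zs ⊆ cols s n → k + length zs ≡ n → sumℤ zs ℤ.≤ run (s + k) (length zs)
sum-⊆-cols s zero    k []       eq = ℤ.≤-refl
sum-⊆-cols {zs} s (suc n) zero    (_ ∷ʳ p) eq = ⊥-elim (<-irrefl refl (subst (_≤ n) eq (⊆-length (suc s) n p)))
sum-⊆-cols {zs} s (suc n) (suc k) (_ ∷ʳ p) eq =
  subst (λ t → sumℤ zs ℤ.≤ run t (length zs)) (sym (+-suc s k)) (sum-⊆-cols (suc s) n k p (suc-injective eq))
sum-⊆-cols {_ ∷ zs} s (suc n) k (refl ∷ p) eq =
  ℤ.+-mono-≤ (ℤ.+≤+ (m≤m+n s k)) (sum-⊆-cols (suc s) n k p (suc-injective (trans (sym (+-suc k (length zs))) eq)))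

sum-rows : ∀ j r γ → sumℤ (rowEnds j r γ) ℤ.+ run j r ≡ tailSum γ j r
sum-rows j zero    γ = refl
sum-rows j (suc r) γ = lia 1 4 (λ j g x y z → x :+ y := z ⇒ (g :- ↑ j :+ x) :+ (↑ j :+ y) := g :+ z)
  j (γ j) (sumℤ (rowEnds (suc j) r γ)) (run (suc j) r) (tailSum γ (suc j) r) (sum-rows (suc j) r γ)

length-rows : ∀ s n γ → length (rowEnds s n γ) ≡ n
length-rows s zero    γ = refl
length-rows s (suc n) γ = cong suc (length-rows (suc s) n γ)

-- However the rows before j choose their columns, the last r rows are left with columns whose sum
-- is at most that of the last r columns. The degrees of their factors then add up to at most the
-- tail sum, so one of them is negative.
minor-tail : ∀ s d {N} j r γ → s + d ≡ j → j + r ≡ N → tailSum γ j r ℤ.< + 0 →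
  ∀ {zs} → zs ⊆ cols 0 N → ∀ F → minor (rowEnds s (d + r) γ) zs F ≡ + 0
minor-tail s (suc d) j r γ e e' t {zs} sub F = lap-vanish (γ s ℤ.- + s) {minor (rowEnds (suc s) (d + r) γ)} zs
  (λ sub' → minor-tail (suc s) d j r γ (trans (sym (+-suc s d)) e) e' t (⊆-trans sub' sub)) F
minor-tail s zero {N} j r γ e e' t {zs} sub F with trans (sym e) (+-identityʳ s)
... | refl = minor-neg-degree (rowEnds s r γ) zs F λ len →
  let len' = trans len (length-rows s r γ) in
  lia 0 4 (λ x y u v → x :+ v := u ⇒ u :< ♯ 0 ⇒ y :≤ v ⇒ x :+ y :< ♯ 0)
    (sumℤ (rowEnds s r γ)) (sumℤ zs) (tailSum γ s r) (run s r) (sum-rows s r γ) t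
    (subst (λ m → sumℤ zs ℤ.≤ run s m) len' (sum-⊆-cols 0 N s sub (trans (cong (_+_ s) len') e')))

sdet-tail : ∀ j r {N} γ → j + r ≡ N → tailSum γ j r ℤ.< + 0 → ∀ F → sdet N γ F ≡ + 0
sdet-tail j r γ refl t F = minor-tail 0 j j r γ refl refl t ⊆-refl F

-- Ke d is the transpose of multiplication by e_d.
Ke : ℕ → Fn → Fn
Ke zero    F p           = F p
Ke (suc d) F []          = + 0
Ke (suc d) F (zero ∷ p)  = Ke (suc d) (λ q → F (zero ∷ q)) p
Ke (suc d) F (suc a ∷ p) = Ke (suc d) (λ q → F (suc a ∷ q)) p ℤ.+ Ke d (λ q → F (a ∷ q)) p

Ke-zero : ∀ d p → Ke d (λ _ → + 0) p ≡ + 0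
Ke-zero zero    p           = refl
Ke-zero (suc d) []          = refl
Ke-zero (suc d) (zero ∷ p)  = Ke-zero (suc d) p
Ke-zero (suc d) (suc a ∷ p) = cong₂ ℤ._+_ (Ke-zero (suc d) p) (Ke-zero d p)

ev-+ : ∀ f F G → ev f (λ p → F p ℤ.+ G p) ≡ ev f F ℤ.+ ev f G
ev-+ f F G = trans (∑-cong (expand f) (λ p → ℤ.*-distribˡ-+ (proj₁ p) (F (proj₂ p)) (G (proj₂ p)))) (∑-+ _ _ (expand f))

ev-0 : ∀ f → ev f (λ _ → + 0) ≡ + 0
ev-0 f = ∑-zero (expand f) (λ p → ℤ.*-zeroʳ (proj₁ p))

Ke-ev : ∀ d f (G : List ℕ → Fn) p → Ke d (λ p' → ev f (G p')) p ≡ ev f (λ q → Ke d (λ p' → G p' q) p)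
Ke-ev zero    f G p           = refl
Ke-ev (suc d) f G []          = sym (ev-0 f)
Ke-ev (suc d) f G (zero ∷ p)  = Ke-ev (suc d) f (λ p' → G (zero ∷ p')) p
Ke-ev (suc d) f G (suc a ∷ p) = trans (cong₂ ℤ._+_ (Ke-ev (suc d) f (λ p' → G (suc a ∷ p')) p) (Ke-ev d f (λ p' → G (a ∷ p')) p))
  (sym (ev-+ f (λ q → Ke (suc d) (λ p' → G (suc a ∷ p') q) p) (λ q → Ke d (λ p' → G (a ∷ p') q) p)))

K-zero-cons : ∀ d F p → K d F (0 ∷ p) ≡ K d (λ q → F (0 ∷ q)) p
K-zero-cons d F p = trans (K-cons d F 0 p) (trans (cong (λ n → ∑ (upTo (suc n)) (λ i → K (d ∸ i) (λ q → F ((0 ∸ i) ∷ q)) p)) (⊓-zeroʳ d)) (ℤ.+-identityʳ _))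

K-suc-cons : ∀ d F a p → K (suc d) F (suc a ∷ p) ≡ K (suc d) (λ q → F (suc a ∷ q)) p ℤ.+ K d F (a ∷ p)
K-suc-cons d F a p = begin
  K (suc d) F (suc a ∷ p)
    ≡⟨ K-cons (suc d) F (suc a) p ⟩
  ∑ (upTo (suc (suc (d ℕ.⊓ a)))) (λ i → K (suc d ∸ i) (λ q → F ((suc a ∸ i) ∷ q)) p)
    ≡⟨ ∑-upTo-suc (suc (d ℕ.⊓ a)) (λ i → K (suc d ∸ i) (λ q → F ((suc a ∸ i) ∷ q)) p) ⟩
  K (suc d) (λ q → F (suc a ∷ q)) p ℤ.+ ∑ (upTo (suc (d ℕ.⊓ a))) (λ i → K (d ∸ i) (λ q → F ((a ∸ i) ∷ q)) p)
    ≡⟨ cong (ℤ._+_ (K (suc d) (λ q → F (suc a ∷ q)) p)) (sym (K-cons d F a p)) ⟩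
  K (suc d) (λ q → F (suc a ∷ q)) p ℤ.+ K d F (a ∷ p) ∎

-- alt k m = Σ_{i ≤ m} (-1)^i K_{k+i} Ke_{m-i}
alt : ℕ → ℕ → Fn → Fn
alt k zero    F p = K k F p
alt k (suc m) F p = K k (Ke (suc m) F) p ℤ.- alt (suc k) m F p

alt-zero-cons : ∀ k m F p → alt k m F (0 ∷ p) ≡ alt k m (λ q → F (0 ∷ q)) p
alt-zero-cons k zero    F p = K-zero-cons k F p
alt-zero-cons k (suc m) F p = cong₂ ℤ._-_ (K-zero-cons k (Ke (suc m) F) p) (alt-zero-cons (suc k) m F p)

K-+ : ∀ d F G p → K d (λ q → F q ℤ.+ G q) p ≡ K d F p ℤ.+ K d G p
K-+ d F G p = ∑-+ _ _ (bounded d p)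

-- From one letter `K` may take any amount and `Ke` at most one. The three terms are: both leave the
-- letter alone, only `Ke` takes from it, and `K` takes at least one, where one unit is split off.
alt-suc-cons : ∀ k m F a p → alt (suc k) (suc m) F (suc a ∷ p) ≡
  alt (suc k) (suc m) (λ q → F (suc a ∷ q)) p ℤ.+ alt (suc k) m (λ q → F (a ∷ q)) p ℤ.+ alt k (suc m) F (a ∷ p)
alt-suc-cons k zero F a p = lia 0 10 (λ l kk a1 a2 k1 ka l0 k20 x y →
    l := kk :+ ka ⇒ kk := k1 :+ a1 ⇒ x := y :+ k20 ⇒ l :- x := (k1 :- y) :+ a1 :+ (ka :- k20))
  (K (suc k) (Ke 1 F) (suc a ∷ p)) (K (suc k) (λ q → Ke 1 F (suc a ∷ q)) p) (K (suc k) (λ q → F (a ∷ q)) p) (+ 0)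
  (K (suc k) (Ke 1 (λ q → F (suc a ∷ q))) p) (K k (Ke 1 F) (a ∷ p)) (+ 0) (K (suc k) F (a ∷ p))
  (K (suc (suc k)) F (suc a ∷ p)) (K (suc (suc k)) (λ q → F (suc a ∷ q)) p)
  (K-suc-cons k (Ke 1 F) a p) (K-+ (suc k) (Ke 1 (λ q → F (suc a ∷ q))) (λ q → F (a ∷ q)) p) (K-suc-cons (suc k) F a p)
alt-suc-cons k (suc m) F a p = lia 0 9 (λ l kk k1 k2 ka x x1 x2 x3 →
    l := kk :+ ka ⇒ kk := k1 :+ k2 ⇒ x := x1 :+ x2 :+ x3 ⇒ l :- x := (k1 :- x1) :+ (k2 :- x2) :+ (ka :- x3))
  (K (suc k) (Ke (suc (suc m)) F) (suc a ∷ p)) (K (suc k) (λ q → Ke (suc (suc m)) F (suc a ∷ q)) p)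
  (K (suc k) (Ke (suc (suc m)) (λ q → F (suc a ∷ q))) p) (K (suc k) (Ke (suc m) (λ q → F (a ∷ q))) p) (K k (Ke (suc (suc m)) F) (a ∷ p))
  (alt (suc (suc k)) (suc m) F (suc a ∷ p)) (alt (suc (suc k)) (suc m) (λ q → F (suc a ∷ q)) p) (alt (suc (suc k)) m (λ q → F (a ∷ q)) p) (alt (suc k) (suc m) F (a ∷ p))
  (K-suc-cons k (Ke (suc (suc m)) F) a p) (K-+ (suc k) (Ke (suc (suc m)) (λ q → F (suc a ∷ q))) (Ke (suc m) (λ q → F (a ∷ q))) p)
  (alt-suc-cons (suc k) m F a p)

alt-suc-nil : ∀ k m F → alt (suc k) m F [] ≡ + 0
alt-suc-nil k zero    F = refl
alt-suc-nil k (suc m) F = trans (ℤ.+-identityˡ _) (cong ℤ.-_ (alt-suc-nil (suc k) m F))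

-- Σ_{i ≤ d} (-1)^i h_i e_{d-i} = 0 for d > 0, transposed.
Ke≡alt : ∀ m F p → Ke (suc m) F p ≡ alt 1 m F p
Ke≡alt m F []          = sym (alt-suc-nil 0 m F)
Ke≡alt m F (zero ∷ p)  = trans (Ke≡alt m (λ q → F (0 ∷ q)) p) (sym (alt-zero-cons 1 m F p))
Ke≡alt zero F (suc a ∷ p) = begin
  Ke 1 (λ q → F (suc a ∷ q)) p ℤ.+ F (a ∷ p)   ≡⟨ cong₂ ℤ._+_ (Ke≡alt 0 (λ q → F (suc a ∷ q)) p) (sym (K-zero F (a ∷ p))) ⟩
  K 1 (λ q → F (suc a ∷ q)) p ℤ.+ K 0 F (a ∷ p) ≡⟨ sym (K-suc-cons 0 F a p) ⟩
  K 1 F (suc a ∷ p)                             ∎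
Ke≡alt (suc m) F (suc a ∷ p) = lia 0 7 (λ e1 e2 a1 a2 r k0 x →
    e1 := a1 ⇒ e2 := a2 ⇒ r := a1 :+ a2 :+ (k0 :- x) ⇒ k0 := x ⇒ e1 :+ e2 := r)
  (Ke (suc (suc m)) (λ q → F (suc a ∷ q)) p) (Ke (suc m) (λ q → F (a ∷ q)) p) _ _ (alt 1 (suc m) F (suc a ∷ p))
  (K 0 (Ke (suc m) F) (a ∷ p)) (alt 1 m F (a ∷ p))
  (Ke≡alt (suc m) (λ q → F (suc a ∷ q)) p) (Ke≡alt m (λ q → F (a ∷ q)) p) (alt-suc-cons 0 m F a p)
  (trans (K-zero (Ke (suc m) F) (a ∷ p)) (Ke≡alt m F (a ∷ p)))

-- Lowering operators

-- opE d s n φ γ = Σ φ(γ - ε_S) over the d-element subsets S of [s, s + n).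
opE : ℕ → ℕ → ℕ → (Weight → ℤ) → Weight → ℤ
opE zero    s n       φ γ = φ γ
opE (suc d) s zero    φ γ = + 0
opE (suc d) s (suc n) φ γ = opE (suc d) (suc s) n φ γ ℤ.+ opE d (suc s) n φ (lower s γ)

opE-local : ∀ d s n {φ φ' : Weight → ℤ} γ → (∀ γ' → (∀ j → j < s → γ' j ≡ γ j) → φ γ' ≡ φ' γ') → opE d s n φ γ ≡ opE d s n φ' γ
opE-local zero    s n       γ h = h γ (λ _ _ → refl)
opE-local (suc d) s zero    γ h = refl
opE-local (suc d) s (suc n) γ h = cong₂ ℤ._+_
  (opE-local (suc d) (suc s) n γ (λ γ' e → h γ' (λ j p → e j (m<n⇒m<1+n p))))
  (opE-local d (suc s) n (lower s γ) (λ γ' e → h γ' (λ j p → trans (e j (m<n⇒m<1+n p))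
    (trans (cong (ℤ._-_ (γ j)) (ε-off s j (>⇒≢ p))) (ℤ.+-identityʳ (γ j))))))

lap-plus : ∀ a (f g : List ℤ → Fn → ℤ) cs F → lap a (λ cs' F' → f cs' F' ℤ.+ g cs' F') cs F ≡ lap a f cs F ℤ.+ lap a g cs F
lap-plus a f g []       F = refl
lap-plus a f g (c ∷ cs) F = lia 0 5 (λ x y u v w → w := u :+ v ⇒ (x :+ y) :- w := (x :- u) :+ (y :- v))
  (f cs (hv (a ℤ.+ c) F)) (g cs (hv (a ℤ.+ c) F)) (lap a (λ cs' → f (c ∷ cs')) cs F) (lap a (λ cs' → g (c ∷ cs')) cs F) _
  (lap-plus a (λ cs' → f (c ∷ cs')) (λ cs' → g (c ∷ cs')) cs F)

lap-0 : ∀ a cs F → lap a (λ _ _ → + 0) cs F ≡ + 0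
lap-0 a []       F = refl
lap-0 a (c ∷ cs) F = cong (λ x → + 0 ℤ.- x) (lap-0 a cs F)

lap-opE : ∀ a d s n (f : Weight → List ℤ → Fn → ℤ) γ cs F →
  lap a (λ cs' F' → opE d s n (λ γ' → f γ' cs' F') γ) cs F ≡ opE d s n (λ γ' → lap a (f γ') cs F) γ
lap-opE a zero    s n       f γ cs F = refl
lap-opE a (suc d) s zero    f γ cs F = lap-0 a cs F
lap-opE a (suc d) s (suc n) f γ cs F = trans
  (lap-plus a (λ cs' F' → opE (suc d) (suc s) n (λ γ' → f γ' cs' F') γ) (λ cs' F' → opE d (suc s) n (λ γ' → f γ' cs' F') (lower s γ)) cs F)
  (cong₂ ℤ._+_ (lap-opE a (suc d) (suc s) n f γ cs F) (lap-opE a d (suc s) n f (lower s γ) cs F))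

-- The transpose of e_{d+1}^⊥ (h_z g) = h_z e_{d+1}^⊥ g + h_{z-1} e_d^⊥ g. Since e_i^⊥ h_z = 0 for i
-- ≥ 2, a factor of a Jacobi-Trudi term is lowered at most once.
hv-Ke : ∀ z d F q → hv z (Ke (suc d) F) q ≡ Ke (suc d) (hv z F) q ℤ.+ Ke d (hv (z ℤ.- + 1) F) q
hv-Ke (+ zero)  d F q = sym (trans (cong (ℤ._+_ (Ke (suc d) (hv (+ 0) F) q)) (Ke-zero d q)) (ℤ.+-identityʳ _))
hv-Ke (+ suc a) d F q = refl
hv-Ke -[1+ n ]  d F q = sym (cong₂ ℤ._+_ (Ke-zero (suc d) q) (Ke-zero d q))

lap-Ke : ∀ a d {f} → Linear f → ∀ cs F → lap a f cs (Ke (suc d) F) ≡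
  lap a (λ cs' F' → f cs' (Ke (suc d) F')) cs F ℤ.+ lap (a ℤ.- + 1) (λ cs' F' → f cs' (Ke d F')) cs F
lap-Ke a d l []       F = refl
lap-Ke a d {f} l (c ∷ cs) F = lia 0 6 (λ x y u v w z → x := u :+ v ⇒ y := w :+ z ⇒ x :- y := (u :- w) :+ (v :- z))
  (f cs (hv (a ℤ.+ c) (Ke (suc d) F))) (lap a (λ cs' → f (c ∷ cs')) cs (Ke (suc d) F)) (f cs (Ke (suc d) (hv (a ℤ.+ c) F))) (f cs (Ke d (hv (a ℤ.- + 1 ℤ.+ c) F)))
  (lap a (λ cs' F' → f (c ∷ cs') (Ke (suc d) F')) cs F) (lap (a ℤ.- + 1) (λ cs' F' → f (c ∷ cs') (Ke d F')) cs F)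
  (trans (linear-ext l cs (λ q → trans (hv-Ke (a ℤ.+ c) d F q)
      (cong (λ z → Ke (suc d) (hv (a ℤ.+ c) F) q ℤ.+ Ke d (hv z F) q) (lia 0 2 (λ a c → a :+ c :- ♯ 1 := a :- ♯ 1 :+ c) a c))))
    (linear-add l cs (Ke (suc d) (hv (a ℤ.+ c) F)) (Ke d (hv (a ℤ.- + 1 ℤ.+ c) F))))
  (lap-Ke a d (cons-linear c l) cs F)

-- Whichever column a row uses, lowering the index of its entry is the same as lowering γ in that
-- row; so the choice of lowered factors becomes a choice of rows, the same for all terms of the
-- determinant.
minor-Ke : ∀ s n d γ cs F → minor (rowEnds s n γ) cs (Ke d F) ≡ opE d s n (λ γ' → minor (rowEnds s n γ') cs F) γ
minor-Ke s n       zero    γ cs       F = refl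
minor-Ke s zero    (suc d) γ []       F = refl
minor-Ke s zero    (suc d) γ (c ∷ cs) F = refl
minor-Ke s (suc n) (suc d) γ cs       F = begin
  lap (γ s ℤ.- + s) (minor (rowEnds (suc s) n γ)) cs (Ke (suc d) F)
    ≡⟨ lap-Ke (γ s ℤ.- + s) d (minor-linear (rowEnds (suc s) n γ)) cs F ⟩
  lap (γ s ℤ.- + s) (λ cs' F' → minor (rowEnds (suc s) n γ) cs' (Ke (suc d) F')) cs F ℤ.+
  lap (γ s ℤ.- + s ℤ.- + 1) (λ cs' F' → minor (rowEnds (suc s) n γ) cs' (Ke d F')) cs F
    ≡⟨ cong₂ ℤ._+_ first second ⟩
  opE (suc d) (suc s) n (λ γ' → minor (rowEnds s (suc n) γ') cs F) γ ℤ.+ opE d (suc s) n (λ γ' → minor (rowEnds s (suc n) γ') cs F) (lower s γ) ∎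
  where
    first : lap (γ s ℤ.- + s) (λ cs' F' → minor (rowEnds (suc s) n γ) cs' (Ke (suc d) F')) cs F ≡ opE (suc d) (suc s) n (λ γ' → minor (rowEnds s (suc n) γ') cs F) γ
    first = begin
      lap (γ s ℤ.- + s) (λ cs' F' → minor (rowEnds (suc s) n γ) cs' (Ke (suc d) F')) cs F
        ≡⟨ lap-cong (γ s ℤ.- + s) (λ cs' F' → minor-Ke (suc s) n (suc d) γ cs' F') cs F ⟩
      lap (γ s ℤ.- + s) (λ cs' F' → opE (suc d) (suc s) n (λ γ' → minor (rowEnds (suc s) n γ') cs' F') γ) cs F
        ≡⟨ lap-opE (γ s ℤ.- + s) (suc d) (suc s) n (λ γ' → minor (rowEnds (suc s) n γ')) γ cs F ⟩
      opE (suc d) (suc s) n (λ γ' → lap (γ s ℤ.- + s) (minor (rowEnds (suc s) n γ')) cs F) γ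
        ≡⟨ opE-local (suc d) (suc s) n γ (λ γ' e → cong (λ x → lap (x ℤ.- + s) (minor (rowEnds (suc s) n γ')) cs F) (sym (e s ≤-refl))) ⟩
      opE (suc d) (suc s) n (λ γ' → minor (rowEnds s (suc n) γ') cs F) γ ∎
    off : ∀ j → suc s ≤ j → j < suc s + n → γ j ≡ lower s γ j
    off j p _ = sym (trans (cong (ℤ._-_ (γ j)) (ε-off s j (<⇒≢ p))) (ℤ.+-identityʳ (γ j)))
    second : lap (γ s ℤ.- + s ℤ.- + 1) (λ cs' F' → minor (rowEnds (suc s) n γ) cs' (Ke d F')) cs F ≡ opE d (suc s) n (λ γ' → minor (rowEnds s (suc n) γ') cs F) (lower s γ)
    second = begin
      lap (γ s ℤ.- + s ℤ.- + 1) (λ cs' F' → minor (rowEnds (suc s) n γ) cs' (Ke d F')) cs F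
        ≡⟨ cong₂ (λ x r → lap x (λ cs' F' → minor r cs' (Ke d F')) cs F)
             (lia 1 2 (λ s g e → e := ♯ 1 ⇒ g :- ↑ s :- ♯ 1 := g :- e :- ↑ s) s (γ s) (ε s s) (ε-diag s)) (rows-cong (suc s) n off) ⟩
      lap (lower s γ s ℤ.- + s) (λ cs' F' → minor (rowEnds (suc s) n (lower s γ)) cs' (Ke d F')) cs F
        ≡⟨ lap-cong (lower s γ s ℤ.- + s) (λ cs' F' → minor-Ke (suc s) n d (lower s γ) cs' F') cs F ⟩
      lap (lower s γ s ℤ.- + s) (λ cs' F' → opE d (suc s) n (λ γ' → minor (rowEnds (suc s) n γ') cs' F') (lower s γ)) cs F
        ≡⟨ lap-opE (lower s γ s ℤ.- + s) d (suc s) n (λ γ' → minor (rowEnds (suc s) n γ')) (lower s γ) cs F ⟩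
      opE d (suc s) n (λ γ' → lap (lower s γ s ℤ.- + s) (minor (rowEnds (suc s) n γ')) cs F) (lower s γ)
        ≡⟨ opE-local d (suc s) n (lower s γ) (λ γ' e → cong (λ x → lap (x ℤ.- + s) (minor (rowEnds (suc s) n γ')) cs F) (sym (e s ≤-refl))) ⟩
      opE d (suc s) n (λ γ' → minor (rowEnds s (suc n) γ') cs F) (lower s γ) ∎

-- Elementary symmetric functions in the second argument of the pairing

one : Weight
one _ = + 1

eD : ℕ → Fn → ℤ
eD d = sdet d one

replicate≡tab : ∀ s d → replicate d (+ 1) ≡ tab s d one
replicate≡tab s zero    = refl
replicate≡tab s (suc d) = cong (+ 1 ∷_) (replicate≡tab (suc s) d)

ev-eSym : ∀ d {F} → Inv F → ev (eSym d) F ≡ eD d F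
ev-eSym d {F} i = trans (cong (λ l → ev (schur l) F) (replicate≡tab 0 d)) (ev-schur d one i)

-- e_m h_{s+1} - e_{m-1} h_{s+2} + ⋯, as a determinant.
hook-det : ℕ → ℕ → Fn → ℤ
hook-det s m = lap (+ 1) (minor (rowEnds (suc s) m one)) (cols s (suc m))

-- Every entry in column t has index at most t - s, which is negative.
minor-neg-col : ∀ s t m cs F → t < s → minor (rowEnds (suc s) m one) (+ t ∷ cs) F ≡ + 0
minor-neg-col s t zero    cs F p = refl
minor-neg-col s t (suc m) cs F p = lia 0 2 (λ x y → x := ♯ 0 ⇒ y := ♯ 0 ⇒ x :- y := ♯ 0) _ _ first
  (lap-vanish (+ 1 ℤ.- + suc s) cs (λ {zs} _ F' → minor-neg-col (suc s) t m zs F' (m<n⇒m<1+n p)) F)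
  where
    first : minor (rowEnds (suc (suc s)) m one) cs (hv ((+ 1 ℤ.- + suc s) ℤ.+ + t) F) ≡ + 0
    first with (+ 1 ℤ.- + suc s) ℤ.+ + t in eq
    ... | -[1+ n ] = linear-zero (minor-linear (rowEnds (suc (suc s)) m one)) cs
    ... | + n = ⊥-elim (lia 3 1 (λ s t n z → ♯ 1 :- ↑ (♯ 1 :+ s) :+ ↑ t := ↑ n ⇒ t :< s ⇒ :⊥) s t n (+ 0) eq p)

minor-shift : ∀ s t n m F → minor (rowEnds (suc s) m one) (cols (suc t) n) F ≡ minor (rowEnds s m one) (cols t n) F
minor-shift s t n zero    F = nil n F
  where
    nil : ∀ n F → minor [] (cols (suc t) n) F ≡ minor [] (cols t n) F
    nil zero    F = refl
    nil (suc n) F = refl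
minor-shift s t n (suc m) F = trans
  (cong₂ (λ a l → lap a (minor (rowEnds (suc (suc s)) m one)) l F) (lia 1 0 (λ s → ♯ 1 :- ↑ (♯ 1 :+ s) := ♯ 1 :- ↑ s :- ♯ 1) s) (cols-suc t n))
  (lap-shift (+ 1 ℤ.- + s) (shift m s) (cols t n) F)
  where
    sucs : List ℤ → List ℤ
    sucs = map (ℤ._+_ (+ 1))
    cols-suc : ∀ t n → cols (suc t) n ≡ sucs (cols t n)
    cols-suc t zero    = refl
    cols-suc t (suc n) = cong (+ suc t ∷_) (cols-suc (suc t) n)
    lap-shift : ∀ a {f g : List ℤ → Fn → ℤ} → (∀ zs F → f (sucs zs) F ≡ g zs F) → ∀ zs F → lap (a ℤ.- + 1) f (sucs zs) F ≡ lap a g zs F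
    lap-shift a h []       F = refl
    lap-shift a {f} {g} h (c ∷ cs) F = cong₂ ℤ._-_
      (trans (cong (λ z → f (sucs cs) (hv z F)) (lia 0 2 (λ a c → a :- ♯ 1 :+ (♯ 1 :+ c) := a :+ c) a c)) (h cs (hv (a ℤ.+ c) F)))
      (lap-shift a {λ zs → f ((+ 1 ℤ.+ c) ∷ zs)} {λ zs → g (c ∷ zs)} (λ zs → h (c ∷ zs)) cs F)
    shift : ∀ m s zs F → minor (rowEnds (suc (suc s)) m one) (sucs zs) F ≡ minor (rowEnds (suc s) m one) zs F
    shift zero    s []       F = refl
    shift zero    s (z ∷ zs) F = refl
    shift (suc m) s zs       F = trans
      (cong (λ a → lap a (minor (rowEnds (suc (suc (suc s))) m one)) (sucs zs) F) (lia 1 0 (λ s → ♯ 1 :- ↑ (♯ 2 :+ s) := ♯ 1 :- ↑ (♯ 1 :+ s) :- ♯ 1) s))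
      (lap-shift (+ 1 ℤ.- + suc s) (shift m (suc s)) zs F)

minor-shift* : ∀ s m F → minor (rowEnds s m one) (cols s m) F ≡ eD m F
minor-shift* zero    m F = refl
minor-shift* (suc s) m F = trans (minor-shift s s m m F) (minor-shift* s m F)

-- Expansion along the first row. In the minors that keep column s, this column consists of h₀ = 1
-- followed by entries of negative index; deleting it together with its row leaves a hook
-- determinant with s raised by one.
hook-det-suc : ∀ s m {F} → Inv F → hook-det s (suc m) F ≡ eD (suc m) (hv (+ suc s) F) ℤ.- hook-det (suc s) m F
hook-det-suc s m {F} i = cong₂ ℤ._-_ (minor-shift* (suc s) (suc m) (hv (+ suc s) F))
  (lap-cong′ (cols (suc s) (suc m)) i)
  where
    lap-cong′ : ∀ cs {F} → Inv F → lap (+ 1) (λ zs → minor (rowEnds (suc s) (suc m) one) (+ s ∷ zs)) cs F ≡ lap (+ 1) (minor (rowEnds (suc (suc s)) m one)) cs F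
    lap-cong′ cs {F} i = lap-inv-cong cs (λ zs {F} i → lia 0 3 (λ x y z → x := z ⇒ y := ♯ 0 ⇒ x :- y := z) _ _ _
        (trans (cong (λ z → minor (rowEnds (suc (suc s)) m one) zs (hv z F)) (lia 1 0 (λ s → ♯ 1 :- ↑ (♯ 1 :+ s) :+ ↑ s := ♯ 0) s))
          (linear-ext (minor-linear (rowEnds (suc (suc s)) m one)) zs (inv-unit i)))
        (lap-vanish (+ 1 ℤ.- + suc s) zs (λ {zs'} _ F' → minor-neg-col (suc s) s m zs' F' ≤-refl) F)) i
      where
        lap-inv-cong : ∀ {a} {f g : List ℤ → Fn → ℤ} cs → (∀ zs {F} → Inv F → f zs F ≡ g zs F) → ∀ {F} → Inv F → lap a f cs F ≡ lap a g cs F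
        lap-inv-cong []       h i = refl
        lap-inv-cong {a} {f} {g} (c ∷ cs) h i = cong₂ ℤ._-_ (h cs (hv-inv i (a ℤ.+ c))) (lap-inv-cong {a} {λ zs → f (c ∷ zs)} {λ zs → g (c ∷ zs)} cs (λ zs → h (c ∷ zs)) i)

hook-det-zero : ∀ s F → hook-det s 0 F ≡ eD 0 (hv (+ suc s) F)
hook-det-zero s F = ℤ.+-identityʳ _

eD-∑-K : ∀ d k (G : List ℕ → Fn) p → eD d (λ q → K k (λ p' → G p' q) p) ≡ K k (λ p' → eD d (G p')) p
eD-∑-K d k G p = linear-∑ (minor-linear (rowEnds 0 d one)) (cols 0 d) (bounded k p) _

mc-inv : ∀ q' p → Inv (λ q → mc p (q ++ q'))
mc-inv q' p .inv-perm h = inv-perm (mc-cols p) (↭ₚ.++⁺ʳ q' h)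
mc-inv q' p .inv-unit q = inv-unit (mc-cols p) (q ++ q')

hook-det-mc : ∀ s m q' p → (∀ m' p → m' ≤ m → eD m' (λ q → mc p (q ++ q')) ≡ Ke m' (λ p' → mc p' q') p) →
  hook-det s m (λ q → mc p (q ++ q')) ≡ alt (suc s) m (λ p' → mc p' q') p
term-mc : ∀ s m q' p → (∀ p → eD m (λ q → mc p (q ++ q')) ≡ Ke m (λ p' → mc p' q') p) →
  eD m (hv (+ suc s) (λ q → mc p (q ++ q'))) ≡ K (suc s) (Ke m (λ p' → mc p' q')) p
term-mc s m q' p h = begin
  eD m (λ q → mc p (suc s ∷ (q ++ q')))
    ≡⟨ linear-ext (minor-linear (rowEnds 0 m one)) (cols 0 m) (λ q → mc-col p (suc s) (q ++ q')) ⟩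
  eD m (λ q → K (suc s) (λ p' → mc p' (q ++ q')) p)
    ≡⟨ eD-∑-K m (suc s) (λ p' q → mc p' (q ++ q')) p ⟩
  K (suc s) (λ p' → eD m (λ q → mc p' (q ++ q'))) p
    ≡⟨ K-cong (suc s) h p ⟩
  K (suc s) (Ke m (λ p' → mc p' q')) p ∎

hook-det-mc s zero    q' p h = trans (hook-det-zero s (λ q → mc p (q ++ q'))) (term-mc s 0 q' p (λ p → h 0 p z≤n))
hook-det-mc s (suc m) q' p h = trans (hook-det-suc s m (mc-inv q' p))
  (cong₂ ℤ._-_ (term-mc s (suc m) q' p (λ p → h (suc m) p ≤-refl)) (hook-det-mc (suc s) m q' p (λ m' p l → h m' p (m≤n⇒m≤1+n l))))

-- Multiplication by e_d in the second argument of the pairing is Ke d in the first.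
eD-mc : ∀ d q' p → eD d (λ q → mc p (q ++ q')) ≡ Ke d (λ p' → mc p' q') p
eD-mc d q' p = go d d ≤-refl p
  where
    go : ∀ n d → d ≤ n → ∀ p → eD d (λ q → mc p (q ++ q')) ≡ Ke d (λ p' → mc p' q') p
    go n       zero    _       p = refl
    go (suc n) (suc d) (s≤s l) p = trans (hook-det-mc 0 d q' p (λ m' p l' → go n m' (≤-trans l' l) p)) (sym (Ke≡alt d (λ p' → mc p' q') p))

test : Sym → Fn
test x p = ev x (mc p)

test-inv : ∀ x → Inv (test x)
test-inv x .inv-perm h = ev-cong x (λ q → inv-perm (mc-rows q) h)
test-inv x .inv-unit p = ev-cong x (λ q → inv-unit (mc-rows q) p)

pairing-schur : ∀ n γ x → ⟪ schur (tab 0 n γ) , x ⟫ ≡ sdet n γ (test x)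
pairing-schur n γ x = trans (pairing≡ev (schur (tab 0 n γ)) x) (ev-schur n γ (test-inv x))

test-eSym : ∀ d x p → test (eSym d ⊗ x) p ≡ Ke d (test x) p
test-eSym d x p = begin
  ev (eSym d ⊗ x) (mc p)                          ≡⟨ ev-⊗ (eSym d) x (mc p) ⟩
  ev (eSym d) (λ q → ev x (λ q' → mc p (q ++ q'))) ≡⟨ ev-swap (eSym d) x (λ q q' → mc p (q ++ q')) ⟩
  ev x (λ q' → ev (eSym d) (λ q → mc p (q ++ q'))) ≡⟨ ev-cong x (λ q' → trans (ev-eSym d (mc-inv q' p)) (eD-mc d q' p)) ⟩
  ev x (λ q' → Ke d (λ p' → mc p' q') p)           ≡⟨ sym (Ke-ev d x mc p) ⟩
  Ke d (test x) p                                  ∎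

e-perp-schur : ∀ d n γ x → ⟪ schur (tab 0 n γ) , eSym d ⊗ x ⟫ ≡ opE d 0 n (λ γ' → ⟪ schur (tab 0 n γ') , x ⟫) γ
e-perp-schur d n γ x = begin
  ⟪ schur (tab 0 n γ) , eSym d ⊗ x ⟫                ≡⟨ pairing-schur n γ (eSym d ⊗ x) ⟩
  sdet n γ (test (eSym d ⊗ x))                      ≡⟨ linear-ext (minor-linear (rowEnds 0 n γ)) (cols 0 n) (test-eSym d x) ⟩
  sdet n γ (Ke d (test x))                          ≡⟨ minor-Ke 0 n d γ (cols 0 n) (test x) ⟩
  opE d 0 n (λ γ' → sdet n γ' (test x)) γ           ≡⟨ opE-local d 0 n γ (λ γ' _ → sym (pairing-schur n γ' x)) ⟩
  opE d 0 n (λ γ' → ⟪ schur (tab 0 n γ') , x ⟫) γ   ∎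

-- The pairing of `f` with `x` times e_m h_{s+1} - e_{m-1} h_{s+2} + ⋯, which is the Schur function
-- of the hook (s + 1, 1^m).
altHE : Sym → Sym → ℕ → ℕ → ℤ
altHE f x s zero    = ⟪ f , eSym 0 ⊗ (hh (+ suc s) ⊗ x) ⟫
altHE f x s (suc m) = ⟪ f , eSym (suc m) ⊗ (hh (+ suc s) ⊗ x) ⟫ ℤ.- altHE f x (suc s) m

module _ (x : Sym) where
  private
    G : List ℕ → Fn
    G p q = ev x (λ q' → mc p (q ++ q'))

  G-inv : ∀ p → Inv (G p)
  G-inv p .inv-perm h = ev-cong x (λ q' → inv-perm (mc-inv q' p) h)
  G-inv p .inv-unit q = ev-cong x (λ q' → inv-unit (mc-inv q' p) q)

  pairing-eh : ∀ f m s → ⟪ f , eSym m ⊗ (hh (+ suc s) ⊗ x) ⟫ ≡ ev f (λ p → eD m (hv (+ suc s) (G p)))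
  pairing-eh f m s = trans (pairing≡ev f (eSym m ⊗ (hh (+ suc s) ⊗ x))) (ev-cong f (λ p → begin
    ev (eSym m ⊗ (hh (+ suc s) ⊗ x)) (mc p)
      ≡⟨ ev-⊗ (eSym m) (hh (+ suc s) ⊗ x) (mc p) ⟩
    ev (eSym m) (λ q → ev (hh (+ suc s) ⊗ x) (λ r → mc p (q ++ r)))
      ≡⟨ ev-cong (eSym m) (λ q → trans (ev-⊗ (hh (+ suc s)) x (λ r → mc p (q ++ r))) (trans (ℤ.+-identityʳ _) (trans (ℤ.*-identityˡ _)
           (ev-cong x (λ q' → inv-perm (mc-cols p) (↭ₚ.shift (suc s) q q')))))) ⟩
    ev (eSym m) (hv (+ suc s) (G p))
      ≡⟨ ev-eSym m (hv-inv (G-inv p) (+ suc s)) ⟩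
    eD m (hv (+ suc s) (G p)) ∎))

  hook-det-altHE : ∀ f s m → ev f (λ p → hook-det s m (G p)) ≡ altHE f x s m
  hook-det-altHE f s zero    = trans (ev-cong f (λ p → hook-det-zero s (G p))) (sym (pairing-eh f 0 s))
  hook-det-altHE f s (suc m) = begin
    ev f (λ p → hook-det s (suc m) (G p))
      ≡⟨ ev-cong f (λ p → hook-det-suc s m (G-inv p)) ⟩
    ev f (λ p → eD (suc m) (hv (+ suc s) (G p)) ℤ.- hook-det (suc s) m (G p))
      ≡⟨ ev-+ f (λ p → eD (suc m) (hv (+ suc s) (G p))) (λ p → ℤ.- hook-det (suc s) m (G p)) ⟩
    ev f (λ p → eD (suc m) (hv (+ suc s) (G p))) ℤ.+ ev f (λ p → ℤ.- hook-det (suc s) m (G p))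
      ≡⟨ cong₂ ℤ._+_ (sym (pairing-eh f (suc m) s)) (trans (ev-cong f (λ p → sym (ℤ.-1*i≡-i _)))
           (trans (ev-scale f (ℤ.- (+ 1)) (λ p → hook-det (suc s) m (G p))) (trans (ℤ.-1*i≡-i _) (cong ℤ.-_ (hook-det-altHE f (suc s) m))))) ⟩
    altHE f x s (suc m) ∎

  -- e_{m+1} = h_1 e_m - h_2 e_{m-1} + ⋯
  e-by-h : ∀ f m → ⟪ f , eSym (suc m) ⊗ x ⟫ ≡ altHE f x 0 m
  e-by-h f m = trans (pairing≡ev f (eSym (suc m) ⊗ x)) (trans (ev-cong f (λ p → trans (ev-⊗ (eSym (suc m)) x (mc p)) (ev-eSym (suc m) (G-inv p)))) (hook-det-altHE f 0 m))

-- Bounded partitions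

win : ℕ → ℕ → ℕ → ℕ
win s h i with s ≤? i | i <? s + h
... | yes _ | yes _ = 1
... | _     | _     = 0

win-in : ∀ s h i → s ≤ i → i < s + h → win s h i ≡ 1
win-in s h i p q with s ≤? i | i <? s + h
... | yes _ | yes _ = refl
... | yes _ | no ¬q = ⊥-elim (¬q q)
... | no ¬p | _     = ⊥-elim (¬p p)

win-below : ∀ s h i → i < s → win s h i ≡ 0
win-below s h i p with s ≤? i | i <? s + h
... | yes q | yes _ = ⊥-elim (<⇒≱ p q)
... | yes _ | no _  = refl
... | no _  | _     = refl

win-above : ∀ s h i → s + h ≤ i → win s h i ≡ 0
win-above s h i p with s ≤? i | i <? s + h
... | yes _ | yes q = ⊥-elim (<⇒≱ q p)
... | yes _ | no _  = refl
... | no _  | _     = refl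

data WinView (s h i : ℕ) : ℕ → Set where
  within : s ≤ i → i < s + h → WinView s h i 1
  before : i < s → WinView s h i 0
  after  : s + h ≤ i → WinView s h i 0

winView : ∀ s h i → WinView s h i (win s h i)
winView s h i with s ≤? i | i <? s + h
... | yes p | yes q = within p q
... | yes p | no ¬q = after (≮⇒≥ ¬q)
... | no ¬p | _     = before (≰⇒> ¬p)

win-suc-same : ∀ s h → win s (suc h) (s + h) ≡ 1
win-suc-same s h = win-in s (suc h) (s + h) (m≤m+n s h) (≤-reflexive (sym (+-suc s h)))

win-suc-other : ∀ s h i → i ≢ s + h → win s (suc h) i ≡ win s h i
win-suc-other s h i ne with win s h i | winView s h i
... | _ | within p q = win-in s (suc h) i p (≤-trans q (+-monoʳ-≤ s (n≤1+n h)))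
... | _ | before p    = win-below s (suc h) i p
... | _ | after p    = win-above s (suc h) i (≤-trans (≤-reflexive (+-suc s h)) (≤∧≢⇒< p (ne ∘ sym)))

-- A k-bounded partition μ with n = k + 1; down i is the index of the first root in row i,
-- or equivalently the row of the bead n below the bead of row i.
record Bounded (n : ℕ) (μ : ℕ → ℕ) : Set where
  field
    decreasing : ∀ i → μ (suc i) ≤ μ i
    ceiling    : ∀ i → μ i < n

module Rows {n : ℕ} {μ : ℕ → ℕ} (B : Bounded n μ) where
  open Bounded B

  down : ℕ → ℕ
  down i = i + (n ∸ μ i)

  down-μ : ∀ i → down i + μ i ≡ i + n
  down-μ i = trans (+-assoc i (n ∸ μ i) (μ i)) (cong (_+_ i) (m∸n+n≡m (<⇒≤ (ceiling i))))

  down-suc : ∀ i → down i < down (suc i)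
  down-suc i = lia 6 0 (λ i n x y a b → x :+ a := i :+ n ⇒ y :+ b := ♯ 1 :+ i :+ n ⇒ b :≤ a ⇒ x :< y)
    i n (down i) (down (suc i)) (μ i) (μ (suc i)) (down-μ i) (down-μ (suc i)) (decreasing i)

  down-above : ∀ i → i < down i
  down-above i = lia 4 0 (λ i n x a → x :+ a := i :+ n ⇒ a :< n ⇒ i :< x) i n (down i) (μ i) (down-μ i) (ceiling i)

  down-mono : ∀ {i j} → i < j → down i < down j
  down-mono {i} {suc j} (s≤s p) with m≤n⇒m<n∨m≡n p
  ... | inj₁ q    = <-trans (down-mono q) (down-suc j)
  ... | inj₂ refl = down-suc i

  down-mono-≤ : ∀ {i j} → i ≤ j → down i ≤ down j
  down-mono-≤ p with m≤n⇒m<n∨m≡n p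
  ... | inj₁ q    = <⇒≤ (down-mono q)
  ... | inj₂ refl = ≤-refl

  down-injective : ∀ {i j} → down i ≡ down j → i ≡ j
  down-injective {i} {j} e with <-cmp i j
  ... | tri< p _ _ = ⊥-elim (<-irrefl e (down-mono p))
  ... | tri≈ _ p _ = p
  ... | tri> _ _ p = ⊥-elim (<-irrefl (sym e) (down-mono p))

  down-reflects : ∀ {i j} → down i < down j → i < j
  down-reflects {i} {j} p with i <? j
  ... | yes q = q
  ... | no ¬q = ⊥-elim (<⇒≱ p (down-mono-≤ (≮⇒≥ ¬q)))

  μ-antitone : ∀ i s → μ (i + s) ≤ μ i
  μ-antitone i zero    = ≤-reflexive (cong μ (+-identityʳ i))
  μ-antitone i (suc s) = ≤-trans (≤-trans (≤-reflexive (cong μ (+-suc i s))) (decreasing (i + s))) (μ-antitone i s)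

  down-flat : ∀ r s → μ (r + s) ≡ μ r → down (r + s) ≡ down r + s
  down-flat r s e = lia 7 0 (λ r s n x y a b → x :+ a := r :+ s :+ n ⇒ y :+ b := r :+ n ⇒ a := b ⇒ x := y :+ s)
    r s n (down (r + s)) (down r) (μ (r + s)) (μ r) (down-μ (r + s)) (down-μ r) e

  flat-down : ∀ r s → down (r + s) ≡ down r + s → μ (r + s) ≡ μ r
  flat-down r s e = lia 7 0 (λ r s n x y a b → x :+ a := r :+ s :+ n ⇒ y :+ b := r :+ n ⇒ x := y :+ s ⇒ a := b)
    r s n (down (r + s)) (down r) (μ (r + s)) (μ r) (down-μ (r + s)) (down-μ r) e

  down⁻¹ : ∀ j → (∃ λ i → down i ≡ j) ⊎ (∀ i → down i ≢ j)
  down⁻¹ j = search j (λ i p e → <⇒≱ (down-above i) (≤-trans (≤-reflexive e) p))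
    where
      search : ∀ b → (∀ i → b ≤ i → down i ≢ j) → (∃ λ i → down i ≡ j) ⊎ (∀ i → down i ≢ j)
      search zero    h = inj₂ (λ i → h i z≤n)
      search (suc b) h with down b ≟ j
      ... | yes e = inj₁ (b , e)
      ... | no ¬e = search b h'
        where
          h' : ∀ i → b ≤ i → down i ≢ j
          h' i p with m≤n⇒m<n∨m≡n p
          ... | inj₁ q    = h i q
          ... | inj₂ refl = ¬e

  -- Ups w y rs: rs is the sequence of rows from w upwards with down (next row) = row; it ends in y.
  data Ups : ℕ → ℕ → List ℕ → Set where
    last : ∀ {w} → (∀ i → down i ≢ w) → Ups w w (w ∷ [])
    up   : ∀ {w u y rs} → down u ≡ w → Ups u y rs → Ups w y (w ∷ rs)

  ups : ∀ w → ∃ λ y → ∃ λ rs → Ups w y rs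
  ups w = go w w ≤-refl
    where
      go : ∀ f w → w ≤ f → ∃ λ y → ∃ λ rs → Ups w y rs
      go f w p with down⁻¹ w
      ... | inj₂ h = w , _ , last h
      go zero    w p | inj₁ (u , e) = ⊥-elim (<⇒≱ (down-above u) (≤-trans (≤-reflexive e) (≤-trans p z≤n)))
      go (suc f) w p | inj₁ (u , e) with go f u (≤-pred (≤-trans (subst (u <_) e (down-above u)) p))
      ... | y , rs , q = y , _ , up e q

  ups-functional : ∀ {w y y' rs rs'} → Ups w y rs → Ups w y' rs' → y ≡ y' × rs ≡ rs'
  ups-functional (last h) (last h') = refl , refl
  ups-functional (last h) (up e q)  = ⊥-elim (h _ e)
  ups-functional (up e q) (last h)  = ⊥-elim (h _ e)
  ups-functional (up e q) (up e' q') with trans e (sym e')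
  ... | e'' with down-injective e''
  ...   | refl with ups-functional q q'
  ...     | refl , refl = refl , refl

  ups-head : ∀ {w y rs} → Ups w y rs → w ∈ rs
  ups-head (last h) = here refl
  ups-head (up e q) = here refl

  ups-last : ∀ {w y rs} → Ups w y rs → y ∈ rs
  ups-last (last h) = here refl
  ups-last (up e q) = there (ups-last q)

  ups-no-up : ∀ {w y rs} → Ups w y rs → ∀ i → down i ≢ y
  ups-no-up (last h) = h
  ups-no-up (up e q) = ups-no-up q

  ups-≤ : ∀ {w y rs r} → Ups w y rs → r ∈ rs → r ≤ w
  ups-≤ (last h)         (here refl) = ≤-refl
  ups-≤ (up e q)         (here refl) = ≤-refl
  ups-≤ (up {u = u} e q) (there p)   = ≤-trans (ups-≤ q p) (<⇒≤ (subst (u <_) e (down-above u)))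

  ups-≥ : ∀ {w y rs r} → Ups w y rs → r ∈ rs → y ≤ r
  ups-≥ (last h) (here refl) = ≤-refl
  ups-≥ (up {u = u} e q) (here refl) = ≤-trans (ups-≥ q (ups-head q)) (<⇒≤ (subst (u <_) e (down-above u)))
  ups-≥ (up e q) (there p) = ups-≥ q p

  ups-down : ∀ {w y rs r} → Ups w y rs → r ∈ rs → r ≡ w ⊎ down r ∈ rs
  ups-down (last h) (here refl) = inj₁ refl
  ups-down (up e q) (here refl) = inj₁ refl
  ups-down (up e q) (there p) with ups-down q p
  ... | inj₁ refl = inj₂ (here e)
  ... | inj₂ p'   = inj₂ (there p')

  ups-separated : ∀ {w y rs r z} → Ups w y rs → r ∈ rs → z ∈ rs → z ≤ r ⊎ down r ≤ z
  ups-separated (last h) (here refl) (here refl) = inj₁ ≤-refl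
  ups-separated (up e q) (here refl) z∈ = inj₁ (ups-≤ (up e q) z∈)
  ups-separated (up e q) (there r∈) (here refl) = inj₂ (subst (down _ ≤_) e (down-mono-≤ (ups-≤ q r∈)))
  ups-separated (up e q) (there r∈) (there z∈) = ups-separated q r∈ z∈

  -- The rows w, …, w + h - 1 can lose one box each: Pre collects the conditions apart from the maximality of h.
  record Pre (w y : ℕ) (rs : List ℕ) (h : ℕ) : Set where
    field
      flat : ∀ {r} → r ∈ rs → ∀ s → s < h → μ (r + s) ≡ μ r
      room : w + h ≤ down w
      tops : ∀ s → 1 ≤ s → s < h → ∃ λ v → down v ≡ y + s

  -- The height is `suc extra`, and `drop` makes it maximal: the row just below the block of w is
  -- shorter than row w, so `flat` fails for any larger height. A row therefore has at most one good
  -- height.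
  record Good (w : ℕ) : Set where
    field
      {top}    : ℕ
      {rows}   : List ℕ
      {extra}  : ℕ
      runner   : Ups w top rows
      pre      : Pre w top rows (suc extra)
      positive : 1 ≤ μ w
      drop     : μ (w + suc extra) < μ w
    open Pre pre public

  pre-weaken : ∀ {w y rs h h'} → h' ≤ h → Pre w y rs h → Pre w y rs h'
  pre-weaken {w} p P = record
    { flat = λ r∈ s q → Pre.flat P r∈ s (≤-trans q p)
    ; room = ≤-trans (+-monoʳ-≤ w p) (Pre.room P)
    ; tops = λ s q q' → Pre.tops P s q (≤-trans q' p)
    }

  -- The equalities contradict `drop` at every height up to h, so the height supplied by `Good w`
  -- exceeds h.
  good-pre : ∀ {w y rs h} → Ups w y rs → (∀ s → s ≤ h → μ (w + s) ≡ μ w) → Good w → Pre w y rs (suc h)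
  good-pre {w} {y} {rs} {h} U eq G with ups-functional U (Good.runner G)
  ... | refl , refl with suc h ≤? suc (Good.extra G)
  ...   | yes p = pre-weaken p (Good.pre G)
  ...   | no ¬p = ⊥-elim (<-irrefl (eq (suc (Good.extra G)) (≤-pred (≰⇒> ¬p))) (Good.drop G))

  -- Boxes removed from several rows at once stay clear of the next rows of the runner.
  room-step : ∀ {u w h} → down u ≡ w → (∀ s → s < h → μ (u + s) ≡ μ u) → w + h ≤ down w → u + h ≤ down u
  room-step {u} {w} {h} e flat rm with u + h ≤? down u
  ... | yes p = p
  ... | no ¬p = ⊥-elim (lia 7 0 (λ u w h i n a dw → i :< h ⇒ dw :+ a := w :+ n ⇒ w :+ a := u :+ n ⇒ w := u :+ i ⇒ w :+ h :≤ dw ⇒ :⊥)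
          u w h i n (μ u) (down w) i<h (trans (cong (_+_ (down w)) (sym μw)) (down-μ w)) (trans (cong (_+ μ u) (sym e)) (down-μ u)) w≡ rm)
    where
      i : ℕ
      i = w ∸ u
      w≡ : w ≡ u + i
      w≡ = sym (m+[n∸m]≡n (<⇒≤ (subst (u <_) e (down-above u))))
      i<h : i < h
      i<h = lia 4 0 (λ u w h i → w := u :+ i ⇒ w :< u :+ h ⇒ i :< h) u w h i w≡ (subst (_< u + h) e (≰⇒> ¬p))
      μw : μ w ≡ μ u
      μw = trans (cong μ w≡) (flat i i<h)

  room-up : ∀ {w y rs h} → Ups w y rs → (∀ {r} → r ∈ rs → ∀ s → s < h → μ (r + s) ≡ μ r) → w + h ≤ down w → ∀ {r} → r ∈ rs → r + h ≤ down r
  room-up (last _) flat rm (here refl) = rm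
  room-up (up e q) flat rm (here refl) = rm
  room-up (up e q) flat rm (there r∈)  = room-up q (λ r∈ → flat (there r∈)) (room-step e (flat (there (ups-head q))) rm) r∈

  -- The residue after ribbons of height x + 1 have been removed along the runner. The rows w, ...,
  -- w + x lose a box. A row v with `down v` equal to y + s, 1 ≤ s ≤ x, gains one, because the bead
  -- below it now sits in row y + s - 1. In the blocks in between, the bead and the one below it
  -- move alike.
  newμ : ℕ → ℕ → ℕ → ℕ → ℕ
  newμ w y x i = (μ i + win (suc y) x (down i)) ∸ win w (suc x) i

-- Catalan functions

-- Power series in t, as coefficient sequences; sh is multiplication by t.
Series : Set
Series = ℕ → ℤ

sh : Series → Series
sh f zero    = + 0
sh f (suc m) = f m

shs : ℕ → Series → Series
shs zero    f = f
shs (suc n) f = sh (shs n f)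

sh-cong : ∀ {f g : Series} → (∀ m → f m ≡ g m) → ∀ m → sh f m ≡ sh g m
sh-cong h zero    = refl
sh-cong h (suc m) = h m

shs-cong : ∀ n {f g : Series} → (∀ m → f m ≡ g m) → ∀ m → shs n f m ≡ shs n g m
shs-cong zero    h = h
shs-cong (suc n) h = sh-cong (shs-cong n h)

sh-zero : ∀ {f : Series} → (∀ m → f m ≡ + 0) → ∀ m → sh f m ≡ + 0
sh-zero h zero    = refl
sh-zero h (suc m) = h m

Root : Set
Root = ℕ × ℕ

raiseW : Root → Weight → Weight
raiseW (i , j) γ k = γ k ℤ.+ ε i k ℤ.- ε j k

unique-set⇒↭ : ∀ {A : Set} {xs ys : List A} → Unique xs → Unique ys → (∀ {x} → x ∈ xs → x ∈ ys) → (∀ {x} → x ∈ ys → x ∈ xs) → xs ↭ ys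
unique-set⇒↭ u v f g = ∼bag⇒↭ (unique∧set⇒bag u v (mk⇔ f g))

tr : ℕ → ℕ → ℕ
tr a i with i ≟ a
... | yes _ = suc a
... | no _ with i ≟ suc a
...   | yes _ = a
...   | no _  = i

data TrView (a : ℕ) : ℕ → ℕ → Set where
  low   : TrView a a (suc a)
  high  : TrView a (suc a) a
  other : ∀ {i} → i ≢ a → i ≢ suc a → TrView a i i

trView : ∀ a i → TrView a i (tr a i)
trView a i with i ≟ a
... | yes refl = low
... | no ¬p with i ≟ suc a
...   | yes refl = high
...   | no ¬q    = other ¬p ¬q

trView-functional : ∀ {a i j k} → TrView a i j → TrView a i k → j ≡ k
trView-functional low         low         = refl
trView-functional low         (other p q) = ⊥-elim (p refl)
trView-functional high        high        = refl
trView-functional high        (other p q) = ⊥-elim (q refl)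
trView-functional (other p q) low         = ⊥-elim (p refl)
trView-functional (other p q) high        = ⊥-elim (q refl)
trView-functional (other p q) (other _ _) = refl

trView-sym : ∀ {a i j} → TrView a i j → TrView a j i
trView-sym low         = high
trView-sym high        = low
trView-sym (other p q) = other p q

tr-involutive : ∀ a i → tr a (tr a i) ≡ i
tr-involutive a i = trView-functional (trView a (tr a i)) (trView-sym (trView a i))

ε-tr : ∀ a i j → ε (tr a i) j ≡ ε i (tr a j)
ε-tr a i j with i ≟ tr a j
... | yes refl = trans (cong (λ k → ε k j) (tr-involutive a j)) (trans (ε-diag j) (sym (ε-diag (tr a j))))
... | no ¬p = trans (ε-off (tr a i) j (λ e → ¬p (trans (sym (tr-involutive a i)) (cong (tr a) e)))) (sym (ε-off i (tr a j) ¬p))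

-- Swapped a γ γ': the straightening relation s_γ' = - s_γ holds at rows a, a + 1.
Swapped : ℕ → Weight → Weight → Set
Swapped a γ γ' = ∀ j → γ' j ≡ γ (tr a j) ℤ.+ ε (suc a) j ℤ.- ε a j

tr₂ : ℕ → Root → Root
tr₂ a (i , j) = tr a i , tr a j

swapped-raise : ∀ a β {γ γ'} → Swapped a γ γ' → Swapped a (raiseW β γ) (raiseW (tr₂ a β) γ')
swapped-raise a (i , k) {γ} {γ'} h j = begin
  γ' j ℤ.+ ε (tr a i) j ℤ.- ε (tr a k) j
    ≡⟨ cong₂ (λ x y → γ' j ℤ.+ x ℤ.- y) (ε-tr a i j) (ε-tr a k j) ⟩
  γ' j ℤ.+ ε i (tr a j) ℤ.- ε k (tr a j)
    ≡⟨ lia 0 6 (λ g' g x y u v → g' := g :+ u :- v ⇒ g' :+ x :- y := (g :+ x :- y) :+ u :- v)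
         (γ' j) (γ (tr a j)) (ε i (tr a j)) (ε k (tr a j)) (ε (suc a) j) (ε a j) (h j) ⟩
  raiseW (i , k) γ (tr a j) ℤ.+ ε (suc a) j ℤ.- ε a j ∎

upd : (ℕ → ℕ) → ℕ → ℕ → ℕ → ℕ
upd σ w v i with i ≟ w
... | yes _ = v
... | no _  = σ i

upd-same : ∀ σ w v → upd σ w v w ≡ v
upd-same σ w v with w ≟ w
... | yes _ = refl
... | no ¬p = ⊥-elim (¬p refl)

upd-other : ∀ σ w v i → i ≢ w → upd σ w v i ≡ σ i
upd-other σ w v i h with i ≟ w
... | yes p = ⊥-elim (h p)
... | no _  = refl

-- Root ideals, straightening at a pair of rows, and ladders

module Raising (ℓ : ℕ) where

  isRoot? : (σ : ℕ → ℕ) (β : Root) → Dec (proj₁ β < proj₂ β × σ (proj₁ β) ≤ proj₂ β)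
  isRoot? σ (i , j) = (i <? j) ×-dec (σ i ≤? j)

  roots : (ℕ → ℕ) → List Root
  roots σ = filter (isRoot? σ) (cartesianProduct (upTo ℓ) (upTo ℓ))

  IsRoot : (ℕ → ℕ) → ℕ → ℕ → Set
  IsRoot σ i j = i < j × j < ℓ × σ i ≤ j

  ∈-roots⁻ : ∀ σ {i j} → (i , j) ∈ roots σ → IsRoot σ i j
  ∈-roots⁻ σ p with ∈-filter⁻ (isRoot? σ) {xs = cartesianProduct (upTo ℓ) (upTo ℓ)} p
  ... | q , (i<j , σ≤) = i<j , ∈-upTo⁻ (proj₂ (∈-cartesianProduct⁻ (upTo ℓ) (upTo ℓ) q)) , σ≤

  ∈-roots⁺ : ∀ σ {i j} → IsRoot σ i j → (i , j) ∈ roots σ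
  ∈-roots⁺ σ (i<j , j<ℓ , σ≤) = ∈-filter⁺ (isRoot? σ) (∈-cartesianProduct⁺ (∈-upTo⁺ (<-trans i<j j<ℓ)) (∈-upTo⁺ j<ℓ)) (i<j , σ≤)

  roots-unique : ∀ σ → Unique (roots σ)
  roots-unique σ = Uniqueₚ.filter⁺ (isRoot? σ) (Uniqueₚ.cartesianProduct⁺ (Uniqueₚ.upTo⁺ ℓ) (Uniqueₚ.upTo⁺ ℓ))

  roots-cong : ∀ {σ σ'} → (∀ i j → IsRoot σ i j → IsRoot σ' i j) → (∀ i j → IsRoot σ' i j → IsRoot σ i j) → roots σ ↭ roots σ'
  roots-cong {σ} {σ'} f g = unique-set⇒↭ (roots-unique σ) (roots-unique σ')
    (λ p → ∈-roots⁺ σ' (f _ _ (∈-roots⁻ σ p))) (λ p → ∈-roots⁺ σ (g _ _ (∈-roots⁻ σ' p)))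

  -- Rows a and a + 1 have the same roots, (a, a + 1) is not a root, and no earlier row has its
  -- first root in column a + 1, so the columns a and a + 1 have the same roots above them.
  -- Exchanging a and a + 1 then permutes the roots.
  roots-tr : ∀ σ a → suc a < ℓ → σ a ≡ σ (suc a) → suc a < σ a → (∀ i → i < a → σ i ≢ suc a) → map (tr₂ a) (roots σ) ↭ roots σ
  roots-tr σ a a<ℓ eq wall ceil = unique-set⇒↭ (Uniqueₚ.map⁺ tr₂-injective (roots-unique σ)) (roots-unique σ) to from
    where
      tr₂-involutive : ∀ β → tr₂ a (tr₂ a β) ≡ β
      tr₂-involutive (i , j) = cong₂ _,_ (tr-involutive a i) (tr-involutive a j)
      tr₂-injective : ∀ {β β'} → tr₂ a β ≡ tr₂ a β' → β ≡ β'
      tr₂-injective {β} {β'} e = trans (sym (tr₂-involutive β)) (trans (cong (tr₂ a) e) (tr₂-involutive β'))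
      stable′ : ∀ {i j i' j'} → TrView a i i' → TrView a j j' → IsRoot σ i j → IsRoot σ i' j'
      stable′ low low (p , q , r) = ⊥-elim (<-irrefl refl p)
      stable′ low high (p , q , r) = ⊥-elim (<⇒≱ wall r)
      stable′ {j = j} low (other h h') (p , q , r) = <-≤-trans wall r , q , subst (_≤ j) eq r
      stable′ high low (p , q , r) = ⊥-elim (<-asym p (n<1+n a))
      stable′ high high (p , q , r) = ⊥-elim (<-irrefl refl p)
      stable′ {j = j} high (other h h') (p , q , r) = <-trans (n<1+n a) p , q , subst (_≤ j) (sym eq) r
      stable′ (other h h') low (p , q , r) = m<n⇒m<1+n p , a<ℓ , m≤n⇒m≤1+n r
      stable′ {i} (other h h') high (p , q , r) = i<a , <-trans (n<1+n a) a<ℓ , ≤-pred (≤∧≢⇒< r (ceil i i<a))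
        where
          i<a : i < a
          i<a = ≤∧≢⇒< (≤-pred p) h
      stable′ (other h h') (other k k') r = r
      stable : ∀ {β} → β ∈ roots σ → tr₂ a β ∈ roots σ
      stable {i , j} p = ∈-roots⁺ σ (stable′ (trView a i) (trView a j) (∈-roots⁻ σ p))
      to : ∀ {β} → β ∈ map (tr₂ a) (roots σ) → β ∈ roots σ
      to p with ∈-map⁻ (tr₂ a) p
      ... | β , q , refl = stable q
      from : ∀ {β} → β ∈ roots σ → β ∈ map (tr₂ a) (roots σ)
      from {β} p = subst (_∈ map (tr₂ a) (roots σ)) (tr₂-involutive β) (∈-map⁺ (tr₂ a) (stable p))

  roots-remove : ∀ σ w → w < σ w → σ w < ℓ → roots σ ↭ (w , σ w) ∷ roots (upd σ w (suc (σ w)))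
  roots-remove σ w w<σ σ<ℓ = unique-set⇒↭ (roots-unique σ) (fresh ∷ roots-unique σ') to from
    where
      σ' : ℕ → ℕ
      σ' = upd σ w (suc (σ w))
      fresh : All.All ((w , σ w) ≢_) (roots σ')
      fresh = All.tabulate (λ { {β} p refl → <-irrefl refl (subst (_≤ σ w) (upd-same σ w (suc (σ w))) (proj₂ (proj₂ (∈-roots⁻ σ' p)))) })
      to : ∀ {β} → β ∈ roots σ → β ∈ (w , σ w) ∷ roots σ'
      to {i , j} p with i ≟ w | ∈-roots⁻ σ p
      ... | no ¬q | (i<j , j<ℓ , r) = there (∈-roots⁺ σ' (i<j , j<ℓ , subst (_≤ j) (sym (upd-other σ w _ i ¬q)) r))
      ... | yes refl | (i<j , j<ℓ , r) with j ≟ σ i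
      ...   | yes refl = here refl
      ...   | no ¬e = there (∈-roots⁺ σ' (i<j , j<ℓ , subst (_≤ j) (sym (upd-same σ i _)) (≤∧≢⇒< r (¬e ∘ sym))))
      from : ∀ {β} → β ∈ (w , σ w) ∷ roots σ' → β ∈ roots σ
      from (here refl) = ∈-roots⁺ σ (w<σ , σ<ℓ , ≤-refl)
      from {i , j} (there p) with i ≟ w | ∈-roots⁻ σ' p
      ... | no ¬q | (i<j , j<ℓ , r) = ∈-roots⁺ σ (i<j , j<ℓ , r)
      ... | yes refl | (i<j , j<ℓ , r) = ∈-roots⁺ σ (i<j , j<ℓ , <⇒≤ r)

  -- The functionals z^γ ↦ ψ γ considered below are alternating only at the pairs of rows (a , a + 1) with A a.
  record Alternating (A : ℕ → Set) (ψ : Weight → ℤ) : Set where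
    field
      ext  : ∀ {γ γ'} → (∀ j → j < ℓ → γ j ≡ γ' j) → ψ γ ≡ ψ γ'
      anti : ∀ a {γ γ'} → suc a < ℓ → A a → Swapped a γ γ' → ψ γ' ≡ ℤ.- ψ γ

  Hl : (Weight → ℤ) → List Root → Weight → Series
  Hl ψ []      γ zero    = ψ γ
  Hl ψ []      γ (suc m) = + 0
  Hl ψ (β ∷ Ψ) γ zero    = Hl ψ Ψ γ zero
  Hl ψ (β ∷ Ψ) γ (suc m) = Hl ψ Ψ γ (suc m) ℤ.+ Hl ψ (β ∷ Ψ) (raiseW β γ) m

  Hl-cons : ∀ ψ β Ψ γ m → Hl ψ (β ∷ Ψ) γ m ≡ Hl ψ Ψ γ m ℤ.+ sh (Hl ψ (β ∷ Ψ) (raiseW β γ)) m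
  Hl-cons ψ β Ψ γ zero    = sym (ℤ.+-identityʳ _)
  Hl-cons ψ β Ψ γ (suc m) = refl

  module Catalan {A : ℕ → Set} {ψ : Weight → ℤ} (alt : Alternating A ψ) where
    open Alternating alt

    raiseW-cong : ∀ β {γ γ' : Weight} → (∀ j → j < ℓ → γ j ≡ γ' j) → ∀ j → j < ℓ → raiseW β γ j ≡ raiseW β γ' j
    raiseW-cong (i , k) h j p = cong (λ x → x ℤ.+ ε i j ℤ.- ε k j) (h j p)

    Hl-ext : ∀ Ψ {γ γ'} → (∀ j → j < ℓ → γ j ≡ γ' j) → ∀ m → Hl ψ Ψ γ m ≡ Hl ψ Ψ γ' m
    Hl-ext []      h zero    = ext h
    Hl-ext []      h (suc m) = refl
    Hl-ext (β ∷ Ψ) h zero    = Hl-ext Ψ h zero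
    Hl-ext (β ∷ Ψ) h (suc m) = cong₂ ℤ._+_ (Hl-ext Ψ h (suc m)) (Hl-ext (β ∷ Ψ) (raiseW-cong β h) m)

    raiseW-comm : ∀ α β γ j → raiseW α (raiseW β γ) j ≡ raiseW β (raiseW α γ) j
    raiseW-comm (i , k) (i' , k') γ j = lia 0 5 (λ g a b c d → (g :+ a :- b) :+ c :- d := (g :+ c :- d) :+ a :- b)
      (γ j) (ε i' j) (ε k' j) (ε i j) (ε k j)

    Hl-swap : ∀ α β Ψ γ m → Hl ψ (α ∷ β ∷ Ψ) γ m ≡ Hl ψ (β ∷ α ∷ Ψ) γ m
    Hl-swap α β Ψ γ zero    = refl
    Hl-swap α β Ψ γ (suc m) = lia 0 9 (λ x y z u s1 s2 ab ab' ba →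
        ab' := ba ⇒ ba := u :+ s1 ⇒ s1 := s2 ⇒ z := y :+ s2 ⇒ x :+ y :+ ab' := (x :+ u) :+ z)
      (Hl ψ Ψ γ (suc m)) (Hl ψ (β ∷ Ψ) (raiseW β γ) m) (Hl ψ (β ∷ α ∷ Ψ) (raiseW β γ) m) (Hl ψ (α ∷ Ψ) (raiseW α γ) m)
      (sh (Hl ψ (β ∷ α ∷ Ψ) (raiseW β (raiseW α γ))) m) (sh (Hl ψ (α ∷ β ∷ Ψ) (raiseW α (raiseW β γ))) m)
      (+ 0) (Hl ψ (α ∷ β ∷ Ψ) (raiseW α γ) m) (Hl ψ (β ∷ α ∷ Ψ) (raiseW α γ) m)
      (Hl-swap α β Ψ (raiseW α γ) m) (Hl-cons ψ β (α ∷ Ψ) (raiseW α γ) m) (rest m)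
      (trans (sym (Hl-swap α β Ψ (raiseW β γ) m)) (Hl-cons ψ α (β ∷ Ψ) (raiseW β γ) m))
      where
        rest : ∀ m → sh (Hl ψ (β ∷ α ∷ Ψ) (raiseW β (raiseW α γ))) m ≡ sh (Hl ψ (α ∷ β ∷ Ψ) (raiseW α (raiseW β γ))) m
        rest zero    = refl
        rest (suc m) = trans (sym (Hl-swap α β Ψ (raiseW β (raiseW α γ)) m))
          (Hl-ext (α ∷ β ∷ Ψ) (λ j _ → raiseW-comm β α γ j) m)

    Hl-perm : ∀ {Ψ Ψ'} → Ψ ↭ Ψ' → ∀ γ m → Hl ψ Ψ γ m ≡ Hl ψ Ψ' γ m
    Hl-perm _↭_.refl        γ m       = refl
    Hl-perm (prep β h)    γ zero    = Hl-perm h γ zero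
    Hl-perm (prep β h)    γ (suc m) = cong₂ ℤ._+_ (Hl-perm h γ (suc m)) (Hl-perm (prep β h) (raiseW β γ) m)
    Hl-perm (swap {Ψ} {Ψ'} α β h) γ m = trans (Hl-swap α β Ψ γ m) (Hl-perm′ (β ∷ α ∷ []) γ m)
      where
        Hl-perm′ : ∀ Θ γ m → Hl ψ (Θ ++ Ψ) γ m ≡ Hl ψ (Θ ++ Ψ') γ m
        Hl-perm′ []      γ m       = Hl-perm h γ m
        Hl-perm′ (β ∷ Θ) γ zero    = Hl-perm′ Θ γ zero
        Hl-perm′ (β ∷ Θ) γ (suc m) = cong₂ ℤ._+_ (Hl-perm′ Θ γ (suc m)) (Hl-perm′ (β ∷ Θ) (raiseW β γ) m)
    Hl-perm (_↭_.trans h h')  γ m       = trans (Hl-perm h γ m) (Hl-perm h' γ m)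

    Hl-tr : ∀ a → suc a < ℓ → A a → ∀ Ψ {γ γ'} → Swapped a γ γ' → ∀ m → Hl ψ (map (tr₂ a) Ψ) γ' m ≡ ℤ.- Hl ψ Ψ γ m
    Hl-tr a p q []      h zero    = anti a p q h
    Hl-tr a p q []      h (suc m) = refl
    Hl-tr a p q (β ∷ Ψ) h zero    = Hl-tr a p q Ψ h zero
    Hl-tr a p q (β ∷ Ψ) {γ} h (suc m) = trans
      (cong₂ ℤ._+_ (Hl-tr a p q Ψ h (suc m)) (Hl-tr a p q (β ∷ Ψ) (swapped-raise a β {γ} h) m))
      (sym (ℤ.neg-distrib-+ (Hl ψ Ψ γ (suc m)) (Hl ψ (β ∷ Ψ) (raiseW β γ) m)))

    H : (ℕ → ℕ) → Weight → Series
    H σ = Hl ψ (roots σ)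

    H-ext : ∀ σ {γ γ'} → (∀ j → γ j ≡ γ' j) → ∀ m → H σ γ m ≡ H σ γ' m
    H-ext σ h = Hl-ext (roots σ) (λ j _ → h j)

    H-roots : ∀ {σ σ'} → (∀ i → σ i ≡ σ' i) → ∀ γ m → H σ γ m ≡ H σ' γ m
    H-roots {σ} {σ'} h = Hl-perm (roots-cong {σ} {σ'} (λ i j (p , q , r) → p , q , subst (_≤ j) (h i) r) (λ i j (p , q , r) → p , q , subst (_≤ j) (sym (h i)) r))

    H-expand : ∀ σ w → w < σ w → σ w < ℓ → ∀ γ m →
      H σ γ m ≡ H (upd σ w (suc (σ w))) γ m ℤ.+ sh (H σ (raiseW (w , σ w) γ)) m
    H-expand σ w p q γ m = begin
      H σ γ m
        ≡⟨ Hl-perm (roots-remove σ w p q) γ m ⟩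
      Hl ψ ((w , σ w) ∷ roots (upd σ w (suc (σ w)))) γ m
        ≡⟨ Hl-cons ψ (w , σ w) (roots (upd σ w (suc (σ w)))) γ m ⟩
      H (upd σ w (suc (σ w))) γ m ℤ.+ sh (Hl ψ ((w , σ w) ∷ roots (upd σ w (suc (σ w)))) (raiseW (w , σ w) γ)) m
        ≡⟨ cong (ℤ._+_ (H (upd σ w (suc (σ w))) γ m)) (sh-cong (λ m → sym (Hl-perm (roots-remove σ w p q) (raiseW (w , σ w) γ) m)) m) ⟩
      H (upd σ w (suc (σ w))) γ m ℤ.+ sh (H σ (raiseW (w , σ w) γ)) m ∎

    H-swap : ∀ σ a → suc a < ℓ → A a → σ a ≡ σ (suc a) → suc a < σ a → (∀ i → i < a → σ i ≢ suc a) →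
      ∀ {γ γ'} → Swapped a γ γ' → ∀ m → H σ γ' m ≡ ℤ.- H σ γ m
    H-swap σ a a<ℓ Aa eq wall ceil {γ} {γ'} s m = trans (sym (Hl-perm (roots-tr σ a a<ℓ eq wall ceil) γ' m)) (Hl-tr a a<ℓ Aa (roots σ) s m)

    fixed-swapped : ∀ a γ → γ (suc a) ≡ γ a ℤ.+ + 1 → Swapped a γ γ
    fixed-swapped a γ h j with tr a j | trView a j
    ... | _ | low = lia 0 4 (λ x y u v → y := x :+ ♯ 1 ⇒ u := ♯ 0 ⇒ v := ♯ 1 ⇒ x := y :+ u :- v)
          (γ a) (γ (suc a)) (ε (suc a) a) (ε a a) h (ε-off (suc a) a 1+n≢n) (ε-diag a)
    ... | _ | high = lia 0 4 (λ x y u v → y := x :+ ♯ 1 ⇒ u := ♯ 1 ⇒ v := ♯ 0 ⇒ y := x :+ u :- v)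
          (γ a) (γ (suc a)) (ε (suc a) (suc a)) (ε a (suc a)) h (ε-diag (suc a)) (ε-off a (suc a) (1+n≢n ∘ sym))
    ... | _ | other p q = lia 0 3 (λ x u v → u := ♯ 0 ⇒ v := ♯ 0 ⇒ x := x :+ u :- v)
          (γ j) (ε (suc a) j) (ε a j) (ε-off (suc a) j (q ∘ sym)) (ε-off a j (p ∘ sym))

    -- A weight with γ_{a+1} = γ_a + 1 is its own straightening partner, so the value equals its
    -- negative.
    H-zero : ∀ σ a → suc a < ℓ → A a → σ a ≡ σ (suc a) → suc a < σ a → (∀ i → i < a → σ i ≢ suc a) →
      ∀ {γ} → γ (suc a) ≡ γ a ℤ.+ + 1 → ∀ m → H σ γ m ≡ + 0
    H-zero σ a a<ℓ Aa eq wall ceil {γ} h m = lia 0 1 (λ x → x := :- x ⇒ x := ♯ 0) (H σ γ m)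
      (H-swap σ a a<ℓ Aa eq wall ceil (fixed-swapped a γ h) m)

    -- Only row u, whose first root is in column a + 1, spoils the symmetry of the two columns. With
    -- the root (u, a) added, the function vanishes by `H-zero`; the expansion in this root
    -- expresses the original function by minus t times one of weight γ + ε_u - ε_a, and
    -- straightening turns ε_a into ε_{a+1} and removes the sign.
    H-lift : ∀ σ a u → suc a < ℓ → A a → σ a ≡ σ (suc a) → suc a < σ a → u < a → σ u ≡ suc a → (∀ i → i < a → σ i ≡ suc a → i ≡ u) →
      ∀ {γ} → γ (suc a) ≡ γ a ℤ.+ + 1 → ∀ m → H σ γ m ≡ sh (H (upd σ u a) (raiseW (u , suc a) γ)) m
    H-lift σ a u a<ℓ Aa eq wall u<a σu uniq {γ} h m = begin
      H σ γ m
        ≡⟨ lia 0 3 (λ x y z → y := x :+ z ⇒ y := ♯ 0 ⇒ x := :- z) (H σ γ m) (H σ' γ m) (sh (H σ' (raiseW (u , σ' u) γ)) m) expanded vanishing ⟩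
      ℤ.- sh (H σ' (raiseW (u , σ' u) γ)) m
        ≡⟨ sym (sh-neg (λ m → H-swap σ' a a<ℓ Aa eq' wall' ceil swapped m) m) ⟩
      sh (H σ' (raiseW (u , suc a) γ)) m ∎
      where
        σ' : ℕ → ℕ
        σ' = upd σ u a
        u≢a : a ≢ u
        u≢a = >⇒≢ u<a
        u≢a+1 : suc a ≢ u
        u≢a+1 = >⇒≢ (m<n⇒m<1+n u<a)
        σ'u : σ' u ≡ a
        σ'u = upd-same σ u a
        eq' : σ' a ≡ σ' (suc a)
        eq' = trans (upd-other σ u a a u≢a) (trans eq (sym (upd-other σ u a (suc a) u≢a+1)))
        wall' : suc a < σ' a
        wall' = subst (suc a <_) (sym (upd-other σ u a a u≢a)) wall
        ceil : ∀ i → i < a → σ' i ≢ suc a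
        ceil i i<a e with i ≟ u
        ... | yes refl = 1+n≢n (sym e)
        ... | no ¬p = ¬p (uniq i i<a e)
        vanishing : H σ' γ m ≡ + 0
        vanishing = H-zero σ' a a<ℓ Aa eq' wall' ceil h m
        expanded : H σ' γ m ≡ H σ γ m ℤ.+ sh (H σ' (raiseW (u , σ' u) γ)) m
        expanded = trans (H-expand σ' u (subst (u <_) (sym σ'u) u<a) (subst (_< ℓ) (sym σ'u) (<-trans (n<1+n a) a<ℓ)) γ m)
          (cong (ℤ._+ sh (H σ' (raiseW (u , σ' u) γ)) m) (H-roots restore γ m))
          where
            restore : ∀ i → upd σ' u (suc (σ' u)) i ≡ σ i
            restore i with i ≟ u
            ... | yes refl = trans (cong suc σ'u) (sym σu)
            ... | no ¬p = upd-other σ u a i ¬p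
        sh-neg : ∀ {f g : Series} → (∀ m → f m ≡ ℤ.- g m) → ∀ m → sh f m ≡ ℤ.- sh g m
        sh-neg h zero    = refl
        sh-neg h (suc m) = h m
        swapped : Swapped a (raiseW (u , σ' u) γ) (raiseW (u , suc a) γ)
        swapped rewrite σ'u = go
          where
            go : ∀ j → raiseW (u , suc a) γ j ≡ raiseW (u , a) γ (tr a j) ℤ.+ ε (suc a) j ℤ.- ε a j
            go j with tr a j | trView a j
            ... | _ | low = lia 0 9 (λ x y p q r s t v w → y := x :+ ♯ 1 ⇒ p := ♯ 0 ⇒ q := ♯ 0 ⇒ r := ♯ 0 ⇒ s := ♯ 0 ⇒ t := ♯ 0 ⇒ v := ♯ 1 ⇒
                    x :+ p :- q := (y :+ r :- s) :+ t :- v)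
                  (γ a) (γ (suc a)) (ε u a) (ε (suc a) a) (ε u (suc a)) (ε a (suc a)) (ε (suc a) a) (ε a a) (+ 0)
                  h (ε-off u a (u≢a ∘ sym)) (ε-off (suc a) a 1+n≢n) (ε-off u (suc a) (u≢a+1 ∘ sym)) (ε-off a (suc a) (1+n≢n ∘ sym)) (ε-off (suc a) a 1+n≢n) (ε-diag a)
            ... | _ | high = lia 0 9 (λ x y p q r s t v w → y := x :+ ♯ 1 ⇒ p := ♯ 0 ⇒ q := ♯ 1 ⇒ r := ♯ 0 ⇒ s := ♯ 1 ⇒ t := ♯ 1 ⇒ v := ♯ 0 ⇒
                    y :+ p :- q := (x :+ r :- s) :+ t :- v)
                  (γ a) (γ (suc a)) (ε u (suc a)) (ε (suc a) (suc a)) (ε u a) (ε a a) (ε (suc a) (suc a)) (ε a (suc a)) (+ 0)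
                  h (ε-off u (suc a) (u≢a+1 ∘ sym)) (ε-diag (suc a)) (ε-off u a (u≢a ∘ sym)) (ε-diag a) (ε-diag (suc a)) (ε-off a (suc a) (1+n≢n ∘ sym))
            ... | _ | other p q = lia 0 4 (λ x y u v → u := ♯ 0 ⇒ v := ♯ 0 ⇒ x :+ y :- u := (x :+ y :- v) :+ u :- v)
                  (γ j) (ε u j) (ε (suc a) j) (ε a j) (ε-off (suc a) j (q ∘ sym)) (ε-off a j (p ∘ sym))

    -- A ladder over a is a chain of pairs of rows u, u + 1, each mirrored in the pair of columns that is the previous pair.
    record Rung (σ : ℕ → ℕ) (γ : Weight) (a u : ℕ) : Set where
      field
        below  : suc u < a
        left   : σ u ≡ a
        right  : σ (suc u) ≡ suc a
        level  : γ (suc u) ≡ γ u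
        unique : ∀ i → i < a → σ i ≡ suc a → i ≡ suc u
        alt-u  : A u
    open Rung

    data Ladder (σ : ℕ → ℕ) (γ : Weight) (a : ℕ) : ℕ → Set where
      stop : ∀ {c} → (∀ i → i < a → σ i ≢ suc a) → Ladder σ γ a c
      step : ∀ u {c} → Rung σ γ a u → Ladder σ γ u c → Ladder σ γ a (suc c)

    data LadderTo (v : ℕ) (σ : ℕ → ℕ) (γ : Weight) (a : ℕ) : ℕ → Set where
      top  : v < a → σ v ≡ suc a → (∀ i → i < a → σ i ≡ suc a → i ≡ v) → LadderTo v σ γ a 1
      step : ∀ u {c} → Rung σ γ a u → LadderTo v σ γ u c → LadderTo v σ γ a (suc c)

    rung-resp : ∀ {σ σ' γ γ' a u} → (∀ i → i < a → σ' i ≡ σ i) → (∀ i → i < a → γ' i ≡ γ i) → Rung σ γ a u → Rung σ' γ' a u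
    rung-resp {u = u} f g r .below = r .below
    rung-resp {u = u} f g r .left = trans (f u (<-trans (n<1+n u) (r .below))) (r .left)
    rung-resp {u = u} f g r .right = trans (f (suc u) (r .below)) (r .right)
    rung-resp {u = u} f g r .level = trans (g (suc u) (r .below)) (trans (r .level) (sym (g u (<-trans (n<1+n u) (r .below)))))
    rung-resp {u = u} f g r .unique i p e = r .unique i p (trans (sym (f i p)) e)
    rung-resp {u = u} f g r .alt-u = r .alt-u

    below′ : ∀ {σ γ a u} → Rung σ γ a u → ∀ i → i < u → i < a
    below′ r i p = <-trans p (<-trans (n<1+n _) (r .below))

    ladder-resp : ∀ {σ σ' γ γ' a c} → (∀ i → i < a → σ' i ≡ σ i) → (∀ i → i < a → γ' i ≡ γ i) → Ladder σ γ a c → Ladder σ' γ' a c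
    ladder-resp f g (stop h) = stop (λ i p e → h i p (trans (sym (f i p)) e))
    ladder-resp f g (step u r l) = step u (rung-resp f g r) (ladder-resp (λ i p → f i (below′ r i p)) (λ i p → g i (below′ r i p)) l)

    ladderTo-resp : ∀ {v σ σ' γ γ' a c} → (∀ i → i < a → σ' i ≡ σ i) → (∀ i → i < a → γ' i ≡ γ i) → LadderTo v σ γ a c → LadderTo v σ' γ' a c
    ladderTo-resp f g (top p q h) = top p (trans (f _ p) q) (λ i p e → h i p (trans (sym (f i p)) e))
    ladderTo-resp f g (step u r l) = step u (rung-resp f g r) (ladderTo-resp (λ i p → f i (below′ r i p)) (λ i p → g i (below′ r i p)) l)

    ladderTo-top : ∀ {v σ γ a c} → LadderTo v σ γ a c → v < a × σ v ≤ suc a × 1 ≤ σ v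
    ladderTo-top (top p q h) = p , ≤-reflexive q , subst (1 ≤_) (sym q) (s≤s z≤n)
    ladderTo-top (step u r l) with ladderTo-top l
    ... | p , q , h = below′ r _ p , ≤-trans q (s≤s (<⇒≤ (<-trans (n<1+n u) (r .below)))) , h

    -- Once the row at the top of a ladder is moved, the ladder is blocked.
    ladderTo-block : ∀ {v σ σ' γ γ' a c} → (∀ i → i < a → i ≢ v → σ' i ≡ σ i) → σ' v ≡ σ v ∸ 1 →
      (∀ i → i < a → i ≢ v → γ' i ≡ γ i) → LadderTo v σ γ a c → Ladder σ' γ' a c
    ladderTo-block {v} {a = a} f e g (top p q h) = stop blocked
      where
        blocked : ∀ i → i < a → _ ≢ suc a
        blocked i i<a e' with i ≟ v
        ... | yes refl = 1+n≢n (sym (trans (sym (trans e (cong (_∸ 1) q))) e'))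
        ... | no ¬p = ¬p (h i i<a (trans (sym (f i i<a ¬p)) e'))
    ladderTo-block {v} {σ} {σ'} {a = a} f e g (step u r l) = step u rung
      (ladderTo-block (λ i p → f i (below′ r i p)) e (λ i p → g i (below′ r i p)) l)
      where
        v<u : v < u
        v<u = proj₁ (ladderTo-top l)
        u<a : u < a
        u<a = <-trans (n<1+n u) (r .below)
        u≢v : u ≢ v
        u≢v = >⇒≢ v<u
        u+1≢v : suc u ≢ v
        u+1≢v = >⇒≢ (m<n⇒m<1+n v<u)
        rung : Rung _ _ _ u
        rung .below = r .below
        rung .left = trans (f u u<a u≢v) (r .left)
        rung .right = trans (f (suc u) (r .below) u+1≢v) (r .right)
        rung .level = trans (g (suc u) (r .below) u+1≢v) (trans (r .level) (sym (g u u<a u≢v)))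
        rung .unique i p e' with i ≟ v
        ... | yes refl = ⊥-elim (lia 3 0 (λ s u a → s :≤ ♯ 1 :+ u ⇒ ♯ 2 :+ u :≤ a ⇒ ♯ 1 :+ a :≤ s ⇒ :⊥) (σ v) u a
              (proj₁ (proj₂ (ladderTo-top l))) (r .below) (≤-trans (≤-reflexive (trans (sym e') e)) (m∸n≤m (σ v) 1)))
        ... | no ¬p = r .unique i p (trans (sym (f i p ¬p)) e')
        rung .alt-u = r .alt-u

    record Start (σ : ℕ → ℕ) (γ : Weight) (a : ℕ) : Set where
      field
        interior : suc a < ℓ
        alt-a  : A a
        same   : σ a ≡ σ (suc a)
        wall   : suc a < σ a
        slope  : γ (suc a) ≡ γ a ℤ.+ + 1

    raiseW-other : ∀ i j γ k → k ≢ i → k ≢ j → raiseW (i , j) γ k ≡ γ k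
    raiseW-other i j γ k p q = lia 0 3 (λ g x y → x := ♯ 0 ⇒ y := ♯ 0 ⇒ g :+ x :- y := g) (γ k) (ε i k) (ε j k) (ε-off i k (p ∘ sym)) (ε-off j k (q ∘ sym))

    raiseW-up : ∀ i j γ → i ≢ j → raiseW (i , j) γ i ≡ γ i ℤ.+ + 1
    raiseW-up i j γ p = lia 0 3 (λ g x y → x := ♯ 1 ⇒ y := ♯ 0 ⇒ g :+ x :- y := g :+ ♯ 1) (γ i) (ε i i) (ε j i) (ε-diag i) (ε-off j i (p ∘ sym))

    next-start : ∀ {σ γ a u} → Start σ γ a → Rung σ γ a u → Start (upd σ (suc u) a) (raiseW (suc u , suc a) γ) u
    next-start {σ} {γ} {a} {u} s r = record
      { interior = <-trans (r .below) (<-trans (n<1+n a) (Start.interior s))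
      ; alt-a  = r .alt-u
      ; same   = trans σ'u (sym (upd-same σ (suc u) a))
      ; wall   = subst (suc u <_) (sym σ'u) (r .below)
      ; slope  = trans (raiseW-up (suc u) (suc a) γ (<⇒≢ (m<n⇒m<1+n (r .below))))
          (cong (ℤ._+ + 1) (trans (r .level) (sym (raiseW-other (suc u) (suc a) γ u (1+n≢n ∘ sym) (<⇒≢ (m<n⇒m<1+n (<-trans (n<1+n u) (r .below))))))))
      }
      where
        σ'u : upd σ (suc u) a u ≡ a
        σ'u = trans (upd-other σ (suc u) a u (1+n≢n ∘ sym)) (r .left)

    rung-lift : ∀ {σ γ a u} → Start σ γ a → Rung σ γ a u → ∀ m → H σ γ m ≡ sh (H (upd σ (suc u) a) (raiseW (suc u , suc a) γ)) m
    rung-lift {σ} {γ} {a} {u} s r m = H-lift σ a (suc u) (Start.interior s) (Start.alt-a s) (Start.same s) (Start.wall s) (r .below) (r .right) (r .unique) (Start.slope s) m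

    -- Each rung is passed by `H-lift`, and at the end of the ladder the two columns agree, so that
    -- `H-zero` applies.
    H-blocked : ∀ {σ γ a c} → Start σ γ a → Ladder σ γ a c → ∀ m → H σ γ m ≡ + 0
    H-blocked {σ} {γ} {a} s (stop h) m = H-zero σ a (Start.interior s) (Start.alt-a s) (Start.same s) (Start.wall s) h (Start.slope s) m
    H-blocked {σ} {γ} {a} {suc c} s (step u r l) m = trans (rung-lift s r m)
      (sh-zero (H-blocked (next-start s r) (ladder-resp f g l)) m)
      where
        f : ∀ i → i < u → upd σ (suc u) a i ≡ σ i
        f i p = upd-other σ (suc u) a i (<⇒≢ (m<n⇒m<1+n p))
        g : ∀ i → i < u → raiseW (suc u , suc a) γ i ≡ γ i
        g i p = raiseW-other (suc u) (suc a) γ i (<⇒≢ (m<n⇒m<1+n p)) (<⇒≢ (m<n⇒m<1+n (below′ r i p)))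

    -- Every rung contributes one factor t and moves the surplus unit further up, until it ends in
    -- row v: the intermediate ε_{u+1} cancel in the weight. Each rung also adds an auxiliary root,
    -- which has to be taken out again.
    H-climb : ∀ {v σ γ a c} → Start σ γ a → LadderTo v σ γ a c → ∀ m →
      H σ γ m ≡ shs c (H (upd σ v (σ v ∸ 1)) (raiseW (v , suc a) γ)) m
    H-climb {v} {σ} {γ} {a} s (top p q h) m = trans
      (H-lift σ a v (Start.interior s) (Start.alt-a s) (Start.same s) (Start.wall s) p q h (Start.slope s) m)
      (sh-cong (λ m → H-roots (λ i → cong (λ x → upd σ v x i) (sym (cong (_∸ 1) q))) (raiseW (v , suc a) γ) m) m)
    H-climb {v} {σ} {γ} {a} {suc c} s (step u r l) m = trans (rung-lift s r m) (sh-cong (λ m → trans (H-climb s' l' m) (shs-cong c cleanup m)) m)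
      where
        σ' : ℕ → ℕ
        σ' = upd σ (suc u) a
        γ' : Weight
        γ' = raiseW (suc u , suc a) γ
        s' : Start σ' γ' u
        s' = next-start s r
        v<u : v < u
        v<u = proj₁ (ladderTo-top l)
        l' : LadderTo v σ' γ' u c
        l' = ladderTo-resp (λ i p → upd-other σ (suc u) a i (<⇒≢ (m<n⇒m<1+n p)))
          (λ i p → raiseW-other (suc u) (suc a) γ i (<⇒≢ (m<n⇒m<1+n p)) (<⇒≢ (m<n⇒m<1+n (below′ r i p)))) l
        σ'' : ℕ → ℕ
        σ'' = upd σ' v (σ' v ∸ 1)
        γ'' : Weight
        γ'' = raiseW (v , suc u) γ'
        σ'v : σ' v ≡ σ v
        σ'v = upd-other σ (suc u) a v (<⇒≢ (m<n⇒m<1+n v<u))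
        σ''-other : ∀ i → i ≢ v → σ'' i ≡ σ' i
        σ''-other i p = upd-other σ' v _ i p
        u+1≢v : suc u ≢ v
        u+1≢v = >⇒≢ (m<n⇒m<1+n v<u)
        u≢v : u ≢ v
        u≢v = >⇒≢ v<u
        σ''u : σ'' u ≡ a
        σ''u = trans (σ''-other u u≢v) (trans (upd-other σ (suc u) a u (1+n≢n ∘ sym)) (r .left))
        σ''u+1 : σ'' (suc u) ≡ a
        σ''u+1 = trans (σ''-other (suc u) u+1≢v) (upd-same σ (suc u) a)
        γ''≗ : ∀ j → γ'' j ≡ raiseW (v , suc a) γ j
        γ''≗ j = lia 0 4 (λ g x y z → g :+ y :- z :+ x :- y := g :+ x :- z) (γ j) (ε v j) (ε (suc u) j) (ε (suc a) j)
        a<ℓ : a < ℓ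
        a<ℓ = <-trans (n<1+n a) (Start.interior s)
        γ''' : Weight
        γ''' = raiseW (suc u , σ'' (suc u)) γ''
        γ'''-other : ∀ i → i ≤ u → i ≢ v → γ''' i ≡ γ i
        γ'''-other i p q = trans (raiseW-other (suc u) (σ'' (suc u)) γ'' i (<⇒≢ (s≤s p)) (subst (i ≢_) (sym σ''u+1) (<⇒≢ i<a)))
          (trans (γ''≗ i) (raiseW-other v (suc a) γ i q (<⇒≢ (m<n⇒m<1+n i<a))))
          where
            i<a : i < a
            i<a = <-trans (s≤s p) (r .below)
        blocked-start : Start σ'' γ''' u
        blocked-start = record
          { interior = Start.interior s'
          ; alt-a  = r .alt-u
          ; same   = trans σ''u (sym σ''u+1)
          ; wall   = subst (suc u <_) (sym σ''u) (r .below)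
          ; slope  = trans (raiseW-up (suc u) (σ'' (suc u)) γ'' (subst (suc u ≢_) (sym σ''u+1) (<⇒≢ (r .below))))
              (cong (ℤ._+ + 1) (trans (γ''≗ (suc u)) (trans (raiseW-other v (suc a) γ (suc u) u+1≢v (<⇒≢ (m<n⇒m<1+n (r .below))))
                (trans (r .level) (sym (γ'''-other u ≤-refl u≢v))))))
          }
        blocked : Ladder σ'' γ''' u c
        blocked = ladderTo-block
          (λ i p q → trans (σ''-other i q) (upd-other σ (suc u) a i (<⇒≢ (m<n⇒m<1+n p))))
          (trans (upd-same σ' v _) (cong (_∸ 1) σ'v)) (λ i p q → γ'''-other i (<⇒≤ p) q) l
        restore : ∀ i → upd σ'' (suc u) (suc (σ'' (suc u))) i ≡ upd σ v (σ v ∸ 1) i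
        restore i with i ≟ suc u
        ... | yes refl = trans (cong suc σ''u+1) (sym (trans (upd-other σ v _ (suc u) u+1≢v) (r .right)))
        ... | no ¬p with i ≟ v
        ...   | yes refl = cong (_∸ 1) σ'v
        ...   | no ¬q = upd-other σ (suc u) a i ¬p
        -- Expansion in the auxiliary root (u + 1, a). The unwanted term has a weight to which the
        -- ladder below v applies once more; since row v has moved, that ladder is now blocked, and
        -- the term is zero.
        cleanup : ∀ m → H σ'' γ'' m ≡ H (upd σ v (σ v ∸ 1)) (raiseW (v , suc a) γ) m
        cleanup m = begin
          H σ'' γ'' m
            ≡⟨ H-expand σ'' (suc u) (subst (suc u <_) (sym σ''u+1) (r .below)) (subst (_< ℓ) (sym σ''u+1) a<ℓ) γ'' m ⟩
          H (upd σ'' (suc u) (suc (σ'' (suc u)))) γ'' m ℤ.+ sh (H σ'' γ''') m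
            ≡⟨ cong₂ ℤ._+_ (trans (H-roots restore γ'' m) (H-ext (upd σ v (σ v ∸ 1)) γ''≗ m)) (sh-zero (H-blocked blocked-start blocked) m) ⟩
          H (upd σ v (σ v ∸ 1)) (raiseW (v , suc a) γ) m ℤ.+ + 0
            ≡⟨ ℤ.+-identityʳ _ ⟩
          H (upd σ v (σ v ∸ 1)) (raiseW (v , suc a) γ) m ∎

-- Straightening

module Straighten {n : ℕ} {μ : ℕ → ℕ} (Bd : Bounded n μ) (ℓ : ℕ) (finite : ∀ i → ℓ ≤ i → μ i ≡ 0) where
  open Bounded Bd
  open Rows Bd
  open Raising ℓ

  -- `A-low` and `A-up` describe the pairs of rows at which straightening is going to be used: those
  -- starting at row w or later, and those strictly between a row of the runner and the next one
  -- down.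
  module Row {A : ℕ → Set} {ψ : Weight → ℤ} (alt : Alternating A ψ) {w y : ℕ} {rs : List ℕ} (U : Ups w y rs) (pos : 1 ≤ μ w)
             (A-low : ∀ i → w ≤ i → A i) (A-up : ∀ {r} → r ∈ rs → ∀ i → r ≤ i → suc i < down r → A i) where
    open Catalan alt

    y≤w : y ≤ w
    y≤w = ups-≥ U (ups-head U)

    weight : ℕ → Weight
    weight x i = + μ i ℤ.- + win w (suc x) i ℤ.+ + win (suc y) x (down i)

    -- The roots are those of Δ^k of the current weight: the first root of row i is in column i + n
    -- - weight i. A stage changes the weight in two rows, the row v that gains a box and row w + x
    -- + 1 that loses one, and σ has to follow in both.
    record Coupled (σ : ℕ → ℕ) (x : ℕ) : Set where
      field
        room   : w + suc x ≤ down w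
        couple : ∀ i → + σ i ℤ.+ weight x i ≡ + (i + n)

      private
        value : ∀ {b c} i → win w (suc x) i ≡ b → win (suc y) x (down i) ≡ c → σ i + c ≡ down i + b
        value {b} {c} i e e' = lia 6 0 (λ s d m i b c → s :+ m :+ c := i :+ b ⇒ d :+ m := i ⇒ s :+ c := d :+ b) (σ i) (down i) (μ i) (i + n) b c
          (ℤ.+-injective (lia 6 1 (λ s d m i b c v → ↑ s :+ v := ↑ i ⇒ v := ↑ m :- ↑ b :+ ↑ c ⇒ ↑ (s :+ m :+ c) := ↑ (i :+ b))
            (σ i) (down i) (μ i) (i + n) b c (weight x i) (couple i) (cong₂ (λ b c → + μ i ℤ.- + b ℤ.+ + c) e e'))) (down-μ i)

      σ-block : ∀ i → w ≤ i → i < w + suc x → σ i ≡ suc (down i)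
      σ-block i p q = lia 2 0 (λ s d → s :+ ♯ 0 := d :+ ♯ 1 ⇒ s := ♯ 1 :+ d) (σ i) (down i)
        (value i (win-in w (suc x) i p q) (win-above (suc y) x (down i)
          (lia 5 0 (λ w x y dw di → y :≤ w ⇒ w :+ (♯ 1 :+ x) :≤ dw ⇒ dw :≤ di ⇒ ♯ 1 :+ y :+ x :≤ di) w x y (down w) (down i) y≤w room (down-mono-≤ p))))

      σ-free : ∀ i → i < w → (down i ≤ y ⊎ suc (y + x) ≤ down i) → σ i ≡ down i
      σ-free i p (inj₁ q) = lia 2 0 (λ s d → s :+ ♯ 0 := d :+ ♯ 0 ⇒ s := d) (σ i) (down i)
        (value i (win-below w (suc x) i p) (win-below (suc y) x (down i) (s≤s q)))
      σ-free i p (inj₂ q) = lia 2 0 (λ s d → s :+ ♯ 0 := d :+ ♯ 0 ⇒ s := d) (σ i) (down i)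
        (value i (win-below w (suc x) i p) (win-above (suc y) x (down i) q))

      σ-low : ∀ i → w + suc x ≤ i → σ i ≡ down i
      σ-low i p = lia 2 0 (λ s d → s :+ ♯ 0 := d :+ ♯ 0 ⇒ s := d) (σ i) (down i)
        (value i (win-above w (suc x) i p) (win-above (suc y) x (down i)
          (lia 6 0 (λ w x y i dw di → y :≤ w ⇒ w :+ (♯ 1 :+ x) :≤ i ⇒ i :< di ⇒ ♯ 1 :+ y :+ x :≤ di) w x y i (down w) (down i) y≤w p (down-above i))))

      σ-level : ∀ r → y ≤ r → r ≤ w → ∀ i → i < r + x → σ i ≡ suc (r + x) → i < w × down i ≡ suc (r + x)
      σ-level r y≤r r≤w i p e with w ≤? i
      ... | yes w≤i = ⊥-elim (lia 6 0 (λ w x r dw di s → w :+ (♯ 1 :+ x) :≤ dw ⇒ r :≤ w ⇒ dw :≤ di ⇒ s := ♯ 1 :+ di ⇒ s := ♯ 1 :+ (r :+ x) ⇒ :⊥)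
            w x r (down w) (down i) (σ i) room r≤w (down-mono-≤ w≤i)
            (σ-block i w≤i (lia 4 0 (λ w x r i → i :< r :+ x ⇒ r :≤ w ⇒ i :< w :+ (♯ 1 :+ x)) w x r i p r≤w)) e)
      ... | no ¬q with win (suc y) x (down i) in eq | winView (suc y) x (down i)
      ...   | _ | before q = ≰⇒> ¬q , trans (sym (σ-free i (≰⇒> ¬q) (inj₁ (≤-pred q)))) e
      ...   | _ | after q = ≰⇒> ¬q , trans (sym (σ-free i (≰⇒> ¬q) (inj₂ q))) e
      ...   | _ | within q q' = ⊥-elim (lia 5 0 (λ s d y x r → s :+ ♯ 1 := d :+ ♯ 0 ⇒ d :< ♯ 1 :+ y :+ x ⇒ y :≤ r ⇒ s := ♯ 1 :+ (r :+ x) ⇒ :⊥)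
            (σ i) (down i) y x r (value i (win-below w (suc x) i (≰⇒> ¬q)) eq) q' y≤r e)

    module _ {σ : ℕ → ℕ} {x : ℕ} (C : Coupled σ x) (P : Pre w y rs (suc x)) (flat : ∀ {r} → r ∈ rs → ∀ s → s ≤ x → μ (r + s) ≡ μ r) (μw : μ (w + suc x) ≡ μ w) where
      open Coupled C

      ν : Weight
      ν = weight x

      weight-free : ∀ i → i < w → suc (y + x) ≤ down i → ν i ≡ + μ i
      weight-free i p q = lia 1 3 (λ m v a b → v := ↑ m :- a :+ b ⇒ a := ♯ 0 ⇒ b := ♯ 0 ⇒ v := ↑ m) (μ i) (ν i) (+ win w (suc x) i) (+ win (suc y) x (down i))
        refl (cong +_ (win-below w (suc x) i p)) (cong +_ (win-above (suc y) x (down i) q))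

      private
        rung-flat : ∀ {u r} → down u ≡ r → down (u + suc x) ≡ r + suc x → μ (u + suc x) ≡ μ u
        rung-flat {u} e f = flat-down u (suc x) (trans f (cong (_+ suc x) (sym e)))

        rung-room : ∀ {u r} → u ∈ rs → down u ≡ r → r + suc (suc x) ≤ down r → down (u + suc x) ≡ r + suc x → u + suc (suc x) ≤ down u
        rung-room {u} u∈ e rm f = room-step e flat-or rm
          where
            flat-or : ∀ s → s < suc (suc x) → μ (u + s) ≡ μ u
            flat-or s p with m≤n⇒m<n∨m≡n (≤-pred p)
            ... | inj₁ s≤x  = flat u∈ s (≤-pred s≤x)
            ... | inj₂ refl = rung-flat e f

        rung : ∀ {u r} → u ∈ rs → r ∈ rs → down u ≡ r → u + suc (suc x) ≤ down u → down (u + suc x) ≡ r + suc x → Rung σ ν (r + x) (u + x)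
        rung {u} {r} u∈ r∈ e rm f = record
          { below  = ≤-trans u+x+1<r (m≤m+n r x)
          ; left   = trans (σ-free (u + x) (<-trans (n<1+n _) u+x+1<w) (inj₂ (subst (suc (y + x) ≤_) (sym du+x) free))) du+x
          ; right  = trans (σ-free (suc (u + x)) u+x+1<w (inj₂ (subst (suc (y + x) ≤_) (sym du+x+1) (m≤n⇒m≤1+n free)))) du+x+1
          ; level  = trans (weight-free (suc (u + x)) u+x+1<w (subst (suc (y + x) ≤_) (sym du+x+1) (m≤n⇒m≤1+n free)))
              (trans (cong +_ (trans (cong μ (sym (+-suc u x))) (trans (rung-flat e f) (sym (flat u∈ x ≤-refl)))))
                (sym (weight-free (u + x) (<-trans (n<1+n _) u+x+1<w) (subst (suc (y + x) ≤_) (sym du+x) free))))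
          ; unique = λ i p e' → down-injective (trans (proj₂ (σ-level r (ups-≥ U r∈) (ups-≤ U r∈) i p e')) (sym du+x+1))
          ; alt-u  = A-up u∈ (u + x) (m≤m+n u x) (subst (suc (u + x) <_) (sym e) u+x+1<r)
          }
          where
            u+x+1<r : suc (u + x) < r
            u+x+1<r = lia 4 0 (λ u x r du → u :+ (♯ 2 :+ x) :≤ du ⇒ du := r ⇒ ♯ 1 :+ (u :+ x) :< r) u x r (down u) rm e
            u+x+1<w : suc (u + x) < w
            u+x+1<w = <-≤-trans u+x+1<r (ups-≤ U r∈)
            du+x : down (u + x) ≡ r + x
            du+x = trans (down-flat u x (flat u∈ x ≤-refl)) (cong (_+ x) e)
            du+x+1 : down (suc (u + x)) ≡ suc (r + x)
            du+x+1 = trans (cong down (sym (+-suc u x))) (trans f (+-suc r x))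
            free : suc (y + x) ≤ r + x
            free = +-monoˡ-≤ x (≤-trans (s≤s (ups-≥ U u∈)) (subst (u <_) e (down-above u)))

      data Climb (r : ℕ) (rs' : List ℕ) : Set where
        success : ∀ v → down v ≡ suc (y + x) → (∀ {r'} → r' ∈ rs' → μ (r' + suc x) ≡ μ r') → LadderTo v σ ν (r + x) (length rs') → Climb r rs'
        failure : ∀ {c} → (Pre w y rs (suc (suc x)) → ⊥) → Ladder σ ν (r + x) c → Climb r rs'

      -- The ladder follows the runner: the rung over row r + x is the pair u + x, u + x + 1, where
      -- `down u` is r. It meets a ceiling where `Pre` for one more row fails, either because the
      -- block of u does not extend flatly or because no row points to y + x + 1.
      climb : ∀ {r rs'} → Ups r y rs' → (∀ {r'} → r' ∈ rs' → r' ∈ rs) → r + suc (suc x) ≤ down r → μ (r + suc x) ≡ μ r → Climb r rs'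
      climb {r} (last h) sub rm fl with down⁻¹ (suc (y + x))
      ... | inj₂ no-row = failure {c = 0} (λ P → let (v , e) = Pre.tops P (suc x) (s≤s z≤n) ≤-refl in no-row v (trans e (+-suc y x)))
              (stop (λ i p e → no-row i (proj₂ (σ-level r (ups-≥ U (sub (here refl))) (ups-≤ U (sub (here refl))) i p e))))
      ... | inj₁ (v , e) = success v e (λ { (here refl) → fl }) (top (≤-trans v<y (m≤m+n y x))
              (trans (σ-free v (<-≤-trans v<y y≤w) (inj₂ (≤-reflexive (sym e)))) e)
              (λ i p e' → down-injective (trans (proj₂ (σ-level r ≤-refl y≤w i p e')) (sym e))))
        where
          v<y : v < y
          v<y = down-reflects (lia 4 0 (λ dv dy y x → dv := ♯ 1 :+ (y :+ x) ⇒ y :+ (♯ 2 :+ x) :≤ dy ⇒ dv :< dy) (down v) (down y) y x e rm)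
      climb {r} {rs'} (up {u = u} {rs = rs''} e q) sub rm fl with down (u + suc x) ≟ r + suc x
      ... | no ¬f = failure {c = 0} (λ P → ¬f (trans (down-flat u (suc x) (Pre.flat P (sub (there (ups-head q))) (suc x) ≤-refl)) (cong (_+ suc x) e)))
              (stop (λ i p e' → ¬f (squeeze i (proj₂ (σ-level r (ups-≥ U (sub (here refl))) (ups-≤ U (sub (here refl))) i p e')))))
        where
          -- `down` increases strictly and takes the value r + x at u + x; if it takes the value r +
          -- x + 1 anywhere, it does so at u + x + 1.
          squeeze : ∀ i → down i ≡ suc (r + x) → down (u + suc x) ≡ r + suc x
          squeeze i ei = ≤-antisym (subst (down (u + suc x) ≤_) (trans ei (sym (+-suc r x))) (down-mono-≤ u+≤i)) (≤-trans (≤-reflexive (+-suc r x)) at-least)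
            where
              du+x : down (u + x) ≡ r + x
              du+x = trans (down-flat u x (flat (sub (there (ups-head q))) x ≤-refl)) (cong (_+ x) e)
              at-least : r + x < down (u + suc x)
              at-least = subst₂ _<_ du+x (cong down (sym (+-suc u x))) (down-suc (u + x))
              u+≤i : u + suc x ≤ i
              u+≤i = ≤-trans (≤-reflexive (+-suc u x)) (down-reflects (subst₂ _<_ (sym du+x) (sym ei) ≤-refl))
      ... | yes f with sub (there (ups-head q))
      ...   | u∈ with climb q (sub ∘ there) (rung-room u∈ e rm f) (rung-flat e f)
      ...     | success v ev fls lad = success v ev (λ { (here refl) → fl ; (there r∈) → fls r∈ }) (step (u + x) (rung u∈ (sub (here refl)) e (rung-room u∈ e rm f) f) lad)
      ...     | failure bad lad = failure bad (step (u + x) (rung u∈ (sub (here refl)) e (rung-room u∈ e rm f) f) lad)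

      private
        a : ℕ
        a = w + x

        a+1≡ : w + suc x ≡ suc a
        a+1≡ = +-suc w x

        down-a : down a ≡ down w + x
        down-a = down-flat w x (flat (ups-head U) x ≤-refl)

        down-a+1 : down (suc a) ≡ suc (down a)
        down-a+1 = trans (cong down (sym a+1≡)) (trans (down-flat w (suc x) μw) (trans (+-suc (down w) x) (cong suc (sym down-a))))

        σa : σ a ≡ suc (down a)
        σa = σ-block a (m≤m+n w x) (≤-reflexive (sym a+1≡))

        σa+1 : σ (suc a) ≡ down (suc a)
        σa+1 = σ-low (suc a) (≤-reflexive a+1≡)

        start : Start σ ν a
        start = record
          { interior = ≰⇒> (λ p → <⇒≱ pos (≤-reflexive (trans (sym μw) (finite (w + suc x) (subst (ℓ ≤_) (sym a+1≡) p)))))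
          ; alt-a  = A-low a (m≤m+n w x)
          ; same   = trans σa (sym (trans σa+1 down-a+1))
          ; wall   = subst (suc a <_) (sym σa) (s≤s (down-above a))
          ; slope  = lia 3 8 (λ m m1 mw v v1 b b1 c c1 z z' → v := ↑ m :- b :+ c ⇒ v1 := ↑ m1 :- b1 :+ c1 ⇒ b := ♯ 1 ⇒ b1 := ♯ 0 ⇒ c := ♯ 0 ⇒ c1 := ♯ 0 ⇒ m := mw ⇒ m1 := mw ⇒ v1 := v :+ ♯ 1)
              (μ a) (μ (suc a)) (μ w) (ν a) (ν (suc a)) (+ win w (suc x) a) (+ win w (suc x) (suc a)) (+ win (suc y) x (down a)) (+ win (suc y) x (down (suc a))) (+ 0) (+ 0)
              refl refl (cong +_ (win-in w (suc x) a (m≤m+n w x) (≤-reflexive (sym a+1≡)))) (cong +_ (win-above w (suc x) (suc a) (≤-reflexive a+1≡)))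
              (cong +_ (win-above (suc y) x (down a) far)) (cong +_ (win-above (suc y) x (down (suc a)) (≤-trans far (<⇒≤ (down-suc a)))))
              (flat (ups-head U) x ≤-refl) (trans (cong μ (sym a+1≡)) μw)
          }
          where
            far : suc (y + x) ≤ down a
            far = lia 4 0 (λ w x y d → y :≤ w ⇒ w :+ x :< d ⇒ ♯ 1 :+ (y :+ x) :≤ d) w x y (down a) y≤w (down-above a)

      -- One stage. If row w + x + 1 is as long as row w was, then after the lowering of row w + x
      -- the two neighbouring weights are in the position of `H-zero` and their first roots lie in
      -- the same column. The ladder then either gives zero or moves one more box, at the cost of
      -- one factor t per row of the runner.
      advance : (Pre w y rs (suc (suc x)) × Σ (ℕ → ℕ) λ σ' → Coupled σ' (suc x) × (∀ m → H σ ν m ≡ shs (length rs) (H σ' (weight (suc x))) m))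
                ⊎ ((Pre w y rs (suc (suc x)) → ⊥) × (∀ m → H σ ν m ≡ + 0))
      advance with w + suc (suc x) ≤? down w
      -- Here `down w` is w + x + 1, and a row with its first root in that column would have the
      -- same `down` as w. So no rung exists, and the value is zero at once.
      ... | no ¬rm = inj₂ ((λ P → ¬rm (Pre.room P)) , H-blocked {c = 0} start (stop (λ i p e →
              let (i<w , di) = σ-level w y≤w ≤-refl i p e in
              <⇒≢ i<w (down-injective (trans di (≤-antisym (≤-trans (≤-reflexive (sym a+1≡)) room) (≤-pred (≤-trans (≰⇒> ¬rm) (≤-reflexive (trans (+-suc w (suc x)) (cong suc a+1≡))))))))))
                )
      ... | yes rm with climb U (λ p → p) rm μw
      ...   | failure bad lad = inj₂ (bad , H-blocked start lad)
      ...   | success v ev fls lad = inj₁ (pre' , σ₂ , coupled , λ m → trans (H-climb start lad m) (shs-cong (length rs) remove m))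
        where
          v<w : v < w
          v<w = down-reflects (lia 5 0 (λ dv dw y w x → dv := ♯ 1 :+ (y :+ x) ⇒ y :≤ w ⇒ w :+ (♯ 2 :+ x) :≤ dw ⇒ dv :< dw) (down v) (down w) y w x ev y≤w rm)
          v≢a+1 : v ≢ suc a
          v≢a+1 e = <⇒≱ v<w (subst (w ≤_) (sym e) (m≤n⇒m≤1+n (m≤m+n w x)))
          σv : σ v ≡ down v
          σv = σ-free v v<w (inj₂ (≤-reflexive (sym ev)))
          σ₁ σ₂ : ℕ → ℕ
          σ₁ = upd σ v (σ v ∸ 1)
          σ₂ = upd σ₁ (suc a) (suc (σ₁ (suc a)))
          σ₁a+1 : σ₁ (suc a) ≡ σ (suc a)
          σ₁a+1 = upd-other σ v _ (suc a) (v≢a+1 ∘ sym)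
          γ₁ : Weight
          γ₁ = raiseW (v , suc a) ν
          tops' : ∀ s → 1 ≤ s → s < suc (suc x) → Pre w y rs (suc x) → ∃ λ v → down v ≡ y + s
          tops' s p q P with m≤n⇒m<n∨m≡n (≤-pred q)
          ... | inj₁ q'   = Pre.tops P s p q'
          ... | inj₂ refl = v , trans ev (sym (+-suc y x))
          pre' : Pre w y rs (suc (suc x))
          pre' = record { flat = flat' ; room = rm ; tops = λ s p q → tops' s p q P }
            where
              flat' : ∀ {r} → r ∈ rs → ∀ s → s < suc (suc x) → μ (r + s) ≡ μ r
              flat' r∈ s p with m≤n⇒m<n∨m≡n (≤-pred p)
              ... | inj₁ q    = flat r∈ s (≤-pred q)
              ... | inj₂ refl = fls r∈
          win-ε : ∀ s h i → + win s (suc h) i ≡ + win s h i ℤ.+ ε (s + h) i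
          win-ε s h i with i ≟ s + h
          ... | yes refl = trans (cong +_ (win-suc-same s h)) (sym (cong₂ ℤ._+_ (cong +_ (win-above s h (s + h) ≤-refl)) (ε-diag (s + h))))
          ... | no ¬p = trans (cong +_ (win-suc-other s h i ¬p)) (trans (sym (ℤ.+-identityʳ _)) (cong (ℤ._+_ (+ win s h i)) (sym (ε-off (s + h) i (¬p ∘ sym)))))
          ε-v : ∀ i → ε (suc y + x) (down i) ≡ ε v i
          ε-v i with v ≟ i
          ... | yes refl = trans (cong (ε (suc y + x)) ev) (trans (ε-diag (suc y + x)) (sym (ε-diag v)))
          ... | no ¬p = trans (ε-off (suc y + x) (down i) (λ e → ¬p (down-injective (trans ev e)))) (sym (ε-off v i ¬p))
          weight-suc : ∀ i → γ₁ i ≡ weight (suc x) i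
          weight-suc i = lia 1 6 (λ m a b e e' a' b' → a' := a :+ e' ⇒ b' := b :+ e ⇒ (↑ m :- a :+ b) :+ e :- e' := ↑ m :- a' :+ b')
            (μ i) (+ win w (suc x) i) (+ win (suc y) x (down i)) (ε v i) (ε (suc a) i) (+ win w (suc (suc x)) i) (+ win (suc y) (suc x) (down i))
            (trans (win-ε w (suc x) i) (cong (λ j → + win w (suc x) i ℤ.+ ε j i) a+1≡)) (trans (win-ε (suc y) x (down i)) (cong (ℤ._+_ (+ win (suc y) x (down i))) (ε-v i)))
          σ₂-value : ∀ i → + σ₂ i ≡ + σ i ℤ.- ε v i ℤ.+ ε (suc a) i
          σ₂-value i with i ≟ suc a
          ... | yes refl = lia 2 2 (λ s s' e e' → s' := s ⇒ e := ♯ 0 ⇒ e' := ♯ 1 ⇒ ↑ (♯ 1 :+ s') := ↑ s :- e :+ e') (σ (suc a)) (σ₁ (suc a)) (ε v (suc a)) (ε (suc a) (suc a))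
                σ₁a+1 (ε-off v (suc a) v≢a+1) (ε-diag (suc a))
          ... | no ¬p with i ≟ v
          ...   | yes refl = lia 2 2 (λ s s' e e' → s := ♯ 1 :+ s' ⇒ e := ♯ 1 ⇒ e' := ♯ 0 ⇒ ↑ s' := ↑ s :- e :+ e') (σ i) (σ i ∸ 1) (ε i i) (ε (suc a) i)
                (sym (m+[n∸m]≡n (subst (1 ≤_) (sym (trans σv ev)) (s≤s z≤n)))) (ε-diag i) (ε-off (suc a) i (¬p ∘ sym))
          ...   | no ¬q = lia 1 2 (λ s e e' → e := ♯ 0 ⇒ e' := ♯ 0 ⇒ ↑ s := ↑ s :- e :+ e') (σ i) (ε v i) (ε (suc a) i) (ε-off v i (¬q ∘ sym)) (ε-off (suc a) i (¬p ∘ sym))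
          coupled : Coupled σ₂ (suc x)
          coupled = record { room = rm ; couple = λ i → lia 2 6 (λ s N s₂ v e e' v' z → s₂ := ↑ s :- e :+ e' ⇒ v :+ e :- e' := v' ⇒ ↑ s :+ v := ↑ N ⇒ s₂ :+ v' := ↑ N)
            (σ i) (i + n) (+ σ₂ i) (ν i) (ε v i) (ε (suc a) i) (weight (suc x) i) (+ 0) (σ₂-value i) (weight-suc i) (couple i) }
          -- The weight of row w + x + 1 has dropped by one, so its first root must go if the roots
          -- are to match the weight again. The other term of the expansion is a blocked ladder; if
          -- the column of that root is at least ℓ, the two root sets already agree.
          remove : ∀ m → H σ₁ γ₁ m ≡ H σ₂ (weight (suc x)) m
          remove m with σ₁ (suc a) <? ℓ
          ... | yes p = trans (H-expand σ₁ (suc a) (subst (suc a <_) (sym (trans σ₁a+1 σa+1)) (down-above (suc a))) p γ₁ m)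
                  (trans (cong₂ ℤ._+_ (H-ext σ₂ weight-suc m) (sh-zero (H-blocked start' block) m)) (ℤ.+-identityʳ _))
            where
              γ₂ : Weight
              γ₂ = raiseW (suc a , σ₁ (suc a)) γ₁
              a+1≢ : suc a ≢ σ₁ (suc a)
              a+1≢ e = <⇒≢ (down-above (suc a)) (trans e (trans σ₁a+1 σa+1))
              v<a : v < a
              v<a = <-≤-trans v<w (m≤m+n w x)
              off : ∀ i → i ≤ a → i ≢ v → γ₂ i ≡ ν i
              off i q r = trans (raiseW-other (suc a) (σ₁ (suc a)) γ₁ i (<⇒≢ (s≤s q)) (<⇒≢ (<-trans (s≤s q) (subst (suc a <_) (sym (trans σ₁a+1 σa+1)) (down-above (suc a))))))
                (raiseW-other v (suc a) ν i r (<⇒≢ (s≤s q)))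
              start' : Start σ₁ γ₂ a
              start' = record
                { interior = Start.interior start
                ; alt-a  = Start.alt-a start
                ; same   = trans (upd-other σ v _ a (>⇒≢ v<a)) (trans (Start.same start) (sym σ₁a+1))
                ; wall   = subst (suc a <_) (sym (upd-other σ v _ a (>⇒≢ v<a))) (Start.wall start)
                ; slope  = trans (lia 0 6 (λ g2 g1 e e' v' va → g2 := g1 :+ ♯ 1 ⇒ g1 := v' :+ e :- e' ⇒ e := ♯ 0 ⇒ e' := ♯ 1 ⇒ v' := va :+ ♯ 1 ⇒ g2 := va :+ ♯ 1)
                    (γ₂ (suc a)) (γ₁ (suc a)) (ε v (suc a)) (ε (suc a) (suc a)) (ν (suc a)) (ν a)
                    (raiseW-up (suc a) (σ₁ (suc a)) γ₁ a+1≢) refl (ε-off v (suc a) v≢a+1) (ε-diag (suc a)) (Start.slope start))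
                    (cong (ℤ._+ + 1) (sym (off a ≤-refl (>⇒≢ v<a))))
                }
              block : Ladder σ₁ γ₂ a (length rs)
              block = ladderTo-block (λ i q r → upd-other σ v _ i r) (upd-same σ v _) (λ i q r → off i (<⇒≤ q) r) lad
          ... | no ¬p = trans (H-ext σ₁ weight-suc m) (Hl-perm (roots-cong {σ₁} {σ₂} f g) (weight (suc x)) m)
            where
              f : ∀ i j → IsRoot σ₁ i j → IsRoot σ₂ i j
              f i j (p , q , r) with i ≟ suc a
              ... | yes refl = ⊥-elim (¬p (≤-<-trans r q))
              ... | no _ = p , q , r
              g : ∀ i j → IsRoot σ₂ i j → IsRoot σ₁ i j
              g i j (p , q , r) with i ≟ suc a
              ... | yes refl = p , q , <⇒≤ r
              ... | no _ = p , q , r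

    shs-+ : ∀ c d (f : Series) m → shs (c + d) f m ≡ shs c (shs d f) m
    shs-+ zero    d f m = refl
    shs-+ (suc c) d f m = sh-cong (shs-+ c d f) m

    shs-zero : ∀ c {f : Series} → (∀ m → f m ≡ + 0) → ∀ m → shs c f m ≡ + 0
    shs-zero zero    h m = h m
    shs-zero (suc c) h m = sh-zero (shs-zero c h) m

    newH : ℕ → Series
    newH x = H (λ i → i + (n ∸ newμ w y x i)) (λ i → + newμ w y x i)

    data Outcome (x : ℕ) (S : Series) : Set where
      good : ∀ j → Pre w y rs (suc (j + x)) → μ (w + suc (j + x)) < μ w → (∀ m → S m ≡ shs (length rs * j) (newH (j + x)) m) → Outcome x S
      bad  : (Good w → ⊥) → (∀ m → S m ≡ + 0) → Outcome x S

    finish : ∀ {σ x} → Coupled σ x → Pre w y rs (suc x) → ∀ m → H σ (weight x) m ≡ newH x m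
    finish {σ} {x} C P m = trans (H-roots σ≗ (weight x) m) (H-ext _ weight≗ m)
      where
        open Coupled C
        covered : ∀ i → win w (suc x) i ≤ μ i + win (suc y) x (down i)
        covered i with win w (suc x) i | winView w (suc x) i
        ... | _ | before _ = z≤n
        ... | _ | after _ = z≤n
        ... | _ | within p q = ≤-trans pos (≤-trans (≤-reflexive (sym μi)) (m≤m+n (μ i) _))
          where
            μi : μ i ≡ μ w
            μi = trans (cong μ (sym (m+[n∸m]≡n p))) (Pre.flat P (ups-head U) (i ∸ w)
              (lia 4 0 (λ w i x k → w :+ k := i ⇒ i :< w :+ (♯ 1 :+ x) ⇒ k :< ♯ 1 :+ x) w i x (i ∸ w) (m+[n∸m]≡n p) q))
        new : ∀ i → newμ w y x i + win w (suc x) i ≡ μ i + win (suc y) x (down i)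
        new i = m∸n+n≡m (covered i)
        weight≗ : ∀ i → weight x i ≡ + newμ w y x i
        weight≗ i = lia 4 0 (λ a b m c → c :+ a := m :+ b ⇒ ↑ m :- ↑ a :+ ↑ b := ↑ c) (win w (suc x) i) (win (suc y) x (down i)) (μ i) (newμ w y x i) (new i)
        win≤1 : ∀ s h i → win s h i ≤ 1
        win≤1 s h i with win s h i | winView s h i
        ... | _ | before _ = z≤n
        ... | _ | after _ = z≤n
        ... | _ | within _ _ = ≤-refl
        new≤n : ∀ i → newμ w y x i ≤ n
        new≤n i = lia 5 0 (λ a b m c n → c :+ a := m :+ b ⇒ b :≤ ♯ 1 ⇒ m :< n ⇒ c :≤ n) (win w (suc x) i) (win (suc y) x (down i)) (μ i) (newμ w y x i) n (new i) (win≤1 (suc y) x (down i)) (ceiling i)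
        σ≗ : ∀ i → σ i ≡ i + (n ∸ newμ w y x i)
        σ≗ i = lia 5 0 (λ s c i n k → s :+ c := i :+ n ⇒ c :+ k := n ⇒ s := i :+ k) (σ i) (newμ w y x i) i n (n ∸ newμ w y x i)
          (ℤ.+-injective (trans (cong (ℤ._+_ (+ σ i)) (sym (weight≗ i))) (couple i))) (m+[n∸m]≡n (new≤n i))

    -- f bounds the number of remaining stages: each raises x, while `room` keeps w + x + 1 at most
    -- `down w`.
    run-stages : ∀ f {σ x} → down w ≤ w + x + f → Coupled σ x → Pre w y rs (suc x) → Outcome x (H σ (weight x))
    run-stages f {σ} {x} fuel C P with μ (w + suc x) <? μ w
    ... | yes d = good 0 P d (λ m → trans (finish C P m) (cong (λ c → shs c (newH x) m) (sym (*-zeroʳ (length rs)))))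
    ... | no ¬d with advance C P (λ r∈ s p → Pre.flat P r∈ s (s≤s p)) (≤-antisym (μ-antitone w (suc x)) (≮⇒≥ ¬d))
    ...   | inj₂ (¬P , z) = bad (λ G → ¬P (good-pre U eq G)) z
      where
        eq : ∀ s → s ≤ suc x → μ (w + s) ≡ μ w
        eq s p with m≤n⇒m<n∨m≡n p
        ... | inj₁ q    = Pre.flat P (ups-head U) s q
        ... | inj₂ refl = ≤-antisym (μ-antitone w (suc x)) (≮⇒≥ ¬d)
    run-stages zero {σ} {x} fuel C P | no ¬d | inj₁ (P' , _) =
      ⊥-elim (lia 3 0 (λ w x d → d :≤ w :+ x :+ ♯ 0 ⇒ w :+ (♯ 2 :+ x) :≤ d ⇒ :⊥) w x (down w) fuel (Pre.room P'))
    run-stages (suc f) {σ} {x} fuel C P | no ¬d | inj₁ (P' , σ' , C' , eq)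
      with run-stages f {σ'} {suc x} (subst (down w ≤_) (lia 3 0 (λ w x f → w :+ x :+ (♯ 1 :+ f) := w :+ (♯ 1 :+ x) :+ f) w x f) fuel) C' P'
    ... | bad ¬G z = bad ¬G (λ m → trans (eq m) (shs-zero (length rs) z m))
    ... | good j Pj dj eqj = good (suc j) (subst (λ t → Pre w y rs (suc t)) (+-suc j x) Pj) (subst (λ t → μ (w + suc t) < μ w) (+-suc j x) dj)
          (λ m → trans (eq m) (trans (shs-cong (length rs) eqj m) (trans (sym (shs-+ (length rs) (length rs * j) (newH (j + suc x)) m))
            (cong₂ (λ c t → shs c (newH t) m) (sym (*-suc (length rs) j)) (+-suc j x)))))

    -- The weight lowered in row w, with the root (w, `down w`) removed: these are the roots of Δ^k
    -- for the lowered weight, so this is the coupled situation with x = 0.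
    stripped : Series
    stripped = H (upd down w (suc (down w))) (lower w (λ i → + μ i))

    data Result (S : Series) : Set where
      good : ∀ x → Pre w y rs (suc x) → μ (w + suc x) < μ w → (∀ m → S m ≡ shs (length rs * x) (newH x) m) → Result S
      bad  : (Good w → ⊥) → (∀ m → S m ≡ + 0) → Result S

    evaluate : Result stripped
    evaluate = transport (run-stages (down w) {σ₀} {0} (lia 2 0 (λ w d → d :≤ w :+ ♯ 0 :+ d) w (down w)) C₀ P₀)
      where
        σ₀ : ℕ → ℕ
        σ₀ = upd down w (suc (down w))
        weight₀ : ∀ i → lower w (λ i → + μ i) i ≡ weight 0 i
        weight₀ i with w ≟ i
        ... | yes refl = lia 1 3 (λ m e a b → e := ♯ 1 ⇒ a := ♯ 1 ⇒ b := ♯ 0 ⇒ ↑ m :- e := ↑ m :- a :+ b) (μ w) (ε w w) (+ win w 1 w) (+ win (suc y) 0 (down w))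
              (ε-diag w) (cong +_ (win-in w 1 w ≤-refl (m<m+n w (s≤s z≤n)))) (cong +_ (win0 (suc y) (down w)))
          where
            win0 : ∀ s i → win s 0 i ≡ 0
            win0 s i with win s 0 i | winView s 0 i
            ... | _ | before _ = refl
            ... | _ | after _ = refl
            ... | _ | within p q = ⊥-elim (<⇒≱ q (≤-trans (≤-reflexive (+-identityʳ s)) p))
        ... | no ¬p = lia 1 3 (λ m e a b → e := ♯ 0 ⇒ a := ♯ 0 ⇒ b := ♯ 0 ⇒ ↑ m :- e := ↑ m :- a :+ b) (μ i) (ε w i) (+ win w 1 i) (+ win (suc y) 0 (down i))
              (ε-off w i ¬p) (cong +_ win1) (cong +_ win0)
          where
            win1 : win w 1 i ≡ 0
            win1 with win w 1 i | winView w 1 i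
            ... | _ | before _ = refl
            ... | _ | after _ = refl
            ... | _ | within p q = ⊥-elim (¬p (≤-antisym p (≤-pred (subst (i <_) (+-comm w 1) q))))
            win0 : win (suc y) 0 (down i) ≡ 0
            win0 with win (suc y) 0 (down i) | winView (suc y) 0 (down i)
            ... | _ | before _ = refl
            ... | _ | after _ = refl
            ... | _ | within p q = ⊥-elim (<⇒≱ q (≤-trans (≤-reflexive (+-identityʳ (suc y))) p))
        C₀ : Coupled σ₀ 0
        C₀ = record { room = ≤-trans (≤-reflexive (+-comm w 1)) (down-above w) ; couple = λ i → trans (cong (ℤ._+_ (+ σ₀ i)) (sym (weight₀ i))) (couple₀ i) }
          where
            couple₀ : ∀ i → + σ₀ i ℤ.+ lower w (λ i → + μ i) i ≡ + (i + n)
            couple₀ i with i ≟ w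
            ... | yes refl = lia 4 1 (λ d m i n e → d :+ m := i :+ n ⇒ e := ♯ 1 ⇒ ↑ (♯ 1 :+ d) :+ (↑ m :- e) := ↑ (i :+ n)) (down i) (μ i) i n (ε i i) (down-μ i) (ε-diag i)
            ... | no ¬p = lia 4 1 (λ d m i n e → d :+ m := i :+ n ⇒ e := ♯ 0 ⇒ ↑ d :+ (↑ m :- e) := ↑ (i :+ n)) (down i) (μ i) i n (ε w i) (down-μ i) (ε-off w i (¬p ∘ sym))
        P₀ : Pre w y rs 1
        P₀ = record
          { flat = λ { {r} _ zero _ → cong μ (+-identityʳ r) ; _ (suc s) (s≤s ()) }
          ; room = Coupled.room C₀
          ; tops = λ { (suc s) _ (s≤s ()) }
          }
        transport : Outcome 0 (H σ₀ (weight 0)) → Result stripped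
        transport (good j P d eq) rewrite +-identityʳ j = good j P d (λ m → trans (H-ext σ₀ weight₀ m) (eq m))
        transport (bad ¬G z) = bad ¬G (λ m → trans (H-ext σ₀ weight₀ m) (z m))

-- Tail sums under raising, and functionals lowered in an initial segment of rows

tailSum-+ : ∀ (γ γ' : Weight) j r → tailSum (λ i → γ i ℤ.+ γ' i) j r ≡ tailSum γ j r ℤ.+ tailSum γ' j r
tailSum-+ γ γ' j zero    = refl
tailSum-+ γ γ' j (suc r) = lia 0 5 (λ a b c d e → e := c :+ d ⇒ a :+ b :+ e := (a :+ c) :+ (b :+ d)) (γ j) (γ' j) (tailSum γ (suc j) r) (tailSum γ' (suc j) r) _ (tailSum-+ γ γ' (suc j) r)

tailSum-neg : ∀ (γ : Weight) j r → tailSum (λ i → ℤ.- γ i) j r ≡ ℤ.- tailSum γ j r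
tailSum-neg γ j zero    = refl
tailSum-neg γ j (suc r) = trans (cong (ℤ._+_ (ℤ.- γ j)) (tailSum-neg γ (suc j) r)) (sym (ℤ.neg-distrib-+ (γ j) (tailSum γ (suc j) r)))

tailSum-ε-out : ∀ i j r → i < j → tailSum (ε i) j r ≡ + 0
tailSum-ε-out i j zero    p = refl
tailSum-ε-out i j (suc r) p = cong₂ ℤ._+_ (ε-off i j (<⇒≢ p)) (tailSum-ε-out i (suc j) r (m<n⇒m<1+n p))

tailSum-ε-in : ∀ i j r → j ≤ i → i < j + r → tailSum (ε i) j r ≡ + 1
tailSum-ε-in i j zero    p q = ⊥-elim (<⇒≱ q (≤-trans (≤-reflexive (+-identityʳ j)) p))
tailSum-ε-in i j (suc r) p q with m≤n⇒m<n∨m≡n p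
... | inj₁ j<i  = cong₂ ℤ._+_ (ε-off i j (>⇒≢ j<i)) (tailSum-ε-in i (suc j) r j<i (subst (i <_) (+-suc j r) q))
... | inj₂ refl = cong₂ ℤ._+_ (ε-diag i) (tailSum-ε-out i (suc i) r ≤-refl)

tailSum-ε-bounds : ∀ i j r → + 0 ℤ.≤ tailSum (ε i) j r × tailSum (ε i) j r ℤ.≤ + 1
tailSum-ε-bounds i j r with i <? j
... | yes p = subst (λ x → + 0 ℤ.≤ x × x ℤ.≤ + 1) (sym (tailSum-ε-out i j r p)) (ℤ.+≤+ z≤n , ℤ.+≤+ z≤n)
... | no ¬p with i <? j + r
...   | yes q = subst (λ x → + 0 ℤ.≤ x × x ℤ.≤ + 1) (sym (tailSum-ε-in i j r (≮⇒≥ ¬p) q)) (ℤ.+≤+ z≤n , ℤ.+≤+ (s≤s z≤n))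
...   | no ¬q = subst (λ x → + 0 ℤ.≤ x × x ℤ.≤ + 1) (sym (above j r (≮⇒≥ ¬q))) (ℤ.+≤+ z≤n , ℤ.+≤+ z≤n)
  where
    above : ∀ j r → j + r ≤ i → tailSum (ε i) j r ≡ + 0
    above j zero    q = refl
    above j (suc r) q = cong₂ ℤ._+_ (ε-off i j (>⇒≢ (<-≤-trans (m<m+n j (s≤s z≤n)) q))) (above (suc j) r (subst (_≤ i) (+-suc j r) q))

tailSum-raise : ∀ i k γ j r → tailSum (raiseW (i , k) γ) j r ≡ tailSum γ j r ℤ.+ tailSum (ε i) j r ℤ.- tailSum (ε k) j r
tailSum-raise i k γ j r = trans (tailSum-+ (λ l → γ l ℤ.+ ε i l) (λ l → ℤ.- ε k l) j r) (cong₂ ℤ._+_ (tailSum-+ γ (ε i) j r) (tailSum-neg (ε k) j r))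

tailSum-lower : ∀ i γ j r → tailSum (lower i γ) j r ≡ tailSum γ j r ℤ.- tailSum (ε i) j r
tailSum-lower i γ j r = trans (tailSum-+ γ (λ l → ℤ.- ε i l) j r) (cong (ℤ._+_ (tailSum γ j r)) (tailSum-neg (ε i) j r))

-- A root moves a unit from a lower row to a higher one. A tail that contains i also contains k, so
-- no tail sum increases, and all terms in the expansion of a weight with a negative tail vanish
-- together.
raise-tail : ∀ i k γ j r → i < k → k < j + r → tailSum γ j r ℤ.< + 0 → tailSum (raiseW (i , k) γ) j r ℤ.< + 0
raise-tail i k γ j r i<k k< t with j ≤? k
... | yes p = lia 0 4 (λ x y a b → x := y :+ a :- b ⇒ y :< ♯ 0 ⇒ a :≤ ♯ 1 ⇒ b := ♯ 1 ⇒ x :< ♯ 0) _ (tailSum γ j r) (tailSum (ε i) j r) (tailSum (ε k) j r)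
      (tailSum-raise i k γ j r) t (proj₂ (tailSum-ε-bounds i j r)) (tailSum-ε-in k j r p k<)
... | no ¬p = lia 0 4 (λ x y a b → x := y :+ a :- b ⇒ y :< ♯ 0 ⇒ a := ♯ 0 ⇒ ♯ 0 :≤ b ⇒ x :< ♯ 0) _ (tailSum γ j r) (tailSum (ε i) j r) (tailSum (ε k) j r)
      (tailSum-raise i k γ j r) t (tailSum-ε-out i j r (<-trans i<k (≰⇒> ¬p))) (proj₁ (tailSum-ε-bounds k j r))

lower-tail : ∀ i γ j r → tailSum γ j r ℤ.< + 0 → tailSum (lower i γ) j r ℤ.< + 0
lower-tail i γ j r t = lia 0 3 (λ x y a → x := y :- a ⇒ y :< ♯ 0 ⇒ ♯ 0 :≤ a ⇒ x :< ♯ 0) _ (tailSum γ j r) (tailSum (ε i) j r) (tailSum-lower i γ j r) t (proj₁ (tailSum-ε-bounds i j r))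

-- sub d z φ γ = Σ φ(γ - ε_S) over the d-element subsets S of [0, z).
sub : ℕ → ℕ → (Weight → ℤ) → Weight → ℤ
sub zero    z       φ γ = φ γ
sub (suc d) zero    φ γ = + 0
sub (suc d) (suc z) φ γ = sub (suc d) z φ γ ℤ.+ sub d z φ (lower z γ)

sub-ext : ∀ {φ : Weight → ℤ} → (∀ {γ γ'} → (∀ i → γ i ≡ γ' i) → φ γ ≡ φ γ') → ∀ d z {γ γ'} → (∀ i → γ i ≡ γ' i) → sub d z φ γ ≡ sub d z φ γ'
sub-ext e zero    z       h = e h
sub-ext e (suc d) zero    h = refl
sub-ext e (suc d) (suc z) h = cong₂ ℤ._+_ (sub-ext e (suc d) z h) (sub-ext e d z (λ i → cong (ℤ._- ε z i) (h i)))

lower-comm : ∀ i j γ k → lower i (lower j γ) k ≡ lower j (lower i γ) k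
lower-comm i j γ k = lia 0 3 (λ g a b → g :- a :- b := g :- b :- a) (γ k) (ε j k) (ε i k)

opE-ext : ∀ {φ : Weight → ℤ} → (∀ {γ γ'} → (∀ i → γ i ≡ γ' i) → φ γ ≡ φ γ') → ∀ d s n {γ γ'} → (∀ i → γ i ≡ γ' i) → opE d s n φ γ ≡ opE d s n φ γ'
opE-ext e zero    s n       h = e h
opE-ext e (suc d) s zero    h = refl
opE-ext e (suc d) s (suc n) h = cong₂ ℤ._+_ (opE-ext e (suc d) (suc s) n h) (opE-ext e d (suc s) n (λ i → cong (ℤ._- ε s i) (h i)))

opE-last : ∀ {φ : Weight → ℤ} → (∀ {γ γ'} → (∀ i → γ i ≡ γ' i) → φ γ ≡ φ γ') → ∀ d s n γ →
  opE (suc d) s (suc n) φ γ ≡ opE (suc d) s n φ γ ℤ.+ opE d s n φ (lower (s + n) γ)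
opE-last {φ} e zero s zero γ = cong (λ i → + 0 ℤ.+ φ (lower i γ)) (sym (+-identityʳ s))
opE-last e (suc d) s zero γ = refl
opE-last {φ} e zero s (suc n) γ = lia 0 5 (λ a b c a' c' → a' := a :+ c ⇒ c' := c ⇒ a' :+ b := a :+ b :+ c')
  (opE 1 (suc s) n φ γ) (φ (lower s γ)) (φ (lower (suc (s + n)) γ)) (opE 1 (suc s) (suc n) φ γ) (φ (lower (s + suc n) γ))
  (opE-last e zero (suc s) n γ) (cong (λ i → φ (lower i γ)) (+-suc s n))
opE-last {φ} e (suc d) s (suc n) γ = lia 0 8 (λ a b c f a' b' c' f' → a' := a :+ c ⇒ b' := b :+ f ⇒ c' := c ⇒ f' := f ⇒ a' :+ b' := (a :+ b) :+ (c' :+ f'))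
  (opE (suc (suc d)) (suc s) n φ γ) (opE (suc d) (suc s) n φ (lower s γ)) (opE (suc d) (suc s) n φ (lower (suc (s + n)) γ)) (opE d (suc s) n φ (lower (suc (s + n)) (lower s γ)))
  (opE (suc (suc d)) (suc s) (suc n) φ γ) (opE (suc d) (suc s) (suc n) φ (lower s γ)) (opE (suc d) (suc s) n φ (lower (s + suc n) γ)) (opE d (suc s) n φ (lower s (lower (s + suc n) γ)))
  (opE-last e (suc d) (suc s) n γ) (opE-last e d (suc s) n (lower s γ)) (cong (λ i → opE (suc d) (suc s) n φ (lower i γ)) (+-suc s n))
  (opE-ext e d (suc s) n (λ k → trans (lower-comm s (s + suc n) γ k) (cong (λ i → lower i (lower s γ) k) (+-suc s n))))

sub≡opE : ∀ {φ : Weight → ℤ} → (∀ {γ γ'} → (∀ i → γ i ≡ γ' i) → φ γ ≡ φ γ') → ∀ d z γ → opE d 0 z φ γ ≡ sub d z φ γ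
sub≡opE e zero    z       γ = refl
sub≡opE e (suc d) zero    γ = refl
sub≡opE e (suc d) (suc z) γ = trans (opE-last e d 0 z γ) (cong₂ ℤ._+_ (sub≡opE e (suc d) z γ) (sub≡opE e d z (lower z γ)))

swapped-lower : ∀ a i j γ γ' → TrView a i j → Swapped a γ γ' → Swapped a (lower i γ) (lower j γ')
swapped-lower a i j γ γ' v h k = begin
  γ' k ℤ.- ε j k
    ≡⟨ cong (λ x → γ' k ℤ.- ε x k) (trView-functional v (trView a i)) ⟩
  γ' k ℤ.- ε (tr a i) k
    ≡⟨ cong (λ x → γ' k ℤ.- x) (ε-tr a i k) ⟩
  γ' k ℤ.- ε i (tr a k)
    ≡⟨ lia 0 5 (λ g' g x u v → g' := g :+ u :- v ⇒ g' :- x := (g :- x) :+ u :- v) (γ' k) (γ (tr a k)) (ε i (tr a k)) (ε (suc a) k) (ε a k) (h k) ⟩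
  lower i γ (tr a k) ℤ.+ ε (suc a) k ℤ.- ε a k ∎

-- The exchange of a and a + 1 preserves [0, z) unless it contains a but not a + 1, that is, unless
-- z = a + 1. This is the only pair at which the alternation is lost.
sub-anti : ∀ {φ : Weight → ℤ} a → (∀ {γ γ'} → (∀ i → γ i ≡ γ' i) → φ γ ≡ φ γ') → (∀ {γ γ'} → Swapped a γ γ' → φ γ' ≡ ℤ.- φ γ) →
  ∀ d z → suc a ≢ z → ∀ {γ γ'} → Swapped a γ γ' → sub d z φ γ' ≡ ℤ.- sub d z φ γ
sub-anti a e h zero    z       p {γ} {γ'} s = h {γ} {γ'} s
sub-anti a e h (suc d) zero    p s = refl
sub-anti a e h (suc d) (suc z) p {γ} {γ'} s with z ≟ suc a
sub-anti {φ} a e h (suc d) (suc z) p {γ} {γ'} s | no ¬q = trans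
  (cong₂ ℤ._+_ (sub-anti a e h (suc d) z (¬q ∘ sym) {γ} {γ'} s) (sub-anti a e h d z (¬q ∘ sym) {lower z γ} {lower z γ'} (swapped-lower a z z γ γ' (other (p ∘ cong suc ∘ sym) ¬q) s)))
  (sym (ℤ.neg-distrib-+ (sub (suc d) z φ γ) (sub d z φ (lower z γ))))
sub-anti {φ} a e h (suc zero) (suc _) p {γ} {γ'} s | yes refl = lia 0 6 (λ x y z x' y' z' → x' := :- x ⇒ y' := :- z ⇒ z' := :- y ⇒ x' :+ y' :+ z' := :- (x :+ y :+ z))
  (sub 1 a φ γ) (φ (lower a γ)) (φ (lower (suc a) γ)) (sub 1 a φ γ') (φ (lower a γ')) (φ (lower (suc a) γ'))
  (sub-anti a e h 1 a 1+n≢n {γ} {γ'} s) (h {lower (suc a) γ} {lower a γ'} (swapped-lower a (suc a) a γ γ' high s)) (h {lower a γ} {lower (suc a) γ'} (swapped-lower a a (suc a) γ γ' low s))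
sub-anti {φ} a e h (suc (suc d)) (suc _) p {γ} {γ'} s | yes refl = lia 0 8 (λ x y z w x' y' z' w' → x' := :- x ⇒ y' := :- z ⇒ z' := :- y ⇒ w' := :- w ⇒
    x' :+ y' :+ (z' :+ w') := :- (x :+ y :+ (z :+ w)))
  (sub (suc (suc d)) a φ γ) (sub (suc d) a φ (lower a γ)) (sub (suc d) a φ (lower (suc a) γ)) (sub d a φ (lower a (lower (suc a) γ)))
  (sub (suc (suc d)) a φ γ') (sub (suc d) a φ (lower a γ')) (sub (suc d) a φ (lower (suc a) γ')) (sub d a φ (lower a (lower (suc a) γ')))
  (sub-anti a e h (suc (suc d)) a 1+n≢n {γ} {γ'} s) (sub-anti a e h (suc d) a 1+n≢n {lower (suc a) γ} {lower a γ'} (swapped-lower a (suc a) a γ γ' high s))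
  (sub-anti a e h (suc d) a 1+n≢n {lower a γ} {lower (suc a) γ'} (swapped-lower a a (suc a) γ γ' low s))
  (trans (sub-ext e d a (lower-comm a (suc a) γ')) (sub-anti a e h d a 1+n≢n {lower a (lower (suc a) γ)} {lower (suc a) (lower a γ')} (swapped-lower a a (suc a) (lower (suc a) γ) (lower a γ') low (swapped-lower a (suc a) a γ γ' high s))))

sub-tail : ∀ {φ : Weight → ℤ} j r → (∀ γ → tailSum γ j r ℤ.< + 0 → φ γ ≡ + 0) → ∀ d z γ → tailSum γ j r ℤ.< + 0 → sub d z φ γ ≡ + 0
sub-tail j r h zero    z       γ t = h γ t
sub-tail j r h (suc d) zero    γ t = refl
sub-tail j r h (suc d) (suc z) γ t = cong₂ ℤ._+_ (sub-tail j r h (suc d) z γ t) (sub-tail j r h d z (lower z γ) (lower-tail z γ j r t))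

-- Expansion of a function lowered in one row over the good rows

module Vertical (ℓ : ℕ) where
  open Raising ℓ

  Vanishing : (Weight → ℤ) → Set
  Vanishing φ = ∀ j r γ → j + r ≡ ℓ → tailSum γ j r ℤ.< + 0 → φ γ ≡ + 0

  Hl-vanish : ∀ {φ} → Vanishing φ → ∀ Ψ → All (λ β → proj₁ β < proj₂ β × proj₂ β < ℓ) Ψ → ∀ j r γ → j + r ≡ ℓ → tailSum γ j r ℤ.< + 0 → ∀ m → Hl φ Ψ γ m ≡ + 0
  Hl-vanish v []      _        j r γ e t zero    = v j r γ e t
  Hl-vanish v []      _        j r γ e t (suc m) = refl
  Hl-vanish v (β ∷ Ψ) (_ ∷ bs) j r γ e t zero    = Hl-vanish v Ψ bs j r γ e t zero
  Hl-vanish v ((i , k) ∷ Ψ) ((p , q) ∷ bs) j r γ e t (suc m) = cong₂ ℤ._+_ (Hl-vanish v Ψ bs j r γ e t (suc m))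
    (Hl-vanish v ((i , k) ∷ Ψ) ((p , q) ∷ bs) j r (raiseW (i , k) γ) e (raise-tail i k γ j r p (subst (k <_) (sym e) q) t) m)

  roots-bounded : ∀ σ → All (λ β → proj₁ β < proj₂ β × proj₂ β < ℓ) (roots σ)
  roots-bounded σ = All.tabulate (λ p → let (a , b , _) = ∈-roots⁻ σ p in a , b)

  Hl-split : ∀ {ψ ψ₁ ψ₂ : Weight → ℤ} z → (∀ {γ γ'} → (∀ i → γ i ≡ γ' i) → ψ₂ γ ≡ ψ₂ γ') → (∀ γ → ψ γ ≡ ψ₁ γ ℤ.+ ψ₂ (lower z γ)) →
    ∀ Ψ γ m → Hl ψ Ψ γ m ≡ Hl ψ₁ Ψ γ m ℤ.+ Hl ψ₂ Ψ (lower z γ) m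
  Hl-split z e h []      γ zero    = h γ
  Hl-split z e h []      γ (suc m) = refl
  Hl-split z e h (β ∷ Ψ) γ zero    = Hl-split z e h Ψ γ zero
  Hl-split {ψ} {ψ₁} {ψ₂} z e h (β ∷ Ψ) γ (suc m) = lia 0 7 (λ a b a1 a2 b1 b2 b2' → a := a1 :+ a2 ⇒ b := b1 :+ b2' ⇒ b2' := b2 ⇒ a :+ b := (a1 :+ b1) :+ (a2 :+ b2))
    (Hl ψ Ψ γ (suc m)) (Hl ψ (β ∷ Ψ) (raiseW β γ) m) (Hl ψ₁ Ψ γ (suc m)) (Hl ψ₂ Ψ (lower z γ) (suc m)) (Hl ψ₁ (β ∷ Ψ) (raiseW β γ) m)
    (Hl ψ₂ (β ∷ Ψ) (raiseW β (lower z γ)) m) (Hl ψ₂ (β ∷ Ψ) (lower z (raiseW β γ)) m)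
    (Hl-split z e h Ψ γ (suc m)) (Hl-split z e h (β ∷ Ψ) (raiseW β γ) m) (ext′ (β ∷ Ψ) (comm β) m)
    where
      comm : ∀ β i → lower z (raiseW β γ) i ≡ raiseW β (lower z γ) i
      comm (i , k) l = lia 0 4 (λ g a b c → g :+ a :- b :- c := g :- c :+ a :- b) (γ l) (ε i l) (ε k l) (ε z l)
      ext′ : ∀ Ψ {γ γ' : Weight} → (∀ i → γ i ≡ γ' i) → ∀ m → Hl ψ₂ Ψ γ m ≡ Hl ψ₂ Ψ γ' m
      ext′ []            h zero    = e h
      ext′ []            h (suc m) = refl
      ext′ (β ∷ Ψ)       h zero    = ext′ Ψ h zero
      ext′ ((i , k) ∷ Ψ) h (suc m) = cong₂ ℤ._+_ (ext′ Ψ h (suc m)) (ext′ ((i , k) ∷ Ψ) (λ l → cong (λ x → x ℤ.+ ε i l ℤ.- ε k l) (h l)) m)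

  -- occ z rs f = Σ t^j f over the positions j of z in rs.
  occ : ℕ → List ℕ → Series → Series
  occ z []       f m = + 0
  occ z (r ∷ rs) f m with r ≟ z
  ... | yes _ = f m ℤ.+ sh (occ z rs f) m
  ... | no _  = sh (occ z rs f) m

  occ-cong : ∀ z rs {f g : Series} → (∀ m → f m ≡ g m) → ∀ m → occ z rs f m ≡ occ z rs g m
  occ-cong z []       h m = refl
  occ-cong z (r ∷ rs) h m with r ≟ z
  ... | yes _ = cong₂ ℤ._+_ (h m) (sh-cong (occ-cong z rs h) m)
  ... | no _  = sh-cong (occ-cong z rs h) m

  occ-cong-∈ : ∀ z rs {f g : Series} → (z ∈ rs → ∀ m → f m ≡ g m) → ∀ m → occ z rs f m ≡ occ z rs g m
  occ-cong-∈ z []       h m = refl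
  occ-cong-∈ z (r ∷ rs) h m with r ≟ z
  ... | yes refl = cong₂ ℤ._+_ (h (here refl) m) (sh-cong (occ-cong-∈ z rs (h ∘ there)) m)
  ... | no _     = sh-cong (occ-cong-∈ z rs (h ∘ there)) m

  occ-zero : ∀ z rs {f : Series} → (z ∈ rs → ∀ m → f m ≡ + 0) → ∀ m → occ z rs f m ≡ + 0
  occ-zero z []       h m = refl
  occ-zero z (r ∷ rs) h m with r ≟ z
  ... | yes refl = cong₂ ℤ._+_ (h (here refl) m) (sh-zero (occ-zero z rs (h ∘ there)) m)
  ... | no _     = sh-zero (occ-zero z rs (h ∘ there)) m

  occ-∉ : ∀ z rs {f : Series} → (∀ {r} → r ∈ rs → r ≢ z) → ∀ m → occ z rs f m ≡ + 0
  occ-∉ z rs h = occ-zero z rs (λ p → ⊥-elim (h p refl))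

  module Expansion {n : ℕ} {μ : ℕ → ℕ} (Bd : Bounded n μ) (finite : ∀ i → ℓ ≤ i → μ i ≡ 0) where
    open Rows Bd
    open Straighten Bd ℓ finite using (module Row)

    wt : Weight
    wt i = + μ i

    rowsOf : ℕ → List ℕ
    rowsOf w = proj₁ (proj₂ (ups w))

    upsOf : ∀ w → Ups w (proj₁ (ups w)) (rowsOf w)
    upsOf w = proj₂ (proj₂ (ups w))

    good-unique : ∀ {w} (G : Good w) {y rs x} → Ups w y rs → Pre w y rs (suc x) → μ (w + suc x) < μ w → Good.top G ≡ y × Good.rows G ≡ rs × Good.extra G ≡ x
    good-unique {w} G {x = x} U P d with ups-functional (Good.runner G) U
    ... | refl , refl = refl , refl , ≤-antisym
            (≮⇒≥ (λ p → <⇒≢ d (Pre.flat (Good.pre G) (ups-head U) (suc x) (s≤s p))))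
            (≮⇒≥ (λ p → <⇒≢ (Good.drop G) (Pre.flat P (ups-head U) (suc (Good.extra G)) (s≤s p))))

    newH : (ψ : Weight → ℤ) → ∀ {w} → Good w → Series
    newH ψ {w} G = Hl ψ (roots (λ i → i + (n ∸ newμ w (Good.top G) (Good.extra G) i))) (λ i → + newμ w (Good.top G) (Good.extra G) i)

    stripped : (ψ : Weight → ℤ) → ℕ → Series
    stripped ψ w = Hl ψ (roots (upd down w (suc (down w)))) (lower w wt)

    data Verdict (w : ℕ) : Set where
      is  : Good w → Verdict w
      absent : (Good w → ⊥) → Verdict w

    -- The combinatorial outcome of the straightening does not depend on the functional, so running
    -- it on the zero functional serves as a decision procedure for `Good`.
    zero-alternating : Alternating (λ _ → ⊤) (λ _ → + 0)
    zero-alternating = record { ext = λ _ → refl ; anti = λ _ _ _ _ → refl }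

    verdict : ∀ w → Verdict w
    verdict w with 1 ≤? μ w
    ... | no ¬p = absent (λ G → ¬p (Good.positive G))
    ... | yes p with Row.evaluate zero-alternating (upsOf w) p (λ _ _ → tt) (λ _ _ _ _ → tt)
    ...   | Row.good j P d _ = is (record { runner = upsOf w ; pre = P ; positive = p ; drop = d })
    ...   | Row.bad ¬G _     = absent ¬G

    -- The value of H at a row w where nothing can be added below w.
    value : (∀ {w} → Good w → Series) → ℕ → Series
    value X w m with verdict w
    ... | is G  = shs (length (Good.rows G) * Good.extra G) (X G) m
    ... | absent _ = + 0

    module _ {ψ : Weight → ℤ} {z : ℕ} (alt : Alternating (λ i → suc i ≢ z) ψ) (van : Vanishing ψ) where
      open Catalan alt

      -- Since z lies on the runner of w, it is at most w and never strictly between two consecutive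
      -- rows of the runner. So the one pair at which `ψ` need not alternate is not among the pairs
      -- used.
      stripped-value : ∀ w → z ∈ rowsOf w → 1 ≤ μ w → ∀ m → stripped ψ w m ≡ value (newH ψ) w m
      stripped-value w z∈ pos m with verdict w | Row.evaluate alt (upsOf w) pos low-ok up-ok
        where
          low-ok : ∀ i → w ≤ i → suc i ≢ z
          low-ok i p e = <⇒≱ (≤-<-trans p (n<1+n i)) (subst (_≤ w) (sym e) (ups-≤ (upsOf w) z∈))
          up-ok : ∀ {r} → r ∈ rowsOf w → ∀ i → r ≤ i → suc i < down r → suc i ≢ z
          up-ok r∈ i p q e with ups-separated (upsOf w) r∈ z∈
          ... | inj₁ z≤r = <⇒≱ (s≤s p) (subst (_≤ _) (sym e) z≤r)
          ... | inj₂ d≤z = <⇒≱ q (subst (down _ ≤_) (sym e) d≤z)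
      ... | is G  | Row.bad ¬G _ = ⊥-elim (¬G G)
      ... | absent _ | Row.bad _ v  = v m
      ... | absent ¬G | Row.good j P d _ = ⊥-elim (¬G (record { runner = upsOf w ; pre = P ; positive = pos ; drop = d }))
      ... | is G  | Row.good j P d v with good-unique G (upsOf w) P d
      ...   | refl , refl , refl = v m

      F : ℕ → Series
      F i m with i <? ℓ
      ... | yes _ = H down (lower i wt) m
      ... | no _  = + 0

      tail-zero : ∀ j r → (∀ i → j ≤ i → μ i ≡ 0) → tailSum wt j r ≡ + 0
      tail-zero j zero    h = refl
      tail-zero j (suc r) h = cong₂ ℤ._+_ (cong +_ (h j ≤-refl)) (tail-zero (suc j) r (λ i p → h i (<⇒≤ p)))

      zero-below : ∀ i j → μ i ≡ 0 → i ≤ j → μ j ≡ 0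
      zero-below i j e p = n≤0⇒n≡0 (≤-trans (≤-reflexive (cong μ (sym (m+[n∸m]≡n p)))) (≤-trans (μ-antitone i (j ∸ i)) (≤-reflexive e)))

      -- Lowering an empty row makes the sum of the weight from row i on equal to -1.
      H-tail : ∀ i → i < ℓ → μ i ≡ 0 → ∀ m → H down (lower i wt) m ≡ + 0
      H-tail i p e m = Hl-vanish van (roots down) (roots-bounded down) i (ℓ ∸ i) (lower i wt) (m+[n∸m]≡n (<⇒≤ p))
        (lia 0 3 (λ x y a → x := y :- a ⇒ y := ♯ 0 ⇒ a := ♯ 1 ⇒ x :< ♯ 0) _ (tailSum wt i (ℓ ∸ i)) (tailSum (ε i) i (ℓ ∸ i)) (tailSum-lower i wt i (ℓ ∸ i))
          (tail-zero i (ℓ ∸ i) (λ j → zero-below i j e)) (tailSum-ε-in i i (ℓ ∸ i) ≤-refl (subst (i <_) (sym (m+[n∸m]≡n (<⇒≤ p))) p))) m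

      G : ℕ → Series
      G w m with 1 ≤? μ w
      ... | yes _ = stripped ψ w m
      ... | no _  = + 0

      positive-inside : ∀ i → 1 ≤ μ i → i < ℓ
      positive-inside i p with i <? ℓ
      ... | yes q = q
      ... | no ¬q = ⊥-elim (<⇒≱ p (≤-reflexive (finite i (≮⇒≥ ¬q))))

      F-in : ∀ i → i < ℓ → ∀ m → F i m ≡ H down (lower i wt) m
      F-in i p m with i <? ℓ
      ... | yes _ = refl
      ... | no ¬p = ⊥-elim (¬p p)

      F-out : ∀ i → ℓ ≤ i → ∀ m → F i m ≡ + 0
      F-out i p m with i <? ℓ
      ... | yes q = ⊥-elim (<⇒≱ q p)
      ... | no _  = refl

      F-null : ∀ i → μ i ≡ 0 → ∀ m → F i m ≡ + 0
      F-null i e m with i <? ℓ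
      ... | yes p = H-tail i p e m
      ... | no _  = refl

      G-null : ∀ i → μ i ≡ 0 → ∀ m → G i m ≡ + 0
      G-null i e m with 1 ≤? μ i
      ... | yes q = ⊥-elim (<⇒≢ q (sym e))
      ... | no _  = refl

      G-in : ∀ i → 1 ≤ μ i → ∀ m → G i m ≡ stripped ψ i m
      G-in i p m with 1 ≤? μ i
      ... | yes _ = refl
      ... | no ¬p = ⊥-elim (¬p p)

      F-step : ∀ i m → F i m ≡ G i m ℤ.+ sh (F (down i)) m
      F-step i m = by-value (1 ≤? μ i)
        where
          by-column : 1 ≤ μ i → Dec (down i < ℓ) → F i m ≡ G i m ℤ.+ sh (F (down i)) m
          by-column q (yes r) = begin
            F i m
              ≡⟨ F-in i (positive-inside i q) m ⟩
            H down (lower i wt) m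
              ≡⟨ H-expand down i (down-above i) r (lower i wt) m ⟩
            stripped ψ i m ℤ.+ sh (H down (raiseW (i , down i) (lower i wt))) m
              ≡⟨ cong₂ ℤ._+_ (sym (G-in i q m)) (sh-cong (λ m → trans (H-ext down (λ j → lia 0 3 (λ g a b → g :- a :+ a :- b := g :- b) (wt j) (ε i j) (ε (down i) j)) m) (sym (F-in (down i) r m))) m) ⟩
            G i m ℤ.+ sh (F (down i)) m ∎
          by-column q (no ¬r) = begin
            F i m
              ≡⟨ F-in i (positive-inside i q) m ⟩
            H down (lower i wt) m
              ≡⟨ Hl-perm (roots-cong {down} {upd down i (suc (down i))} f g) (lower i wt) m ⟩
            stripped ψ i m
              ≡⟨ sym (ℤ.+-identityʳ _) ⟩
            stripped ψ i m ℤ.+ + 0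
              ≡⟨ cong₂ ℤ._+_ (sym (G-in i q m)) (sym (sh-zero (F-out (down i) (≮⇒≥ ¬r)) m)) ⟩
            G i m ℤ.+ sh (F (down i)) m ∎
            where
              f : ∀ a b → IsRoot down a b → IsRoot (upd down i (suc (down i))) a b
              f a b (x , y , v) with a ≟ i
              ... | yes refl = ⊥-elim (¬r (≤-<-trans v y))
              ... | no _ = x , y , v
              g : ∀ a b → IsRoot (upd down i (suc (down i))) a b → IsRoot down a b
              g a b (x , y , v) with a ≟ i
              ... | yes refl = x , y , <⇒≤ v
              ... | no _ = x , y , v
          by-value : Dec (1 ≤ μ i) → F i m ≡ G i m ℤ.+ sh (F (down i)) m
          by-value (yes q) = by-column q (down i <? ℓ)
          by-value (no ¬q) = trans (F-null i μi m) (sym (cong₂ ℤ._+_ (G-null i μi m) (sh-zero (F-null (down i) (zero-below i (down i) μi (<⇒≤ (down-above i)))) m)))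
            where
              μi : μ i ≡ 0
              μi = n≤0⇒n≡0 (≤-pred (≰⇒> ¬q))

      occ-step : ∀ {w y rs} → Ups w y rs → ∀ i (f : Series) m → occ i rs f m ≡ occ i (w ∷ []) f m ℤ.+ sh (occ (down i) rs f) m
      occ-step {w} (last h) i f m = trans (sym (ℤ.+-identityʳ _)) (cong (ℤ._+_ (occ i (w ∷ []) f m))
        (sym (sh-zero (occ-∉ (down i) (w ∷ []) (λ { (here refl) e → h i (sym e) ; (there ()) })) m)))
      occ-step {w} {y} (up {u = u} {rs = rs} e q) i f m = begin
        occ i (w ∷ rs) f m
          ≡⟨ occ-cons i w rs m ⟩
        occ i (w ∷ []) f m ℤ.+ sh (occ i rs f) m
          ≡⟨ cong (ℤ._+_ (occ i (w ∷ []) f m)) (sh-cong (λ m → trans (occ-step q i f m) (trans (cong (ℤ._+ sh (occ (down i) rs f) m) (match m)) (sym (occ-cons (down i) w rs m)))) m) ⟩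
        occ i (w ∷ []) f m ℤ.+ sh (occ (down i) (w ∷ rs) f) m ∎
        where
          occ-cons : ∀ i w rs m → occ i (w ∷ rs) f m ≡ occ i (w ∷ []) f m ℤ.+ sh (occ i rs f) m
          occ-cons i w rs m with w ≟ i
          ... | yes _ = cong (ℤ._+ sh (occ i rs f) m) (sym (trans (cong (ℤ._+_ (f m)) (sh-zero (λ _ → refl) m)) (ℤ.+-identityʳ (f m))))
          ... | no _  = sym (trans (cong (ℤ._+ sh (occ i rs f) m) (sh-zero (λ _ → refl) m)) (ℤ.+-identityˡ _))
          match : ∀ m → occ i (u ∷ []) f m ≡ occ (down i) (w ∷ []) f m
          match m with u ≟ i | w ≟ down i
          ... | yes _ | yes _ = refl
          ... | no _  | no _  = refl
          ... | yes refl | no ¬p = ⊥-elim (¬p (sym e))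
          ... | no ¬p | yes p = ⊥-elim (¬p (down-injective (trans e p)))

      S : ℕ → Series
      S i m = ∑ (upTo ℓ) (λ w → occ i (rowsOf w) (G w) m)

      ∑-sh : ∀ (f : ℕ → Series) m → ∑ (upTo ℓ) (λ w → sh (f w) m) ≡ sh (λ m → ∑ (upTo ℓ) (λ w → f w m)) m
      ∑-sh f zero    = ∑-0 (upTo ℓ)
      ∑-sh f (suc m) = refl

      ∑-delta : ∀ N i m → (i < N → ∑ (upTo N) (λ w → occ i (w ∷ []) (G w) m) ≡ G i m) × (N ≤ i → ∑ (upTo N) (λ w → occ i (w ∷ []) (G w) m) ≡ + 0)
      ∑-delta zero    i m = (λ ()) , (λ _ → refl)
      ∑-delta (suc N) i m = on , off
        where
          single : occ i (i ∷ []) (G i) m ≡ G i m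
          single with i ≟ i
          ... | yes _ = trans (cong (ℤ._+_ (G i m)) (sh-zero (λ _ → refl) m)) (ℤ.+-identityʳ _)
          ... | no ¬p = ⊥-elim (¬p refl)
          none : ∀ w → w ≢ i → occ i (w ∷ []) (G w) m ≡ + 0
          none w p = occ-∉ i (w ∷ []) (λ { (here refl) → p ; (there ()) }) m
          on : i < suc N → ∑ (upTo (suc N)) (λ w → occ i (w ∷ []) (G w) m) ≡ G i m
          on p with m≤n⇒m<n∨m≡n (≤-pred p)
          ... | inj₁ q = trans (∑-upTo-last N (λ w → occ i (w ∷ []) (G w) m)) (trans (cong₂ ℤ._+_ (proj₁ (∑-delta N i m) q) (none N (>⇒≢ q))) (ℤ.+-identityʳ _))
          ... | inj₂ refl = trans (∑-upTo-last N (λ w → occ i (w ∷ []) (G w) m)) (trans (cong₂ ℤ._+_ (proj₂ (∑-delta N i m) ≤-refl) single) (ℤ.+-identityˡ _))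
          off : suc N ≤ i → ∑ (upTo (suc N)) (λ w → occ i (w ∷ []) (G w) m) ≡ + 0
          off p = trans (∑-upTo-last N (λ w → occ i (w ∷ []) (G w) m)) (cong₂ ℤ._+_ (proj₂ (∑-delta N i m) (<⇒≤ p)) (none N (<⇒≢ p)))

      S-step : ∀ i m → S i m ≡ G i m ℤ.+ sh (S (down i)) m
      S-step i m = begin
        S i m
          ≡⟨ ∑-cong (upTo ℓ) (λ w → occ-step (upsOf w) i (G w) m) ⟩
        ∑ (upTo ℓ) (λ w → occ i (w ∷ []) (G w) m ℤ.+ sh (occ (down i) (rowsOf w) (G w)) m)
          ≡⟨ ∑-+ _ _ (upTo ℓ) ⟩
        ∑ (upTo ℓ) (λ w → occ i (w ∷ []) (G w) m) ℤ.+ ∑ (upTo ℓ) (λ w → sh (occ (down i) (rowsOf w) (G w)) m)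
          ≡⟨ cong₂ ℤ._+_ delta (∑-sh (λ w → occ (down i) (rowsOf w) (G w)) m) ⟩
        G i m ℤ.+ sh (S (down i)) m ∎
        where
          delta : ∑ (upTo ℓ) (λ w → occ i (w ∷ []) (G w) m) ≡ G i m
          delta with i <? ℓ
          ... | yes p = proj₁ (∑-delta ℓ i m) p
          ... | no ¬p = trans (proj₂ (∑-delta ℓ i m) (≮⇒≥ ¬p)) (sym (G-null i (finite i (≮⇒≥ ¬p)) m))

      -- Both sides satisfy X i = G i + t X (down i), which determines the coefficient of t^m by
      -- induction on m. Unfolded, this is the sum of t^j G w over the rows w reached from i by j
      -- steps of `down`; `S` records the same j as the position of i in the runner of w.
      F≡S : ∀ i m → F i m ≡ S i m
      F≡S i zero    = trans (F-step i 0) (sym (S-step i 0))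
      F≡S i (suc m) = trans (F-step i (suc m)) (trans (cong (ℤ._+_ (G i (suc m))) (F≡S (down i) m)) (sym (S-step i (suc m))))

      H-lower : z < ℓ → ∀ m → H down (lower z wt) m ≡ ∑ (upTo ℓ) (λ w → occ z (rowsOf w) (value (newH ψ) w) m)
      H-lower p m = trans (sym (F-in z p m)) (trans (F≡S z m) (∑-cong (upTo ℓ) (λ w → occ-cong-∈ z (rowsOf w) (G≡value w) m)))
        where
          G≡value : ∀ w → z ∈ rowsOf w → ∀ m → G w m ≡ value (newH ψ) w m
          G≡value w z∈ m = by (1 ≤? μ w)
            where
              by : Dec (1 ≤ μ w) → G w m ≡ value (newH ψ) w m
              by (yes q) = trans (G-in w q m) (stripped-value w z∈ q m)
              by (no ¬q) with verdict w
              ... | is G  = ⊥-elim (¬q (Good.positive G))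
              ... | absent _ = G-null w (n≤0⇒n≡0 (≤-pred (≰⇒> ¬q))) m

    -- The additional term collects the subsets whose largest row is z. Their remaining rows lie in
    -- [0, z) and stay in the functional `sub d z φ`, which inherits the vanishing on negative tails
    -- and all alternations but one.
    vertical-step : ∀ {φ : Weight → ℤ} → Alternating (λ _ → ⊤) φ → (∀ {γ γ'} → (∀ i → γ i ≡ γ' i) → φ γ ≡ φ γ') → Vanishing φ → ∀ d z → z < ℓ → ∀ m →
      Hl (sub (suc d) (suc z) φ) (roots down) wt m ≡
      Hl (sub (suc d) z φ) (roots down) wt m ℤ.+ ∑ (upTo ℓ) (λ w → occ z (rowsOf w) (value (newH (sub d z φ)) w) m)
    vertical-step {φ} alt e van d z p m = trans (Hl-split z (sub-ext e d z) (λ γ → refl) (roots down) wt m)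
      (cong (ℤ._+_ (Hl (sub (suc d) z φ) (roots down) wt m)) (H-lower alt' (λ j r γ eq → sub-tail j r (λ γ → van j r γ eq) d z γ) p m))
      where
        sub-local : ∀ d z → z ≤ ℓ → ∀ {γ γ'} → (∀ j → j < ℓ → γ j ≡ γ' j) → sub d z φ γ ≡ sub d z φ γ'
        sub-local zero    z       q h = Alternating.ext alt h
        sub-local (suc d) zero    q h = refl
        sub-local (suc d) (suc z) q h = cong₂ ℤ._+_ (sub-local (suc d) z (<⇒≤ q) h) (sub-local d z (<⇒≤ q) (λ j r → cong (ℤ._- ε z j) (h j r)))
        alt' : Alternating (λ i → suc i ≢ z) (sub d z φ)
        alt' = record
          { ext  = sub-local d z (<⇒≤ p)
          ; anti = λ a a<ℓ ne s → sub-anti a e (λ {γ} {γ'} s → Alternating.anti alt a {γ} {γ'} a<ℓ tt s) d z ne s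
          }

-- Cores and their residues

T-∧ : ∀ {a b} → T a → T b → T (a ∧ b)
T-∧ {true} {true} _ _ = tt

T⇒true : ∀ {b} → T b → b ≡ true
T⇒true {true} _ = refl

not-T : ∀ {b} → b ≡ false → T (not b)
not-T {false} _ = tt

<ᵇ-true : ∀ {m n} → m < n → (m <ᵇ n) ≡ true
<ᵇ-true p = T⇒true (<⇒<ᵇ p)

<ᵇ-false : ∀ {m n} → n ≤ m → (m <ᵇ n) ≡ false
<ᵇ-false {m} {n} p with m <ᵇ n in e
... | false = refl
... | true  = ⊥-elim (<⇒≱ (<ᵇ⇒< m n (subst T (sym e) tt)) p)

≤ᵇ-true : ∀ {m n} → m ≤ n → (m ≤ᵇ n) ≡ true
≤ᵇ-true p = T⇒true (≤⇒≤ᵇ p)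

≤ᵇ-false : ∀ {m n} → n < m → (m ≤ᵇ n) ≡ false
≤ᵇ-false {m} {n} p with m ≤ᵇ n in e
... | false = refl
... | true  = ⊥-elim (<⇒≱ p (≤ᵇ⇒≤ m n (subst T (sym e) tt)))

≡ᵇ-true : ∀ m → (m ≡ᵇ m) ≡ true
≡ᵇ-true m = T⇒true (≡⇒≡ᵇ m m refl)

≡ᵇ-false : ∀ {m n} → m ≢ n → (m ≡ᵇ n) ≡ false
≡ᵇ-false {m} {n} p with m ≡ᵇ n in e
... | false = refl
... | true  = ⊥-elim (p (≡ᵇ⇒≡ m n (subst T (sym e) tt)))

nth-beyond : ∀ xs i → length xs ≤ i → nth xs i ≡ 0
nth-beyond []       i       p       = refl
nth-beyond (x ∷ xs) (suc i) (s≤s p) = nth-beyond xs i p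

Antitone : (ℕ → ℕ) → Set
Antitone f = ∀ i → f (suc i) ≤ f i

antitone-≤ : ∀ {f} → Antitone f → ∀ {i j} → i ≤ j → f j ≤ f i
antitone-≤ {f} h {i} {j} p = subst (λ x → f x ≤ f i) (m+[n∸m]≡n p) (go (j ∸ i))
  where
    go : ∀ s → f (i + s) ≤ f i
    go zero    = ≤-reflexive (cong f (+-identityʳ i))
    go (suc s) = ≤-trans (subst (λ x → f x ≤ f (i + s)) (sym (+-suc i s)) (h (i + s))) (go s)

record IsPartition (xs : List ℕ) : Set where
  field
    antitone : Antitone (nth xs)
    positive : ∀ i → i < length xs → 1 ≤ nth xs i

isPartition⁻ : ∀ xs → T (isPartitionB xs) → IsPartition xs
isPartition⁻ [] _ = record { antitone = λ i → z≤n ; positive = λ i () }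
isPartition⁻ (zero ∷ []) ()
isPartition⁻ (suc a ∷ []) _ = record { antitone = λ i → z≤n ; positive = λ { zero _ → s≤s z≤n ; (suc i) (s≤s ()) } }
isPartition⁻ (a ∷ b ∷ xs) p with isPartition⁻ (b ∷ xs) (∧-snd {b ≤ᵇ a} p)
... | q = record { antitone = λ { zero → ≤ᵇ⇒≤ b a (∧-fst p) ; (suc i) → IsPartition.antitone q i }
                 ; positive = λ { zero _ → ≤-trans (IsPartition.positive q 0 (s≤s z≤n)) (≤ᵇ⇒≤ b a (∧-fst p)) ; (suc i) (s≤s r) → IsPartition.positive q i r } }

isPartition⁺ : ∀ xs → IsPartition xs → T (isPartitionB xs)
isPartition⁺ [] _ = tt
isPartition⁺ (a ∷ []) q = not-T (≡ᵇ-false (λ e → <⇒≢ (IsPartition.positive q 0 (s≤s z≤n)) (sym e)))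
isPartition⁺ (a ∷ b ∷ xs) q = T-∧ (≤⇒≤ᵇ (IsPartition.antitone q 0)) (isPartition⁺ (b ∷ xs)
  (record { antitone = λ i → IsPartition.antitone q (suc i) ; positive = λ i r → IsPartition.positive q (suc i) (s≤s r) }))

hgt : List ℕ → ℕ → ℕ
hgt xs c = count (λ x → c <ᵇ x) xs

hgt-spec : ∀ xs c → Antitone (nth xs) → (∀ i → i < hgt xs c → c < nth xs i) × (∀ i → c < nth xs i → i < hgt xs c)
hgt-spec []       c h = (λ i ()) , (λ i ())
hgt-spec (x ∷ xs) c h with c <? x
... | yes p rewrite <ᵇ-true p = to , from
  where
    ih : (∀ i → i < hgt xs c → c < nth xs i) × (∀ i → c < nth xs i → i < hgt xs c)
    ih = hgt-spec xs c (λ i → h (suc i))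
    to : ∀ i → i < suc (hgt xs c) → c < nth (x ∷ xs) i
    to zero    _       = p
    to (suc i) (s≤s q) = proj₁ ih i q
    from : ∀ i → c < nth (x ∷ xs) i → i < suc (hgt xs c)
    from zero    _ = s≤s z≤n
    from (suc i) q = s≤s (proj₂ ih i q)
... | no ¬p rewrite <ᵇ-false (≮⇒≥ ¬p) = (λ i q → ⊥-elim (<⇒≱ q (≤-trans (≤-reflexive none) z≤n))) , (λ i q → ⊥-elim (¬p (<-≤-trans q (antitone-≤ h {0} {i} z≤n))))
  where
    none : hgt xs c ≡ 0
    none with hgt xs c in e | hgt-spec xs c (λ i → h (suc i))
    ... | zero  | _ = refl
    ... | suc m | (f , _) = ⊥-elim (¬p (<-≤-trans (f 0 (s≤s z≤n)) (h 0)))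

-- h is the height of column c, so the rows counted are those from s and from r + 1 on up to h - 1.
count-hook : ∀ xs s r c h → (∀ i → s + i < h → c < nth xs i) → (∀ i → c < nth xs i → s + i < h) →
  count (λ p → (r <ᵇ proj₁ p) ∧ (c <ᵇ proj₂ p)) (enumFrom s xs) ≡ h ∸ (s ⊔ suc r)
count-hook [] s r c h f g = sym (m≤n⇒m∸n≡0 (≤-trans h≤s (ℕ.m≤m⊔n s (suc r))))
  where
    h≤s : h ≤ s
    h≤s = ≮⇒≥ (λ p → <⇒≱ (f 0 (subst (_< h) (sym (+-identityʳ s)) p)) z≤n)
count-hook (x ∷ xs) s r c h f g with s <? h
... | no ¬p rewrite <ᵇ-false {c} {x} (≮⇒≥ (λ q → ¬p (subst (_< h) (+-identityʳ s) (g 0 q)))) with r <ᵇ s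
...   | false = trans (count-hook xs (suc s) r c h (λ i q → f (suc i) (subst (_< h) (sym (+-suc s i)) q)) (λ i q → subst (_< h) (+-suc s i) (g (suc i) q)))
                  (trans (m≤n⇒m∸n≡0 (≤-trans (m≤n⇒m≤1+n (≮⇒≥ ¬p)) (ℕ.m≤m⊔n (suc s) (suc r)))) (sym (m≤n⇒m∸n≡0 (≤-trans (≮⇒≥ ¬p) (ℕ.m≤m⊔n s (suc r))))))
...   | true  = trans (count-hook xs (suc s) r c h (λ i q → f (suc i) (subst (_< h) (sym (+-suc s i)) q)) (λ i q → subst (_< h) (+-suc s i) (g (suc i) q)))
                  (trans (m≤n⇒m∸n≡0 (≤-trans (m≤n⇒m≤1+n (≮⇒≥ ¬p)) (ℕ.m≤m⊔n (suc s) (suc r)))) (sym (m≤n⇒m∸n≡0 (≤-trans (≮⇒≥ ¬p) (ℕ.m≤m⊔n s (suc r))))))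
count-hook (x ∷ xs) s r c h f g | yes p rewrite <ᵇ-true (f 0 (subst (_< h) (sym (+-identityʳ s)) p)) with r <? s
... | yes q rewrite <ᵇ-true q | m≥n⇒m⊔n≡m q = trans (cong suc (trans (count-hook xs (suc s) r c h (λ i q → f (suc i) (subst (_< h) (sym (+-suc s i)) q)) (λ i q → subst (_< h) (+-suc s i) (g (suc i) q)))
                  (cong (h ∸_) (m≥n⇒m⊔n≡m (s≤s (<⇒≤ q)))))) (sym (+-∸-assoc 1 p))
... | no ¬q rewrite <ᵇ-false (≮⇒≥ ¬q) = trans (count-hook xs (suc s) r c h (λ i q → f (suc i) (subst (_< h) (sym (+-suc s i)) q)) (λ i q → subst (_< h) (+-suc s i) (g (suc i) q)))
                  (cong (h ∸_) (trans (m≤n⇒m⊔n≡n (s≤s (≮⇒≥ ¬q))) (sym (m≤n⇒m⊔n≡n (m≤n⇒m≤1+n (≮⇒≥ ¬q))))))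

hook-formula : ∀ xs r c → Antitone (nth xs) → c < nth xs r → hook xs r c + suc (c + r) ≡ nth xs r + hgt xs c
hook-formula xs r c h p rewrite indexed≡enumFrom xs | count-hook xs 0 r c (hgt xs c) (proj₁ (hgt-spec xs c h)) (proj₂ (hgt-spec xs c h)) =
  lia 6 0 (λ N H c r a b → a :+ (♯ 1 :+ c) := N ⇒ b :+ (♯ 1 :+ r) := H ⇒ ♯ 1 :+ (a :+ b) :+ (♯ 1 :+ (c :+ r)) := N :+ H)
    (nth xs r) (hgt xs c) c r (nth xs r ∸ suc c) (hgt xs c ∸ suc r) (m∸n+n≡m p) (m∸n+n≡m (proj₂ (hgt-spec xs c h) r p))

-- The positions where an upward closed predicate holds form a final segment, so c belongs to it
-- exactly when the segment has at least N - c elements.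
count-upTo : ∀ (p : ℕ → Bool) N → (∀ c → T (p c) → T (p (suc c))) → ∀ c → c < N → (T (p c) → N ≤ c + count p (upTo N)) × (N ≤ c + count p (upTo N) → T (p c))
count-upTo p N mono c c<N = go id N (λ c → mono c) c c<N
  where
    all-true : ∀ (f : ℕ → ℕ) N → (∀ c → T (p (f c))) → count p (applyUpTo f N) ≡ N
    all-true f zero    h = refl
    all-true f (suc N) h rewrite T⇒true (h 0) = cong suc (all-true (f ∘ suc) N (λ c → h (suc c)))
    count≤ : ∀ (f : ℕ → ℕ) N → count p (applyUpTo f N) ≤ N
    count≤ f zero    = z≤n
    count≤ f (suc N) with p (f 0)
    ... | true  = s≤s (count≤ (f ∘ suc) N)
    ... | false = m≤n⇒m≤1+n (count≤ (f ∘ suc) N)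
    go : ∀ (f : ℕ → ℕ) N → (∀ c → T (p (f c)) → T (p (f (suc c)))) → ∀ c → c < N →
      (T (p (f c)) → N ≤ c + count p (applyUpTo f N)) × (N ≤ c + count p (applyUpTo f N) → T (p (f c)))
    go f (suc N) m zero q with p (f 0) in e
    ... | true  = (λ _ → s≤s (≤-reflexive (sym (all-true (f ∘ suc) N up)))) , (λ _ → tt)
      where
        up : ∀ c → T (p (f (suc c)))
        up zero    = m 0 (subst T (sym e) tt)
        up (suc c) = m (suc c) (up c)
    ... | false = (λ ()) , (λ r → ⊥-elim (<⇒≱ r (count≤ (f ∘ suc) N)))
    go f (suc N) m (suc c) (s≤s q) with p (f 0) in e
    ... | true  = (λ _ → s≤s (≤-trans (n≤1+n N) (≤-trans (s≤s (≤-reflexive (sym (all-true (f ∘ suc) N up)))) (m≤n+m _ c)))) , (λ _ → up c)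
      where
        up : ∀ c → T (p (f (suc c)))
        up zero    = m 0 (subst T (sym e) tt)
        up (suc c) = m (suc c) (up c)
    ... | false with go (f ∘ suc) N (λ c → m (suc c)) c q
    ...   | (a , b) = (λ t → s≤s (a t)) , (λ { (s≤s r) → b r })

count-upTo-≤ : ∀ (p : ℕ → Bool) (f : ℕ → ℕ) N → count p (applyUpTo f N) ≤ N
count-upTo-≤ p f zero    = z≤n
count-upTo-≤ p f (suc N) with p (f 0)
... | true  = s≤s (count-upTo-≤ p (f ∘ suc) N)
... | false = m≤n⇒m≤1+n (count-upTo-≤ p (f ∘ suc) N)

nth-enumFrom-map : ∀ (f : ℕ → ℕ → ℕ) s xs i → (∀ j → f j 0 ≡ 0) → nth (map (λ p → f (proj₁ p) (proj₂ p)) (enumFrom s xs)) i ≡ f (s + i) (nth xs i)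
nth-enumFrom-map f s []       i       h = sym (h (s + i))
nth-enumFrom-map f s (x ∷ xs) zero    h = cong (λ j → f j x) (sym (+-identityʳ s))
nth-enumFrom-map f s (x ∷ xs) (suc i) h = trans (nth-enumFrom-map f (suc s) xs i h) (cong (λ j → f j (nth xs i)) (sym (+-suc s i)))

nth-𝔭 : ∀ k xs i → nth (𝔭 k xs) i ≡ count (λ c → hook xs i c ≤ᵇ k) (upTo (nth xs i))
nth-𝔭 k xs i = trans (cong (λ l → nth (map (λ p → count (λ c → hook xs (proj₁ p) c ≤ᵇ k) (upTo (proj₂ p))) l) i) (indexed≡enumFrom xs))
  (nth-enumFrom-map (λ r m → count (λ c → hook xs r c ≤ᵇ k) (upTo m)) 0 xs i (λ _ → refl))

-- An n-core κ with its k-bounded partition μ, n = k + 1.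
record CoreData (n : ℕ) (κ μ : ℕ → ℕ) : Set where
  field
    κ-antitone : Antitone κ
    link       : ∀ i → κ i ≡ μ i + κ (i + (n ∸ μ i))
    bounded-μ  : Bounded n μ

all-enumFrom : ∀ {f : ℕ × ℕ → List (ℕ × ℕ)} {q : ℕ × ℕ → Bool} s xs → T (all q (concatMap f (enumFrom s xs))) → ∀ i → i < length xs → T (all q (f (s + i , nth xs i)))
all-++ˡ : ∀ {q : ℕ × ℕ → Bool} xs ys → T (all q (xs ++ ys)) → T (all q xs) × T (all q ys)
all-++ˡ []       ys t = tt , t
all-++ˡ {q} (x ∷ xs) ys t with q x
... | true  = all-++ˡ xs ys t
... | false = ⊥-elim t
all-enumFrom {f} {q} s (x ∷ xs) t zero p = subst (λ j → T (all q (f (j , x)))) (sym (+-identityʳ s)) (proj₁ (all-++ˡ (f (s , x)) _ t))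
all-enumFrom {f} {q} s (x ∷ xs) t (suc i) (s≤s p) = subst (λ j → T (all q (f (j , nth xs i)))) (sym (+-suc s i)) (all-enumFrom {f} {q} (suc s) xs (proj₂ (all-++ˡ (f (s , x)) _ t)) i p)

all-enumFrom⁺ : ∀ {f : ℕ × ℕ → List (ℕ × ℕ)} {q : ℕ × ℕ → Bool} s xs → (∀ i → i < length xs → T (all q (f (s + i , nth xs i)))) → T (all q (concatMap f (enumFrom s xs)))
all-++⁺ : ∀ {q : ℕ × ℕ → Bool} xs ys → T (all q xs) → T (all q ys) → T (all q (xs ++ ys))
all-++⁺ []       ys s t = t
all-++⁺ {q} (x ∷ xs) ys s t with q x
... | true  = all-++⁺ xs ys s t
... | false = ⊥-elim s
all-enumFrom⁺ s [] h = tt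
all-enumFrom⁺ {f} {q} s (x ∷ xs) h = all-++⁺ (f (s , x)) _ (subst (λ j → T (all q (f (j , x)))) (+-identityʳ s) (h 0 (s≤s z≤n)))
  (all-enumFrom⁺ {f} {q} (suc s) xs (λ i p → subst (λ j → T (all q (f (j , nth xs i)))) (+-suc s i) (h (suc i) (s≤s p))))

all-row : ∀ {q : ℕ × ℕ → Bool} r (f : ℕ → ℕ) N → T (all q (map (λ c → r , c) (applyUpTo f N))) → ∀ c → c < N → T (q (r , f c))
all-row r f (suc N) t zero    p       = ∧-fst t
all-row {q} r f (suc N) t (suc c) (s≤s p) = all-row r (f ∘ suc) N (∧-snd {q (r , f 0)} t) c p

all-row⁺ : ∀ {q : ℕ × ℕ → Bool} r (f : ℕ → ℕ) N → (∀ c → c < N → T (q (r , f c))) → T (all q (map (λ c → r , c) (applyUpTo f N)))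
all-row⁺ r f zero    h = tt
all-row⁺ r f (suc N) h = T-∧ (h 0 (s≤s z≤n)) (all-row⁺ r (f ∘ suc) N (λ c p → h (suc c) (s≤s p)))

inside-length : ∀ xs i c → c < nth xs i → i < length xs
inside-length xs i c p = ≰⇒> (λ q → <⇒≱ p (≤-trans (≤-reflexive (nth-beyond xs i q)) z≤n))

core-hooks : ∀ n xs → T (isCoreB n xs) → ∀ r c → c < nth xs r → hook xs r c ≢ n
core-hooks n xs t r c p e = subst T (trans (cong not (trans (cong (_≡ᵇ n) e) (≡ᵇ-true n))) refl)
  (all-row {λ b → not (hook xs (proj₁ b) (proj₂ b) ≡ᵇ n)} r id (nth xs r)
    (all-enumFrom {λ p → map (λ c → proj₁ p , c) (upTo (proj₂ p))} 0 xs
      (subst (λ l → T (all (λ b → not (hook xs (proj₁ b) (proj₂ b) ≡ᵇ n)) (concatMap (λ p → map (λ c → (proj₁ p , c)) (upTo (proj₂ p))) l))) (indexed≡enumFrom xs)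
        (∧-snd {isPartitionB xs} t)) r (inside-length xs r c p)) c p)

core-hooks⁺ : ∀ n xs → IsPartition xs → (∀ r c → c < nth xs r → hook xs r c ≢ n) → T (isCoreB n xs)
core-hooks⁺ n xs P h = T-∧ (isPartition⁺ xs P)
  (subst (λ l → T (all (λ b → not (hook xs (proj₁ b) (proj₂ b) ≡ᵇ n)) (concatMap (λ p → map (λ c → (proj₁ p , c)) (upTo (proj₂ p))) l))) (sym (indexed≡enumFrom xs))
    (all-enumFrom⁺ {λ p → map (λ c → proj₁ p , c) (upTo (proj₂ p))} 0 xs (λ i _ → all-row⁺ i id (nth xs i) (λ c p → not-T (≡ᵇ-false (h i c p))))))

module _ (k : ℕ) (xs : List ℕ) where
  private
    n : ℕ
    n = suc k
    κ : ℕ → ℕ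
    κ = nth xs

  hook-mono : Antitone κ → ∀ r c → suc c < κ r → hook xs r (suc c) < hook xs r c
  hook-mono A r c p = lia 6 0 (λ h h' c r N H → h' :+ (♯ 1 :+ (♯ 1 :+ c :+ r)) :≤ N :+ H ⇒ h :+ (♯ 1 :+ (c :+ r)) := N :+ H ⇒ h' :< h)
    (hook xs r c) (hook xs r (suc c)) c r (κ r) (hgt xs c)
    (≤-trans (≤-reflexive (hook-formula xs r (suc c) A p)) (+-monoʳ-≤ (κ r) hgt-mono))
    (hook-formula xs r c A (<-trans (n<1+n c) p))
    where
      hgt-mono : hgt xs (suc c) ≤ hgt xs c
      hgt-mono = ≮⇒≥ (λ q → <-irrefl refl (proj₂ (hgt-spec xs c A) (hgt xs c) (<-trans (n<1+n c) (proj₁ (hgt-spec xs (suc c) A) (hgt xs c) q))))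

  -- Hook lengths decrease along a row, so the μ_i boxes of hook length at most k stand at its end.
  -- That row `i + (n ∸ μ i)` has exactly the remaining length κ_i - μ_i is read off the hooks of
  -- the two boxes on either side of this boundary.
  core-data : T (isCoreB n xs) → CoreData n κ (nth (𝔭 k xs))
  core-data t = record { κ-antitone = A ; link = λ i → trans (link′ i) (cong (λ x → μ i + κ x) (+-∸-assoc i (<⇒≤ (μ<n i)))) ; bounded-μ = record { decreasing = dec ; ceiling = μ<n } }
    where
      P : IsPartition xs
      P = isPartition⁻ xs (∧-fst t)
      A : Antitone κ
      A = IsPartition.antitone P
      μ : ℕ → ℕ
      μ = nth (𝔭 k xs)
      small : ℕ → ℕ → Bool
      small i c = hook xs i c ≤ᵇ k
      -- hooks outside the diagram do not matter; extending by true makes the predicate monotone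
      ext : ℕ → ℕ → Bool
      ext i c = if c <ᵇ κ i then small i c else true
      ext-mono : ∀ i c → T (ext i c) → T (ext i (suc c))
      ext-mono i c p with suc c <? κ i
      ... | no ¬q rewrite <ᵇ-false (≮⇒≥ ¬q) = tt
      ... | yes q rewrite <ᵇ-true q | <ᵇ-true (<-trans (n<1+n c) q) = ≤⇒≤ᵇ (≤-trans (<⇒≤ (hook-mono A i c q)) (≤ᵇ⇒≤ _ k p))
      count-cong : ∀ (p q : ℕ → Bool) (f : ℕ → ℕ) N → (∀ c → c < N → p (f c) ≡ q (f c)) → count p (applyUpTo f N) ≡ count q (applyUpTo f N)
      count-cong p q f zero    h = refl
      count-cong p q f (suc N) h rewrite h 0 (s≤s z≤n) = cong (λ m → if q (f 0) then suc m else m) (count-cong p q (f ∘ suc) N (λ c r → h (suc c) (s≤s r)))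
      μ≡ : ∀ i → μ i ≡ count (ext i) (upTo (κ i))
      μ≡ i = trans (nth-𝔭 k xs i) (count-cong (small i) (ext i) id (κ i) (λ c p → sym (cong (λ b → if b then small i c else true) (<ᵇ-true p))))
      μ≤κ : ∀ i → μ i ≤ κ i
      μ≤κ i = subst (_≤ κ i) (sym (μ≡ i)) (count-upTo-≤ (ext i) id (κ i))
      small⇒ : ∀ i c → c < κ i → hook xs i c ≤ k → κ i ≤ c + μ i
      small⇒ i c p q = subst (λ m → κ i ≤ c + m) (sym (μ≡ i)) (proj₁ (count-upTo (ext i) (κ i) (ext-mono i) c p)
        (subst T (sym (cong (λ b → if b then small i c else true) (<ᵇ-true p))) (≤⇒≤ᵇ q)))
      ⇒small : ∀ i c → c < κ i → κ i ≤ c + μ i → hook xs i c ≤ k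
      ⇒small i c p q = ≤ᵇ⇒≤ _ k (subst T (cong (λ b → if b then small i c else true) (<ᵇ-true p))
        (proj₂ (count-upTo (ext i) (κ i) (ext-mono i) c p) (subst (λ m → κ i ≤ c + m) (μ≡ i) q)))
      hgt-in : ∀ i c → c < κ i → i < hgt xs c
      hgt-in i c = proj₂ (hgt-spec xs c A) i
      μ<n : ∀ i → μ i < n
      μ<n i with μ i ≟ 0
      ... | yes e = subst (_< n) (sym e) (s≤s z≤n)
      ... | no ¬e = s≤s (lia 7 0 (λ h c i N H m k → h :+ (♯ 1 :+ (c :+ i)) := N :+ H ⇒ h :≤ k ⇒ c :+ m := N ⇒ i :< H ⇒ m :≤ k)
              (hook xs i c) c i (κ i) (hgt xs c) (μ i) k (hook-formula xs i c A c<) (⇒small i c c< (≤-reflexive (sym (m∸n+n≡m (μ≤κ i))))) (m∸n+n≡m (μ≤κ i)) (hgt-in i c c<))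
        where
          c : ℕ
          c = κ i ∸ μ i
          c< : c < κ i
          c< = lia 3 0 (λ c m N → c :+ m := N ⇒ ♯ 1 :≤ m ⇒ c :< N) c (μ i) (κ i) (m∸n+n≡m (μ≤κ i)) (n≢0⇒n>0 ¬e)
      link′ : ∀ i → κ i ≡ μ i + κ (i + n ∸ μ i)
      link′ i = trans (sym (trans (+-comm (μ i) c) (m∸n+n≡m (μ≤κ i)))) (cong (_+_ (μ i)) (≤-antisym lower-bound upper))
        where
          c d : ℕ
          c = κ i ∸ μ i
          d = i + n ∸ μ i
          c+μ : c + μ i ≡ κ i
          c+μ = m∸n+n≡m (μ≤κ i)
          d+μ : d + μ i ≡ i + n
          d+μ = m∸n+n≡m (≤-trans (<⇒≤ (μ<n i)) (m≤n+m n i))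
          i<d : i < d
          i<d = lia 4 0 (λ i d m n → d :+ m := i :+ n ⇒ m :< n ⇒ i :< d) i d (μ i) n d+μ (μ<n i)
          upper : κ d ≤ c
          upper = ≮⇒≥ contra
            where
              contra : c < κ d → ⊥
              contra p with c <? κ i
              ... | no ¬q = <⇒≱ (<-≤-trans p (antitone-≤ A (<⇒≤ i<d))) (≮⇒≥ ¬q)
              ... | yes q = lia 8 0 (λ h c i N H m k d → h :+ (♯ 1 :+ (c :+ i)) := N :+ H ⇒ h :≤ k ⇒ c :+ m := N ⇒ d :< H ⇒ d :+ m := i :+ (♯ 1 :+ k) ⇒ :⊥)
                      (hook xs i c) c i (κ i) (hgt xs c) (μ i) k d (hook-formula xs i c A q) (⇒small i c q (≤-reflexive (sym c+μ))) c+μ (hgt-in d c p) d+μ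
          lower-bound : c ≤ κ d
          lower-bound with c in ec
          ... | zero  = z≤n
          ... | suc c' = proj₁ (hgt-spec xs c' A) d (lia 8 0 (λ h c' i N H m k d → h :+ (♯ 1 :+ (c' :+ i)) := N :+ H ⇒ ♯ 2 :+ k :≤ h ⇒ ♯ 1 :+ c' :+ m := N ⇒ d :+ m := i :+ (♯ 1 :+ k) ⇒ d :< H)
                      (hook xs i c') c' i (κ i) (hgt xs c') (μ i) k d (hook-formula xs i c' A c'<) big eq d+μ)
            where
              eq : suc c' + μ i ≡ κ i
              eq = trans (cong (_+ μ i) (sym ec)) c+μ
              c'< : c' < κ i
              c'< = ≤-trans (m≤m+n (suc c') (μ i)) (≤-reflexive eq)
              -- Here the core condition enters: the hook exceeds k, and the value n = k + 1 is
              -- excluded. The extra unit is what makes column c' reach row d.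
              big : suc n ≤ hook xs i c'
              big = ≤∧≢⇒< (≰⇒> (λ q → <⇒≱ (≤-reflexive eq) (small⇒ i c' c'< q))) (λ e → core-hooks n xs t i c' c'< (sym e))
      dec : ∀ i → μ (suc i) ≤ μ i
      dec i = ≮⇒≥ contra
        where
          contra : μ i < μ (suc i) → ⊥
          contra p = lia 6 0 (λ a b m m' z z' → a :≤ b ⇒ b := m :+ z ⇒ a := m' :+ z' ⇒ z :≤ z' ⇒ m :< m' ⇒ :⊥)
            (κ (suc i)) (κ i) (μ i) (μ (suc i)) (κ (i + n ∸ μ i)) (κ (suc i + n ∸ μ (suc i))) (A i) (link′ i) (link′ (suc i)) (antitone-≤ A d'≤d) p
            where
              d'≤d : suc i + n ∸ μ (suc i) ≤ i + n ∸ μ i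
              d'≤d = lia 6 0 (λ i n d d' m m' → d :+ m := i :+ n ⇒ d' :+ m' := ♯ 1 :+ i :+ n ⇒ m :< m' ⇒ d' :≤ d) i n (i + n ∸ μ i) (suc i + n ∸ μ (suc i)) (μ i) (μ (suc i))
                (m∸n+n≡m (≤-trans (<⇒≤ (μ<n i)) (m≤n+m n i))) (m∸n+n≡m (≤-trans (<⇒≤ (μ<n (suc i))) (m≤n+m n (suc i)))) p

  module _ {μ : ℕ → ℕ} (D : CoreData n κ μ) where
    open CoreData D
    private
      d : ℕ → ℕ
      d i = i + (n ∸ μ i)

      d+μ : ∀ i → d i + μ i ≡ i + n
      d+μ i = trans (+-assoc i (n ∸ μ i) (μ i)) (cong (_+_ i) (m∸n+n≡m (<⇒≤ (Bounded.ceiling bounded-μ i))))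

      small : ∀ i c → c < κ i → κ (d i) ≤ c → hook xs i c ≤ k
      small i c p q = lia 9 0 (λ h c i N H m k d z → h :+ (♯ 1 :+ (c :+ i)) := N :+ H ⇒ N := m :+ z ⇒ z :≤ c ⇒ H :≤ d ⇒ d :+ m := i :+ (♯ 1 :+ k) ⇒ h :≤ k)
        (hook xs i c) c i (κ i) (hgt xs c) (μ i) k (d i) (κ (d i)) (hook-formula xs i c κ-antitone p) (link i) q
        (≮⇒≥ (λ r → <⇒≱ (proj₁ (hgt-spec xs c κ-antitone) (d i) r) q)) (d+μ i)

      large : ∀ i c → c < κ i → c < κ (d i) → n < hook xs i c
      large i c p q = lia 9 0 (λ h c i N H m k d z → h :+ (♯ 1 :+ (c :+ i)) := N :+ H ⇒ N := m :+ z ⇒ c :< z ⇒ d :< H ⇒ d :+ m := i :+ (♯ 1 :+ k) ⇒ ♯ 1 :+ k :< h)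
        (hook xs i c) c i (κ i) (hgt xs c) (μ i) k (d i) (κ (d i)) (hook-formula xs i c κ-antitone p) (link i) q
        (proj₂ (hgt-spec xs c κ-antitone) (d i) q) (d+μ i)

      count-threshold : ∀ (p : ℕ → Bool) (f : ℕ → ℕ) N t → (∀ c → c < N → p (f c) ≡ (t ≤ᵇ c)) → count p (applyUpTo f N) ≡ N ∸ t
      count-threshold p f zero    t       h = sym (0∸n≡0 t)
      count-threshold p f (suc N) zero    h rewrite h 0 (s≤s z≤n) = cong suc (count-threshold p (f ∘ suc) N 0 (λ c q → h (suc c) (s≤s q)))
      count-threshold p f (suc N) (suc t) h rewrite h 0 (s≤s z≤n) = count-threshold p (f ∘ suc) N t (λ c q → trans (h (suc c) (s≤s q)) (shift t c))
        where
          shift : ∀ t c → (suc t ≤ᵇ suc c) ≡ (t ≤ᵇ c)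
          shift zero    c = refl
          shift (suc t) c = refl

    -- Conversely `link` forces a jump in the hook lengths of row i: they exceed n left of column κ
    -- (d i) and are at most k from there on.
    isCore⁺ : IsPartition xs → T (isCoreB n xs)
    isCore⁺ P = core-hooks⁺ n xs P (λ r c p → neither r c p (c <? κ (d r)))
      where
        neither : ∀ r c → c < κ r → Dec (c < κ (d r)) → hook xs r c ≢ n
        neither r c p (yes q) = >⇒≢ (large r c p q)
        neither r c p (no ¬q) = <⇒≢ (s≤s (small r c p (≮⇒≥ ¬q)))

    𝔭-value : ∀ i → nth (𝔭 k xs) i ≡ μ i
    𝔭-value i = trans (nth-𝔭 k xs i) (trans (count-threshold (λ c → hook xs i c ≤ᵇ k) id (κ i) (κ (d i)) threshold)
      (trans (cong (_∸ κ (d i)) (link i)) (m+n∸n≡m (μ i) (κ (d i)))))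
      where
        threshold : ∀ c → c < κ i → (hook xs i c ≤ᵇ k) ≡ (κ (d i) ≤ᵇ c)
        threshold c p with c <? κ (d i)
        ... | yes q = trans (≤ᵇ-false (<-trans (n<1+n k) (large i c p q))) (sym (≤ᵇ-false q))
        ... | no ¬q = trans (≤ᵇ-true (small i c p (≮⇒≥ ¬q))) (sym (≤ᵇ-true (≮⇒≥ ¬q)))

-- Removing ribbons

sumTo : ℕ → (ℕ → ℕ) → ℕ
sumTo zero    f = 0
sumTo (suc N) f = sumTo N f + f N

sumTo-+ : ∀ N f g → sumTo N (λ i → f i + g i) ≡ sumTo N f + sumTo N g
sumTo-+ zero    f g = refl
sumTo-+ (suc N) f g = lia 5 0 (λ s a b c d → s := a :+ c ⇒ s :+ (b :+ d) := (a :+ b) :+ (c :+ d)) (sumTo N (λ i → f i + g i)) (sumTo N f) (f N) (sumTo N g) (g N) (sumTo-+ N f g)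

sumTo-cong : ∀ N {f g} → (∀ i → f i ≡ g i) → sumTo N f ≡ sumTo N g
sumTo-cong zero    h = refl
sumTo-cong (suc N) h = cong₂ _+_ (sumTo-cong N h) (h N)

win-split : ∀ s h i → win s (suc h) i ≡ win s h i + win (s + h) 1 i
win-split s h i with i ≟ s + h
... | yes refl = trans (win-suc-same s h) (sym (cong₂ _+_ (win-above s h (s + h) ≤-refl) (win-in (s + h) 1 (s + h) ≤-refl (m<m+n (s + h) (s≤s z≤n)))))
... | no ¬p = trans (win-suc-other s h i ¬p) (sym (trans (cong (_+_ (win s h i)) (elsewhere i ¬p)) (+-identityʳ _)))
  where
    elsewhere : ∀ i → i ≢ s + h → win (s + h) 1 i ≡ 0
    elsewhere i ne with win (s + h) 1 i | winView (s + h) 1 i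
    ... | _ | before _ = refl
    ... | _ | after _  = refl
    ... | _ | within p q = ⊥-elim (ne (≤-antisym (≤-pred (subst (i <_) (+-comm (s + h) 1) q)) p))

win-zero : ∀ s i → win s 0 i ≡ 0
win-zero s i with win s 0 i | winView s 0 i
... | _ | before _ = refl
... | _ | after _  = refl
... | _ | within p q = ⊥-elim (<⇒≱ q (≤-trans (≤-reflexive (+-identityʳ s)) p))

sumTo-point : ∀ N v → v < N → sumTo N (win v 1) ≡ 1
sumTo-point N v p = on N p
  where
    off : ∀ N → N ≤ v → sumTo N (win v 1) ≡ 0
    off zero    q = refl
    off (suc N) q = cong₂ _+_ (off N (<⇒≤ q)) (win-below v 1 N q)
    on : ∀ N → v < N → sumTo N (win v 1) ≡ 1
    on (suc N) q with m≤n⇒m<n∨m≡n (≤-pred q)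
    ... | inj₁ r = cong₂ _+_ (on N r) (win-above v 1 N (subst (_≤ N) (+-comm 1 v) r))
    ... | inj₂ refl = cong₂ _+_ (off v ≤-refl) (win-in v 1 v ≤-refl (m<m+n v (s≤s z≤n)))

sumTo-win : ∀ N s h → s + h ≤ N → sumTo N (win s h) ≡ h
sumTo-win N s zero    p = trans (sumTo-cong N (win-zero s)) (zeros N)
  where
    zeros : ∀ N → sumTo N (λ _ → 0) ≡ 0
    zeros zero    = refl
    zeros (suc N) = trans (+-identityʳ _) (zeros N)
sumTo-win N s (suc h) p = trans (sumTo-cong N (win-split s h)) (trans (sumTo-+ N (win s h) (win (s + h) 1))
  (trans (cong₂ _+_ (sumTo-win N s h (≤-trans (+-monoʳ-≤ s (n≤1+n h)) p)) (sumTo-point N (s + h) (subst (_≤ N) (+-suc s h) p))) (+-comm h 1)))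

-- Induction upwards from row ℓ, with f bounding the distance to it: in τ_i = ν_i + τ_{down i} the
-- first summand decreases, and the second refers to rows further down.
link-antitone : ∀ {n ν} (Bd : Bounded n ν) (τ : ℕ → ℕ) ℓ → (∀ i → τ i ≡ ν i + τ (i + (n ∸ ν i))) → (∀ i → ℓ ≤ i → τ i ≡ 0) → Antitone τ
link-antitone {n} {ν} Bd τ ℓ link zero-τ i = go ℓ i (m≤n+m ℓ i)
  where
    open Rows Bd
    go : ∀ f i → ℓ ≤ i + f → τ (suc i) ≤ τ i
    go zero    i p = ≤-trans (≤-reflexive (zero-τ (suc i) (m≤n⇒m≤1+n (subst (ℓ ≤_) (+-identityʳ i) p)))) z≤n
    go (suc f) i p = subst₂ _≤_ (sym (link (suc i))) (sym (link i)) (+-mono-≤ (Bounded.decreasing Bd i)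
      (subst (λ j → τ j ≤ τ (down i)) (m+[n∸m]≡n (<⇒≤ (down-suc i))) (chain (down (suc i) ∸ down i))))
      where
        chain : ∀ s → τ (down i + s) ≤ τ (down i)
        chain zero    = ≤-reflexive (cong τ (+-identityʳ (down i)))
        chain (suc s) = ≤-trans (subst (λ j → τ j ≤ τ (down i + s)) (sym (+-suc (down i) s))
          (go f (down i + s) (lia 5 0 (λ l i f d s → l :≤ i :+ (♯ 1 :+ f) ⇒ i :< d ⇒ l :≤ d :+ s :+ f) ℓ i f (down i) s p (down-above i)))) (chain s)

module Cover {n : ℕ} {κ μ : ℕ → ℕ} (D : CoreData n κ μ) (ℓ : ℕ) (finite : ∀ i → ℓ ≤ i → κ i ≡ 0) where
  open CoreData D
  open Rows bounded-μ

  μ≤κ : ∀ i → μ i ≤ κ i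
  μ≤κ i = ≤-trans (m≤m+n (μ i) _) (≤-reflexive (sym (link i)))

  μ-finite : ∀ i → ℓ ≤ i → μ i ≡ 0
  μ-finite i p = n≤0⇒n≡0 (≤-trans (μ≤κ i) (≤-reflexive (finite i p)))

  inside-ℓ : ∀ i → 1 ≤ μ i → i < ℓ
  inside-ℓ i p = ≰⇒> (λ q → <⇒≢ p (sym (μ-finite i q)))

  module Removal {w : ℕ} (G : Good w) where
    y x h d : ℕ
    y = Good.top G
    x = Good.extra G
    h = suc x
    d = down w

    rs : List ℕ
    rs = Good.rows G

    U : Ups w y rs
    U = Good.runner G

    flat : ∀ {r} → r ∈ rs → ∀ s → s ≤ x → μ (r + s) ≡ μ r
    flat r∈ s p = Good.flat G r∈ s (s≤s p)

    sep : ∀ {r} → r ∈ rs → r + h ≤ down r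
    sep = room-up U (Good.flat G) (Good.room G)

    y≤w : y ≤ w
    y≤w = ups-≥ U (ups-head U)

    InBlock : ℕ → ℕ → Set
    InBlock r i = r ≤ i × i < r + h

    inBlock? : ∀ r i → Dec (InBlock r i)
    inBlock? r i with r ≤? i | i <? r + h
    ... | yes p | yes q = yes (p , q)
    ... | no ¬p | _     = no (¬p ∘ proj₁)
    ... | yes _ | no ¬q = no (¬q ∘ proj₂)

    data Block (i : ℕ) : Set where
      at      : ∀ r → r ∈ rs → InBlock r i → Block i
      nowhere : (∀ {r} → r ∈ rs → ¬ InBlock r i) → Block i

    block : ∀ i → Block i
    block i = go rs (λ p → p) (λ r∈ ¬r∈ → ⊥-elim (¬r∈ r∈))
      where
        go : ∀ rs' → (∀ {r} → r ∈ rs' → r ∈ rs) → (∀ {r} → r ∈ rs → ¬ (r ∈ rs') → ¬ InBlock r i) → Block i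
        go []       sub out = nowhere (λ r∈ → out r∈ (λ ()))
        go (r ∷ rs') sub out with inBlock? r i
        ... | yes p = at r (sub (here refl)) p
        ... | no ¬p = go rs' (sub ∘ there) (λ r∈ ¬r∈ → λ b → out r∈ (λ { (here refl) → ¬p b ; (there q) → ¬r∈ q }) b)

    block-unique : ∀ {r r' i} → r ∈ rs → r' ∈ rs → InBlock r i → InBlock r' i → r ≡ r'
    block-unique r∈ r'∈ b b' = ≤-antisym (le r'∈ r∈ b' b) (le r∈ r'∈ b b')
      where
        le : ∀ {r r' i} → r ∈ rs → r' ∈ rs → InBlock r i → InBlock r' i → r' ≤ r
        le {r} {r'} {i} r∈ r'∈ (_ , q) (p' , _) with ups-separated U r∈ r'∈
        ... | inj₁ z = z
        ... | inj₂ z = ⊥-elim (<⇒≱ q (≤-trans (sep r∈) (≤-trans z p')))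

    -- The first h - 1 rows of a block receive the next row shortened by one box.
    τ : ℕ → ℕ
    τ i with block i
    ... | nowhere _ = κ i
    ... | at r _ _ with i <? r + x
    ...   | yes _ = κ (suc i) ∸ 1
    ...   | no _  = (κ r + κ (d + h)) ∸ suc (κ d)

    τ-out : ∀ i → (∀ {r} → r ∈ rs → ¬ InBlock r i) → τ i ≡ κ i
    τ-out i h with block i
    ... | nowhere _ = refl
    ... | at r r∈ b = ⊥-elim (h r∈ b)

    τ-mid′ : ∀ r s → r ∈ rs → s < x → τ (r + s) ≡ κ (suc (r + s)) ∸ 1
    τ-mid′ r s r∈ p with block (r + s)
    ... | nowhere out = ⊥-elim (out r∈ (m≤m+n r s , +-monoʳ-< r (m<n⇒m<1+n p)))
    ... | at r' r'∈ b with block-unique r∈ r'∈ (m≤m+n r s , +-monoʳ-< r (m<n⇒m<1+n p)) b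
    ...   | refl with r + s <? r + x
    ...     | yes _ = refl
    ...     | no ¬q = ⊥-elim (¬q (+-monoʳ-< r p))

    τ-end′ : ∀ r → r ∈ rs → τ (r + x) ≡ (κ r + κ (d + h)) ∸ suc (κ d)
    τ-end′ r r∈ with block (r + x)
    ... | nowhere out = ⊥-elim (out r∈ (m≤m+n r x , +-monoʳ-< r ≤-refl))
    ... | at r' r'∈ b with block-unique r∈ r'∈ (m≤m+n r x , +-monoʳ-< r ≤-refl) b
    ...   | refl with r + x <? r + x
    ...     | yes q = ⊥-elim (<-irrefl refl q)
    ...     | no _  = refl

    μ-rows : ∀ {r} → r ∈ rs → 1 ≤ μ r
    μ-rows {r} r∈ = ≤-trans (Good.positive G) (subst (λ j → μ j ≤ μ r) (m+[n∸m]≡n (ups-≤ U r∈)) (μ-antitone r (w ∸ r)))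

    μ-block : ∀ {r} s → r ∈ rs → s ≤ x → 1 ≤ μ (r + s)
    μ-block s r∈ p = subst (1 ≤_) (sym (flat r∈ s p)) (μ-rows r∈)

    along : (P : ℕ → Set) → P w → (∀ {u r} → u ∈ rs → r ∈ rs → down u ≡ r → P r → P u) → ∀ {r} → r ∈ rs → P r
    along P base ind = go U (λ p → p) base
      where
        go : ∀ {v y' rs'} → Ups v y' rs' → (∀ {r} → r ∈ rs' → r ∈ rs) → P v → ∀ {r} → r ∈ rs' → P r
        go (last _) sub p (here refl) = p
        go (up e q) sub p (here refl) = p
        go (up e q) sub p (there r∈) = go q (sub ∘ there) (ind (sub (there (ups-head q))) (sub (here refl)) e p) r∈

    link-flat : ∀ r s → μ (r + s) ≡ μ r → κ (r + s) ≡ μ r + κ (down r + s)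
    link-flat r s e = trans (link (r + s)) (cong₂ (λ a b → a + κ b) e (down-flat r s e))

    -- As μ is constant on each block, `link` passes the differences of row lengths unchanged from
    -- one block to the next, and finally to the rows from d on.
    κ-parallel : ∀ {r} → r ∈ rs → ∀ s → s ≤ x → κ (r + s) + κ d ≡ κ r + κ (d + s)
    κ-parallel = along (λ r → ∀ s → s ≤ x → κ (r + s) + κ d ≡ κ r + κ (d + s))
      (λ s p → lia 5 0 (λ a b c e m → a := m :+ e ⇒ c := m :+ b ⇒ a :+ b := c :+ e) (κ (w + s)) (κ d) (κ w) (κ (d + s)) (μ w)
        (link-flat w s (flat (ups-head U) s p)) (link w))
      (λ {u} {r} u∈ r∈ e ih s p → lia 7 0 (λ us u rs r kd ds m → us := m :+ rs ⇒ u := m :+ r ⇒ rs :+ kd := r :+ ds ⇒ us :+ kd := u :+ ds)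
        (κ (u + s)) (κ u) (κ (r + s)) (κ r) (κ d) (κ (d + s)) (μ u)
        (trans (link-flat u s (flat u∈ s p)) (cong (λ j → μ u + κ (j + s)) e)) (trans (link u) (cong (λ j → μ u + κ j) e)) (ih s p))

    -- The drop of μ below the block of w gives one unit of slack, which persists up the runner
    -- because μ decreases. It prevents the subtraction in `τ` from truncating and keeps the last
    -- row of a block at least as long as the row after it.
    κ-gap : ∀ {r} → r ∈ rs → κ (r + h) + suc (κ d) ≤ κ r + κ (d + h)
    κ-gap = along (λ r → κ (r + h) + suc (κ d) ≤ κ r + κ (d + h))
      (lia 7 0 (λ a kd kw dh m m' z → a := m' :+ z ⇒ z :≤ dh ⇒ m' :< m ⇒ kw := m :+ kd ⇒ a :+ (♯ 1 :+ kd) :≤ kw :+ dh)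
        (κ (w + h)) (κ d) (κ w) (κ (d + h)) (μ w) (μ (w + h)) (κ (down (w + h))) (link (w + h)) (antitone-≤ κ-antitone (down-far w h)) (Good.drop G) (link w))
      (λ {u} {r} u∈ r∈ e ih → lia 9 0 (λ uh u rh r kd dh m m' z → uh := m' :+ z ⇒ z :≤ rh ⇒ m' :≤ m ⇒ u := m :+ r ⇒ rh :+ (♯ 1 :+ kd) :≤ r :+ dh ⇒ uh :+ (♯ 1 :+ kd) :≤ u :+ dh)
        (κ (u + h)) (κ u) (κ (r + h)) (κ r) (κ d) (κ (d + h)) (μ u) (μ (u + h)) (κ (down (u + h))) (link (u + h))
        (antitone-≤ κ-antitone (subst (λ j → j + h ≤ down (u + h)) e (down-far u h))) (μ-antitone u h) (trans (link u) (cong (λ j → μ u + κ j) e)) ih)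
      where
        down-far : ∀ r s → down r + s ≤ down (r + s)
        down-far r s = lia 7 0 (λ r s n x y a b → x :+ a := r :+ s :+ n ⇒ y :+ b := r :+ n ⇒ a :≤ b ⇒ y :+ s :≤ x)
          r s n (down (r + s)) (down r) (μ (r + s)) (μ r) (down-μ (r + s)) (down-μ r) (μ-antitone r s)

    τ-mid : ∀ {r} s → r ∈ rs → s < x → suc (τ (r + s)) ≡ κ (suc (r + s))
    τ-mid {r} s r∈ p = trans (cong suc (τ-mid′ r s r∈ p)) (m+[n∸m]≡n (≤-trans (subst (λ j → 1 ≤ μ j) (+-suc r s) (μ-block (suc s) r∈ p)) (μ≤κ _)))

    -- In terms of beads: the bead of every runner row moves down by the distance between the beads
    -- of rows d and d + h, the same for all blocks. It passes the other h - 1 beads of its block;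
    -- these keep their positions and move up one row.
    τ-end : ∀ {r} → r ∈ rs → τ (r + x) + suc (κ d) ≡ κ r + κ (d + h)
    τ-end {r} r∈ = trans (cong (_+ suc (κ d)) (τ-end′ r r∈)) (m∸n+n≡m (≤-trans (m≤n+m (suc (κ d)) (κ (r + h))) (κ-gap r∈)))

    split-block : ∀ {r i} → InBlock r i → ∃ λ s → s ≤ x × r + s ≡ i
    split-block {r} {i} (p , q) = i ∸ r , lia 4 0 (λ r i s x → r :+ s := i ⇒ i :< r :+ (♯ 1 :+ x) ⇒ s :≤ x) r i (i ∸ r) x (m+[n∸m]≡n p) q , m+[n∸m]≡n p

    τ≤κ : ∀ i → τ i ≤ κ i
    τ≤κ i with block i in eq
    ... | nowhere _ = ≤-refl
    ... | at r r∈ b with split-block b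
    ...   | s , s≤x , refl with m≤n⇒m<n∨m≡n s≤x
    ...     | inj₁ s<x with r + s <? r + x
    ...       | yes _ = ≤-trans (m∸n≤m _ 1) (κ-antitone (r + s))
    ...       | no ¬q = ⊥-elim (¬q (+-monoʳ-< r s<x))
    τ≤κ i | at r r∈ b | s , s≤x , refl | inj₂ refl with r + s <? r + s
    ...       | yes q = ⊥-elim (<-irrefl refl q)
    ...       | no _ = lia 6 0 (λ t kd kr dh ds krs → t :+ (♯ 1 :+ kd) := kr :+ dh ⇒ krs :+ kd := kr :+ ds ⇒ dh :≤ ds ⇒ t :≤ krs)
                ((κ r + κ (d + h)) ∸ suc (κ d)) (κ d) (κ r) (κ (d + h)) (κ (d + x)) (κ (r + x))
                (m∸n+n≡m (≤-trans (m≤n+m (suc (κ d)) (κ (r + h))) (κ-gap r∈))) (κ-parallel r∈ x ≤-refl) (antitone-≤ κ-antitone (+-monoʳ-≤ d (n≤1+n x)))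

    τ<κ : ∀ {r} s → r ∈ rs → s ≤ x → τ (r + s) < κ (r + s)
    τ<κ {r} s r∈ p with m≤n⇒m<n∨m≡n p
    ... | inj₁ q = ≤-trans (≤-reflexive (τ-mid s r∈ q)) (κ-antitone (r + s))
    ... | inj₂ refl = lia 6 0 (λ t kd kr dh ds krs → t :+ (♯ 1 :+ kd) := kr :+ dh ⇒ krs :+ kd := kr :+ ds ⇒ dh :≤ ds ⇒ t :< krs)
                (τ (r + x)) (κ d) (κ r) (κ (d + h)) (κ (d + x)) (κ (r + x)) (τ-end r∈) (κ-parallel r∈ x ≤-refl) (antitone-≤ κ-antitone (+-monoʳ-≤ d (n≤1+n x)))

    τ-beyond-block : ∀ {r} → r ∈ rs → κ (r + h) ≤ τ (r + x)
    τ-beyond-block {r} r∈ = lia 5 0 (λ t kd kr dh rh → t :+ (♯ 1 :+ kd) := kr :+ dh ⇒ rh :+ (♯ 1 :+ kd) :≤ kr :+ dh ⇒ rh :≤ t)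
      (τ (r + x)) (κ d) (κ r) (κ (d + h)) (κ (r + h)) (τ-end r∈) (κ-gap r∈)

    τ-finite : ∀ i → ℓ ≤ i → τ i ≡ 0
    τ-finite i p = n≤0⇒n≡0 (≤-trans (τ≤κ i) (≤-reflexive (finite i p)))

    ν : ℕ → ℕ
    ν = newμ w y x

    private
      far : ∀ i → w ≤ i → suc y + x ≤ down i
      far i p = lia 5 0 (λ w x y dw di → y :≤ w ⇒ w :+ (♯ 1 :+ x) :≤ dw ⇒ dw :≤ di ⇒ ♯ 1 :+ y :+ x :≤ di) w x y d (down i) y≤w (Good.room G) (down-mono-≤ p)

    ν-bottom : ∀ i → w ≤ i → i < w + h → ν i ≡ μ i ∸ 1
    ν-bottom i p q = cong₂ _∸_ (trans (cong (_+_ (μ i)) (win-above (suc y) x (down i) (far i p))) (+-identityʳ _)) (win-in w h i p q)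

    ν-top : ∀ i → y < down i → down i ≤ y + x → ν i ≡ suc (μ i)
    ν-top i p q = trans (cong₂ (λ a b → (μ i + a) ∸ b) (win-in (suc y) x (down i) p (s≤s q)) (win-below w h i (≰⇒> (λ r → <⇒≱ (s≤s q) (far i r))))) (+-comm (μ i) 1)

    ν-same : ∀ i → ¬ InBlock w i → (y < down i → down i ≤ y + x → ⊥) → ν i ≡ μ i
    ν-same i ¬b ¬t = trans (cong₂ (λ a b → (μ i + a) ∸ b) no-top no-block) (+-identityʳ _)
      where
        no-top : win (suc y) x (down i) ≡ 0
        no-top with win (suc y) x (down i) | winView (suc y) x (down i)
        ... | _ | before _ = refl
        ... | _ | after _  = refl
        ... | _ | within p q = ⊥-elim (¬t p (≤-pred q))
        no-block : win w h i ≡ 0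
        no-block with win w h i | winView w h i
        ... | _ | before _ = refl
        ... | _ | after _  = refl
        ... | _ | within p q = ⊥-elim (¬b (p , q))

    -- The rows of the blocks are `bottom` in the block of w and `middle` in the others; `crown`
    -- rows point into the block of y strictly below its first row and gain a box. In a `plain` row
    -- neither the core nor the residue changes.
    data Kind (i : ℕ) : Set where
      bottom : ∀ s → s ≤ x → w + s ≡ i → Kind i
      middle : ∀ r s → r ∈ rs → down r ∈ rs → s ≤ x → r + s ≡ i → Kind i
      crown  : ∀ s → 1 ≤ s → s ≤ x → down i ≡ y + s → i < y → Kind i
      plain  : (∀ {r} → r ∈ rs → ¬ InBlock r i) → (y < down i → down i ≤ y + x → ⊥) → Kind i

    crown-above : ∀ i s → s ≤ x → down i ≡ y + s → i < y
    crown-above i s p e = down-reflects (<-≤-trans (lia 4 0 (λ di y s x → di := y :+ s ⇒ s :≤ x ⇒ di :< y :+ (♯ 1 :+ x)) (down i) y s x e p) (sep (ups-last U)))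

    kind : ∀ i → Kind i
    kind i with block i
    ... | at r r∈ b with split-block b | ups-down U r∈
    ...   | s , p , e | inj₁ refl = bottom s p e
    ...   | s , p , e | inj₂ d∈  = middle r s r∈ d∈ p e
    kind i | nowhere out with suc y ≤? down i | down i ≤? y + x
    ... | yes p | yes q = crown (down i ∸ y) (m<n⇒0<n∸m p) (lia 4 0 (λ y s x di → y :+ s := di ⇒ di :≤ y :+ x ⇒ s :≤ x) y (down i ∸ y) x (down i) (m+[n∸m]≡n (<⇒≤ p)) q)
            (sym (m+[n∸m]≡n (<⇒≤ p))) (crown-above i (down i ∸ y) (lia 4 0 (λ y s x di → y :+ s := di ⇒ di :≤ y :+ x ⇒ s :≤ x) y (down i ∸ y) x (down i) (m+[n∸m]≡n (<⇒≤ p)) q) (sym (m+[n∸m]≡n (<⇒≤ p))))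
    ... | no ¬p | _     = plain out (λ p _ → ¬p p)
    ... | yes _ | no ¬q = plain out (λ _ q → ¬q q)

    not-in-block : ∀ i → i < y → ∀ {r} → r ∈ rs → ¬ InBlock r i
    not-in-block i p r∈ (q , _) = <⇒≱ p (≤-trans (ups-≥ U r∈) q)

    after-blocks : ∀ i → d ≤ i → ∀ {r} → r ∈ rs → ¬ InBlock r i
    after-blocks i p {r} r∈ (_ , q) with m≤n⇒m<n∨m≡n (ups-≤ U r∈)
    ... | inj₂ refl = <⇒≱ q (≤-trans (Good.room G) p)
    ... | inj₁ r<w = <⇒≱ q (≤-trans (sep r∈) (≤-trans (<⇒≤ (down-mono r<w)) p))

    -- A row of a block is pointed to only from the corresponding row of the block above. For the
    -- topmost block these rows are the crown, and row y itself is pointed to by no row.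
    preimage : ∀ i → (∀ {r} → r ∈ rs → ¬ InBlock r i) → (y < down i → down i ≤ y + x → ⊥) → ∀ {r} → r ∈ rs → ¬ InBlock r (down i)
    preimage i out ¬t {r} r∈ b with split-block b
    ... | s , p , e = go U (λ q → q) r∈
      where
        go : ∀ {v y' rs'} → Ups v y' rs' → (∀ {r} → r ∈ rs' → r ∈ rs) → r ∈ rs' → ⊥
        go (last h') sub (here refl) = top-case (ups-functional′ h')
          where
            ups-functional′ : (∀ j → down j ≢ r) → r ≡ y
            ups-functional′ h' = top-of U r∈ h'
              where
                top-of : ∀ {v y rs'} → Ups v y rs' → r ∈ rs' → (∀ j → down j ≢ r) → r ≡ y
                top-of (last _) (here refl) _ = refl
                top-of (up e q) (here refl) h = ⊥-elim (h _ e)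
                top-of (up e q) (there m) h = top-of q m h
            top-case : r ≡ y → ⊥
            top-case r≡y = by s p e
              where
                by : ∀ s → s ≤ x → r + s ≡ down i → ⊥
                by zero    p e = h' i (trans (sym e) (+-identityʳ r))
                by (suc s) p e = ¬t (subst₂ _<_ r≡y e (m<m+n r (s≤s z≤n))) (≤-trans (≤-reflexive (sym e)) (+-mono-≤ (≤-reflexive r≡y) p))
        go (up {u = u} e' q) sub (here refl) = out (sub (there (ups-head q))) (subst (InBlock u) u+s≡i (m≤m+n u s , +-monoʳ-< u (s≤s p)))
          where
            u+s≡i : u + s ≡ i
            u+s≡i = down-injective (trans (down-flat u s (flat (sub (there (ups-head q))) s p)) (trans (cong (_+ s) e') e))
        go (up e' q) sub (there m) = go q (sub ∘ there) m

    -- In `middle` rows the change of a row and of the row it points to cancel. At the two ends of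
    -- the runner only one of the two changes, and the difference appears in ν as the box lost at
    -- the bottom or gained in the crown.
    τ-link : ∀ i → τ i ≡ ν i + τ (i + (n ∸ ν i))
    τ-link i with kind i
    ... | plain out ¬t = begin′
      where
        νi : ν i ≡ μ i
        νi = ν-same i (out (ups-head U)) ¬t
        begin′ : τ i ≡ ν i + τ (i + (n ∸ ν i))
        begin′ = trans (τ-out i out) (trans (link i) (sym (cong₂ _+_ νi (trans (cong (λ m → τ (i + (n ∸ m))) νi) (τ-out (down i) (preimage i out ¬t))))))
    ... | crown (suc s) _ p e i<y = trans (τ-out i (not-in-block i i<y)) (trans (link i)
            (trans (lia 3 0 (λ m a b → ♯ 1 :+ a := b ⇒ m :+ b := ♯ 1 :+ m :+ a) (μ i) (τ (y + s)) (κ (down i)) (trans (τ-mid s (ups-last U) p) (cong κ (trans (sym (+-suc y s)) (sym e)))))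
              (sym (cong₂ _+_ νi (cong τ target)))))
      where
        νi : ν i ≡ suc (μ i)
        νi = ν-top i (subst (y <_) (sym e) (m<m+n y (s≤s z≤n))) (≤-trans (≤-reflexive e) (+-monoʳ-≤ y p))
        target : i + (n ∸ ν i) ≡ y + s
        target = lia 8 0 (λ i n m v k di y s → v := ♯ 1 :+ m ⇒ k :+ v := n ⇒ di :+ m := i :+ n ⇒ di := y :+ (♯ 1 :+ s) ⇒ i :+ k := y :+ s) i n (μ i) (ν i) (n ∸ ν i) (down i) y s
          νi (m∸n+n≡m (subst (_≤ n) (sym νi) (Bounded.ceiling bounded-μ i))) (down-μ i) e
    ... | middle r s r∈ d∈ p refl = trans core (sym (cong₂ _+_ νi (cong (λ m → τ (r + s + (n ∸ m))) νi)))
      where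
        r<w : down r ≤ w
        r<w = ups-≤ U d∈
        νi : ν (r + s) ≡ μ (r + s)
        νi = ν-same (r + s)
          (λ (q , _) → <⇒≱ (<-≤-trans (+-monoʳ-< r (s≤s p)) (≤-trans (sep r∈) r<w)) q)
          (λ _ q → lia 6 0 (λ dr r s y x drs → drs := dr :+ s ⇒ drs :≤ y :+ x ⇒ r :+ (♯ 1 :+ x) :≤ dr ⇒ y :≤ r ⇒ :⊥) (down r) r s y x (down (r + s))
            (down-flat r s (flat r∈ s p)) q (sep r∈) (ups-≥ U r∈))
        core : τ (r + s) ≡ μ (r + s) + τ (down (r + s))
        core with m≤n⇒m<n∨m≡n p
        ... | inj₁ q = lia 6 0 (λ t t' k k' m m' → ♯ 1 :+ t := k ⇒ k := m' :+ k' ⇒ ♯ 1 :+ t' := k' ⇒ m := m' ⇒ t := m :+ t')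
              (τ (r + s)) (τ (down (r + s))) (κ (suc (r + s))) (κ (suc (down r + s))) (μ (r + s)) (μ r)
              (τ-mid s r∈ q) (trans (cong κ (sym (+-suc r s))) (trans (link-flat r (suc s) (flat r∈ (suc s) q)) (cong (λ j → μ r + κ j) (+-suc (down r) s))))
              (trans (cong (λ j → suc (τ j)) (down-flat r s (flat r∈ s p))) (τ-mid s d∈ q)) (flat r∈ s p)
        ... | inj₂ refl = lia 8 0 (λ t t' kd dh k k' m m' → t :+ (♯ 1 :+ kd) := k :+ dh ⇒ t' :+ (♯ 1 :+ kd) := k' :+ dh ⇒ k := m' :+ k' ⇒ m := m' ⇒ t := m :+ t')
              (τ (r + x)) (τ (down (r + x))) (κ d) (κ (d + h)) (κ r) (κ (down r)) (μ (r + x)) (μ r)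
              (τ-end r∈) (trans (cong (λ j → τ j + suc (κ d)) (down-flat r s (flat r∈ s p))) (τ-end d∈)) (link r) (flat r∈ s p)
    ... | bottom s p refl = trans core (sym (cong (_+_ (ν (w + s))) (trans (cong τ target) (τ-out (d + suc s) (after-blocks (d + suc s) (m≤m+n d (suc s)))))))
      where
        w∈ : w ∈ rs
        w∈ = ups-head U
        νi : suc (ν (w + s)) ≡ μ (w + s)
        νi = trans (cong suc (ν-bottom (w + s) (m≤m+n w s) (+-monoʳ-< w (s≤s p)))) (m+[n∸m]≡n (μ-block s w∈ p))
        target : w + s + (n ∸ ν (w + s)) ≡ d + suc s
        target = lia 8 0 (λ w s n m v k d ds → ♯ 1 :+ v := m ⇒ k :+ v := n ⇒ ds :+ m := w :+ s :+ n ⇒ ds := d :+ s ⇒ w :+ s :+ k := d :+ (♯ 1 :+ s)) w s n (μ (w + s)) (ν (w + s)) (n ∸ ν (w + s)) d (down (w + s))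
          νi (m∸n+n≡m (≤-trans (n≤1+n _) (≤-trans (≤-reflexive νi) (<⇒≤ (Bounded.ceiling bounded-μ (w + s)))))) (down-μ (w + s)) (down-flat w s (flat w∈ s p))
        core : τ (w + s) ≡ ν (w + s) + κ (d + suc s)
        core with m≤n⇒m<n∨m≡n p
        ... | inj₁ q = lia 6 0 (λ t v k k' m m' → ♯ 1 :+ t := k ⇒ k := m' :+ k' ⇒ ♯ 1 :+ v := m ⇒ m := m' ⇒ t := v :+ k')
              (τ (w + s)) (ν (w + s)) (κ (suc (w + s))) (κ (d + suc s)) (μ (w + s)) (μ w)
              (τ-mid s w∈ q) (trans (cong κ (sym (+-suc w s))) (link-flat w (suc s) (flat w∈ (suc s) q))) νi (flat w∈ s p)
        ... | inj₂ refl = lia 7 0 (λ t v kd dh k m m' → t :+ (♯ 1 :+ kd) := k :+ dh ⇒ k := m' :+ kd ⇒ ♯ 1 :+ v := m ⇒ m := m' ⇒ t := v :+ dh)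
              (τ (w + x)) (ν (w + x)) (κ d) (κ (d + h)) (κ w) (μ (w + x)) (μ w) (τ-end w∈) (link w) νi (flat w∈ s p)

    balance : ∀ i → ν i + win w h i ≡ μ i + win (suc y) x (down i)
    balance i = m∸n+n≡m covered
      where
        covered : win w h i ≤ μ i + win (suc y) x (down i)
        covered with win w h i | winView w h i
        ... | _ | before _ = z≤n
        ... | _ | after _  = z≤n
        ... | _ | within p q with split-block (p , q)
        ...   | s , s≤x , refl = ≤-trans (μ-block s (ups-head U) s≤x) (m≤m+n _ _)

    ν-bounded : Bounded n ν
    ν-bounded = record { decreasing = dec ; ceiling = bnd }
      where
        bnd : ∀ i → ν i < n
        bnd i = by (win (suc y) x (down i)) refl (winView (suc y) x (down i))
          where
            easy : win (suc y) x (down i) ≡ 0 → ν i < n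
            easy e = lia 5 0 (λ v a m b n → v :+ a := m :+ b ⇒ b := ♯ 0 ⇒ m :< n ⇒ v :< n) (ν i) (win w h i) (μ i) (win (suc y) x (down i)) n (balance i) e (Bounded.ceiling bounded-μ i)
            by : ∀ b → win (suc y) x (down i) ≡ b → WinView (suc y) x (down i) b → ν i < n
            by _ e (before _) = easy e
            by _ e (after _)  = easy e
            -- A crown row lies above y and points below y, hence at least two rows down; so its
            -- residue is at most n - 2 and has space for one more box.
            by _ e (within p q) = lia 8 0 (λ v a m n i di y b → v :+ a := m :+ b ⇒ b := ♯ 1 ⇒ di :+ m := i :+ n ⇒ i :< y ⇒ y :< di ⇒ v :< n) (ν i) (win w h i) (μ i) n i (down i) y (win (suc y) x (down i))
              (balance i) e (down-μ i) (crown-above i (down i ∸ y) (lia 4 0 (λ y s x di → y :+ s := di ⇒ di :< ♯ 1 :+ (y :+ x) ⇒ s :≤ x) y (down i ∸ y) x (down i) (m+[n∸m]≡n (<⇒≤ p)) q) (sym (m+[n∸m]≡n (<⇒≤ p)))) p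
        dec-inside : ∀ i → w ≤ i → i < w + h → Dec (suc i < w + h) → ν (suc i) ≤ ν i
        dec-inside i p q (yes q') = lia 8 0 (λ v a m b v' a' m' b' → v :+ a := m :+ b ⇒ v' :+ a' := m' :+ b' ⇒ a := ♯ 1 ⇒ a' := ♯ 1 ⇒ b' := ♯ 0 ⇒ m' :≤ m ⇒ v' :≤ v)
                (ν i) (win w h i) (μ i) (win (suc y) x (down i)) (ν (suc i)) (win w h (suc i)) (μ (suc i)) (win (suc y) x (down (suc i)))
                (balance i) (balance (suc i)) (win-in w h i p q) (win-in w h (suc i) (m≤n⇒m≤1+n p) q') (win-above (suc y) x (down (suc i)) (far (suc i) (m≤n⇒m≤1+n p))) (Bounded.decreasing bounded-μ i)
        dec-inside i p q (no ¬q') = lia 8 0 (λ v a m b v' a' m' b' → v :+ a := m :+ b ⇒ v' :+ a' := m' :+ b' ⇒ a := ♯ 1 ⇒ b' := ♯ 0 ⇒ m' :< m ⇒ v' :≤ v)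
                (ν i) (win w h i) (μ i) (win (suc y) x (down i)) (ν (suc i)) (win w h (suc i)) (μ (suc i)) (win (suc y) x (down (suc i)))
                (balance i) (balance (suc i)) (win-in w h i p q) (win-above (suc y) x (down (suc i)) (far (suc i) (m≤n⇒m≤1+n p))) dropped
          where
            i+1≡ : suc i ≡ w + h
            i+1≡ = ≤-antisym q (≮⇒≥ ¬q')
            dropped : μ (suc i) < μ i
            dropped with split-block (p , q)
            ... | s , s≤x , refl = subst₂ _<_ (cong μ (sym i+1≡)) (sym (flat (ups-head U) s s≤x)) (Good.drop G)
        dec-outside : ∀ i → ¬ InBlock w i → ν (suc i) ≤ ν i
        dec-outside i ¬b = by (win (suc y) x (down (suc i))) refl (winView (suc y) x (down (suc i))) (win (suc y) x (down i)) refl (winView (suc y) x (down i))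
          where
            win-not : win w h i ≡ 0
            win-not with win w h i | winView w h i
            ... | _ | before _ = refl
            ... | _ | after _  = refl
            ... | _ | within p q = ⊥-elim (¬b (p , q))
            compare : ∀ b b' → win (suc y) x (down i) ≡ b → win (suc y) x (down (suc i)) ≡ b' → μ (suc i) + b' ≤ μ i + b → ν (suc i) ≤ ν i
            compare b b' e e' le = lia 8 0 (λ v a m b v' a' m' b' → v :+ a := m :+ b ⇒ v' :+ a' := m' :+ b' ⇒ a := ♯ 0 ⇒ m' :+ b' :≤ m :+ b ⇒ v' :≤ v)
              (ν i) (win w h i) (μ i) b (ν (suc i)) (win w h (suc i)) (μ (suc i)) b' (trans (balance i) (cong (_+_ (μ i)) e)) (trans (balance (suc i)) (cong (_+_ (μ (suc i))) e')) win-not le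
            by : ∀ b' → win (suc y) x (down (suc i)) ≡ b' → WinView (suc y) x (down (suc i)) b' → ∀ b → win (suc y) x (down i) ≡ b → WinView (suc y) x (down i) b → ν (suc i) ≤ ν i
            by _ e' (before _)   b e _ = compare b 0 e e' (+-mono-≤ (Bounded.decreasing bounded-μ i) z≤n)
            by _ e' (after _)    b e _ = compare b 0 e e' (+-mono-≤ (Bounded.decreasing bounded-μ i) z≤n)
            by _ e' (within p' q') _ e (within p q) = compare 1 1 e e' (+-monoˡ-≤ 1 (Bounded.decreasing bounded-μ i))
            by _ e' (within p' q') _ e (after r) = ⊥-elim (<⇒≱ (<-trans (down-suc i) q') r)
            -- `down` jumps over y because no row points to the top of the runner. So μ drops from
            -- row i to row i + 1, and the box added to row i + 1 fits.
            by _ e' (within p' q') _ e (before r) = compare 0 1 e e' (lia 7 0 (λ m m' i n d d' y → d :+ m := i :+ n ⇒ d' :+ m' := ♯ 1 :+ i :+ n ⇒ d :< y ⇒ y :< d' ⇒ m' :+ ♯ 1 :≤ m :+ ♯ 0)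
              (μ i) (μ (suc i)) i n (down i) (down (suc i)) y (down-μ i) (down-μ (suc i)) (≤∧≢⇒< (≤-pred r) (ups-no-up U i)) p')

        dec : ∀ i → ν (suc i) ≤ ν i
        dec i with inBlock? w i
        ... | yes (p , q) = dec-inside i p q (suc i <? w + h)
        ... | no ¬b       = dec-outside i ¬b

    newCore : CoreData n τ ν
    newCore = record { κ-antitone = link-antitone ν-bounded τ ℓ τ-link τ-finite ; link = τ-link ; bounded-μ = ν-bounded }

    -- The block of w loses h boxes and the crown gains h - 1, one for each s supplied by `tops`.
    size-drop : ∀ N → ℓ ≤ N → suc (sumTo N ν) ≡ sumTo N μ
    size-drop N ℓ≤N = lia 4 0 (λ v m h x → v :+ (♯ 1 :+ x) := m :+ x ⇒ ♯ 1 :+ v := m) (sumTo N ν) (sumTo N μ) h x total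
      where
        w+h≤N : w + h ≤ N
        w+h≤N = ≤-trans (≤-trans (≤-reflexive (+-suc w x)) (inside-ℓ (w + x) (μ-block x (ups-head U) ≤-refl))) ℓ≤N
        tops-sum : ∀ x' → x' ≤ x → sumTo N (λ i → win (suc y) x' (down i)) ≡ x'
        tops-sum zero    _ = trans (sumTo-cong N (λ i → trans (win-zero (suc y) (down i)) (sym (win-zero 0 i)))) (sumTo-win N 0 0 z≤n)
        tops-sum (suc x') p with Good.tops G (suc x') (s≤s z≤n) (s≤s p)
        ... | v , e = trans (sumTo-cong N (λ i → trans (win-split (suc y) x' (down i)) (cong (_+_ (win (suc y) x' (down i))) (point i))))
                (trans (sumTo-+ N (λ i → win (suc y) x' (down i)) (win v 1)) (trans (cong₂ _+_ (tops-sum x' (<⇒≤ p)) (sumTo-point N v v<N)) (+-comm x' 1)))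
          where
            v<N : v < N
            v<N = <-≤-trans (crown-above v (suc x') p e) (≤-trans y≤w (≤-trans (m≤m+n w h) w+h≤N))
            e' : down v ≡ suc y + x'
            e' = trans e (+-suc y x')
            point : ∀ i → win (suc y + x') 1 (down i) ≡ win v 1 i
            point i with win v 1 i | winView v 1 i
            ... | _ | before p = win-below _ 1 (down i) (subst (down i <_) e' (down-mono p))
            ... | _ | after p  = win-above _ 1 (down i) (subst (_≤ down i) (trans (cong suc e') (+-comm 1 _)) (down-mono (subst (_≤ i) (+-comm v 1) p)))
            ... | _ | within p q with ≤-antisym p (≤-pred (subst (i <_) (+-comm v 1) q))
            ...   | refl = win-in _ 1 (down i) (≤-reflexive (sym e')) (subst (_< suc y + x' + 1) (sym e') (m<m+n (suc y + x') (s≤s z≤n)))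
        total : sumTo N ν + h ≡ sumTo N μ + x
        total = trans (cong (_+_ (sumTo N ν)) (sym (sumTo-win N w h w+h≤N))) (trans (sym (sumTo-+ N ν (win w h))) (trans (sumTo-cong N balance)
          (trans (sumTo-+ N μ (λ i → win (suc y) x (down i))) (cong (_+_ (sumTo N μ)) (tops-sum x ≤-refl)))))

-- Maya diagrams

least : {P : ℕ → Set} → (∀ i → Dec (P i)) → ∀ b → P b → ∃ λ i → i ≤ b × P i × (∀ j → j < i → ¬ P j)
least {P} P? b pb = go b 0 (sym (+-identityʳ b)) (λ j ())
  where
    go : ∀ f i → b ≡ f + i → (∀ j → j < i → ¬ P j) → ∃ λ i → i ≤ b × P i × (∀ j → j < i → ¬ P j)
    go f i e h with P? i
    ... | yes p = i , subst (i ≤_) (sym e) (m≤n+m i f) , p , h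
    go zero i e h | no ¬p = ⊥-elim (¬p (subst P e pb))
    go (suc f) i e h | no ¬p = go f (suc i) (trans e (sym (+-suc f i))) h'
      where
        h' : ∀ j → j < suc i → ¬ P j
        h' j q with m≤n⇒m<n∨m≡n (≤-pred q)
        ... | inj₁ r    = h j r
        ... | inj₂ refl = ¬p

-- Row i of a partition f is the bead f i - i.
module Beads {f : ℕ → ℕ} (A : Antitone f) where

  bead : ℕ → ℤ
  bead i = + f i ℤ.- + i

  bead-mono : ∀ {i j} → i < j → bead j ℤ.< bead i
  bead-mono {i} {j} p = lia 4 0 (λ i j a b → i :< j ⇒ b :≤ a ⇒ ↑ b :- ↑ j :< ↑ a :- ↑ i) i j (f i) (f j) p (antitone-≤ A (<⇒≤ p))

  bead-mono-≤ : ∀ {i j} → i ≤ j → bead j ℤ.≤ bead i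
  bead-mono-≤ {i} {j} p = lia 4 0 (λ i j a b → i :≤ j ⇒ b :≤ a ⇒ ↑ b :- ↑ j :≤ ↑ a :- ↑ i) i j (f i) (f j) p (antitone-≤ A p)

  bead-reflects : ∀ {i j} → bead i ℤ.< bead j → j < i
  bead-reflects {i} {j} p with j <? i
  ... | yes q = q
  ... | no ¬q = ⊥-elim (ℤ.<⇒≱ p (bead-mono-≤ (≮⇒≥ ¬q)))

  bead-injective : ∀ {i j} → bead i ≡ bead j → i ≡ j
  bead-injective {i} {j} e with <-cmp i j
  ... | tri< p _ _ = ⊥-elim (ℤ.<-irrefl (sym e) (bead-mono p))
  ... | tri≈ _ p _ = p
  ... | tri> _ _ p = ⊥-elim (ℤ.<-irrefl e (bead-mono p))

  private
    search : ∀ p → ∃ λ i → i ≤ suc (f 0 + ℤ.∣ p ∣) × bead i ℤ.< p × (∀ j → j < i → ¬ bead j ℤ.< p)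
    search p = least (λ i → bead i ℤ.<? p) (suc (f 0 + ℤ.∣ p ∣)) (sinks p)
      where
        sinks : ∀ p → bead (suc (f 0 + ℤ.∣ p ∣)) ℤ.< p
        sinks (+ q) = lia 3 0 (λ z a q → a :≤ z ⇒ ↑ a :- ↑ (♯ 1 :+ (z :+ q)) :< ↑ q) (f 0) (f (suc (f 0 + q))) q (antitone-≤ A z≤n)
        sinks -[1+ q ] = lia 3 1 (λ z a q p → a :≤ z ⇒ p := :- ↑ (♯ 1 :+ q) ⇒ ↑ a :- ↑ (♯ 1 :+ (z :+ (♯ 1 :+ q))) :< p) (f 0) (f (suc (f 0 + suc q))) q -[1+ q ] (antitone-≤ A z≤n) refl

  -- The number of beads in positions ≥ p.
  N : ℤ → ℕ
  N p = proj₁ (search p)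

  N-below : ∀ p → bead (N p) ℤ.< p
  N-below p = proj₁ (proj₂ (proj₂ (search p)))

  N⁻ : ∀ p i → i < N p → p ℤ.≤ bead i
  N⁻ p i q = ℤ.≮⇒≥ (proj₂ (proj₂ (proj₂ (search p))) i q)

  N⁺ : ∀ p i → p ℤ.≤ bead i → i < N p
  N⁺ p i q = ≰⇒> (λ r → ℤ.<⇒≱ (ℤ.≤-<-trans (bead-mono-≤ r) (N-below p)) q)

  N≤ : ∀ p i → bead i ℤ.< p → N p ≤ i
  N≤ p i q = ≮⇒≥ (λ r → ℤ.<⇒≱ q (N⁻ p i r))

  Mem : ℤ → Set
  Mem p = ∃ λ i → bead i ≡ p

  N-mem : ∀ p → Mem p → N p ≡ suc (N (p ℤ.+ + 1))
  N-mem p (i , refl) = trans Np (cong suc (sym Np+1))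
    where
      Np : N p ≡ suc i
      Np = ≤-antisym (N≤ p (suc i) (bead-mono ≤-refl)) (N⁺ p i ℤ.≤-refl)
      Np+1 : N (p ℤ.+ + 1) ≡ i
      Np+1 = ≤-antisym (N≤ (p ℤ.+ + 1) i (lia 0 1 (λ p → p :< p :+ ♯ 1) p))
        (≮⇒≥ (λ q → ℤ.<⇒≱ (N-below (p ℤ.+ + 1)) (lia 0 2 (λ p b → p :< b ⇒ p :+ ♯ 1 :≤ b) p (bead (N (p ℤ.+ + 1))) (bead-mono q))))

  N-nonmem : ∀ p → ¬ Mem p → N p ≡ N (p ℤ.+ + 1)
  N-nonmem p h = ≤-antisym
    (≮⇒≥ (λ q → ℤ.<⇒≱ (N-below (p ℤ.+ + 1)) (lia 0 2 (λ p b → p :< b ⇒ p :+ ♯ 1 :≤ b) p (bead (N (p ℤ.+ + 1)))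
      (ℤ.≤∧≢⇒< (N⁻ p (N (p ℤ.+ + 1)) q) (λ e → h (N (p ℤ.+ + 1) , sym e))))))
    (≮⇒≥ (λ q → ℤ.<⇒≱ (N-below p) (lia 0 2 (λ p b → p :+ ♯ 1 :≤ b ⇒ p :≤ b) p (bead (N p)) (N⁻ (p ℤ.+ + 1) (N p) q))))

  mem? : ∀ p → Dec (Mem p)
  mem? p with bead (N (p ℤ.+ + 1)) ℤ.≟ p
  ... | yes e = yes (N (p ℤ.+ + 1) , e)
  ... | no ¬e = no absent
    where
      absent : ¬ Mem p
      absent (i , e) = ¬e (trans (cong bead (sym (≤-antisym lo hi))) e)
        where
          lo : i ≤ N (p ℤ.+ + 1)
          lo = ≮⇒≥ (λ q → ℤ.<⇒≱ (N-below (p ℤ.+ + 1)) (lia 0 3 (λ p b c → b := p ⇒ b :< c ⇒ p :+ ♯ 1 :≤ c) p (bead i) (bead (N (p ℤ.+ + 1))) e (bead-mono q)))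
          hi : N (p ℤ.+ + 1) ≤ i
          hi = N≤ (p ℤ.+ + 1) i (lia 0 2 (λ p b → b := p ⇒ b :< p :+ ♯ 1) p (bead i) e)

module CoreBeads {n : ℕ} {κ μ : ℕ → ℕ} (D : CoreData n κ μ) where
  open CoreData D
  open Rows bounded-μ
  open Beads κ-antitone public

  -- The abacus description of an n-core: below every bead, at distance n, there is another one.
  bead-down : ∀ i → bead (down i) ≡ bead i ℤ.- + n
  bead-down i = lia 6 0 (λ i n d m k k' → k := m :+ k' ⇒ d :+ m := i :+ n ⇒ ↑ k' :- ↑ d := (↑ k :- ↑ i) :- ↑ n) i n (down i) (μ i) (κ i) (κ (down i)) (link i) (down-μ i)

  mem-down : ∀ {p} → Mem p → Mem (p ℤ.- + n)
  mem-down (i , refl) = down i , bead-down i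

  mem-downs : ∀ j {p} → Mem p → Mem (p ℤ.- + (j * n))
  mem-downs zero    {p} m = subst Mem (lia 0 1 (λ p → p := p :- ♯ 0) p) m
  mem-downs (suc j) {p} m = subst Mem (lia 2 1 (λ n jn p → p :- ↑ n :- ↑ jn := p :- ↑ (n :+ jn)) n (j * n) p) (mem-downs j (mem-down m))

-- Every properly contained core lies inside a removal

module Completeness {n : ℕ} {κ μ τ lam : ℕ → ℕ} (D : CoreData n κ μ) (D' : CoreData n τ lam) (ℓ : ℕ)
  (finite : ∀ i → ℓ ≤ i → κ i ≡ 0) (contained : ∀ i → τ i ≤ κ i) where
  open CoreData D
  open Rows bounded-μ
  open Cover D ℓ finite
  module K = CoreBeads D
  module L = CoreBeads D'
  open K using (bead; Mem)

  -- Containment means that at or above any position κ has at least as many beads as τ. Moving a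
  -- bead of κ down from P to P - δ lowers this count by one on the positions above P - δ up to P,
  -- so τ stays inside as long as these have excess.
  Excess : ℤ → Set
  Excess p = L.N p < K.N p

  N≤N : ∀ p → L.N p ≤ K.N p
  N≤N p = L.N≤ p (K.N p) (ℤ.≤-<-trans (lia 3 0 (λ i a b → a :≤ b ⇒ ↑ a :- ↑ i :≤ ↑ b :- ↑ i) (K.N p) (τ (K.N p)) (κ (K.N p)) (contained (K.N p))) (K.N-below p))

  excess-at : ∀ {i p} → L.bead i ℤ.< p → p ℤ.≤ bead i → Excess p
  excess-at {i} {p} a b = ≤-<-trans (L.N≤ p i a) (K.N⁺ p i b)

  no-excess-low : ∀ p → p ℤ.≤ ℤ.- + ℓ → ¬ Excess p
  no-excess-low p q e = ℤ.<⇒≱ (L.N-below p) (ℤ.≤-trans (K.N⁻ p (L.N p) e) (ℤ.≤-reflexive (cong (λ x → + x ℤ.- + L.N p) same)))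
    where
      ℓ≤N : ℓ ≤ L.N p
      ℓ≤N = ≮⇒≥ (λ r → ℤ.<⇒≱ (L.N-below p) (lia 3 1 (λ l i a p → p :≤ :- ↑ l ⇒ i :< l ⇒ p :≤ ↑ a :- ↑ i) ℓ (L.N p) (τ (L.N p)) p q r))
      same : κ (L.N p) ≡ τ (L.N p)
      same = trans (finite (L.N p) ℓ≤N) (sym (n≤0⇒n≡0 (≤-trans (contained (L.N p)) (≤-reflexive (finite (L.N p) ℓ≤N)))))

  NoUp : ℕ → Set
  NoUp y = ∀ i → down i ≢ y

  pos : ℤ → ℕ → ℕ → ℤ
  pos P j δ = P ℤ.- + (j * n) ℤ.- + δ

  pos-suc : ∀ P j δ → pos P (suc j) δ ≡ pos P j δ ℤ.- + n
  pos-suc P j δ = lia 3 1 (λ n jn δ P → P :- ↑ (n :+ jn) :- ↑ δ := P :- ↑ jn :- ↑ δ :- ↑ n) n (j * n) δ P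

  -- By the excess, each of the translates of the bead of y by j n, j < c, can be moved down by δ
  -- without losing τ. The target is vacant for j = 0 and occupied for j = c, so somewhere in
  -- between a runner of beads to be moved comes to an end.
  record Window (y c δ : ℕ) : Set where
    field
      no-up  : NoUp y
      gap    : ¬ Mem (pos (bead y) 0 δ)
      bottom : Mem (pos (bead y) c δ)
      excess : ∀ j → j < c → ∀ δ' → δ' < δ → Excess (pos (bead y) j δ')

  module _ (minimal : ∀ {w} (G : Good w) → (∀ i → τ i ≤ Removal.τ G i) → ⊥) where

    module Irreducible {y c δ : ℕ} (W : Window y (suc c) δ) (gaps : ∀ j → j < suc c → ¬ Mem (pos (bead y) j δ)) (δ<n : δ < n)
      (interior : ∀ j → j ≤ suc c → ∀ δ' → 0 < δ' → δ' < δ → Mem (pos (bead y) j δ') → Mem (pos (bead y) 0 δ'))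
      (upper : ∀ i δ' → 0 < δ' → δ' < δ → bead i ≡ pos (bead y) 0 δ' → ∃ λ v → down v ≡ i) where
      open Window W

      P : ℤ
      P = bead y

      downs : ℕ → ℕ
      downs zero    = y
      downs (suc j) = down (downs j)

      bead-downs : ∀ j → bead (downs j) ≡ pos P j 0
      bead-downs zero    = lia 0 1 (λ P → P := P :- ♯ 0 :- ♯ 0) P
      bead-downs (suc j) = trans (K.bead-down (downs j)) (trans (cong (ℤ._- + n) (bead-downs j)) (sym (pos-suc P j 0)))

      h : ℕ
      h = K.N (pos P 0 δ) ∸ y

      0<δ : 0 < δ
      0<δ = n≢0⇒n>0 (λ { refl → gap (y , bead-downs 0) })

      y<N : y < K.N (pos P 0 δ)
      y<N = K.N⁺ (pos P 0 δ) y (lia 1 1 (λ δ P → P :- ♯ 0 :- ↑ δ :≤ P) δ P)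

      y+h : y + h ≡ K.N (pos P 0 δ)
      y+h = m+[n∸m]≡n (<⇒≤ y<N)

      1≤h : 1 ≤ h
      1≤h = lia 3 0 (λ y h N → y :+ h := N ⇒ y :< N ⇒ ♯ 1 :≤ h) y h (K.N (pos P 0 δ)) y+h y<N

      -- distance of the bead of row y + s from P
      off : ℕ → ℕ
      off s = ℤ.∣ P ℤ.- bead (y + s) ∣

      off-spec : ∀ s → bead (y + s) ≡ pos P 0 (off s)
      off-spec s = lia 1 3 (λ o P b z → ↑ o := P :- b ⇒ b := P :- ♯ 0 :- ↑ o) (off s) P (bead (y + s)) (+ 0)
        (ℤ.0≤i⇒+∣i∣≡i (ℤ.i≤j⇒0≤j-i (K.bead-mono-≤ (m≤m+n y s))))

      off-<δ : ∀ s → s < h → off s < δ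
      off-<δ s p = lia 2 2 (λ o δ P b → b := P :- ♯ 0 :- ↑ o ⇒ P :- ♯ 0 :- ↑ δ :< b ⇒ o :< δ) (off s) δ P (bead (y + s)) (off-spec s)
        (ℤ.≤∧≢⇒< (K.N⁻ (pos P 0 δ) (y + s) (subst (y + s <_) y+h (+-monoʳ-< y p))) (λ e → gap (y + s , sym e)))

      off-pos : ∀ s → 0 < s → 0 < off s
      off-pos s p = lia 1 2 (λ o P b → b := P :- ♯ 0 :- ↑ o ⇒ b :< P ⇒ ♯ 0 :< o) (off s) P (bead (y + s)) (off-spec s) (K.bead-mono (m<m+n y p))

      -- a bead strictly below row y + s, strictly above position δ
      squeeze : ∀ i s δ' → suc s ≤ h → bead i ≡ pos P 0 δ' → off s < δ' → δ' < δ → y + suc s ≤ i × i < y + h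
      squeeze i s δ' p e q r = subst (_≤ i) (sym (+-suc y s)) (K.bead-reflects (lia 2 3 (λ o d P b bi → b := P :- ♯ 0 :- ↑ o ⇒ bi := P :- ♯ 0 :- ↑ d ⇒ o :< d ⇒ bi :< b)
            (off s) δ' P (bead (y + s)) (bead i) (off-spec s) e q)) ,
          subst (i <_) (sym y+h) (K.N⁺ (pos P 0 δ) i (lia 2 2 (λ d δ P bi → bi := P :- ♯ 0 :- ↑ d ⇒ d :< δ ⇒ P :- ♯ 0 :- ↑ δ :≤ bi) δ' δ P (bead i) e r))

      -- The h beads from P down to above P - δ recur in every translate because the abacus is
      -- flush. An additional bead between two of them would, by `interior`, also be present in
      -- translate 0, between two consecutive rows.
      ladder : ∀ j → j ≤ suc c → ∀ s → s < h → bead (downs j + s) ≡ pos P j (off s)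
      ladder zero    _ s _ = off-spec s
      ladder (suc j) p zero q = trans (cong bead (+-identityʳ (downs (suc j)))) (trans (bead-downs (suc j)) (cong (pos P (suc j)) (sym off0)))
        where
          off0 : off 0 ≡ 0
          off0 = lia 1 2 (λ o P b → b := P :- ♯ 0 :- ↑ o ⇒ b := P ⇒ o := ♯ 0) (off 0) P (bead (y + 0)) (off-spec 0) (cong bead (+-identityʳ y))
      ladder (suc j) p (suc s) q = trans (cong bead same) R'-bead
        where
          ih : bead (downs (suc j) + s) ≡ pos P (suc j) (off s)
          ih = ladder (suc j) p s (<-trans ≤-refl q)
          R' : ℕ
          R' = down (downs j + suc s)
          R'-bead : bead R' ≡ pos P (suc j) (off (suc s))
          R'-bead = trans (K.bead-down (downs j + suc s)) (trans (cong (ℤ._- + n) (ladder j (<⇒≤ p) (suc s) q)) (sym (pos-suc P j (off (suc s)))))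
          off< : off s < off (suc s)
          off< = lia 2 3 (λ o o' P b b' → b := P :- ♯ 0 :- ↑ o ⇒ b' := P :- ♯ 0 :- ↑ o' ⇒ b' :< b ⇒ o :< o') (off s) (off (suc s)) P (bead (y + s)) (bead (y + suc s))
            (off-spec s) (off-spec (suc s)) (K.bead-mono (+-monoʳ-< y ≤-refl))
          next : ℕ
          next = suc (downs (suc j) + s)
          next≤R' : next ≤ R'
          next≤R' = K.bead-reflects (subst₂ ℤ._<_ (sym R'-bead) (sym ih) (lia 3 1 (λ a o o' P → o :< o' ⇒ P :- ↑ a :- ↑ o' :< P :- ↑ a :- ↑ o) (suc j * n) (off s) (off (suc s)) P off<))
          R'≤next : R' ≤ next
          R'≤next = ≮⇒≥ contra
            where
              contra : next < R' → ⊥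
              contra r = ⊥-elim (<⇒≱ (K.bead-reflects (subst₂ ℤ._<_ (sym (off-spec (suc s))) (sym (proj₂ found)) (lia 2 1 (λ d o P → d :< o ⇒ P :- ♯ 0 :- ↑ o :< P :- ♯ 0 :- ↑ d) δ' (off (suc s)) P δ'<)))
                             (≤-trans (≤-reflexive refl) (proj₁ (squeeze (proj₁ found) s δ' (<⇒≤ q) (proj₂ found) off<δ' (<-trans δ'< (off-<δ (suc s) q))))))
                where
                  δ' : ℕ
                  δ' = ℤ.∣ pos P (suc j) 0 ℤ.- bead next ∣
                  next<ih : bead next ℤ.< pos P (suc j) (off s)
                  next<ih = subst (bead next ℤ.<_) ih (K.bead-mono ≤-refl)
                  spec : bead next ≡ pos P (suc j) δ'
                  spec = lia 2 3 (λ a d P b x → x := P :- ↑ a :- ♯ 0 ⇒ ↑ d := x :- b ⇒ b := P :- ↑ a :- ↑ d) (suc j * n) δ' P (bead next) (pos P (suc j) 0) refl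
                    (ℤ.0≤i⇒+∣i∣≡i (ℤ.i≤j⇒0≤j-i (ℤ.<⇒≤ (ℤ.<-≤-trans next<ih (lia 2 1 (λ a o P → P :- ↑ a :- ↑ o :≤ P :- ↑ a :- ♯ 0) (suc j * n) (off s) P)))))
                  δ'< : δ' < off (suc s)
                  δ'< = lia 3 2 (λ a d o P b → b := P :- ↑ a :- ↑ d ⇒ P :- ↑ a :- ↑ o :< b ⇒ d :< o) (suc j * n) δ' (off (suc s)) P (bead next) spec (subst (ℤ._< bead next) R'-bead (K.bead-mono r))
                  off<δ' : off s < δ'
                  off<δ' = lia 3 2 (λ a d o P b → b := P :- ↑ a :- ↑ d ⇒ b :< P :- ↑ a :- ↑ o ⇒ o :< d) (suc j * n) δ' (off s) P (bead next) spec next<ih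
                  found : Mem (pos P 0 δ')
                  found = interior (suc j) p δ' (≤-<-trans z≤n off<δ') (<-trans δ'< (off-<δ (suc s) q)) (next , spec)
          same : downs (suc j) + suc s ≡ R'
          same = trans (+-suc (downs (suc j)) s) (≤-antisym next≤R' R'≤next)

      x : ℕ
      x = h ∸ 1

      h≡ : h ≡ suc x
      h≡ = sym (m+[n∸m]≡n 1≤h)

      x<h : x < h
      x<h = ≤-reflexive (sym h≡)

      under : ∀ j → j ≤ suc c → bead (downs j + suc x) ℤ.≤ pos P j δ
      under j p = ℤ.≮⇒≥ contra
        where
          contra : pos P j δ ℤ.< bead (downs j + suc x) → ⊥
          contra r = let (i , e) = found ; (a , b) = squeeze i x δ' (≤-reflexive (sym h≡)) e off<δ' δ'<δ in
                     <⇒≱ b (subst (λ k → y + k ≤ i) (sym h≡) a)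
            where
              b : ℤ
              b = bead (downs j + suc x)
              δ' : ℕ
              δ' = ℤ.∣ pos P j 0 ℤ.- b ∣
              b< : b ℤ.< pos P j (off x)
              b< = subst (b ℤ.<_) (ladder j p x x<h) (K.bead-mono (+-monoʳ-< (downs j) ≤-refl))
              spec : b ≡ pos P j δ'
              spec = lia 2 3 (λ a d P b x → x := P :- ↑ a :- ♯ 0 ⇒ ↑ d := x :- b ⇒ b := P :- ↑ a :- ↑ d) (j * n) δ' P b (pos P j 0) refl
                (ℤ.0≤i⇒+∣i∣≡i (ℤ.i≤j⇒0≤j-i (ℤ.<⇒≤ (ℤ.<-≤-trans b< (lia 2 1 (λ a o P → P :- ↑ a :- ↑ o :≤ P :- ↑ a :- ♯ 0) (j * n) (off x) P)))))
              δ'<δ : δ' < δ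
              δ'<δ = lia 3 2 (λ a d o P b → b := P :- ↑ a :- ↑ d ⇒ P :- ↑ a :- ↑ o :< b ⇒ d :< o) (j * n) δ' δ P b spec r
              off<δ' : off x < δ'
              off<δ' = lia 3 2 (λ a d o P b → b := P :- ↑ a :- ↑ d ⇒ b :< P :- ↑ a :- ↑ o ⇒ o :< d) (j * n) δ' (off x) P b spec b<
              found : Mem (pos P 0 δ')
              found = interior j p δ' (≤-<-trans z≤n off<δ') δ'<δ (downs j + suc x , spec)

      w : ℕ
      w = downs c

      runner-list : ℕ → List ℕ
      runner-list zero    = y ∷ []
      runner-list (suc j) = downs (suc j) ∷ runner-list j

      runner-ups : ∀ j → Ups (downs j) y (runner-list j)
      runner-ups zero    = last no-up
      runner-ups (suc j) = up refl (runner-ups j)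

      runner-∈ : ∀ j {r} → r ∈ runner-list j → ∃ λ j' → j' ≤ j × r ≡ downs j'
      runner-∈ zero    (here refl) = 0 , z≤n , refl
      runner-∈ (suc j) (here refl) = suc j , ≤-refl , refl
      runner-∈ (suc j) (there p) with runner-∈ j p
      ... | j' , q , e = j' , m≤n⇒m≤1+n q , e

      q : ℕ
      q = proj₁ bottom

      q≥ : down w + suc x ≤ q
      q≥ = ≤-trans (≤-reflexive (+-suc (down w) x)) (K.bead-reflects (subst₂ ℤ._<_ (sym (proj₂ bottom)) (sym (ladder (suc c) ≤-refl x x<h))
        (lia 3 1 (λ a o d P → o :< d ⇒ P :- ↑ a :- ↑ d :< P :- ↑ a :- ↑ o) (suc c * n) (off x) δ P (off-<δ x x<h))))

      w+h<gap : bead (w + suc x) ℤ.< pos P c δ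
      w+h<gap = ℤ.≤∧≢⇒< (under c (n≤1+n c)) (λ e → gaps c ≤-refl (w + suc x , e))

      q<down : q < down (w + suc x)
      q<down = K.bead-reflects (subst₂ ℤ._<_ (sym (K.bead-down (w + suc x))) (sym (trans (proj₂ bottom) (pos-suc P c δ))) (lia 1 2 (λ n a b → a :< b ⇒ a :- ↑ n :< b :- ↑ n) n (bead (w + suc x)) (pos P c δ) w+h<gap))

      dropped : μ (w + suc x) < μ w
      dropped = lia 8 0 (λ w h n d d' m m' q → d :+ m := w :+ n ⇒ d' :+ m' := w :+ h :+ n ⇒ d :+ h :≤ q ⇒ q :< d' ⇒ m' :< m)
        w (suc x) n (down w) (down (w + suc x)) (μ w) (μ (w + suc x)) q (down-μ w) (down-μ (w + suc x)) q≥ q<down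

      good : Good w
      good = record
        { runner = runner-ups c
        ; pre = record { flat = flat′ ; room = room′ ; tops = tops′ }
        ; positive = ≤-<-trans z≤n dropped
        ; drop = dropped
        }
        where
          flat′ : ∀ {r} → r ∈ runner-list c → ∀ s → s < suc x → μ (r + s) ≡ μ r
          flat′ r∈ s p with runner-∈ c r∈
          ... | j , j≤c , refl = flat-down (downs j) s (K.bead-injective (trans (K.bead-down (downs j + s)) (trans (cong (ℤ._- + n) (ladder j (m≤n⇒m≤1+n j≤c) s (subst (s <_) (sym h≡) p)))
                (trans (sym (pos-suc P j (off s))) (sym (ladder (suc j) (s≤s j≤c) s (subst (s <_) (sym h≡) p)))))))
          room′ : w + suc x ≤ down w
          room′ = ≤-trans (≤-reflexive (+-suc w x)) (K.bead-reflects (subst₂ ℤ._<_ (sym (trans (bead-downs (suc c)) (pos-suc P c 0))) (sym (ladder c (n≤1+n c) x x<h))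
            (lia 4 1 (λ a o d n P → o :< d ⇒ d :< n ⇒ P :- ↑ a :- ♯ 0 :- ↑ n :< P :- ↑ a :- ↑ o) (c * n) (off x) δ n P (off-<δ x x<h) δ<n)))
          tops′ : ∀ s → 1 ≤ s → s < suc x → ∃ λ v → down v ≡ y + s
          tops′ s p p' = upper (y + s) (off s) (off-pos s p) (off-<δ s (subst (s <_) (sym h≡) p')) (off-spec s)

      -- Excess at the position just above the new place of a bead bounds the number of beads of τ
      -- from there on by the index of the row, so the bead of τ in this row is not above the new
      -- bead.
      contains-block : ∀ {r i} → r ∈ runner-list c → Removal.InBlock good r i → τ i ≤ Removal.τ good i
      contains-block r∈ b with runner-∈ c r∈ | Removal.split-block good b
      ...   | j , j≤c , refl | s , s≤x , refl with m≤n⇒m<n∨m≡n s≤x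
      ...     | inj₁ s<x = lia 4 1 (λ i t t' k p → ♯ 1 :+ t' := k ⇒ ↑ t :- ↑ i :< p ⇒ p :≤ ↑ k :- ↑ i ⇒ t :≤ t') (downs j + s) (τ (downs j + s)) (Removal.τ good (downs j + s)) (κ (suc (downs j + s))) p
                (Removal.τ-mid good s r∈ s<x) (ℤ.≤-<-trans (L.bead-mono-≤ L≤) (L.N-below p)) p≤
        where
          o : ℕ
          o = off (suc s) ∸ 1
          o+1 : suc o ≡ off (suc s)
          o+1 = m+[n∸m]≡n (off-pos (suc s) (s≤s z≤n))
          p : ℤ
          p = pos P j o
          s+1<h : suc s < h
          s+1<h = subst (suc s <_) (sym h≡) (s≤s s<x)
          b-spec : bead (suc (downs j + s)) ≡ pos P j (off (suc s))
          b-spec = trans (cong bead (sym (+-suc (downs j) s))) (ladder j (m≤n⇒m≤1+n j≤c) (suc s) s+1<h)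
          p≡ : p ≡ bead (suc (downs j + s)) ℤ.+ + 1
          p≡ = lia 3 2 (λ a o o' P b → ♯ 1 :+ o := o' ⇒ b := P :- ↑ a :- ↑ o' ⇒ P :- ↑ a :- ↑ o := b :+ ♯ 1) (j * n) o (off (suc s)) P (bead (suc (downs j + s))) o+1 b-spec
          p≤ : p ℤ.≤ + κ (suc (downs j + s)) ℤ.- + (downs j + s)
          p≤ = lia 2 2 (λ k i p b → p := b :+ ♯ 1 ⇒ b := ↑ k :- ↑ (♯ 1 :+ i) ⇒ p :≤ ↑ k :- ↑ i) (κ (suc (downs j + s))) (downs j + s) p (bead (suc (downs j + s))) p≡ refl
          L≤ : L.N p ≤ downs j + s
          L≤ = ≤-pred (≤-trans (excess j (s≤s j≤c) o (<-trans (≤-reflexive o+1) (off-<δ (suc s) s+1<h)))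
            (K.N≤ p (suc (downs j + s)) (subst (bead (suc (downs j + s)) ℤ.<_) (sym p≡) (lia 0 1 (λ b → b :< b :+ ♯ 1) (bead (suc (downs j + s)))))))
      ...     | inj₂ refl = lia 9 3 (λ r t t' x d kd kr kdh o p pj pd → t' :+ (♯ 1 :+ kd) := kr :+ kdh ⇒ ↑ kr :- ↑ r := pj ⇒ p := pj :- ↑ o ⇒ ↑ t :- ↑ (r :+ x) :< p
                     ⇒ ↑ kd :- ↑ d := pd ⇒ ↑ kdh :- ↑ (d :+ (♯ 1 :+ x)) := pd :- ↑ (♯ 1 :+ o) ⇒ t :≤ t')
                (downs j) (τ (downs j + x)) (Removal.τ good (downs j + x)) x (down w) (κ (down w)) (κ (downs j)) (κ (down w + suc x)) o p (pos P j 0) (pos P (suc c) 0)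
                (Removal.τ-end good r∈) (bead-downs j) (lia 2 1 (λ a o P → P :- ↑ a :- ↑ o := P :- ↑ a :- ♯ 0 :- ↑ o) (j * n) o P) (ℤ.≤-<-trans (L.bead-mono-≤ L≤) (L.N-below p)) (bead-downs (suc c))
                (trans bead-q (trans (cong (pos P (suc c)) (sym o+1)) (lia 2 1 (λ a o P → P :- ↑ a :- ↑ (♯ 1 :+ o) := P :- ↑ a :- ♯ 0 :- ↑ (♯ 1 :+ o)) (suc c * n) o P)))
        where
          o : ℕ
          o = δ ∸ 1
          o+1 : suc o ≡ δ
          o+1 = m+[n∸m]≡n 0<δ
          p : ℤ
          p = pos P j o
          bead-q : bead (down w + suc x) ≡ pos P (suc c) δ
          bead-q = ℤ.≤-antisym (under (suc c) ≤-refl) (subst (ℤ._≤ bead (down w + suc x)) (proj₂ bottom) (K.bead-mono-≤ q≥))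
          below-p : bead (downs j + suc x) ℤ.< p
          below-p = ℤ.≤-<-trans (under j (m≤n⇒m≤1+n j≤c)) (lia 3 1 (λ a o d P → ♯ 1 :+ o := d ⇒ P :- ↑ a :- ↑ d :< P :- ↑ a :- ↑ o) (j * n) o δ P o+1)
          L≤ : L.N p ≤ downs j + x
          L≤ = ≤-pred (≤-trans (excess j (s≤s j≤c) o (≤-reflexive o+1)) (≤-trans (K.N≤ p (downs j + suc x) below-p) (≤-reflexive (+-suc (downs j) x))))

      contains : ∀ i → τ i ≤ Removal.τ good i
      contains i = by (Removal.block good i)
        where
          by : Removal.Block good i → τ i ≤ Removal.τ good i
          by (Removal.nowhere out) = ≤-trans (contained i) (≤-reflexive (sym (Removal.τ-out good i out)))
          by (Removal.at r r∈ b)   = contains-block r∈ b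

      absurd : ⊥
      absurd = minimal good contains

    -- Induction on δ, after shortening c to the first occupied target. For δ = n the target under P
    -- would be occupied; for δ > n one may pass to δ - n with one translate more. For δ < n, a bead
    -- that is missing in translate 0, or a bead between P and P - δ with none above it, starts a
    -- window with smaller δ. What remains is irreducible and gives a removal that contains τ.
    no-window : ∀ f δ → δ < f → ∀ y c → Window y c δ → ⊥
    no-window (suc f) δ (s≤s δ≤f) y c W = first (least (λ j → K.mem? (pos P j δ)) c bottom)
      where
        open Window W
        P : ℤ
        P = bead y
        first : (∃ λ j → j ≤ c × Mem (pos P j δ) × (∀ i → i < j → ¬ Mem (pos P i δ))) → ⊥
        first (zero , _ , m , _) = gap m
        first (suc c' , c'≤c , m , gaps) with <-cmp δ n
        ... | tri≈ _ refl _ = gap (subst Mem (lia 1 1 (λ n P → P :- ↑ n := P :- ♯ 0 :- ↑ n) n P) (K.mem-down (y , refl)))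
        ... | tri> _ _ n<δ = no-window f (δ ∸ n) (<-≤-trans smaller δ≤f) y (suc (suc c')) record
              { no-up = no-up
              ; gap = λ m' → gap (subst Mem (lia 3 1 (λ e δ n P → e :+ n := δ ⇒ P :- ♯ 0 :- ↑ e :- ↑ n := P :- ♯ 0 :- ↑ δ) (δ ∸ n) δ n P δ-n) (K.mem-down m'))
              ; bottom = subst Mem (lia 4 1 (λ a e δ n P → e :+ n := δ ⇒ P :- ↑ a :- ↑ δ := P :- ↑ (n :+ a) :- ↑ e) (suc c' * n) (δ ∸ n) δ n P δ-n) m
              ; excess = shifted
              }
          where
            δ-n : δ ∸ n + n ≡ δ
            δ-n = m∸n+n≡m (<⇒≤ n<δ)
            0<n : 0 < n
            0<n = ≤-<-trans z≤n (Bounded.ceiling bounded-μ 0)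
            smaller : δ ∸ n < δ
            smaller = lia 3 0 (λ e n d → e :+ n := d ⇒ ♯ 0 :< n ⇒ e :< d) (δ ∸ n) n δ δ-n 0<n
            shifted : ∀ j → j < suc (suc c') → ∀ δ' → δ' < δ ∸ n → Excess (pos P j δ')
            shifted j p δ' r with m≤n⇒m<n∨m≡n (≤-pred p)
            ... | inj₁ p' = excess j (<-≤-trans p' c'≤c) δ' (<-trans r smaller)
            ... | inj₂ refl = subst Excess (lia 3 1 (λ a d n P → P :- ↑ a :- ↑ (d :+ n) := P :- ↑ (n :+ a) :- ↑ d) (c' * n) δ' n P)
                    (excess c' (<-≤-trans (n<1+n c') c'≤c) (δ' + n) (subst (δ' + n <_) δ-n (+-monoˡ-< n r)))
        ... | tri< δ<n _ _ = Irreducible.absurd {y} {c'} {δ}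
                (record { no-up = no-up ; gap = gap ; bottom = m ; excess = λ j p → excess j (<-≤-trans p c'≤c) }) gaps δ<n interior upper
          where
            interior : ∀ j → j ≤ suc c' → ∀ δ' → 0 < δ' → δ' < δ → Mem (pos P j δ') → Mem (pos P 0 δ')
            interior j p δ' _ r m' with K.mem? (pos P 0 δ')
            ... | yes m'' = m''
            ... | no ¬m'' = ⊥-elim (no-window f δ' (<-≤-trans r δ≤f) y j (record
                    { no-up = no-up ; gap = ¬m'' ; bottom = m' ; excess = λ j' p' δ'' r' → excess j' (<-≤-trans p' (≤-trans p c'≤c)) δ'' (<-trans r' r) }))
            upper : ∀ i δ' → 0 < δ' → δ' < δ → bead i ≡ pos P 0 δ' → ∃ λ v → down v ≡ i
            upper i δ' 0<δ' r e with down⁻¹ i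
            ... | inj₁ v = v
            ... | inj₂ none = ⊥-elim (no-window f (δ ∸ δ') (<-≤-trans smaller δ≤f) i (suc c') (record
                    { no-up = none
                    ; gap = λ m' → gap (subst Mem (rebase 0 (δ ∸ δ') δ δ-) m')
                    ; bottom = subst Mem (sym (rebase (suc c') (δ ∸ δ') δ δ-)) m
                    ; excess = λ j p δ'' r' → subst Excess (sym (rebase j δ'' (δ'' + δ') refl)) (excess j (<-≤-trans p c'≤c) (δ'' + δ') (subst (δ'' + δ' <_) δ- (+-monoˡ-< δ' r')))
                    }))
              where
                δ- : δ ∸ δ' + δ' ≡ δ
                δ- = m∸n+n≡m (<⇒≤ r)
                smaller : δ ∸ δ' < δ
                smaller = lia 3 0 (λ e n d → e :+ n := d ⇒ ♯ 0 :< n ⇒ e :< d) (δ ∸ δ') δ' δ δ- 0<δ'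
                rebase : ∀ j a b → a + δ' ≡ b → pos (bead i) j a ≡ pos P j b
                rebase j a b ab = lia 4 2 (λ jn a b d I P → a :+ d := b ⇒ I := P :- ♯ 0 :- ↑ d ⇒ I :- ↑ jn :- ↑ a := P :- ↑ jn :- ↑ b) (j * n) a b δ' (bead i) P ab e

    module First (y : ℕ) (differ : τ y < κ y) (agree : ∀ i → i < y → τ i ≡ κ i) where

      P : ℤ
      P = bead y

      n>0 : 0 < n
      n>0 = ≤-<-trans z≤n (Bounded.ceiling bounded-μ 0)

      -- A row pointing to y would lie above y, where τ and κ agree. As τ is a core too, it would
      -- also have a bead at P, necessarily in a row before y, and there κ would have a second bead
      -- at P.
      top-free : NoUp y
      top-free i e = <⇒≢ (proj₂ row) same
        where
          i<y : i < y
          i<y = subst (i <_) e (down-above i)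
          j : ℕ
          j = Rows.down (CoreData.bounded-μ D') i
          bead-j : L.bead j ≡ P
          bead-j = trans (L.bead-down i) (trans (cong (λ t → + t ℤ.- + i ℤ.- + n) (agree i i<y)) (trans (sym (K.bead-down i)) (cong bead e)))
          row : L.bead y ℤ.< L.bead j × j < y
          row = lt , L.bead-reflects lt
            where
              lt : L.bead y ℤ.< L.bead j
              lt = subst (L.bead y ℤ.<_) (sym bead-j) (lia 3 0 (λ y a b → a :< b ⇒ ↑ a :- ↑ y :< ↑ b :- ↑ y) y (τ y) (κ y) differ)
          same : j ≡ y
          same = K.bead-injective (trans (cong (λ t → + t ℤ.- + j) (sym (agree j (proj₂ row)))) bead-j)

      excess? : ∀ p → Dec (Excess p)
      excess? p = L.N p <? K.N p

      not-excess : ∀ j δ → ℤ.∣ P ∣ + ℓ ≤ j * n + δ → ¬ Excess (pos P j δ)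
      not-excess j δ p = no-excess-low (pos P j δ) (lia 4 1 (λ a l jn d P → a :+ l :≤ jn :+ d ⇒ P :≤ ↑ a ⇒ P :- ↑ jn :- ↑ d :≤ :- ↑ l) ℤ.∣ P ∣ ℓ (j * n) δ P p (i≤∣i∣ P))
        where
          i≤∣i∣ : ∀ i → i ℤ.≤ + ℤ.∣ i ∣
          i≤∣i∣ (+ k)    = ℤ.≤-refl
          i≤∣i∣ -[1+ k ] = ℤ.-≤+

      decide-not : ∀ {A : Set} → Dec A → Dec (¬ A)
      decide-not (yes a) = no (λ f → f a)
      decide-not (no ¬a) = yes ¬a

      module Step₁ (δ₀ : ℕ) (zero₀ : ¬ Excess (pos P 0 δ₀)) (before₀ : ∀ δ → δ < δ₀ → ¬ ¬ Excess (pos P 0 δ)) where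

        in-window : ∀ δ → δ < δ₀ → Excess (pos P 0 δ)
        in-window δ p with excess? (pos P 0 δ)
        ... | yes e = e
        ... | no ¬e = ⊥-elim (before₀ δ p ¬e)

        δ₀>0 : 0 < δ₀
        δ₀>0 = n≢0⇒n>0 (λ { refl → zero₀ (subst Excess (lia 0 1 (λ P → P := P :- ♯ 0 :- ♯ 0) P)
          (excess-at {y} (lia 3 0 (λ y a b → a :< b ⇒ ↑ a :- ↑ y :< ↑ b :- ↑ y) y (τ y) (κ y) differ) ℤ.≤-refl)) })

        -- In translate 0 the excess persists up to offset δ₀. Translate 0 is going to be compared
        -- with the first translate m where it breaks off earlier; such an m exists because
        -- positions far down have no excess, and the translates before m provide windows.
        HasZero : ℕ → Set
        HasZero j = ∃ λ δ → δ < δ₀ × ¬ Excess (pos P j δ)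

        hasZero? : ∀ j → Dec (HasZero j)
        hasZero? j = ℕ.anyUpTo? (λ δ → decide-not (excess? (pos P j δ))) δ₀

        module Step₂ (m δ₁ : ℕ) (δ₁<δ₀ : δ₁ < δ₀) (zero₁ : ¬ Excess (pos P m δ₁)) (before₁ : ∀ j → j < m → ¬ HasZero j) where

          windows : ∀ j → j < m → ∀ δ → δ < δ₀ → Excess (pos P j δ)
          windows j p δ q with excess? (pos P j δ)
          ... | yes e = e
          ... | no ¬e = ⊥-elim (before₁ j p (δ , q , ¬e))

          repeat : ∀ δ → δ ≤ δ₀ → Mem (pos P m δ) → Mem (pos P 0 δ)
          repeat δ p M with K.mem? (pos P 0 δ)
          ... | yes M' = M'
          ... | no ¬M' = ⊥-elim (no-window (suc δ) δ ≤-refl y m (record { no-up = top-free ; gap = ¬M' ; bottom = M ; excess = λ j q δ' r → windows j q δ' (<-≤-trans r p) }))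

          to-m : ∀ {δ} j → pos P 0 δ ℤ.- + (j * n) ≡ pos P j δ
          to-m {δ} j = lia 2 1 (λ d a P → P :- ♯ 0 :- ↑ d :- ↑ a := P :- ↑ a :- ↑ d) δ (j * n) P

          pos-pred : ∀ j δ → pos P j (suc δ) ℤ.+ + 1 ≡ pos P j δ
          pos-pred j δ = lia 2 1 (λ d a P → P :- ↑ a :- ↑ (♯ 1 :+ d) :+ ♯ 1 := P :- ↑ a :- ↑ d) δ (j * n) P

          compare : ∀ s → δ₁ + s ≤ δ₀ → K.N (pos P m (δ₁ + s)) + K.N (pos P 0 δ₁) ≡ K.N (pos P 0 (δ₁ + s)) + K.N (pos P m δ₁)
          compare zero p = subst (λ t → K.N (pos P m t) + K.N (pos P 0 δ₁) ≡ K.N (pos P 0 t) + K.N (pos P m δ₁)) (sym (+-identityʳ δ₁)) (+-comm (K.N (pos P m δ₁)) _)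
          compare (suc s) p rewrite +-suc δ₁ s with K.mem? (pos P 0 (suc (δ₁ + s)))
          ... | yes M = lia 6 0 (λ a a' b b' c d → a := ♯ 1 :+ a' ⇒ b := ♯ 1 :+ b' ⇒ a' :+ c := b' :+ d ⇒ a :+ c := b :+ d)
                (K.N (pos P m (suc (δ₁ + s)))) (K.N (pos P m (δ₁ + s))) (K.N (pos P 0 (suc (δ₁ + s)))) (K.N (pos P 0 (δ₁ + s))) (K.N (pos P 0 δ₁)) (K.N (pos P m δ₁))
                (trans (K.N-mem _ (subst Mem (to-m m) (K.mem-downs m M))) (cong (suc ∘ K.N) (pos-pred m (δ₁ + s)))) (trans (K.N-mem _ M) (cong (suc ∘ K.N) (pos-pred 0 (δ₁ + s))))
                (compare s (<⇒≤ p))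
          ... | no ¬M = trans (cong (_+ K.N (pos P 0 δ₁)) (trans (K.N-nonmem _ (λ M → ¬M (repeat _ p M))) (cong K.N (pos-pred m (δ₁ + s)))))
                (trans (compare s (<⇒≤ p)) (cong (_+ K.N (pos P m δ₁)) (sym (trans (K.N-nonmem _ ¬M) (cong K.N (pos-pred 0 (δ₁ + s)))))))

          compare-τ : ∀ s → L.N (pos P 0 (δ₁ + s)) + L.N (pos P m δ₁) ≤ L.N (pos P m (δ₁ + s)) + L.N (pos P 0 δ₁)
          compare-τ zero = subst (λ t → L.N (pos P 0 t) + L.N (pos P m δ₁) ≤ L.N (pos P m t) + L.N (pos P 0 δ₁)) (sym (+-identityʳ δ₁)) (≤-reflexive (+-comm (L.N (pos P 0 δ₁)) _))
          compare-τ (suc s) rewrite +-suc δ₁ s with L.mem? (pos P 0 (suc (δ₁ + s)))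
          ... | yes M = lia 6 0 (λ a a' b b' c d → a := ♯ 1 :+ a' ⇒ b := ♯ 1 :+ b' ⇒ b' :+ d :≤ a' :+ c ⇒ b :+ d :≤ a :+ c)
                (L.N (pos P m (suc (δ₁ + s)))) (L.N (pos P m (δ₁ + s))) (L.N (pos P 0 (suc (δ₁ + s)))) (L.N (pos P 0 (δ₁ + s))) (L.N (pos P 0 δ₁)) (L.N (pos P m δ₁))
                (trans (L.N-mem _ (subst L.Mem (to-m m) (L.mem-downs m M))) (cong (suc ∘ L.N) (pos-pred m (δ₁ + s)))) (trans (L.N-mem _ M) (cong (suc ∘ L.N) (pos-pred 0 (δ₁ + s))))
                (compare-τ s)
          ... | no ¬M = ≤-trans (≤-reflexive (cong (_+ L.N (pos P m δ₁)) (trans (L.N-nonmem _ ¬M) (cong L.N (pos-pred 0 (δ₁ + s))))))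
                (≤-trans (compare-τ s) (+-monoˡ-≤ (L.N (pos P 0 δ₁)) grow))
            where
              grow : L.N (pos P m (δ₁ + s)) ≤ L.N (pos P m (suc (δ₁ + s)))
              grow with L.mem? (pos P m (suc (δ₁ + s)))
              ... | yes M = ≤-trans (n≤1+n _) (≤-reflexive (sym (trans (L.N-mem _ M) (cong (suc ∘ L.N) (pos-pred m (δ₁ + s))))))
              ... | no ¬M' = ≤-reflexive (sym (trans (L.N-nonmem _ ¬M') (cong L.N (pos-pred m (δ₁ + s)))))

          -- Count the beads between the offsets δ₁ and δ₀. κ has equally many in translates 0 and
          -- m, by `repeat`; τ has at most as many in translate 0 as in translate m. But the excess
          -- falls to zero over this interval in translate 0, where τ must have more beads than κ,
          -- and starts from zero in translate m, where τ has at most as many.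
          contradiction₀ : ⊥
          contradiction₀ = lia 8 0 (λ a b c d a' b' c' d' → a :+ b := c :+ d ⇒ c' :+ d' :≤ a' :+ b' ⇒ c :≤ c' ⇒ b' :< b ⇒ d :≤ d' ⇒ a' :≤ a ⇒ :⊥)
            (K.N (pos P m δ₀)) (K.N (pos P 0 δ₁)) (K.N (pos P 0 δ₀)) (K.N (pos P m δ₁)) (L.N (pos P m δ₀)) (L.N (pos P 0 δ₁)) (L.N (pos P 0 δ₀)) (L.N (pos P m δ₁))
            (subst (λ t → K.N (pos P m t) + K.N (pos P 0 δ₁) ≡ K.N (pos P 0 t) + K.N (pos P m δ₁)) e (compare (δ₀ ∸ δ₁) (≤-reflexive e)))
            (subst (λ t → L.N (pos P 0 t) + L.N (pos P m δ₁) ≤ L.N (pos P m t) + L.N (pos P 0 δ₁)) e (compare-τ (δ₀ ∸ δ₁)))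
            (≮⇒≥ zero₀) (in-window δ₁ δ₁<δ₀) (≮⇒≥ zero₁) (N≤N (pos P m δ₀))
            where
              e : δ₁ + (δ₀ ∸ δ₁) ≡ δ₀
              e = m+[n∸m]≡n (<⇒≤ δ₁<δ₀)

        step₁ : ⊥
        step₁ with least hasZero? (ℤ.∣ P ∣ + ℓ) (0 , δ₀>0 , not-excess (ℤ.∣ P ∣ + ℓ) 0 (≤-trans (m≤m*n (ℤ.∣ P ∣ + ℓ) n {{ℕ.>-nonZero n>0}}) (m≤m+n _ 0)))
        ... | m , _ , (δ₁ , p , z) , h = Step₂.contradiction₀ m δ₁ p z h

      absurd : ⊥
      absurd with least (λ δ → decide-not (excess? (pos P 0 δ))) (ℤ.∣ P ∣ + ℓ) (not-excess 0 (ℤ.∣ P ∣ + ℓ) ≤-refl)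
      ... | δ₀ , _ , z , h = Step₁.step₁ δ₀ z h

  -- The existence of a removal of κ that still contains τ, in doubly negated form; it is applied
  -- only to decidable conclusions.
  descend : ∀ {i} → τ i < κ i → (∀ {w} (G : Good w) → (∀ i → τ i ≤ Removal.τ G i) → ⊥) → ⊥
  descend {i} p minimal with least (λ j → τ j <? κ j) i p
  ... | y , _ , d , h = First.absurd minimal y d (λ j q → ≤-antisym (contained j) (≮⇒≥ (h j q)))

-- Connected components

unique-resp-↭ : ∀ {A : Set} {xs ys : List A} → xs ↭ ys → Unique xs → Unique ys
unique-resp-↭ p = AllPairs-resp-↭ ≢-sym ((λ { refl q → q }) , (λ { refl q → q })) (↭⇒↭ₛ p)
  where open import Data.List.Relation.Binary.Permutation.Setoid.Properties (setoid _) using (AllPairs-resp-↭)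

Cell : Set
Cell = ℕ × ℕ

Adjacent : Cell → Cell → Set
Adjacent x y = T (adjacentB x y)

any⁻ : (p : Cell → Bool) (xs : List Cell) → T (any p xs) → ∃ λ y → y ∈ xs × T (p y)
any⁻ p (x ∷ xs) t with p x in e
... | true  = x , here refl , subst T (sym e) tt
... | false with any⁻ p xs t
...   | y , m , q = y , there m , q

any⁺ : (p : Cell → Bool) (xs : List Cell) {y : Cell} → y ∈ xs → T (p y) → T (any p xs)
any⁺ p (x ∷ xs) (here refl) t with p x
... | true = tt
any⁺ p (x ∷ xs) (there m) t with p x
... | true  = tt
... | false = any⁺ p xs m t

filterB-∈⁻ : ∀ {A : Set} (p : A → Bool) xs {y} → y ∈ filterB p xs → y ∈ xs × T (p y)
filterB-∈⁻ p (x ∷ xs) m with p x in e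
filterB-∈⁻ p (x ∷ xs) (here refl) | true = here refl , subst T (sym e) tt
filterB-∈⁻ p (x ∷ xs) (there m)   | true = let (a , b) = filterB-∈⁻ p xs m in there a , b
filterB-∈⁻ p (x ∷ xs) m           | false = let (a , b) = filterB-∈⁻ p xs m in there a , b

filterB-∈⁺ : ∀ {A : Set} (p : A → Bool) xs {y} → y ∈ xs → T (p y) → y ∈ filterB p xs
filterB-∈⁺ p (x ∷ xs) (here refl) t with p x
... | true = here refl
filterB-∈⁺ p (x ∷ xs) (there m) t with p x
... | true  = there (filterB-∈⁺ p xs m t)
... | false = filterB-∈⁺ p xs m t

filterB-partition : (p : Cell → Bool) (xs : List Cell) → filterB p xs ++ filterB (not ∘ p) xs ↭ xs
filterB-partition p [] = ↭-refl
filterB-partition p (x ∷ xs) with p x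
... | true  = prep x (filterB-partition p xs)
... | false = ↭-trans (↭ₚ.shift x (filterB p xs) (filterB (not ∘ p) xs)) (prep x (filterB-partition p xs))

length-filterB : ∀ (p : Cell → Bool) xs → length (filterB p xs) ≤ length xs
length-filterB p [] = z≤n
length-filterB p (x ∷ xs) with p x
... | true  = s≤s (length-filterB p xs)
... | false = m≤n⇒m≤1+n (length-filterB p xs)

length-filterB-not : ∀ (p : Cell → Bool) xs → (∀ {y} → y ∈ xs → ¬ T (p y)) ⊎ length (filterB (not ∘ p) xs) < length xs
length-filterB-not p [] = inj₁ (λ ())
length-filterB-not p (x ∷ xs) with p x in e
... | true  = inj₂ (s≤s (length-filterB (not ∘ p) xs))
... | false with length-filterB-not p xs
...   | inj₁ h = inj₁ (λ { (here refl) t → subst T e t ; (there m) t → h m t })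
...   | inj₂ q = inj₂ (s≤s q)

closure-↭ : ∀ n comp rest → proj₁ (closure n comp rest) ++ proj₂ (closure n comp rest) ↭ comp ++ rest
closure-↭ zero    comp rest = ↭-refl
closure-↭ (suc n) comp rest = ↭-trans (closure-↭ n (comp ++ filterB p rest) (filterB (not ∘ p) rest))
  (↭-trans (subst (_↭ comp ++ (filterB p rest ++ filterB (not ∘ p) rest)) (sym (++-assoc comp (filterB p rest) _)) ↭-refl) (↭ₚ.++⁺ˡ comp (filterB-partition p rest)))
  where
    p : Cell → Bool
    p x = any (adjacentB x) comp

closure-⊇ : ∀ n comp rest {y} → y ∈ comp → y ∈ proj₁ (closure n comp rest)
closure-⊇ zero    comp rest m = m
closure-⊇ (suc n) comp rest m = closure-⊇ n _ _ (∈-++⁺ˡ m)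

filterB-none : ∀ (p : Cell → Bool) xs → (∀ {y} → y ∈ xs → ¬ T (p y)) → filterB p xs ≡ [] × filterB (not ∘ p) xs ≡ xs
filterB-none p [] h = refl , refl
filterB-none p (x ∷ xs) h with p x in e
... | true  = ⊥-elim (h (here refl) (subst T (sym e) tt))
... | false = let (a , b) = filterB-none p xs (h ∘ there) in a , cong (x ∷_) b

closure-fixed : ∀ n comp rest → (∀ {y} → y ∈ rest → ¬ T (any (adjacentB y) comp)) → closure n comp rest ≡ (comp , rest)
closure-fixed zero    comp rest h = refl
closure-fixed (suc n) comp rest h = let (a , b) = filterB-none (λ x → any (adjacentB x) comp) rest h in
  trans (cong₂ (closure n) (trans (cong (comp ++_) a) (++-identityʳ comp)) b) (closure-fixed n comp rest h)

-- Once the fuel is exhausted no cell of the rest touches the component.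
closure-stable : ∀ n comp rest → length rest ≤ n → ∀ {y c} → y ∈ proj₂ (closure n comp rest) → c ∈ proj₁ (closure n comp rest) → ¬ Adjacent y c
closure-stable zero    comp []   q () c∈ a
closure-stable (suc n) comp rest q {y} {c} y∈ c∈ a with length-filterB-not (λ x → any (adjacentB x) comp) rest
... | inj₂ shrink = closure-stable n _ _ (≤-pred (≤-trans shrink q)) y∈ c∈ a
... | inj₁ none = none (subst (λ z → y ∈ proj₂ z) eq y∈) (any⁺ _ comp (subst (λ z → c ∈ proj₁ z) eq c∈) a)
  where
    eq : closure (suc n) comp rest ≡ (comp , rest)
    eq = closure-fixed (suc n) comp rest none

Invariant : (Cell → ℕ) → ℕ → List Cell → Set
Invariant lab l comp = ∀ {c} → c ∈ comp → lab c ≡ l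

closure-label : ∀ (lab : Cell → ℕ) l n comp rest → (∀ {x y} → x ∈ rest → y ∈ comp ++ rest → Adjacent x y → lab x ≡ lab y) → Invariant lab l comp →
  Invariant lab l (proj₁ (closure n comp rest))
closure-label lab l zero    comp rest sep inv = inv
closure-label lab l (suc n) comp rest sep inv = closure-label lab l n (comp ++ filterB p rest) (filterB (not ∘ p) rest)
  (λ x∈ y∈ → sep (proj₁ (filterB-∈⁻ _ rest x∈)) (widen y∈)) inv'
  where
    p : Cell → Bool
    p x = any (adjacentB x) comp
    widen : ∀ {y} → y ∈ (comp ++ filterB p rest) ++ filterB (not ∘ p) rest → y ∈ comp ++ rest
    widen m with ∈-++⁻ (comp ++ filterB p rest) m
    ... | inj₂ b = ∈-++⁺ʳ comp (proj₁ (filterB-∈⁻ _ rest b))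
    ... | inj₁ a with ∈-++⁻ comp a
    ...   | inj₁ c = ∈-++⁺ˡ c
    ...   | inj₂ b = ∈-++⁺ʳ comp (proj₁ (filterB-∈⁻ _ rest b))
    inv' : Invariant lab l (comp ++ filterB p rest)
    inv' m with ∈-++⁻ comp m
    ... | inj₁ c = inv c
    ... | inj₂ b with filterB-∈⁻ p rest b
    ...   | x∈ , t with any⁻ _ comp t
    ...     | y , y∈ , a = trans (sep x∈ (∈-++⁺ˡ y∈) a) (inv y∈)

-- A labelling of a set of cells whose classes are the connected components.
record Labelled (X : List Cell) (lab : Cell → ℕ) : Set₁ where
  field
    distinct  : Unique X
    separated : ∀ {x y} → x ∈ X → y ∈ X → Adjacent x y → lab x ≡ lab y
    connected : ∀ {x y} → x ∈ X → y ∈ X → lab x ≡ lab y → (Q : Cell → Set) →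
                (∀ {u v} → u ∈ X → v ∈ X → lab u ≡ lab x → lab v ≡ lab x → Adjacent v u → Q u → Q v) → Q x → Q y

module _ {X : List Cell} {lab : Cell → ℕ} (L : Labelled X lab) where
  open Labelled L

  IsClass : List Cell → ℕ → Set
  IsClass C l = (∀ {y} → y ∈ C → y ∈ X × lab y ≡ l) × (∀ {y} → y ∈ X → lab y ≡ l → y ∈ C)

  record Split (Y : List Cell) : Set where
    field
      labels  : List ℕ
      unique  : Unique labels
      sound   : ∀ {l} → l ∈ labels → ∃ λ y → y ∈ Y × lab y ≡ l
      full    : ∀ {y} → y ∈ Y → lab y ∈ labels
      {comps} : List (List Cell)
      classes : Pointwise IsClass comps labels

  unique-++ : ∀ (as bs : List Cell) → Unique (as ++ bs) → ∀ {y} → y ∈ as → y ∉ bs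
  unique-++ (a ∷ as) bs (h ∷ u) (here refl) m = All.lookup h (∈-++⁺ʳ as m) refl
  unique-++ (a ∷ as) bs (h ∷ u) (there p) m = unique-++ as bs u p m

  unique-++ʳ : ∀ (as bs : List Cell) → Unique (as ++ bs) → Unique bs
  unique-++ʳ []       bs u       = u
  unique-++ʳ (a ∷ as) bs (h ∷ u) = unique-++ʳ as bs u

  private
    module First {x xs} (u : Unique (x ∷ xs)) (sub : ∀ {y} → y ∈ x ∷ xs → y ∈ X)
                 (closed : ∀ {u v} → u ∈ x ∷ xs → v ∈ X → lab v ≡ lab u → v ∈ x ∷ xs) where
      comp' rest' : List Cell
      comp' = proj₁ (closure (length xs) (x ∷ []) xs)
      rest' = proj₂ (closure (length xs) (x ∷ []) xs)
      perm : comp' ++ rest' ↭ x ∷ xs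
      perm = closure-↭ (length xs) (x ∷ []) xs
      ucr : Unique (comp' ++ rest')
      ucr = unique-resp-↭ (↭-sym perm) u
      x∈ : x ∈ comp'
      x∈ = closure-⊇ (length xs) (x ∷ []) xs (here refl)
      shorter : length rest' ≤ length xs
      shorter = ≤-pred (≤-trans (+-monoˡ-≤ (length rest') (nonempty comp' x∈))
        (≤-trans (≤-reflexive (sym (length-++ comp'))) (≤-reflexive (↭ₚ.↭-length perm))))
        where
          nonempty : ∀ (as : List Cell) {y} → y ∈ as → 1 ≤ length as
          nonempty (a ∷ as) _ = s≤s z≤n
      in-rest : ∀ {y} → y ∈ rest' → y ∈ x ∷ xs
      in-rest m = ↭ₚ.∈-resp-↭ perm (∈-++⁺ʳ comp' m)
      in-comp : ∀ {y} → y ∈ comp' → y ∈ X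
      in-comp m = sub (↭ₚ.∈-resp-↭ perm (∈-++⁺ˡ m))
      comp-label : Invariant lab (lab x) comp'
      comp-label = closure-label lab (lab x) (length xs) (x ∷ []) xs (λ a b → separated (sub (there a)) (sub b)) (λ { (here refl) → refl ; (there ()) })
      comp-full : ∀ {y} → y ∈ X → lab y ≡ lab x → y ∈ comp'
      comp-full {y} m e = connected (sub (here refl)) m (sym e) (_∈ comp') extend x∈
        where
          extend : ∀ {u v} → u ∈ X → v ∈ X → lab u ≡ lab x → lab v ≡ lab x → Adjacent v u → u ∈ comp' → v ∈ comp'
          extend _ v∈X _ ev a u∈ with ∈-++⁻ comp' (↭ₚ.∈-resp-↭ (↭-sym perm) (closed (here refl) v∈X ev))
          ... | inj₁ m = m
          ... | inj₂ r = ⊥-elim (closure-stable (length xs) (x ∷ []) xs ≤-refl r u∈ a)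
      closed' : ∀ {u v} → u ∈ rest' → v ∈ X → lab v ≡ lab u → v ∈ rest'
      closed' m v∈X e with ∈-++⁻ comp' (↭ₚ.∈-resp-↭ (↭-sym perm) (closed (in-rest m) v∈X e))
      ... | inj₂ r = r
      ... | inj₁ c = ⊥-elim (unique-++ comp' rest' ucr (comp-full (sub (in-rest m)) (trans (sym e) (comp-label c))) m)
      extended : Split rest' → Split (x ∷ xs)
      extended S = record
        { labels  = lab x ∷ Split.labels S
        ; unique  = All.tabulate fresh ∷ Split.unique S
        ; sound   = λ { (here refl) → x , here refl , refl ; (there p) → let (y , m , e) = Split.sound S p in y , in-rest m , e }
        ; full    = full'
        ; classes = ((λ m → in-comp m , comp-label m) , comp-full) ∷ Split.classes S
        }
        where
          fresh : ∀ {l} → l ∈ Split.labels S → lab x ≢ l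
          fresh p e with Split.sound S p
          ... | y , m , e' = unique-++ comp' rest' ucr (comp-full (sub (in-rest m)) (trans e' (sym e))) m
          full' : ∀ {y} → y ∈ x ∷ xs → lab y ∈ lab x ∷ Split.labels S
          full' m with ∈-++⁻ comp' (↭ₚ.∈-resp-↭ (↭-sym perm) m)
          ... | inj₁ c = here (comp-label c)
          ... | inj₂ r = there (Split.full S r)

  -- The hypothesis that Y is a union of classes is preserved when the closure of its first cell is
  -- peeled off, since that closure is exactly one class.
  split-components : ∀ n Y → length Y ≤ n → Unique Y → (∀ {y} → y ∈ Y → y ∈ X) → (∀ {u v} → u ∈ Y → v ∈ X → lab v ≡ lab u → v ∈ Y) →
    Σ (Split Y) λ S → Split.comps S ≡ componentsN n Y
  split-components n [] _ u sub closed = record { labels = [] ; unique = [] ; sound = λ () ; full = λ () ; classes = [] } , empty n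
    where
      empty : ∀ n → [] ≡ componentsN n []
      empty zero    = refl
      empty (suc n) = refl
  split-components (suc n) (x ∷ xs) (s≤s len) u sub closed =
    let (S , eq) = split-components n rest' (≤-trans shorter len) (unique-++ʳ comp' rest' ucr) (sub ∘ in-rest) closed'
    in extended S , cong (comp' ∷_) eq
    where open First u sub closed

minimum-spec : ∀ xs m → m ∈ xs → (∀ {y} → y ∈ xs → m ≤ y) → minimum xs ≡ m
minimum-spec (x ∷ xs) m m∈ h = ≤-antisym (upper xs m∈) (lower-bound x xs (h (here refl)) (λ p → h (there p)))
  where
    lower-bound : ∀ x xs → m ≤ x → (∀ {y} → y ∈ xs → m ≤ y) → m ≤ foldr _⊓_ x xs
    lower-bound x []       p q = p
    lower-bound x (y ∷ xs) p q = ℕ.⊓-glb (q (here refl)) (lower-bound x xs p (λ r → q (there r)))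
    below-x : ∀ xs → foldr _⊓_ x xs ≤ x
    below-x []       = ≤-refl
    below-x (y ∷ xs) = ≤-trans (ℕ.m⊓n≤n y _) (below-x xs)
    upper′ : ∀ xs → m ∈ xs → foldr _⊓_ x xs ≤ m
    upper′ (y ∷ xs) (here refl) = ℕ.m⊓n≤m y _
    upper′ (y ∷ xs) (there p)   = ≤-trans (ℕ.m⊓n≤n y _) (upper′ xs p)
    upper : ∀ xs → m ∈ x ∷ xs → foldr _⊓_ x xs ≤ m
    upper xs (here refl) = below-x xs
    upper xs (there p)   = upper′ xs p

maximum-spec : ∀ xs m → m ∈ xs → (∀ {y} → y ∈ xs → y ≤ m) → maximum xs ≡ m
maximum-spec xs m m∈ h = ≤-antisym (upper xs h) (lower-bound xs m∈)
  where
    upper : ∀ xs → (∀ {y} → y ∈ xs → y ≤ m) → maximum xs ≤ m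
    upper []       h = z≤n
    upper (x ∷ xs) h = ℕ.⊔-lub (h (here refl)) (upper xs (h ∘ there))
    lower-bound : ∀ xs → m ∈ xs → m ≤ maximum xs
    lower-bound (x ∷ xs) (here refl) = ℕ.m≤m⊔n x _
    lower-bound (x ∷ xs) (there p)   = ≤-trans (lower-bound xs p) (ℕ.m≤n⊔m x _)

-- Ribbons and spin

boxRows : ℕ → List ℕ → List Cell
boxRows s xs = concatMap (λ p → map (λ c → (proj₁ p , c)) (upTo (proj₂ p))) (enumFrom s xs)

boxRows-∈⁺ : ∀ s xs {i c} → c < nth xs i → (s + i , c) ∈ boxRows s xs
boxRows-∈⁺ s (x ∷ xs) {zero} {c} p = ∈-++⁺ˡ (subst (λ a → (a , c) ∈ map (s ,_) (upTo x)) (sym (+-identityʳ s)) (∈-map⁺ (s ,_) (∈-upTo⁺ p)))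
boxRows-∈⁺ s (x ∷ xs) {suc i} {c} p = ∈-++⁺ʳ (map (s ,_) (upTo x)) (subst (λ a → (a , c) ∈ boxRows (suc s) xs) (sym (+-suc s i)) (boxRows-∈⁺ (suc s) xs p))

boxRows-∈⁻ : ∀ s xs {r c} → (r , c) ∈ boxRows s xs → ∃ λ i → r ≡ s + i × c < nth xs i
boxRows-∈⁻ s (x ∷ xs) m with ∈-++⁻ (map (s ,_) (upTo x)) m
... | inj₁ a with ∈-map⁻ (s ,_) a
...   | c , c∈ , refl = 0 , sym (+-identityʳ s) , ∈-upTo⁻ c∈
boxRows-∈⁻ s (x ∷ xs) m | inj₂ b with boxRows-∈⁻ (suc s) xs b
...   | i , e , q = suc i , trans e (sym (+-suc s i)) , q

boxRows-unique : ∀ s xs → Unique (boxRows s xs)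
boxRows-unique s []       = []
boxRows-unique s (x ∷ xs) = Uniqueₚ.++⁺ (Uniqueₚ.map⁺ (cong proj₂) (Uniqueₚ.upTo⁺ x)) (boxRows-unique (suc s) xs) disjoint
  where
    disjoint : ∀ {v} → v ∈ map (s ,_) (upTo x) × v ∈ boxRows (suc s) xs → ⊥
    disjoint (a , b) with ∈-map⁻ (s ,_) a
    ... | c , _ , refl with boxRows-∈⁻ (suc s) xs b
    ...   | i , e , _ = <⇒≢ (s≤s (m≤m+n s i)) e

boxes≡ : ∀ xs → boxes xs ≡ boxRows 0 xs
boxes≡ xs = cong (concatMap _) (indexed≡enumFrom xs)

skewCells-∈⁺ : ∀ κ τ {r c} → nth τ r ≤ c → c < nth κ r → (r , c) ∈ skewCells κ τ
skewCells-∈⁺ κ τ p q = filterB-∈⁺ _ (boxes κ) (subst ((_ , _) ∈_) (sym (boxes≡ κ)) (boxRows-∈⁺ 0 κ q)) (≤⇒≤ᵇ p)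

skewCells-∈⁻ : ∀ κ τ {r c} → (r , c) ∈ skewCells κ τ → nth τ r ≤ c × c < nth κ r
skewCells-∈⁻ κ τ m with filterB-∈⁻ _ (boxes κ) m
... | m' , t with boxRows-∈⁻ 0 κ (subst ((_ , _) ∈_) (boxes≡ κ) m')
...   | i , refl , q = ≤ᵇ⇒≤ _ _ t , q

filterB-unique : ∀ {A : Set} (p : A → Bool) xs → Unique xs → Unique (filterB p xs)
filterB-unique p []       []      = []
filterB-unique p (x ∷ xs) (h ∷ u) with p x
... | false = filterB-unique p xs u
... | true  = All.tabulate (λ m → All.lookup h (proj₁ (filterB-∈⁻ p xs m))) ∷ filterB-unique p xs u

skewCells-unique : ∀ κ τ → Unique (skewCells κ τ)
skewCells-unique κ τ = filterB-unique _ (boxes κ) (subst Unique (sym (boxes≡ κ)) (boxRows-unique 0 κ))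

absDiff-1 : ∀ a b → T (absDiff a b ≡ᵇ 1) → a ≡ suc b ⊎ b ≡ suc a
absDiff-1 zero    (suc zero) t = inj₂ refl
absDiff-1 (suc zero) zero    t = inj₁ refl
absDiff-1 (suc a) (suc b) t with absDiff-1 a b t
... | inj₁ e = inj₁ (cong suc e)
... | inj₂ e = inj₂ (cong suc e)

absDiff-suc : ∀ a → T (absDiff a (suc a) ≡ᵇ 1) × T (absDiff (suc a) a ≡ᵇ 1)
absDiff-suc zero    = tt , tt
absDiff-suc (suc a) = absDiff-suc a

data Step : Cell → Cell → Set where
  right : ∀ {r c} → Step (r , c) (r , suc c)
  left  : ∀ {r c} → Step (r , suc c) (r , c)
  below : ∀ {r c} → Step (r , c) (suc r , c)
  above : ∀ {r c} → Step (suc r , c) (r , c)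

step⁻ : ∀ {u v} → Adjacent u v → Step u v
step⁻ {r , c} {r' , c'} t with Equivalence.to T-∨ t
... | inj₁ p with ≡ᵇ⇒≡ r r' (∧-fst p) | absDiff-1 c c' (∧-snd {r ≡ᵇ r'} p)
...   | refl | inj₁ refl = left
...   | refl | inj₂ refl = right
step⁻ {r , c} {r' , c'} t | inj₂ p with ≡ᵇ⇒≡ c c' (∧-fst p) | absDiff-1 r r' (∧-snd {c ≡ᵇ c'} p)
...   | refl | inj₁ refl = above
...   | refl | inj₂ refl = below

step⁺ : ∀ {u v} → Step u v → Adjacent u v
step⁺ (right {r} {c}) = Equivalence.from T-∨ (inj₁ (T-∧ (≡⇒≡ᵇ r r refl) (proj₁ (absDiff-suc c))))
step⁺ (left {r} {c})  = Equivalence.from T-∨ (inj₁ (T-∧ (≡⇒≡ᵇ r r refl) (proj₂ (absDiff-suc c))))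
step⁺ (below {r} {c}) = Equivalence.from (T-∨ {(r ≡ᵇ suc r) ∧ _}) (inj₂ (T-∧ (≡⇒≡ᵇ c c refl) (proj₁ (absDiff-suc r))))
step⁺ (above {r} {c}) = Equivalence.from (T-∨ {(suc r ≡ᵇ r) ∧ _}) (inj₂ (T-∧ (≡⇒≡ᵇ c c refl) (proj₂ (absDiff-suc r))))

count-↭ : ∀ (p : ℕ → Bool) {xs ys} → xs ↭ ys → count p xs ≡ count p ys
count-↭ p _↭_.refl = refl
count-↭ p (_↭_.prep x q) with p x
... | true  = cong suc (count-↭ p q)
... | false = count-↭ p q
count-↭ p (_↭_.swap x y q) with p x | p y
... | true  | true  = cong (suc ∘ suc) (count-↭ p q)
... | true  | false = cong suc (count-↭ p q)
... | false | true  = cong suc (count-↭ p q)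
... | false | false = count-↭ p q
count-↭ p (_↭_.trans q q') = trans (count-↭ p q) (count-↭ p q')

∑-↭ : ∀ {A : Set} {xs ys : List A} (f : A → ℤ) → xs ↭ ys → ∑ xs f ≡ ∑ ys f
∑-↭ f _↭_.refl = refl
∑-↭ f (_↭_.prep x q) = cong (ℤ._+_ (f x)) (∑-↭ f q)
∑-↭ f (_↭_.swap {xs} {ys} x y q) = trans (cong (λ s → f x ℤ.+ (f y ℤ.+ s)) (∑-↭ f q))
  (lia 0 3 (λ a b s → a := a ⇒ a :+ (b :+ s) := b :+ (a :+ s)) (f x) (f y) (∑ ys f) refl)
∑-↭ f (_↭_.trans q q') = trans (∑-↭ f q) (∑-↭ f q')

∑-cong-∈ : ∀ {A : Set} {f g : A → ℤ} (xs : List A) → (∀ {x} → x ∈ xs → f x ≡ g x) → ∑ xs f ≡ ∑ xs g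
∑-cong-∈ []       h = refl
∑-cong-∈ (x ∷ xs) h = cong₂ ℤ._+_ (h (here refl)) (∑-cong-∈ xs (h ∘ there))

-- In a strictly decreasing list the position of r is the number of larger entries.
∑-rank : ∀ s {rs} → AllPairs _>_ rs → (f : ℕ → ℕ → ℤ) →
  ∑ rs (λ r → f r (s + count (λ l → r <ᵇ l) rs)) ≡ ∑ (enumFrom s rs) (λ p → f (proj₂ p) (proj₁ p))
∑-rank s {[]}     []      f = refl
∑-rank s {w ∷ rs} (h ∷ a) f = cong₂ ℤ._+_ (cong (f w) (trans (cong (ℕ._+_ s) head-rank) (+-identityʳ s)))
  (trans (∑-cong-∈ rs (λ {r} r∈ → cong (f r) (trans (cong (λ b → s + (if b then suc (count (λ l → r <ᵇ l) rs) else count (λ l → r <ᵇ l) rs)) (<ᵇ-true (All.lookup h r∈))) (+-suc s _)))) (∑-rank (suc s) a f))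
  where
    none : ∀ rs' → (∀ {r} → r ∈ rs' → r ≤ w) → count (λ l → w <ᵇ l) rs' ≡ 0
    none []        h = refl
    none (r ∷ rs') h with w <ᵇ r | <ᵇ-false (h (here refl))
    ... | false | _ = none rs' (h ∘ there)
    head-rank : count (λ l → w <ᵇ l) (w ∷ rs) ≡ 0
    head-rank = none (w ∷ rs) (λ { (here refl) → ≤-refl ; (there m) → <⇒≤ (All.lookup h m) })

module _ {n μ} (Bd : Bounded n μ) where
  open Rows Bd

  ups-decreasing : ∀ {w y rs} → Ups w y rs → AllPairs _>_ rs
  ups-decreasing (last _)   = [] ∷ []
  ups-decreasing (up {u = u} e U) = All.tabulate (λ m → ≤-<-trans (ups-≤ U m) (subst (u <_) e (down-above u))) ∷ ups-decreasing U

module Ribbons {n : ℕ} {μ : ℕ → ℕ} (κl : List ℕ) (D : CoreData n (nth κl) μ) (ℓ : ℕ) (finite : ∀ i → ℓ ≤ i → nth κl i ≡ 0) where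
  open CoreData D
  open Rows bounded-μ
  open Cover D ℓ finite

  module Strips {w : ℕ} (G : Good w) (τl : List ℕ) (τl≡ : ∀ i → nth τl i ≡ Removal.τ G i) where
    open Removal G
    κ : ℕ → ℕ
    κ = nth κl
    X : List Cell
    X = skewCells κl τl

    label : ℕ → ℕ
    label i with block i
    ... | at r _ _  = r
    ... | nowhere _ = 0

    lab : Cell → ℕ
    lab = label ∘ proj₁

    label-at : ∀ {r i} → r ∈ rs → InBlock r i → label i ≡ r
    label-at {r} {i} r∈ b with block i
    ... | at r' r'∈ b' = block-unique r'∈ r∈ b' b
    ... | nowhere out  = ⊥-elim (out r∈ b)

    X⁻ : ∀ {i c} → (i , c) ∈ X → (τ i ≤ c × c < κ i) × ∃ λ r → r ∈ rs × InBlock r i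
    X⁻ {i} {c} m with skewCells-∈⁻ κl τl m
    ... | p , q = (p' , q) , blocked (block i)
      where
        p' : τ i ≤ c
        p' = subst (_≤ c) (τl≡ i) p
        blocked : Block i → ∃ λ r → r ∈ rs × InBlock r i
        blocked (at r r∈ b)   = r , r∈ , b
        blocked (nowhere out) = ⊥-elim (<⇒≱ q (subst (_≤ c) (τ-out i out) p'))

    X⁺ : ∀ {i c} → τ i ≤ c → c < κ i → (i , c) ∈ X
    X⁺ {i} {c} p q = skewCells-∈⁺ κl τl (subst (_≤ c) (sym (τl≡ i)) p) q

    -- By `τ-beyond-block` the row after a block ends no later than where the removed cells in the
    -- last row of the block begin, so no removed column crosses the end of a block.
    same-column : ∀ {i c} → (i , c) ∈ X → (suc i , c) ∈ X → label i ≡ label (suc i)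
    same-column {i} {c} m m' with X⁻ m | X⁻ m'
    ... | (p , _) , r , r∈ , b | (_ , q') , _ with split-block b
    ...   | s , s≤x , refl with m≤n⇒m<n∨m≡n s≤x
    ...     | inj₁ s<x = trans (label-at r∈ b) (sym (label-at r∈ (m≤n⇒m≤1+n (proj₁ b) ,
                lia 3 0 (λ r s x → s :< x ⇒ ♯ 1 :+ (r :+ s) :< r :+ (♯ 1 :+ x)) r s x s<x)))
    ...     | inj₂ refl = ⊥-elim (<⇒≱ q' (≤-trans (subst (λ j → κ j ≤ τ (r + x)) (+-suc r x) (τ-beyond-block r∈)) p))

    separated : ∀ {u v} → u ∈ X → v ∈ X → Adjacent u v → lab u ≡ lab v
    separated a b t = go (step⁻ t) a b
      where
        go : ∀ {u v} → Step u v → u ∈ X → v ∈ X → lab u ≡ lab v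
        go right a b = refl
        go left  a b = refl
        go below a b = same-column a b
        go above a b = sym (same-column b a)

    module Connect (r : ℕ) (r∈ : r ∈ rs) (Q : Cell → Set)
                   (walk : ∀ {u v} → u ∈ X → v ∈ X → lab u ≡ r → lab v ≡ r → Step v u → Q u → Q v) where
      Full : ℕ → Set
      Full i = ∀ c → τ i ≤ c → c < κ i → Q (i , c)

      along-row : ∀ {i c} → InBlock r i → τ i ≤ c → c < κ i → Q (i , c) → Full i
      along-row {i} {c} b p q Qc c' p' q' with ≤-total c c'
      ... | inj₁ z = subst (λ a → Q (i , a)) (m+[n∸m]≡n z) (rightwards (c' ∸ c) (subst (_< κ i) (sym (m+[n∸m]≡n z)) q'))
        where
          rightwards : ∀ e → c + e < κ i → Q (i , c + e)
          rightwards zero    _  = subst (λ a → Q (i , a)) (sym (+-identityʳ c)) Qc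
          rightwards (suc e) lt = subst (λ a → Q (i , a)) (sym (+-suc c e))
            (walk (X⁺ (≤-trans p (m≤m+n c e)) lt') (X⁺ (m≤n⇒m≤1+n (≤-trans p (m≤m+n c e))) (subst (_< κ i) (+-suc c e) lt))
              (label-at r∈ b) (label-at r∈ b) left (rightwards e lt'))
            where
              lt' : c + e < κ i
              lt' = <-trans (+-monoʳ-< c (n<1+n e)) lt
      ... | inj₂ z = leftwards (c ∸ c') c' p' (m∸n+n≡m z)
        where
          leftwards : ∀ e a → τ i ≤ a → e + a ≡ c → Q (i , a)
          leftwards zero    a pa refl = Qc
          leftwards (suc e) a pa eq = walk (X⁺ (m≤n⇒m≤1+n pa) (below-κ e (suc a) (trans (+-suc e a) eq))) (X⁺ pa (below-κ (suc e) a eq))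
              (label-at r∈ b) (label-at r∈ b) right (leftwards e (suc a) (m≤n⇒m≤1+n pa) (trans (+-suc e a) eq))
            where
              below-κ : ∀ e a → e + a ≡ c → a < κ i
              below-κ e a eq = ≤-<-trans (≤-trans (m≤n+m a e) (≤-reflexive eq)) q

      in-block : ∀ s → s ≤ x → InBlock r (r + s)
      in-block s p = m≤m+n r s , +-monoʳ-< r (s≤s p)

      -- Consecutive rows of a block meet in the first column of the upper one.
      shared : ∀ s → suc s ≤ x → (r + s , τ (r + s)) ∈ X × (r + suc s , τ (r + s)) ∈ X
      shared s p = X⁺ ≤-refl (τ<κ s r∈ (<⇒≤ p)) ,
        subst (λ i → (i , τ (r + s)) ∈ X) (sym (+-suc r s)) (X⁺ (CoreData.κ-antitone newCore (r + s)) (≤-reflexive (τ-mid s r∈ p)))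

      downwards : ∀ s → s ≤ x → Full r → Full (r + s)
      downwards zero    p F = subst Full (sym (+-identityʳ r)) F
      downwards (suc s) p F with shared s p
      ... | m , m' = along-row (in-block (suc s) p) (proj₁ (proj₁ (X⁻ m'))) (proj₂ (proj₁ (X⁻ m')))
        (walk m m' (label-at r∈ (in-block s (<⇒≤ p))) (label-at r∈ (in-block (suc s) p))
          (subst (λ i → Step (i , τ (r + s)) (r + s , τ (r + s))) (sym (+-suc r s)) above)
          (downwards s (<⇒≤ p) F _ ≤-refl (proj₂ (proj₁ (X⁻ m)))))

      upwards : ∀ s → s ≤ x → Full (r + s) → Full r
      upwards zero    p F = subst Full (+-identityʳ r) F
      upwards (suc s) p F with shared s p
      ... | m , m' = upwards s (<⇒≤ p) (along-row (in-block s (<⇒≤ p)) ≤-refl (proj₂ (proj₁ (X⁻ m)))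
        (walk m' m (label-at r∈ (in-block (suc s) p)) (label-at r∈ (in-block s (<⇒≤ p)))
          (subst (λ i → Step (r + s , τ (r + s)) (i , τ (r + s))) (sym (+-suc r s)) below)
          (F _ (proj₁ (proj₁ (X⁻ m'))) (proj₂ (proj₁ (X⁻ m'))))))

    labelled : Labelled X lab
    labelled = record { distinct = skewCells-unique κl τl ; separated = separated ; connected = connected }
      where
        connected : ∀ {u v} → u ∈ X → v ∈ X → lab u ≡ lab v → (Q : Cell → Set) →
          (∀ {a b} → a ∈ X → b ∈ X → lab a ≡ lab u → lab b ≡ lab u → Adjacent b a → Q a → Q b) → Q u → Q v
        connected {i , c} {i' , c'} m m' e Q walk Qu with X⁻ m | X⁻ m'
        ... | (p , q) , r , r∈ , b | (p' , q') , r' , r'∈ , b' with trans (sym (label-at r∈ b)) (trans e (label-at r'∈ b'))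
        ...   | refl with split-block b | split-block b'
        ...     | s , s≤x , refl | s' , s'≤x , refl = downwards s' s'≤x (upwards s s≤x (along-row b p q Qu)) c' p' q'
          where open Connect r r∈ Q (λ u∈ v∈ eu ev st → walk u∈ v∈ (trans eu (sym (label-at r∈ b))) (trans ev (sym (label-at r∈ b))) (step⁺ st))

    corner : ∀ {r} s → r ∈ rs → s ≤ x → (r + s , τ (r + s)) ∈ X × label (r + s) ≡ r
    corner {r} s r∈ p = X⁺ ≤-refl (τ<κ s r∈ p) , label-at r∈ (m≤m+n r s , +-monoʳ-< r (s≤s p))

    rows-of-class : ∀ {C r} → r ∈ rs → IsClass labelled C r → minimum (map proj₁ C) ≡ r × maximum (map proj₁ C) ≡ r + x
    rows-of-class {C} {r} r∈ (sound , full) =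
      minimum-spec _ r (subst (_∈ map proj₁ C) (+-identityʳ r) (row 0 z≤n)) (proj₁ ∘ range) ,
      maximum-spec _ (r + x) (row x ≤-refl) (λ m → ≤-pred (≤-trans (proj₂ (range m)) (≤-reflexive (+-suc r x))))
      where
        row : ∀ s → s ≤ x → r + s ∈ map proj₁ C
        row s p = ∈-map⁺ proj₁ (full (proj₁ (corner s r∈ p)) (proj₂ (corner s r∈ p)))
        range : ∀ {i} → i ∈ map proj₁ C → InBlock r i
        range m with ∈-map⁻ proj₁ m
        ... | (i , c) , m' , refl with sound m'
        ...   | mX , e with X⁻ mX
        ...     | _ , r' , r'∈ , b = subst (λ a → InBlock a i) (trans (sym (label-at r'∈ b)) e) b

    comps : Σ (Split labelled X) λ S → Split.comps S ≡ components κl τl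
    comps = split-components labelled (length X) X ≤-refl (skewCells-unique κl τl) id (λ _ m _ → m)

    open Split (proj₁ comps) using (labels; unique; sound; full; classes)

    labels-rows : ∀ {r} → r ∈ labels → r ∈ rs
    labels-rows m with sound m
    ... | (i , c) , mX , refl with X⁻ mX
    ...   | _ , r , r∈ , b = subst (_∈ rs) (sym (label-at r∈ b)) r∈

    labels↭rows : labels ↭ rs
    labels↭rows = unique-set⇒↭ unique (AllPairs.map (λ p e → <⇒≢ p (sym e)) (ups-decreasing bounded-μ U)) labels-rows
      (λ {r} r∈ → let (m , e) = corner 0 r∈ z≤n in subst (_∈ labels) e (full m))

    Tops : List (List Cell) → List ℕ → Set
    Tops = Pointwise (λ C r → topRow C ≡ suc r × height C ≡ suc x)

    tops : Tops (components κl τl) labels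
    tops = subst (λ Cs → Tops Cs labels) (proj₂ comps) (go labels-rows classes)
      where
        go : ∀ {Cs ls} → (∀ {r} → r ∈ ls → r ∈ rs) → Pointwise (IsClass labelled) Cs ls → Tops Cs ls
        go sub []       = []
        go sub (_∷_ {y = r} c cs) with rows-of-class (sub (here refl)) c
        ... | e , e' = (cong suc e , cong suc (trans (cong₂ _∸_ e' e) (m+n∸m≡n r x))) ∷ go (sub ∘ there) cs

    tops-length : ∀ {Cs ls} → Tops Cs ls → length Cs ≡ length ls
    tops-length []       = refl
    tops-length (_ ∷ cs) = cong suc (tops-length cs)

    tops-count : ∀ r {Cs ls} → Tops Cs ls → count (λ C → suc r <ᵇ topRow C) Cs ≡ count (λ l → r <ᵇ l) ls
    tops-count r []             = refl
    tops-count r ((e , _) ∷ cs) = cong₂ (λ a m → if suc r <ᵇ a then suc m else m) e (tops-count r cs)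

    tops-height : ∀ {C Cs ls} → Tops (C ∷ Cs) ls → height C ∸ 1 ≡ x
    tops-height ((_ , e) ∷ _) = cong (_∸ 1) e

    tops-nonempty : ∀ {ls} {r : ℕ} → Tops [] ls → r ∈ ls → ⊥
    tops-nonempty [] ()

    -- There is one component for each row of the runner, all of height x + 1; the components below
    -- the marked one are those labelled by a larger row.
    spin≡ : ∀ {r} → r ∈ labels → spin κl τl (suc r) ≡ length rs * x + count (λ l → r <ᵇ l) rs
    spin≡ {r} m with components κl τl | tops
    ... | []     | t = ⊥-elim (tops-nonempty t m)
    ... | C ∷ Cs | t = cong₂ _+_ (cong₂ _*_ (trans (tops-length t) (↭ₚ.↭-length labels↭rows)) (tops-height t)) (trans (tops-count r t) (count-↭ _ labels↭rows))

    -- The sum depends only on the multiset of labels, so the order of `components` may be replaced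
    -- by that of the runner. The runner lists rows from w upwards, hence the number of components
    -- below a given one is its position; these are the exponents produced by `value` and `occ`.
    sum-components : ∀ (f : ℕ → ℕ → ℤ) → ∑ (components κl τl) (λ C → f (topRow C) (spin κl τl (topRow C))) ≡
      ∑ (enumFrom 0 rs) (λ p → f (suc (proj₂ p)) (length rs * x + proj₁ p))
    sum-components f = trans (by-tops tops id) (trans (∑-↭ _ labels↭rows) (∑-rank 0 (ups-decreasing bounded-μ U) (λ r j → f (suc r) (length rs * x + j))))
      where
        by-tops : ∀ {Cs ls} → Tops Cs ls → (∀ {r} → r ∈ ls → r ∈ labels) →
          ∑ Cs (λ C → f (topRow C) (spin κl τl (topRow C))) ≡ ∑ ls (λ r → f (suc r) (length rs * x + count (λ l → r <ᵇ l) rs))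
        by-tops []             sub = refl
        by-tops ((e , _) ∷ cs) sub = cong₂ ℤ._+_ (trans (cong (λ a → f a (spin κl τl a)) e) (cong (f _) (spin≡ (sub (here refl))))) (by-tops cs (sub ∘ there))

-- Strong covers

sumTo-suc : ∀ N f → sumTo (suc N) f ≡ f 0 + sumTo N (f ∘ suc)
sumTo-suc zero    f = sym (+-identityʳ (f 0))
sumTo-suc (suc N) f = trans (cong (_+ f (suc N)) (sumTo-suc N f)) (+-assoc (f 0) _ _)

sum-nth : ∀ xs N → length xs ≤ N → sum xs ≡ sumTo N (nth xs)
sum-nth []       N       p       = sym (zeros N)
  where
    zeros : ∀ N → sumTo N (λ _ → 0) ≡ 0
    zeros zero    = refl
    zeros (suc N) = trans (+-identityʳ _) (zeros N)
sum-nth (x ∷ xs) (suc N) (s≤s p) = trans (cong (ℕ._+_ x) (sum-nth xs N p)) (sym (sumTo-suc N (nth (x ∷ xs))))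

sumTo-≤ : ∀ N {f g} → (∀ i → f i ≤ g i) → sumTo N f ≤ sumTo N g
sumTo-≤ zero    h = z≤n
sumTo-≤ (suc N) h = +-mono-≤ (sumTo-≤ N h) (h N)

sumTo-< : ∀ N {f g} → (∀ i → f i ≤ g i) → ∀ i → i < N → f i < g i → sumTo N f < sumTo N g
sumTo-< (suc N) h i p q with m≤n⇒m<n∨m≡n (≤-pred p)
... | inj₁ i<N  = +-mono-<-≤ (sumTo-< N h i i<N q) (h N)
... | inj₂ refl = +-mono-≤-< (sumTo-≤ N h) q

nth-map-upTo : ∀ (f : ℕ → ℕ) N i → i < N → nth (map f (upTo N)) i ≡ f i
nth-map-upTo f N i p = go id N i p
  where
    go : ∀ (g : ℕ → ℕ) N i → i < N → nth (map f (applyUpTo g N)) i ≡ f (g i)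
    go g (suc N) zero    _       = refl
    go g (suc N) (suc i) (s≤s p) = go (g ∘ suc) N i p

length-map-upTo : ∀ (f : ℕ → ℕ) N → length (map f (upTo N)) ≡ N
length-map-upTo f N = trans (length-map f (upTo N)) (length-upTo id N)

nth-ext : ∀ xs ys → length xs ≡ length ys → (∀ i → nth xs i ≡ nth ys i) → xs ≡ ys
nth-ext []       []       e h = refl
nth-ext (x ∷ xs) (y ∷ ys) e h = cong₂ _∷_ (h 0) (nth-ext xs ys (suc-injective e) (h ∘ suc))

partition-ext : ∀ {xs ys} → IsPartition xs → IsPartition ys → (∀ i → nth xs i ≡ nth ys i) → xs ≡ ys
partition-ext {xs} {ys} P Q h = nth-ext xs ys (≤-antisym (le {xs} {ys} P h) (le {ys} {xs} Q (sym ∘ h))) h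
  where
    le : ∀ {xs ys} → IsPartition xs → (∀ i → nth xs i ≡ nth ys i) → length xs ≤ length ys
    le {xs} {ys} P h = ≮⇒≥ (λ p → <⇒≢ (IsPartition.positive P (length ys) p) (sym (trans (h (length ys)) (nth-beyond ys (length ys) ≤-refl))))

weaklyDec⁻ : ∀ xs → T (weaklyDecB xs) → Antitone (nth xs)
weaklyDec⁻ []           t i       = z≤n
weaklyDec⁻ (a ∷ [])     t i       = z≤n
weaklyDec⁻ (a ∷ b ∷ xs) t zero    = ≤ᵇ⇒≤ b a (∧-fst t)
weaklyDec⁻ (a ∷ b ∷ xs) t (suc i) = weaklyDec⁻ (b ∷ xs) (∧-snd {b ≤ᵇ a} t) i

weaklyDec⁺ : ∀ xs → Antitone (nth xs) → T (weaklyDecB xs)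
weaklyDec⁺ []           A = tt
weaklyDec⁺ (a ∷ [])     A = tt
weaklyDec⁺ (a ∷ b ∷ xs) A = T-∧ (≤⇒≤ᵇ (A 0)) (weaklyDec⁺ (b ∷ xs) (A ∘ suc))

nth-stripZeros : ∀ xs → Antitone (nth xs) → ∀ i → nth (stripZeros xs) i ≡ nth xs i
nth-stripZeros []           A i       = refl
nth-stripZeros (zero ∷ xs)  A i       = trans (nth-stripZeros xs (A ∘ suc) i) (trans (all-zero (suc i)) (sym (all-zero i)))
  where
    all-zero : ∀ i → nth (zero ∷ xs) i ≡ 0
    all-zero i = n≤0⇒n≡0 (antitone-≤ A {0} {i} z≤n)
nth-stripZeros (suc a ∷ xs) A zero    = refl
nth-stripZeros (suc a ∷ xs) A (suc i) = nth-stripZeros xs (A ∘ suc) i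

length-stripZeros : ∀ xs → length (stripZeros xs) ≤ length xs
length-stripZeros []           = z≤n
length-stripZeros (zero ∷ xs)  = m≤n⇒m≤1+n (length-stripZeros xs)
length-stripZeros (suc a ∷ xs) = s≤s (length-stripZeros xs)

stripZeros-partition : ∀ xs → Antitone (nth xs) → IsPartition (stripZeros xs)
stripZeros-partition xs A = record { antitone = λ i → subst₂ _≤_ (sym (nth-stripZeros xs A (suc i))) (sym (nth-stripZeros xs A i)) (A i) ; positive = positive xs }
  where
    positive : ∀ xs i → i < length (stripZeros xs) → 1 ≤ nth (stripZeros xs) i
    positive (zero ∷ xs)  i       p       = positive xs i p
    positive (suc a ∷ xs) zero    p       = s≤s z≤n
    positive (suc a ∷ xs) (suc i) (s≤s p) = positive xs i p

unique-concatMap : ∀ {A C : Set} (g : A → List C) xs → Unique xs → (∀ x → Unique (g x)) → (∀ {x y v} → x ∈ xs → y ∈ xs → v ∈ g x → v ∈ g y → x ≡ y) → Unique (concatMap g xs)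
unique-concatMap g []       _       h i = []
unique-concatMap g (x ∷ xs) (a ∷ u) h i = Uniqueₚ.++⁺ (h x) (unique-concatMap g xs u h (λ p q → i (there p) (there q))) disjoint
  where
    disjoint : ∀ {v} → v ∈ g x × v ∈ concatMap g xs → ⊥
    disjoint (p , q) with find (∈-concatMap⁻ g {xs = xs} q)
    ... | y , y∈ , r = All.lookup a y∈ (i (here refl) (there y∈) p r)

unique-map : ∀ {A C : Set} (g : A → C) xs → Unique xs → (∀ {x y} → x ∈ xs → y ∈ xs → g x ≡ g y → x ≡ y) → Unique (map g xs)
unique-map g []       _       i = []
unique-map g (x ∷ xs) (a ∷ u) i = All.tabulate fresh ∷ unique-map g xs u (λ p q → i (there p) (there q))
  where
    fresh : ∀ {c} → c ∈ map g xs → g x ≢ c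
    fresh m e with ∈-map⁻ g m
    ... | y , y∈ , refl = All.lookup a y∈ (i (here refl) (there y∈) e)

boundedVecs-∈⁻ : ∀ κ {v} → v ∈ boundedVecs κ → length v ≡ length κ × (∀ i → nth v i ≤ nth κ i)
boundedVecs-∈⁻ []      (here refl) = refl , λ i → z≤n
boundedVecs-∈⁻ (a ∷ κ) m with find (∈-concatMap⁻ (λ b → map (b ∷_) (boundedVecs κ)) {xs = upTo (suc a)} m)
... | b , b∈ , m' with ∈-map⁻ (b ∷_) m'
...   | v , v∈ , refl with boundedVecs-∈⁻ κ v∈
...     | e , h = cong suc e , λ { zero → ≤-pred (∈-upTo⁻ b∈) ; (suc i) → h i }

boundedVecs-∈⁺ : ∀ κ v → length v ≡ length κ → (∀ i → nth v i ≤ nth κ i) → v ∈ boundedVecs κ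
boundedVecs-∈⁺ []      []      e h = here refl
boundedVecs-∈⁺ (a ∷ κ) (b ∷ v) e h = ∈-concatMap⁺ _ (lose (∈-upTo⁺ (s≤s (h 0))) (∈-map⁺ (b ∷_) (boundedVecs-∈⁺ κ v (suc-injective e) (h ∘ suc))))

boundedVecs-unique : ∀ κ → Unique (boundedVecs κ)
boundedVecs-unique []      = [] ∷ []
boundedVecs-unique (a ∷ κ) = unique-concatMap _ _ (Uniqueₚ.upTo⁺ (suc a)) (λ b → Uniqueₚ.map⁺ ∷-injectiveʳ (boundedVecs-unique κ)) heads
  where
    heads : ∀ {b c v} → b ∈ upTo (suc a) → c ∈ upTo (suc a) → v ∈ map (b ∷_) (boundedVecs κ) → v ∈ map (c ∷_) (boundedVecs κ) → b ≡ c
    heads {b} {c} _ _ p q with ∈-map⁻ (b ∷_) p | ∈-map⁻ (c ∷_) q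
    ... | _ , _ , refl | _ , _ , e = ∷-injectiveˡ e

subPartitions-unique : ∀ κ → Unique (subPartitions κ)
subPartitions-unique κ = unique-map stripZeros _ (filterB-unique weaklyDecB (boundedVecs κ) (boundedVecs-unique κ)) injective
  where
    injective : ∀ {u v} → u ∈ filterB weaklyDecB (boundedVecs κ) → v ∈ filterB weaklyDecB (boundedVecs κ) → stripZeros u ≡ stripZeros v → u ≡ v
    injective {u} {v} p q e with filterB-∈⁻ _ _ p | filterB-∈⁻ _ _ q
    ... | p' , t | q' , t' = nth-ext u v (trans (proj₁ (boundedVecs-∈⁻ κ p')) (sym (proj₁ (boundedVecs-∈⁻ κ q'))))
      (λ i → trans (sym (nth-stripZeros u (weaklyDec⁻ u t) i)) (trans (cong (λ xs → nth xs i) e) (nth-stripZeros v (weaklyDec⁻ v t') i)))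

subPartitions-∈⁻ : ∀ κ {τ} → τ ∈ subPartitions κ → IsPartition τ × length τ ≤ length κ × (∀ i → nth τ i ≤ nth κ i)
subPartitions-∈⁻ κ m with ∈-map⁻ stripZeros m
... | v , v∈ , refl with filterB-∈⁻ weaklyDecB (boundedVecs κ) v∈
...   | v∈' , t with boundedVecs-∈⁻ κ v∈'
...     | e , h = stripZeros-partition v A , ≤-trans (length-stripZeros v) (≤-reflexive e) , λ i → subst (_≤ nth κ i) (sym (nth-stripZeros v A i)) (h i)
  where
    A : Antitone (nth v)
    A = weaklyDec⁻ v t

partitionOf : ℕ → (ℕ → ℕ) → List ℕ
partitionOf N f = stripZeros (map f (upTo N))

module PartitionOf {N f} (A : Antitone f) (zeros : ∀ i → N ≤ i → f i ≡ 0) where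
  vector : List ℕ
  vector = map f (upTo N)

  nth-vector : ∀ i → nth vector i ≡ f i
  nth-vector i with i <? N
  ... | yes p = nth-map-upTo f N i p
  ... | no ¬p = trans (nth-beyond vector i (≤-trans (≤-reflexive (length-map-upTo f N)) (≮⇒≥ ¬p))) (sym (zeros i (≮⇒≥ ¬p)))

  antitone : Antitone (nth vector)
  antitone i = subst₂ _≤_ (sym (nth-vector (suc i))) (sym (nth-vector i)) (A i)

  nth-partitionOf : ∀ i → nth (partitionOf N f) i ≡ f i
  nth-partitionOf i = trans (nth-stripZeros vector antitone i) (nth-vector i)

  isPartition : IsPartition (partitionOf N f)
  isPartition = stripZeros-partition vector antitone

  partitionOf-∈ : ∀ κ → length κ ≡ N → (∀ i → f i ≤ nth κ i) → partitionOf N f ∈ subPartitions κ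
  partitionOf-∈ κ e h = ∈-map⁺ stripZeros (filterB-∈⁺ weaklyDecB (boundedVecs κ)
    (boundedVecs-∈⁺ κ vector (trans (length-map-upTo f N) (sym e)) (λ i → subst (_≤ nth κ i) (sym (nth-vector i)) (h i))) (weaklyDec⁺ vector antitone))

module _ {n : ℕ} {κ μ κ' μ' : ℕ → ℕ} (D : CoreData n κ μ) (D' : CoreData n κ' μ') where
  private
    module D = CoreData D
    module D' = CoreData D'

  residue-≤ : (∀ i → κ i ≡ κ' i) → ∀ i → μ i ≤ μ' i
  residue-≤ h i = ≮⇒≥ (λ p → <⇒≢ (+-mono-<-≤ p (≤-trans (≤-reflexive (sym (h _))) (antitone-≤ D.κ-antitone (+-monoʳ-≤ i (∸-monoʳ-≤ n (<⇒≤ p))))))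
    (trans (sym (D'.link i)) (trans (sym (h i)) (D.link i))))

  core-unique : ∀ ℓ → (∀ i → ℓ ≤ i → κ i ≡ 0) → (∀ i → ℓ ≤ i → κ' i ≡ 0) → (∀ i → μ i ≡ μ' i) → ∀ i → κ i ≡ κ' i
  core-unique ℓ z z' h i = go ℓ i (m≤n+m ℓ i)
    where
      go : ∀ f i → ℓ ≤ i + f → κ i ≡ κ' i
      go zero    i p = let q = subst (ℓ ≤_) (+-identityʳ i) p in trans (z i q) (sym (z' i q))
      go (suc f) i p = trans (D.link i) (trans (cong₂ _+_ (h i) (trans (go f _ (≤-trans p (≤-trans (≤-reflexive (+-suc i f)) (+-monoˡ-≤ f (Rows.down-above D.bounded-μ i)))))
        (cong (λ m → κ' (i + (n ∸ m))) (h i)))) (sym (D'.link i)))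

residue-unique : ∀ {n κ μ κ' μ'} → CoreData n κ μ → CoreData n κ' μ' → (∀ i → κ i ≡ κ' i) → ∀ i → μ i ≡ μ' i
residue-unique D D' h i = ≤-antisym (residue-≤ D D' h i) (residue-≤ D' D (sym ∘ h) i)

core-resp : ∀ {n κ κ' μ} → (∀ i → κ i ≡ κ' i) → CoreData n κ μ → CoreData n κ' μ
core-resp {n} {κ} {κ'} {μ} h D = record
  { κ-antitone = λ i → subst₂ _≤_ (h (suc i)) (h i) (κ-antitone i)
  ; link       = λ i → trans (sym (h i)) (trans (link i) (cong (ℕ._+_ (μ i)) (h _)))
  ; bounded-μ  = bounded-μ }
  where open CoreData D

strict-or-equal : ∀ {f g : ℕ → ℕ} → (∀ i → f i ≤ g i) → ∀ N → (∀ j → N ≤ j → g j ≡ 0) → (∃ λ j → f j < g j) ⊎ (∀ j → f j ≡ g j)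
strict-or-equal {f} {g} c N z = [ inj₁ , (λ h → inj₂ (λ j → [ h j , beyond j ]′ (<-≤-connex j N))) ]′ (go N)
  where
    beyond : ∀ j → N ≤ j → f j ≡ g j
    beyond j q = trans (n≤0⇒n≡0 (≤-trans (c j) (≤-reflexive (z j q)))) (sym (z j q))
    go : ∀ m → (∃ λ j → f j < g j) ⊎ (∀ j → j < m → f j ≡ g j)
    go zero    = inj₂ (λ j ())
    go (suc m) with f m <? g m | go m
    ... | yes q | _      = inj₁ (m , q)
    ... | no _  | inj₁ e = inj₁ e
    ... | no ¬q | inj₂ h = inj₂ (λ j j<m → [ h j , (λ { refl → ≤-antisym (c m) (≮⇒≥ ¬q) }) ]′ (m≤n⇒m<n∨m≡n (≤-pred j<m)))

-- Pass to a removal that contains τ and repeat until τ is reached; each passage lowers the size of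
-- the residue by one. f bounds the size of κ.
residue-< : ∀ N f {n κ μ τ lam} (D : CoreData n κ μ) (D' : CoreData n τ lam) → (∀ i → N ≤ i → κ i ≡ 0) → sumTo N κ ≤ f →
  (∀ i → τ i ≤ κ i) → ∀ i → τ i < κ i → sumTo N lam < sumTo N μ
residue-< N f {n} {κ} {μ} {τ} {lam} D D' z bound sub i p with sumTo N lam <? sumTo N μ
... | yes q = q
... | no ¬q = ⊥-elim (Completeness.descend D D' N z sub p (λ G c → ¬q (by-cover G c)))
  where
    open CoreData D
    open Rows bounded-μ
    open Cover D N z
    by-cover : ∀ {w} (G : Good w) → (∀ i → τ i ≤ Removal.τ G i) → sumTo N lam < sumTo N μ
    by-cover {w} G c = go f bound (strict-or-equal {τ} {σ} c N τ-finite)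
      where
        open Removal G using (τ≤κ; τ<κ; τ-finite; newCore; size-drop) renaming (τ to σ)
        σ-smaller : sumTo N σ < sumTo N κ
        σ-smaller = sumTo-< N τ≤κ w (inside-ℓ w (Good.positive G)) (subst (λ j → σ j < κ j) (+-identityʳ w) (τ<κ 0 (ups-head (Good.runner G)) z≤n))
        go : ∀ f → sumTo N κ ≤ f → (∃ λ j → τ j < σ j) ⊎ (∀ j → τ j ≡ σ j) → sumTo N lam < sumTo N μ
        go zero    b (inj₁ _)       = ⊥-elim (<⇒≱ σ-smaller (≤-trans b z≤n))
        go (suc f) b (inj₁ (j , q)) = <-trans (residue-< N f newCore D' τ-finite (≤-pred (<-≤-trans σ-smaller b)) c j q) (≤-reflexive (size-drop N ≤-refl))
        go f       b (inj₂ h)       = ≤-reflexive (trans (cong suc (sumTo-cong N (residue-unique D' newCore h))) (size-drop N ≤-refl))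

length-𝔭 : ∀ k xs → length (𝔭 k xs) ≡ length xs
length-𝔭 k xs = trans (length-map _ (indexed xs)) (trans (cong length (indexed≡enumFrom xs)) (go 0 xs))
  where
    go : ∀ s (xs : List ℕ) → length (enumFrom s xs) ≡ length xs
    go s []       = refl
    go s (x ∷ xs) = cong suc (go (suc s) xs)

size-𝔭 : ∀ k xs N → length xs ≤ N → size (𝔭 k xs) ≡ sumTo N (nth (𝔭 k xs))
size-𝔭 k xs N p = sum-nth (𝔭 k xs) N (≤-trans (≤-reflexive (length-𝔭 k xs)) p)

module StrongCovers (k : ℕ) (κl : List ℕ) (core : T (isCoreB (suc k) κl)) (ℓ : ℕ) (finite : ∀ i → ℓ ≤ i → nth κl i ≡ 0) where
  n N : ℕ
  n = suc k
  N = length κl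

  κ μ : ℕ → ℕ
  κ = nth κl
  μ = nth (𝔭 k κl)

  D : CoreData n κ μ
  D = core-data k κl core

  open CoreData D
  open Rows bounded-μ
  open Cover D ℓ finite
  open Vertical ℓ
  open Expansion bounded-μ μ-finite

  module Lowered {w} (G : Good w) where
    open Removal G public
    open PartitionOf {N} {τ} (CoreData.κ-antitone newCore) (λ i p → n≤0⇒n≡0 (≤-trans (τ≤κ i) (≤-reflexive (nth-beyond κl i p)))) public

    lowered : List ℕ
    lowered = partitionOf N τ

    lowered-core : CoreData n (nth lowered) ν
    lowered-core = core-resp (sym ∘ nth-partitionOf) newCore

    lowered-isCore : T (isCoreB n lowered)
    lowered-isCore = isCore⁺ k lowered lowered-core isPartition

    lowered-𝔭 : ∀ i → nth (𝔭 k lowered) i ≡ ν i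
    lowered-𝔭 = 𝔭-value k lowered lowered-core

    lowered-length : length lowered ≤ N
    lowered-length = ≤-trans (length-stripZeros vector) (≤-reflexive (length-map-upTo τ N))

    -- w is the first row in which the residue gets shorter, so a removal determines its row.
    ν-least : ν w < μ w × (∀ i → i < w → μ i ≤ ν i)
    ν-least = ≤-reflexive (trans (cong suc (ν-bottom w ≤-refl (m<m+n w (s≤s z≤n)))) (m+[n∸m]≡n (Good.positive G))) ,
      λ i p → ≤-trans (m≤m+n (μ i) _) (≤-reflexive (trans (sym (balance i)) (trans (cong (ℕ._+_ (ν i)) (win-below w h i p)) (+-identityʳ _))))

  open Lowered public using (lowered)

  good-irrelevant : ∀ {w} (G G' : Good w) → ∀ i → Removal.τ G i ≡ Removal.τ G' i
  good-irrelevant {w} G G' = core-unique (newCore G) (newCore G') ℓ (τ-finite G) (τ-finite G')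
    (λ i → let (e , _ , e') = good-unique G (Good.runner G') (Good.pre G') (Good.drop G') in cong₂ (λ y x → newμ w y x i) e e')
    where open Removal using (newCore; τ-finite)

  row-unique : ∀ {w w'} (G : Good w) (G' : Good w') → (∀ i → Removal.τ G i ≡ Removal.τ G' i) → w ≡ w'
  row-unique G G' h = ≤-antisym (le G G' h) (le G' G (sym ∘ h))
    where
      le : ∀ {w w'} (G : Good w) (G' : Good w') → (∀ i → Removal.τ G i ≡ Removal.τ G' i) → w ≤ w'
      le {w' = w'} G G' h = ≮⇒≥ (λ p → <⇒≱ (proj₁ (Lowered.ν-least G')) (≤-trans (proj₂ (Lowered.ν-least G) w' p)
        (≤-reflexive (residue-unique (Removal.newCore G) (Removal.newCore G') h w'))))

  coverOf : ∀ {w} → Verdict w → List (List ℕ)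
  coverOf (is G)  = lowered G ∷ []
  coverOf (absent _) = []

  strong : List ℕ → Bool
  strong τl = isStrongCoverB k τl κl

  lowered-strong : ∀ {w} (G : Good w) → lowered G ∈ filterB strong (subPartitions κl)
  lowered-strong G = filterB-∈⁺ strong (subPartitions κl) (partitionOf-∈ κl refl τ≤κ)
    (T-∧ lowered-isCore (T-∧ core (≡⇒≡ᵇ _ _ (trans (cong suc (trans (size-𝔭 k (lowered G) (ℓ ⊔ N) (≤-trans lowered-length (ℕ.m≤n⊔m ℓ N))) (sumTo-cong (ℓ ⊔ N) lowered-𝔭)))
      (trans (size-drop (ℓ ⊔ N) (ℕ.m≤m⊔n ℓ N)) (sym (size-𝔭 k κl (ℓ ⊔ N) (ℕ.m≤n⊔m ℓ N))))))))
    where open Lowered G using (τ≤κ; partitionOf-∈; lowered-isCore; lowered-length; lowered-𝔭; size-drop)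

  -- By `descend` a strong cover lies inside some removal; if it were properly inside, its residue
  -- would be smaller by at least two. Membership in the list is decidable, so the negative form of
  -- `descend` is enough.
  strong⇒lowered : ∀ {τl} → τl ∈ filterB strong (subPartitions κl) → τl ∈ concatMap (coverOf ∘ verdict) (upTo ℓ)
  strong⇒lowered {τl} m with filterB-∈⁻ strong (subPartitions κl) m
  ... | m' , t with subPartitions-∈⁻ κl m'
  ...   | P , len , sub with τl ∈? concatMap (coverOf ∘ verdict) (upTo ℓ)
  ...     | yes q = q
  ...     | no ¬q = ⊥-elim (smaller (strict-or-equal {nth τl} {κ} sub ℓ finite))
    where
      core' : T (isCoreB n τl)
      core' = ∧-fst t
      D' : CoreData n (nth τl) (nth (𝔭 k τl))
      D' = core-data k τl core'
      M : ℕ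
      M = ℓ ⊔ N
      sizes : suc (sumTo M (nth (𝔭 k τl))) ≡ sumTo M μ
      sizes = trans (cong suc (sym (size-𝔭 k τl M (≤-trans len (ℕ.m≤n⊔m ℓ N))))) (trans (≡ᵇ⇒≡ _ _ (∧-snd {isCoreB n κl} (∧-snd {isCoreB n τl} t))) (size-𝔭 k κl M (ℕ.m≤n⊔m ℓ N)))
      listed : ∀ {w} (G : Good w) → w < ℓ → (∀ i → nth τl i ≡ Removal.τ G i) → (V : Verdict w) → τl ∈ coverOf V
      listed G p h (absent ¬G) = ⊥-elim (¬G G)
      listed G p h (is G')  = here (partition-ext P (Lowered.isPartition G') (λ i → trans (h i) (trans (good-irrelevant G G' i) (sym (Lowered.nth-partitionOf G' i)))))
      contains : ∀ {w} (G : Good w) → (∀ i → nth τl i ≤ Removal.τ G i) → ⊥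
      contains {w} G c with strict-or-equal {nth τl} {Removal.τ G} c ℓ (Removal.τ-finite G)
      ... | inj₂ h = ¬q (∈-concatMap⁺ (coverOf ∘ verdict) (lose (∈-upTo⁺ (inside-ℓ w (Good.positive G))) (listed G (inside-ℓ w (Good.positive G)) h (verdict w))))
      ... | inj₁ (j , p) = <⇒≢ (residue-< M _ (Removal.newCore G) D' (λ i r → Removal.τ-finite G i (≤-trans (ℕ.m≤m⊔n ℓ N) r)) ≤-refl c j p)
                             (suc-injective (trans sizes (sym (Removal.size-drop G M (ℕ.m≤m⊔n ℓ N)))))
      smaller : (∃ λ j → nth τl j < κ j) ⊎ (∀ j → nth τl j ≡ κ j) → ⊥
      smaller (inj₁ (j , p)) = Completeness.descend D D' ℓ finite sub p contains
      smaller (inj₂ h)       = <⇒≢ (n<1+n _) (trans (sumTo-cong M (residue-unique D' D h)) (sym sizes))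

  covers↭ : filterB strong (subPartitions κl) ↭ concatMap (coverOf ∘ verdict) (upTo ℓ)
  covers↭ = unique-set⇒↭ (filterB-unique strong _ (subPartitions-unique κl))
    (unique-concatMap (coverOf ∘ verdict) _ (Uniqueₚ.upTo⁺ ℓ) (λ w → single (verdict w)) (λ {w} {w'} _ _ → same-row (verdict w) (verdict w'))) strong⇒lowered back
    where
      single : ∀ {w} (V : Verdict w) → Unique (coverOf V)
      single (is _)  = [] ∷ []
      single (absent _) = []
      same-row : ∀ {w w' v} (V : Verdict w) (V' : Verdict w') → v ∈ coverOf V → v ∈ coverOf V' → w ≡ w'
      same-row (is G) (is G') (here refl) (here e) = row-unique G G' (λ i → trans (sym (Lowered.nth-partitionOf G i)) (trans (cong (λ v → nth v i) e) (Lowered.nth-partitionOf G' i)))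
      back : ∀ {v} → v ∈ concatMap (coverOf ∘ verdict) (upTo ℓ) → v ∈ filterB strong (subPartitions κl)
      back m with find (∈-concatMap⁻ (coverOf ∘ verdict) {xs = upTo ℓ} m)
      ... | w , _ , p = listed (verdict w) p
        where
          listed : ∀ {w v} (V : Verdict w) → v ∈ coverOf V → v ∈ filterB strong (subPartitions κl)
          listed (is G) (here refl) = lowered-strong G

  overRow : (List ℕ × ℕ × ℕ → ℤ) → ∀ {w} → Verdict w → ℤ
  overRow f (is G)  = ∑ (enumFrom 0 (Good.rows G)) (λ p → f (lowered G , suc (proj₂ p) , length (Good.rows G) * Good.extra G + proj₁ p))
  overRow f (absent _) = + 0

  ∑-markedCovers : ∀ f → ∑ (markedCovers k κl) f ≡ ∑ (upTo ℓ) (λ w → overRow f (verdict w))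
  ∑-markedCovers f = trans (∑-concatMap marked (filterB strong (subPartitions κl)) f) (trans (∑-↭ (λ τl → ∑ (marked τl) f) covers↭)
    (trans (∑-concatMap (coverOf ∘ verdict) (upTo ℓ) (λ τl → ∑ (marked τl) f)) (∑-cong (upTo ℓ) (λ w → at (verdict w)))))
    where
      marked : List ℕ → List (List ℕ × ℕ × ℕ)
      marked τl = map (λ C → τl , topRow C , spin κl τl (topRow C)) (components κl τl)
      at : ∀ {w} (V : Verdict w) → ∑ (coverOf V) (λ τl → ∑ (marked τl) f) ≡ overRow f V
      at (absent _) = refl
      at (is G)  = trans (ℤ.+-identityʳ _) (trans (∑-map (λ C → lowered G , topRow C , spin κl (lowered G) (topRow C)) (components κl (lowered G)) f)
        (Ribbons.Strips.sum-components κl D ℓ finite G (lowered G) (Lowered.nth-partitionOf G) (λ r s → f (lowered G , r , s))))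

-- Coefficients of Catalan functions

does⁻ : ∀ {P : Set} (d : Dec P) → T (does d) → P
does⁻ (yes p) _ = p

does⁺ : ∀ {P : Set} (d : Dec P) → P → T (does d)
does⁺ (yes _) _ = tt
does⁺ (no ¬p) p = ¬p p

φ : ℕ → Sym → Weight → ℤ
φ ℓ y γ = ⟪ schur (tab 0 ℓ γ) , y ⟫

tab-cong : ∀ s n {γ γ' : Weight} → (∀ k → s ≤ k → k < s + n → γ k ≡ γ' k) → tab s n γ ≡ tab s n γ'
tab-cong s zero    h = refl
tab-cong s (suc n) h = cong₂ _∷_ (h s ≤-refl (m<m+n s (s≤s z≤n))) (tab-cong (suc s) n (λ k p q → h k (<⇒≤ p) (<-≤-trans q (≤-reflexive (sym (+-suc s n))))))

φ-ext : ∀ ℓ y {γ γ'} → (∀ j → j < ℓ → γ j ≡ γ' j) → φ ℓ y γ ≡ φ ℓ y γ'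
φ-ext ℓ y h = cong (λ v → ⟪ schur v , y ⟫) (tab-cong 0 ℓ (λ k _ → h k))

φ-alternating : ∀ ℓ y → Raising.Alternating ℓ (λ _ → ⊤) (φ ℓ y)
φ-alternating ℓ y = record { ext = φ-ext ℓ y ; anti = anti }
  where
    anti : ∀ a {γ γ'} → suc a < ℓ → ⊤ → Swapped a γ γ' → φ ℓ y γ' ≡ ℤ.- φ ℓ y γ
    anti a {γ} {γ'} p _ h = trans (pairing-schur ℓ γ' y) (trans (sdet-anti ℓ a {γ} {γ'} p at-a at-suc others (test-inv y)) (cong ℤ.-_ (sym (pairing-schur ℓ γ y))))
      where
        value : ∀ j {i} → TrView a j i → γ' j ≡ γ i ℤ.+ ε (suc a) j ℤ.- ε a j
        value j v = trans (h j) (cong (λ i → γ i ℤ.+ ε (suc a) j ℤ.- ε a j) (trView-functional (trView a j) v))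
        at-a : γ' a ≡ γ (suc a) ℤ.- + 1
        at-a = trans (value a low) (trans (cong₂ (λ u v → γ (suc a) ℤ.+ u ℤ.- v) (ε-off (suc a) a (λ e → <⇒≢ (n<1+n a) (sym e))) (ε-diag a)) (cong (ℤ._- + 1) (ℤ.+-identityʳ (γ (suc a)))))
        at-suc : γ' (suc a) ≡ γ a ℤ.+ + 1
        at-suc = trans (value (suc a) high) (trans (cong₂ (λ u v → γ a ℤ.+ u ℤ.- v) (ε-diag (suc a)) (ε-off a (suc a) (<⇒≢ (n<1+n a)))) (ℤ.+-identityʳ _))
        others : ∀ j → j ≢ a → j ≢ suc a → γ' j ≡ γ j
        others j p q = trans (value j (other p q)) (trans (cong₂ (λ u v → γ j ℤ.+ u ℤ.- v) (ε-off (suc a) j (q ∘ sym)) (ε-off a j (p ∘ sym))) (trans (ℤ.+-identityʳ _) (ℤ.+-identityʳ _)))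

φ-vanishing : ∀ ℓ y → Vertical.Vanishing ℓ (φ ℓ y)
φ-vanishing ℓ y j r γ e t = trans (pairing-schur ℓ γ y) (sdet-tail j r γ e t (test y))

φ-eSym : ∀ ℓ d y γ → φ ℓ (eSym d ⊗ y) γ ≡ sub d ℓ (φ ℓ y) γ
φ-eSym ℓ d y γ = trans (e-perp-schur d ℓ γ y) (sub≡opE (λ h → φ-ext ℓ y (λ j _ → h j)) d ℓ γ)

pairing-sumSym : ∀ {A : Set} (f : A → Sym) (xs : List A) y → ⟪ sumSym (map f xs) , y ⟫ ≡ ∑ xs (λ a → ⟪ f a , y ⟫)
pairing-sumSym f xs y = trans (pairing≡ev (sumSym (map f xs)) y) (trans (ev-sumSym (map f xs) _)
  (trans (∑-map f xs _) (∑-cong xs (λ a → sym (pairing≡ev (f a) y)))))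

bump : ℕ → ℤ → Weight → Weight
bump i c γ k = γ k ℤ.+ c ℤ.* ε i k

addAt-tab : ∀ i c s n γ → addAt i c (tab s n γ) ≡ tab s n (bump (s + i) c γ)
addAt-tab i       c s zero    γ = refl
addAt-tab zero    c s (suc n) γ = cong₂ _∷_ (cong (ℤ._+_ (γ s)) (sym (trans (cong (ℤ._*_ c) (trans (cong (λ i → ε i s) (+-identityʳ s)) (ε-diag s))) (ℤ.*-identityʳ c))))
  (tab-cong (suc s) n (λ k p _ → sym (trans (cong (λ e → γ k ℤ.+ c ℤ.* e) (ε-off (s + 0) k (λ e → <⇒≢ p (trans (sym (+-identityʳ s)) e)))) (trans (cong (ℤ._+_ (γ k)) (ℤ.*-zeroʳ c)) (ℤ.+-identityʳ (γ k))))))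
addAt-tab (suc i) c s (suc n) γ = cong₂ _∷_ (sym (trans (cong (λ e → γ s ℤ.+ c ℤ.* e) (ε-off (s + suc i) s (λ e → <⇒≢ (m<m+n s (s≤s z≤n)) (sym e)))) (trans (cong (ℤ._+_ (γ s)) (ℤ.*-zeroʳ c)) (ℤ.+-identityʳ (γ s)))))
  (trans (addAt-tab i c (suc s) n γ) (cong (λ j → tab (suc s) n (bump j c γ)) (sym (+-suc s i))))

raiseN : Root → ℕ → Weight → Weight
raiseN β zero    γ = γ
raiseN β (suc a) γ = raiseN β a (raiseW β γ)

raiseN-value : ∀ i j a γ k → raiseN (i , j) a γ k ≡ bump j (ℤ.- (+ a)) (bump i (+ a) γ) k
raiseN-value i j zero    γ k = sym (trans (cong₂ (λ u v → γ k ℤ.+ u ℤ.+ v) (ℤ.*-zeroˡ (ε i k)) (ℤ.*-zeroˡ (ε j k))) (trans (ℤ.+-identityʳ _) (ℤ.+-identityʳ _)))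
raiseN-value i j (suc a) γ k = trans (raiseN-value i j a (raiseW (i , j) γ) k)
  (lia 0 7 (λ g e e' p p' q q' → q := e :+ p ⇒ q' := p' :- e' ⇒ g :+ e :- e' :+ p :+ p' := g :+ q :+ q')
    (γ k) (ε i k) (ε j k) (+ a ℤ.* ε i k) (ℤ.- (+ a) ℤ.* ε j k) (+ suc a ℤ.* ε i k) (ℤ.- (+ suc a) ℤ.* ε j k)
    (ℤ.suc-* (+ a) (ε i k))
    (trans (sym (ℤ.neg-distribˡ-* (+ suc a) (ε j k))) (trans (cong ℤ.-_ (ℤ.suc-* (+ a) (ε j k)))
      (lia 0 3 (λ e p p' → p' := :- p ⇒ :- (e :+ p) := p' :- e) (ε j k) (+ a ℤ.* ε j k) (ℤ.- (+ a) ℤ.* ε j k) (sym (ℤ.neg-distribˡ-* (+ a) (ε j k)))))))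

shift₁ : Root → ℕ × ℕ
shift₁ (i , j) = suc i , suc j

raise-tab : ∀ β a ℓ γ → raise (shift₁ β) a (tab 0 ℓ γ) ≡ tab 0 ℓ (raiseN β a γ)
raise-tab (i , j) a ℓ γ = trans (cong (addAt j (ℤ.- (+ a))) (addAt-tab i (+ a) 0 ℓ γ)) (trans (addAt-tab j (ℤ.- (+ a)) 0 ℓ _)
  (tab-cong 0 ℓ (λ k _ _ → sym (raiseN-value i j a γ k))))

module Coefficients (ℓ : ℕ) where
  open Raising ℓ
  open Vertical ℓ

  -- The recursion in the first root, unfolded into the geometric series of t R_β: the form in which
  -- `distrib` enumerates the exponents.
  Hl-geometric : ∀ ψ β Ψ γ m → Hl ψ (β ∷ Ψ) γ m ≡ ∑ (upTo (suc m)) (λ a → Hl ψ Ψ (raiseN β a γ) (m ∸ a))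
  Hl-geometric ψ β Ψ γ zero    = sym (ℤ.+-identityʳ _)
  Hl-geometric ψ β Ψ γ (suc m) = trans (cong (ℤ._+_ (Hl ψ Ψ γ (suc m))) (Hl-geometric ψ β Ψ (raiseW β γ) m))
    (sym (∑-upTo-suc (suc m) (λ a → Hl ψ Ψ (raiseN β a γ) (suc m ∸ a))))

  catalan-Hl : ∀ y Ψ γ m → ∑ (distrib (length (map shift₁ Ψ)) m) (λ ns → ⟪ schur (raiseAll (map shift₁ Ψ) ns (tab 0 ℓ γ)) , y ⟫) ≡ Hl (φ ℓ y) Ψ γ m
  catalan-Hl y []      γ zero    = ℤ.+-identityʳ _
  catalan-Hl y []      γ (suc m) = refl
  catalan-Hl y (β ∷ Ψ) γ m = trans (∑-concatMap (λ a → map (a ∷_) (distrib (length (map shift₁ Ψ)) (m ∸ a))) (upTo (suc m)) _)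
    (trans (∑-cong (upTo (suc m)) (λ a → trans (∑-map (a ∷_) (distrib (length (map shift₁ Ψ)) (m ∸ a)) _)
      (trans (∑-cong (distrib (length (map shift₁ Ψ)) (m ∸ a)) (λ ns → cong (λ v → ⟪ schur (raiseAll (map shift₁ Ψ) ns v) , y ⟫) (raise-tab β a ℓ γ)))
        (catalan-Hl y Ψ (raiseN β a γ) (m ∸ a))))) (sym (Hl-geometric (φ ℓ y) β Ψ γ m)))

  Hl-φ : ∀ {ψ ψ' : Weight → ℤ} → (∀ γ → ψ γ ≡ ψ' γ) → ∀ Ψ γ m → Hl ψ Ψ γ m ≡ Hl ψ' Ψ γ m
  Hl-φ h []      γ zero    = h γ
  Hl-φ h []      γ (suc m) = refl
  Hl-φ h (β ∷ Ψ) γ zero    = Hl-φ h Ψ γ zero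
  Hl-φ h (β ∷ Ψ) γ (suc m) = cong₂ ℤ._+_ (Hl-φ h Ψ γ (suc m)) (Hl-φ h (β ∷ Ψ) (raiseW β γ) m)

  Hl-translate : ∀ {ψ ψ' : Weight → ℤ} c → (∀ γ → ψ γ ≡ ψ' (λ k → γ k ℤ.+ c)) → (∀ {γ γ'} → (∀ i → γ i ≡ γ' i) → ψ' γ ≡ ψ' γ') →
    ∀ Ψ γ γ' m → (∀ k → γ' k ≡ γ k ℤ.+ c) → Hl ψ Ψ γ m ≡ Hl ψ' Ψ γ' m
  Hl-translate c h e []      γ γ' zero    s = trans (h γ) (e (sym ∘ s))
  Hl-translate c h e []      γ γ' (suc m) s = refl
  Hl-translate c h e (β ∷ Ψ) γ γ' zero    s = Hl-translate c h e Ψ γ γ' zero s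
  Hl-translate c h e (β ∷ Ψ) γ γ' (suc m) s = cong₂ ℤ._+_ (Hl-translate c h e Ψ γ γ' (suc m) s) (Hl-translate c h e (β ∷ Ψ) (raiseW β γ) (raiseW β γ') m
    (λ k → trans (cong (λ g → g ℤ.+ ε (proj₁ β) k ℤ.- ε (proj₂ β) k) (s k))
      (lia 0 4 (λ g c e e' → g := g ⇒ (g :+ c) :+ e :- e' := (g :+ e :- e') :+ c) (γ k) c (ε (proj₁ β) k) (ε (proj₂ β) k) refl)))

  bottom : ℕ → (ℕ → ℕ) → ℕ → ℕ
  bottom k μ i = i + (suc k ∸ μ i)

  kseries : ℕ → (ℕ → ℕ) → (Weight → ℤ) → Series
  kseries k μ ψ = Hl ψ (roots (bottom k μ)) (λ i → + μ i)

  kseries-cong : ∀ k {μ μ' : ℕ → ℕ} ψ {A} → Alternating A ψ → (∀ i → i < ℓ → μ i ≡ μ' i) → ∀ m → kseries k μ ψ m ≡ kseries k μ' ψ m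
  kseries-cong k {μ} {μ'} ψ alt h m = trans (Hl-perm (roots-cong (move h) (move (λ i p → sym (h i p)))) _ m) (Hl-ext (roots (bottom k μ')) (λ j p → cong +_ (h j p)) m)
    where
      open Catalan alt
      move : ∀ {μ μ' : ℕ → ℕ} → (∀ i → i < ℓ → μ i ≡ μ' i) → ∀ i j → IsRoot (bottom k μ) i j → IsRoot (bottom k μ') i j
      move h i j (p , q , r) = p , q , subst (λ a → i + (suc k ∸ a) ≤ j) (h i (<-trans p q)) r

  -- With rows and columns counted from 0 the integer condition k - μ_i + i < j becomes i + (k + 1 -
  -- μ_i) ≤ j, and the bound on μ makes the truncated difference exact.
  Delta-roots : ∀ k μ → length μ ≡ ℓ → (∀ i → nth μ i ≤ k) → Delta k μ ≡ map shift₁ (roots (bottom k (nth μ)))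
  Delta-roots k μ refl bound = outer (upTo ℓ)
    where
      σ : ℕ → ℕ
      σ = bottom k (nth μ)
      is-root : ℕ → ℕ → Bool
      is-root i j = (i <ᵇ j) ∧ does (((+ k) ℤ.- (+ nth μ (i ∸ 1)) ℤ.+ (+ i)) ℤ.<? (+ j))
      cell : ℕ → ℕ → List (ℕ × ℕ)
      cell i j = if is-root i j then (i , j) ∷ [] else []
      same : ∀ i j → is-root (suc i) (suc j) ≡ does (isRoot? σ (i , j))
      same i j = does-⇔ (mk⇔ to from) (T? (is-root (suc i) (suc j))) (isRoot? σ (i , j))
        where
          μi : ℕ
          μi = nth μ i
          c : suc k ∸ μi + μi ≡ suc k
          c = m∸n+n≡m (m≤n⇒m≤1+n (bound i))
          to : T (is-root (suc i) (suc j)) → i < j × σ i ≤ j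
          to t = ≤-pred (<ᵇ⇒< (suc i) (suc j) (∧-fst t)) ,
            lia 5 0 (λ i j k m c → c :+ m := ♯ 1 :+ k ⇒ ↑ k :- ↑ m :+ ↑ (♯ 1 :+ i) :< ↑ (♯ 1 :+ j) ⇒ i :+ c :≤ j) i j k μi (suc k ∸ μi) c
              (does⁻ (_ ℤ.<? _) (∧-snd {suc i <ᵇ suc j} t))
          from : i < j × σ i ≤ j → T (is-root (suc i) (suc j))
          from (p , q) = T-∧ (<⇒<ᵇ (s≤s p)) (does⁺ (_ ℤ.<? _)
            (lia 5 0 (λ i j k m c → c :+ m := ♯ 1 :+ k ⇒ i :+ c :≤ j ⇒ ↑ k :- ↑ m :+ ↑ (♯ 1 :+ i) :< ↑ (♯ 1 :+ j)) i j k μi (suc k ∸ μi) c q))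
      inner : ∀ i ys → concatMap (cell (suc i)) (map suc ys) ≡ map shift₁ (filter (isRoot? σ) (map (i ,_) ys))
      inner i []       = refl
      inner i (j ∷ ys) rewrite same i j with does (isRoot? σ (i , j))
      ... | true  = cong ((suc i , suc j) ∷_) (inner i ys)
      ... | false = inner i ys
      outer : ∀ xs → concatMap (λ i → concatMap (cell i) (map suc (upTo ℓ))) (map suc xs) ≡ map shift₁ (filter (isRoot? σ) (cartesianProduct xs (upTo ℓ)))
      outer []       = refl
      outer (i ∷ xs) = trans (cong₂ _++_ (inner i (upTo ℓ)) (outer xs))
        (sym (trans (cong (map shift₁) (filter-++ (isRoot? σ) (map (i ,_) (upTo ℓ)) (cartesianProduct xs (upTo ℓ)))) (map-++ shift₁ (filter (isRoot? σ) (map (i ,_) (upTo ℓ))) (filter (isRoot? σ) (cartesianProduct xs (upTo ℓ))))))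

  map-tab : ∀ μ s → map +_ μ ≡ tab s (length μ) (λ i → + nth μ (i ∸ s))
  map-tab []      s = refl
  map-tab (x ∷ μ) s = cong₂ _∷_ (cong (λ i → + nth (x ∷ μ) i) (sym (n∸n≡0 s)))
    (trans (map-tab μ (suc s)) (tab-cong (suc s) (length μ) (λ k p _ → cong (λ i → + nth (x ∷ μ) i) (sym (+-∸-assoc 1 p)))))

  kschur-series : ∀ k μ → length μ ≡ ℓ → (∀ i → nth μ i ≤ k) → ∀ m y → ⟪ kschurCoeff k μ m , y ⟫ ≡ kseries k (nth μ) (φ ℓ y) m
  kschur-series k μ e bound m y = trans (pairing-sumSym (λ ns → schur (raiseAll (Delta k μ) ns (map +_ μ))) (distrib (length (Delta k μ)) m) y)
    (trans (cong₂ (λ Ψ v → ∑ (distrib (length Ψ) m) (λ ns → ⟪ schur (raiseAll Ψ ns v) , y ⟫)) (Delta-roots k μ e bound) (trans (map-tab μ 0) (cong (λ n → tab 0 n (λ i → + nth μ i)) e)))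
      (catalan-Hl y (roots (bottom k (nth μ))) (λ i → + nth μ i) m))

  sub-short : ∀ d z {ψ : Weight → ℤ} γ → z < d → sub d z ψ γ ≡ + 0
  sub-short (suc d) zero    γ p       = refl
  sub-short (suc d) (suc z) γ (s≤s p) = cong₂ ℤ._+_ (sub-short (suc d) z γ (m≤n⇒m≤1+n p)) (sub-short d z (lower z γ) p)

  lowerAll : ℕ → Weight → Weight
  lowerAll zero    γ = γ
  lowerAll (suc z) γ = lowerAll z (lower z γ)

  sub-full : ∀ z {ψ : Weight → ℤ} γ → sub z z ψ γ ≡ ψ (lowerAll z γ)
  sub-full zero    γ = refl
  sub-full (suc z) γ = trans (cong₂ ℤ._+_ (sub-short (suc z) z γ (n<1+n z)) (sub-full z (lower z γ))) (ℤ.+-identityˡ _)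

  lowerAll-value : ∀ z γ k → k < z → lowerAll z γ k ≡ γ k ℤ.- + 1
  lowerAll-value (suc z) γ k p with m≤n⇒m<n∨m≡n (≤-pred p)
  ... | inj₁ q    = trans (lowerAll-value z (lower z γ) k q) (cong (λ e → γ k ℤ.- e ℤ.- + 1) (ε-off z k (λ e → <⇒≢ q (sym e))) ⟨ trans ⟩ cong (ℤ._- + 1) (ℤ.+-identityʳ (γ k)))
  ... | inj₂ refl = trans (lowerAll-above z (lower z γ) z ≤-refl) (cong (ℤ._-_ (γ k)) (ε-diag z))
    where
      lowerAll-above : ∀ z γ k → z ≤ k → lowerAll z γ k ≡ γ k
      lowerAll-above zero    γ k p = refl
      lowerAll-above (suc z) γ k p = trans (lowerAll-above z (lower z γ) k (<⇒≤ p)) (trans (cong (λ e → γ k ℤ.- e) (ε-off z k (<⇒≢ p))) (ℤ.+-identityʳ (γ k)))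

  nth-map-suc : ∀ μ i → i < length μ → nth (map suc μ) i ≡ suc (nth μ i)
  nth-map-suc (x ∷ μ) zero    p       = refl
  nth-map-suc (x ∷ μ) (suc i) (s≤s p) = nth-map-suc μ i p

  -- There is only one ℓ-element subset of [0, ℓ), so e_ℓ^⊥ lowers every row by one; and the roots
  -- depend on k and μ only through the differences k - μ_i.
  shift-invariance : ∀ k μ → length μ ≡ ℓ → (∀ i → nth μ i ≤ k) → ∀ m y → ⟪ kschurCoeff k μ m , y ⟫ ≡ ⟪ kschurCoeff (suc k) (map suc μ) m , eSym ℓ ⊗ y ⟫
  shift-invariance k μ refl bound m y = sym (trans (kschur-series (suc k) (map suc μ) (length-map suc μ) bound' m (eSym ℓ ⊗ y))
    (trans (Hl-perm (roots-cong (λ i j r → move i j r) (λ i j r → move' i j r)) _ m)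
    (trans (Hl-translate (ℤ.- + 1) translate (λ h → φ-ext ℓ y (λ j _ → h j)) (roots (bottom k (nth μ))) (λ i → + nth (map suc μ) i) (λ i → + nth (map suc μ) i ℤ.- + 1) m (λ _ → refl))
    (trans (Catalan.Hl-ext (φ-alternating ℓ y) (roots (bottom k (nth μ))) (λ j p → cong (λ a → + a ℤ.- + 1) (nth-map-suc μ j p)) m)
      (sym (kschur-series k μ refl bound m y))))))
    where
      open Catalan (φ-alternating ℓ (eSym ℓ ⊗ y))
      bound' : ∀ i → nth (map suc μ) i ≤ suc k
      bound' i with i <? length μ
      ... | yes p = ≤-trans (≤-reflexive (nth-map-suc μ i p)) (s≤s (bound i))
      ... | no ¬p = ≤-trans (≤-reflexive (nth-beyond (map suc μ) i (≤-trans (≤-reflexive (length-map suc μ)) (≮⇒≥ ¬p)))) z≤n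
      move : ∀ i j → IsRoot (bottom (suc k) (nth (map suc μ))) i j → IsRoot (bottom k (nth μ)) i j
      move i j (p , q , r) = p , q , subst (λ a → i + (suc (suc k) ∸ a) ≤ j) (nth-map-suc μ i (<-trans p q)) r
      move' : ∀ i j → IsRoot (bottom k (nth μ)) i j → IsRoot (bottom (suc k) (nth (map suc μ))) i j
      move' i j (p , q , r) = p , q , subst (λ a → i + (suc (suc k) ∸ a) ≤ j) (sym (nth-map-suc μ i (<-trans p q))) r
      translate : ∀ γ → φ ℓ (eSym ℓ ⊗ y) γ ≡ φ ℓ y (λ k → γ k ℤ.+ ℤ.- + 1)
      translate γ = trans (φ-eSym ℓ ℓ y γ) (trans (sub-full ℓ γ) (φ-ext ℓ y (λ j p → lowerAll-value ℓ γ j p)))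

  -- Besides row i, each of the other m - 1 rows has at least one box.
  staircase-size : ∀ (μ : ℕ → ℕ) m → (∀ i → i < m → 1 ≤ μ i) → m ≤ sumTo m μ × (∀ i → i < m → μ i + m ≤ suc (sumTo m μ))
  staircase-size μ zero    h = z≤n , λ i ()
  staircase-size μ (suc m) h with staircase-size μ m (λ i p → h i (m≤n⇒m≤1+n p))
  ... | a , b = lia 3 0 (λ m s x → m :≤ s ⇒ ♯ 1 :≤ x ⇒ ♯ 1 :+ m :≤ s :+ x) m (sumTo m μ) (μ m) a (h m (n<1+n m)) , step
    where
      step : ∀ i → i < suc m → μ i + suc m ≤ suc (sumTo m μ + μ m)
      step i p with m≤n⇒m<n∨m≡n (≤-pred p)
      ... | inj₁ q    = lia 4 0 (λ y m s x → y :+ m :≤ ♯ 1 :+ s ⇒ ♯ 1 :≤ x ⇒ y :+ (♯ 1 :+ m) :≤ ♯ 1 :+ (s :+ x)) (μ i) m (sumTo m μ) (μ m) (b i q) (h m (n<1+n m))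
      ... | inj₂ refl = lia 3 0 (λ m s x → m :≤ s ⇒ x :+ (♯ 1 :+ m) :≤ ♯ 1 :+ (s :+ x)) m (sumTo m μ) (μ m) a

  sumTo-mono : ∀ (μ : ℕ → ℕ) {m n} → m ≤ n → sumTo m μ ≤ sumTo n μ
  sumTo-mono μ {m} {zero}  z≤n = z≤n
  sumTo-mono μ {m} {suc n} p with m≤n⇒m<n∨m≡n p
  ... | inj₁ q    = ≤-trans (sumTo-mono μ (≤-pred q)) (m≤m+n _ _)
  ... | inj₂ refl = ≤-refl

  tailSum-zero : ∀ γ j r → (∀ i → j ≤ i → γ i ≡ + 0) → tailSum γ j r ≡ + 0
  tailSum-zero γ j zero    h = refl
  tailSum-zero γ j (suc r) h = cong₂ ℤ._+_ (h j ≤-refl) (tailSum-zero γ (suc j) r (λ i p → h i (<⇒≤ p)))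

  -- If (i, j) is a root and row j were nonempty, the rows up to j would hold at least μ_i + j > k
  -- boxes. So every root ends in an empty row, and one application of it makes the tail from there
  -- on negative; only the term without raising survives.
  stability : ∀ k μ → length μ ≡ ℓ → (∀ i → nth μ i ≤ k) → Antitone (nth μ) → size μ ≤ k → ∀ y →
    ⟪ kschurCoeff k μ 0 , y ⟫ ≡ ⟪ schur (map +_ μ) , y ⟫ × (∀ m → ⟪ kschurCoeff k μ (suc m) , y ⟫ ≡ + 0)
  stability k μ refl bound A small y =
    trans (kschur-series k μ refl bound 0 y) (trans (proj₁ (collapse Ψ id)) (cong (λ v → ⟪ schur v , y ⟫) (sym (map-tab μ 0)))) ,
    λ m → trans (kschur-series k μ refl bound (suc m) y) (proj₂ (collapse Ψ id) m)
    where
      Ψ : List Root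
      Ψ = roots (bottom k (nth μ))
      wt : Weight
      wt i = + nth μ i
      empty : ∀ {i j} → (i , j) ∈ Ψ → nth μ j ≡ 0
      empty {i} {j} r∈ = n≤0⇒n≡0 (≮⇒≥ full)
        where
          full : 0 < nth μ j → ⊥
          full p = let (i<j , j<ℓ , q) = ∈-roots⁻ _ r∈ in
            lia 6 0 (λ i j k m s c → c :+ m := ♯ 1 :+ k ⇒ i :+ c :≤ j ⇒ m :+ (♯ 1 :+ j) :≤ ♯ 1 :+ s ⇒ s :≤ k ⇒ :⊥)
              i j k (nth μ i) (sumTo (suc j) (nth μ)) (suc k ∸ nth μ i) (m∸n+n≡m (m≤n⇒m≤1+n (bound i))) q
              (proj₂ (staircase-size (nth μ) (suc j) (λ a a≤j → ≤-trans p (antitone-≤ A (≤-pred a≤j)))) i (m≤n⇒m≤1+n i<j))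
              (≤-trans (sumTo-mono (nth μ) j<ℓ) (≤-trans (≤-reflexive (sym (sum-nth μ ℓ ≤-refl))) small))
      negative : ∀ {i j} r → (i , j) ∈ Ψ → tailSum (raiseW (i , j) wt) j (suc r) ℤ.< + 0
      negative {i} {j} r r∈ = subst (ℤ._< + 0) (sym (cong₂ ℤ._+_ (value j ≤-refl ⟨ trans ⟩ cong ℤ.-_ (ε-diag j))
          (tailSum-zero _ (suc j) r (λ l p → trans (value l (<⇒≤ p)) (cong ℤ.-_ (ε-off j l (<⇒≢ p))))))) ℤ.-<+
        where
          value : ∀ l → j ≤ l → raiseW (i , j) wt l ≡ ℤ.- ε j l
          value l p = trans (cong₂ (λ a b → + a ℤ.+ b ℤ.- ε j l) (n≤0⇒n≡0 (≤-trans (antitone-≤ A p) (≤-reflexive (empty r∈))))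
            (ε-off i l (<⇒≢ (<-≤-trans (proj₁ (∈-roots⁻ _ r∈)) p)))) (ℤ.+-identityˡ _)
      collapse : ∀ Ψ' → (∀ {β} → β ∈ Ψ' → β ∈ Ψ) → Hl (φ ℓ y) Ψ' wt 0 ≡ φ ℓ y wt × (∀ m → Hl (φ ℓ y) Ψ' wt (suc m) ≡ + 0)
      collapse []       sub' = refl , λ m → refl
      collapse (β ∷ Ψ') sub' = proj₁ (collapse Ψ' (sub' ∘ there)) , λ m → cong₂ ℤ._+_ (proj₂ (collapse Ψ' (sub' ∘ there)) m)
        (Hl-vanish (φ-vanishing ℓ y) (β ∷ Ψ') (All.tabulate (λ p → All.lookup (roots-bounded (bottom k (nth μ))) (sub' p)))
          (proj₂ β) (suc (ℓ ∸ suc (proj₂ β))) (raiseW β wt) (trans (+-suc _ _) (m+[n∸m]≡n (proj₁ (proj₂ (∈-roots⁻ (bottom k (nth μ)) (sub' (here refl)))))))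
          (negative (ℓ ∸ suc (proj₂ β)) (sub' (here refl))) m)

-- Dual Pieri rules

ι : Bool → ℤ → ℤ
ι b a = if b then a else + 0

ι-∧ : ∀ a b c → ι (a ∧ b) c ≡ ι b (ι a c)
ι-∧ true  true  c = refl
ι-∧ true  false c = refl
ι-∧ false true  c = refl
ι-∧ false false c = refl

ι-∑ : ∀ {A : Set} b (f : A → ℤ) xs → ∑ xs (λ a → ι b (f a)) ≡ ι b (∑ xs f)
ι-∑ true  f xs = refl
ι-∑ false f xs = ∑-0 xs

shs-zero : ∀ s {f : Series} → (∀ m → f m ≡ + 0) → ∀ m → shs s f m ≡ + 0
shs-zero zero    h = h
shs-zero (suc s) h = sh-zero (shs-zero s h)

shs-ι : ∀ b s (f : Series) m → shs s (λ m → ι b (f m)) m ≡ ι b (shs s f m)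
shs-ι true  s f m = refl
shs-ι false s f m = shs-zero s (λ _ → refl) m

shs-∑ : ∀ {A : Set} s (f : A → Series) xs m → shs s (λ m → ∑ xs (λ a → f a m)) m ≡ ∑ xs (λ a → shs s (f a) m)
shs-∑ zero    f xs m       = refl
shs-∑ (suc s) f xs zero    = sym (∑-0 xs)
shs-∑ (suc s) f xs (suc m) = shs-∑ s f xs m

shs-+ : ∀ a s (f : Series) m → shs (a + s) f m ≡ shs s (shs a f) m
shs-+ a zero    f m = cong (λ b → shs b f m) (+-identityʳ a)
shs-+ a (suc s) f m = trans (cong (λ b → shs b f m) (+-suc a s)) (sh-cong (shs-+ a s f) m)

shs-if : ∀ s (f : Series) m → shs s f m ≡ ι (s ≤ᵇ m) (f (m ∸ s))
shs-if zero          f m       = refl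
shs-if (suc s)       f zero    = refl
shs-if (suc zero)    f (suc m) = refl
shs-if (suc (suc s)) f (suc m) = shs-if (suc s) f m

enumFrom-∈ : ∀ {A : Set} s (xs : List A) {p} → p ∈ enumFrom s xs → proj₂ p ∈ xs
enumFrom-∈ s (x ∷ xs) (here refl) = here refl
enumFrom-∈ s (x ∷ xs) (there m)   = there (enumFrom-∈ (suc s) xs m)

∑-filterB : ∀ {A : Set} (p : A → Bool) xs (f : A → ℤ) → ∑ (filterB p xs) f ≡ ∑ xs (λ a → ι (p a) (f a))
∑-filterB p []       f = refl
∑-filterB p (x ∷ xs) f with p x
... | true  = cong (ℤ._+_ (f x)) (∑-filterB p xs f)
... | false = trans (∑-filterB p xs f) (sym (ℤ.+-identityˡ _))

nth-pad : ∀ xs r i → nth (xs ++ replicate r 0) i ≡ nth xs i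
nth-pad []       zero    i       = refl
nth-pad []       (suc r) zero    = refl
nth-pad []       (suc r) (suc i) = nth-pad [] r i
nth-pad (x ∷ xs) r       zero    = refl
nth-pad (x ∷ xs) r       (suc i) = nth-pad xs r i

strictlyInc-snoc : ∀ ms a b → strictlyIncB ((ms ++ a ∷ []) ++ b ∷ []) ≡ strictlyIncB (ms ++ a ∷ []) ∧ (a <ᵇ b)
strictlyInc-snoc []           a b = ∧-identityʳ (a <ᵇ b)
strictlyInc-snoc (c ∷ [])     a b = trans (cong ((c <ᵇ a) ∧_) (strictlyInc-snoc [] a b)) (cong (_∧ (a <ᵇ b)) (sym (∧-identityʳ (c <ᵇ a))))
strictlyInc-snoc (c ∷ e ∷ ms) a b = trans (cong ((c <ᵇ e) ∧_) (strictlyInc-snoc (e ∷ ms) a b)) (sym (∧-assoc (c <ᵇ e) _ _))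

marks : Tableau → List ℕ
marks T = proj₁ (proj₂ T)

module Pieri (ℓ k : ℕ) where
  open Raising ℓ
  open Vertical ℓ
  open Coefficients ℓ

  module _ (x : Sym) where
    term : Tableau → Series
    term T = shs (spinT T) (λ m → ⟪ kschurCoeff k (pad ℓ (inside k T)) m , x ⟫)

    chainSum : ℕ → (List ℕ → Bool) → List ℕ → Series
    chainSum d P κ m = ∑ (chains k d κ) (λ T → ι (P (marks T)) (term T m))

    chainSum-cong : ∀ d {P Q : List ℕ → Bool} κ → (∀ ms → P ms ≡ Q ms) → ∀ m → chainSum d P κ m ≡ chainSum d Q κ m
    chainSum-cong d κ h m = ∑-cong (chains k d κ) (λ T → cong (λ b → ι b (term T m)) (h (marks T)))

    chainSum-∧ : ∀ d P b κ m → chainSum d (λ ms → P ms ∧ b) κ m ≡ ι b (chainSum d P κ m)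
    chainSum-∧ d P b κ m = trans (∑-cong (chains k d κ) (λ T → ι-∧ (P (marks T)) b (term T m))) (ι-∑ b _ (chains k d κ))

    peeled : ℕ → (List ℕ → Bool) → ℕ → List ℕ × ℕ × ℕ → ℤ
    peeled d P m (τ , r , s) = shs s (chainSum d (λ ms → P (ms ++ r ∷ [])) τ) m

    chainSum-suc : ∀ d P κ m → chainSum (suc d) P κ m ≡ ∑ (markedCovers k κ) (peeled d P m)
    chainSum-suc d P κ m = trans (∑-concatMap extend (markedCovers k κ) _) (∑-cong (markedCovers k κ) (λ c → trans
      (∑-map (extend₁ c) (chains k d (proj₁ c)) _)
      (trans (∑-cong (chains k d (proj₁ c)) (λ T → trans (cong (ι (P (marks T ++ proj₁ (proj₂ c) ∷ []))) (shs-+ (spinT T) (proj₂ (proj₂ c)) _ m))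
               (sym (shs-ι (P (marks T ++ proj₁ (proj₂ c) ∷ [])) (proj₂ (proj₂ c)) (term T) m))))
             (sym (shs-∑ (proj₂ (proj₂ c)) (λ T m → ι (P (marks T ++ proj₁ (proj₂ c) ∷ [])) (term T m)) (chains k d (proj₁ c)) m)))))
      where
        extend₁ : List ℕ × ℕ × ℕ → Tableau → Tableau
        extend₁ c T = proj₁ T , marks T ++ (proj₁ (proj₂ c) ∷ []) , spinT T + proj₂ (proj₂ c)
        extend : List ℕ × ℕ × ℕ → List Tableau
        extend c = map (extend₁ c) (chains k d (proj₁ c))

    padded-series : ∀ κ → T (isCoreB (suc k) κ) → length κ ≤ ℓ → ∀ m → ⟪ kschurCoeff k (pad ℓ (𝔭 k κ)) m , x ⟫ ≡ kseries k (nth (𝔭 k κ)) (φ ℓ x) m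
    padded-series κ core len m = trans (kschur-series k (pad ℓ (𝔭 k κ)) padded
        (λ i → subst (_≤ k) (sym (same i)) (≤-pred (Bounded.ceiling (CoreData.bounded-μ (core-data k κ core)) i))) m x)
      (kseries-cong k (φ ℓ x) (φ-alternating ℓ x) (λ i _ → same i) m)
      where
        same : ∀ i → nth (pad ℓ (𝔭 k κ)) i ≡ nth (𝔭 k κ) i
        same = nth-pad (𝔭 k κ) (ℓ ∸ length (𝔭 k κ))
        padded : length (pad ℓ (𝔭 k κ)) ≡ ℓ
        padded = trans (length-++ (𝔭 k κ)) (trans (cong (ℕ._+_ (length (𝔭 k κ))) (length-replicate (ℓ ∸ length (𝔭 k κ))))
          (m+[n∸m]≡n (≤-trans (≤-reflexive (length-𝔭 k κ)) len)))

    sub-alternating : ∀ d z → z ≤ ℓ → Alternating (λ _ → ⊥) (sub d z (φ ℓ x))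
    sub-alternating d z p = record { ext = go d z ; anti = λ _ _ () }
      where
        go : ∀ d z {γ γ'} → (∀ j → j < ℓ → γ j ≡ γ' j) → sub d z (φ ℓ x) γ ≡ sub d z (φ ℓ x) γ'
        go zero    z       h = φ-ext ℓ x h
        go (suc d) zero    h = refl
        go (suc d) (suc z) h = cong₂ ℤ._+_ (go (suc d) z h) (go d z (λ j q → cong (ℤ._- ε z j) (h j q)))

    Hl-0 : ∀ Ψ γ m → Hl (λ _ → + 0) Ψ γ m ≡ + 0
    Hl-0 []      γ zero    = refl
    Hl-0 []      γ (suc m) = refl
    Hl-0 (β ∷ Ψ) γ zero    = Hl-0 Ψ γ zero
    Hl-0 (β ∷ Ψ) γ (suc m) = cong₂ ℤ._+_ (Hl-0 Ψ γ (suc m)) (Hl-0 (β ∷ Ψ) (raiseW β γ) m)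

    -- Strictly increasing marks, all at most z. Marks are counted from 1, so they belong to the
    -- rows in [0, z).
    under : ℕ → List ℕ → Bool
    under z ms = strictlyIncB (ms ++ suc z ∷ [])

    occ-sh : ∀ z rs (f : Series) m → sh (occ z rs f) m ≡ occ z rs (sh f) m
    occ-sh z []       f m       = sh-zero (λ _ → refl) m
    occ-sh z (r ∷ rs) f zero with r ≟ z
    ... | yes _ = refl
    ... | no _  = refl
    occ-sh z (r ∷ rs) f (suc m) with r ≟ z
    ... | yes _ = cong (ℤ._+_ (f m)) (occ-sh z rs f m)
    ... | no _  = occ-sh z rs f m

    occ-∑ : ∀ z rs p (f : Series) m → occ z rs (shs p f) m ≡ ∑ (enumFrom 0 rs) (λ q → ι (proj₂ q ≡ᵇ z) (shs (p + proj₁ q) f m))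
    occ-∑ z []       p f m = refl
    occ-∑ z (r ∷ rs) p f m = trans (head (r ≟ z)) (cong₂ ℤ._+_ (cong (λ b → ι (r ≡ᵇ z) (shs b f m)) (sym (+-identityʳ p)))
        (trans (occ-sh z rs (shs p f) m) (trans (occ-∑ z rs (suc p) f m)
          (trans (∑-cong (enumFrom 0 rs) (λ q → cong (λ b → ι (proj₂ q ≡ᵇ z) (shs b f m)) (sym (+-suc p (proj₁ q))))) (sym (∑-enumFrom-suc 0 rs _))))))
      where
        head : Dec (r ≡ z) → occ z (r ∷ rs) (shs p f) m ≡ ι (r ≡ᵇ z) (shs p f m) ℤ.+ sh (occ z rs (shs p f)) m
        head d with r ≟ z
        head d | yes refl rewrite ≡ᵇ-true r = refl
        head d | no ¬p rewrite ≡ᵇ-false ¬p = sym (ℤ.+-identityˡ _)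

    module AtCore (κ : List ℕ) (core : T (isCoreB (suc k) κ)) (len : length κ ≤ ℓ) where
      open StrongCovers k κ core ℓ (λ i p → nth-beyond κ i (≤-trans len p)) hiding (κ) public
      open CoreData D using (bounded-μ)
      open Cover D ℓ (λ i p → nth-beyond κ i (≤-trans len p)) using (μ-finite; inside-ℓ)
      open Rows bounded-μ
      open Expansion bounded-μ μ-finite

      ∑-covers-cong : ∀ {f g : List ℕ × ℕ × ℕ → ℤ} → (∀ {w} (G : Good w) r s → r < ℓ → f (lowered G , suc r , s) ≡ g (lowered G , suc r , s)) →
        ∑ (markedCovers k κ) f ≡ ∑ (markedCovers k κ) g
      ∑-covers-cong {f} {g} h = trans (∑-markedCovers f) (trans (∑-cong (upTo ℓ) (λ w → at (verdict w))) (sym (∑-markedCovers g)))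
        where
          at : ∀ {w} (V : Verdict w) → overRow f V ≡ overRow g V
          at (absent _)    = refl
          at {w} (is G) = ∑-cong-∈ (enumFrom 0 (Good.rows G)) (λ {p} m → h G (proj₂ p) _
            (≤-<-trans (ups-≤ (Good.runner G) (enumFrom-∈ 0 (Good.rows G) m)) (inside-ℓ w (Good.positive G))))

      lowered-length : ∀ {w} (G : Good w) → length (lowered G) ≤ ℓ
      lowered-length G = ≤-trans (Lowered.lowered-length G) len

      markedAt : ℕ → ℕ → ℕ → List ℕ × ℕ × ℕ → ℤ
      markedAt d z m (τ , r , s) = ι (r ≡ᵇ suc z) (shs s (kseries k (nth (𝔭 k τ)) (sub d z (φ ℓ x))) m)

      occ-covers : ∀ d z → z ≤ ℓ → ∀ m → ∑ (upTo ℓ) (λ w → occ z (rowsOf w) (value (newH (sub d z (φ ℓ x))) w) m) ≡ ∑ (markedCovers k κ) (markedAt d z m)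
      occ-covers d z p m = trans (∑-cong (upTo ℓ) at) (sym (∑-markedCovers (markedAt d z m)))
        where
          ψ : Weight → ℤ
          ψ = sub d z (φ ℓ x)
          Value : ∀ {w} → Verdict w → Series → Set
          Value (is G)  f = ∀ m → f m ≡ shs (length (Good.rows G) * Good.extra G) (newH ψ G) m
          Value (absent _) f = ∀ m → f m ≡ + 0
          value-verdict : ∀ w → Value (verdict w) (value (newH ψ) w)
          value-verdict w with verdict w
          ... | is G  = λ m → refl
          ... | absent _ = λ m → refl
          by : ∀ {w} (V : Verdict w) f → Value V f → occ z (rowsOf w) f m ≡ overRow (markedAt d z m) V
          by {w} (absent _) f h = occ-zero z (rowsOf w) (λ _ → h) m
          by {w} (is G)  f h with proj₁ (ups-functional (upsOf w) (Good.runner G)) | proj₂ (ups-functional (upsOf w) (Good.runner G))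
          ... | _ | e = trans (cong (λ rs → occ z rs f m) e) (trans (occ-cong z (Good.rows G) h m) (trans (occ-∑ z (Good.rows G) (length (Good.rows G) * Good.extra G) (newH ψ G) m)
            (∑-cong (enumFrom 0 (Good.rows G)) (λ q → cong (ι (proj₂ q ≡ᵇ z)) (shs-cong (length (Good.rows G) * Good.extra G + proj₁ q) (λ m → sym (kseries-cong k ψ (sub-alternating d z p) (λ i _ → Lowered.lowered-𝔭 G i) m)) m)))))
          at : ∀ w → occ z (rowsOf w) (value (newH ψ) w) m ≡ overRow (markedAt d z m) (verdict w)
          at w = by (verdict w) (value (newH ψ) w) (value-verdict w)

    -- Subsets of [0, z) correspond to tableaux with all marks at most z. Passing to z + 1 adds the
    -- subsets with largest row z on one side and the tableaux with last mark z + 1 on the other;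
    -- once this mark is peeled off, the induction hypothesis for d and the same z applies to the
    -- smaller core.
    vertical : ∀ d z → z ≤ ℓ → ∀ κ → T (isCoreB (suc k) κ) → length κ ≤ ℓ → ∀ m → kseries k (nth (𝔭 k κ)) (sub d z (φ ℓ x)) m ≡ chainSum d (under z) κ m
    vertical zero    z       p κ core len m = trans (sym (padded-series κ core len m)) (sym (ℤ.+-identityʳ _))
    vertical (suc d) zero    p κ core len m = trans (Hl-0 (roots (bottom k (nth (𝔭 k κ)))) (λ i → + nth (𝔭 k κ) i) m) (sym (trans (chainSum-suc d (under 0) κ m) (trans
      (∑-covers-cong (λ G r s _ → trans (shs-cong s (λ m → trans (chainSum-cong d (lowered G) (λ ms → strictlyInc-snoc ms (suc r) 1) m) (chainSum-∧ d (under r) false (lowered G) m)) m) (shs-zero s (λ _ → refl) m))) (∑-0 (markedCovers k κ)))))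
      where open AtCore κ core len
    vertical (suc d) (suc z) p κ core len m = trans
      (Expansion.vertical-step (CoreData.bounded-μ (core-data k κ core)) (Cover.μ-finite (core-data k κ core) ℓ (λ i q → nth-beyond κ i (≤-trans len q)))
        (φ-alternating ℓ x) (λ h → φ-ext ℓ x (λ j _ → h j)) (φ-vanishing ℓ x) d z p m)
      (trans (cong₂ ℤ._+_ (trans (vertical (suc d) z (<⇒≤ p) κ core len m) (chainSum-suc d (under z) κ m)) (occ-covers d z (<⇒≤ p) m))
      (trans (sym (∑-+ (peeled d (under z) m) (markedAt d z m) (markedCovers k κ))) (trans (∑-covers-cong (λ G r s _ → compare G r s)) (sym (chainSum-suc d (under (suc z)) κ m)))))
      where
        open AtCore κ core len
        capped : ∀ τ r s b → peeled d (under b) m (τ , suc r , s) ≡ ι (r <ᵇ b) (shs s (chainSum d (under r) τ) m)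
        capped τ r s b = trans (shs-cong s (λ m → trans (chainSum-cong d τ (λ ms → strictlyInc-snoc ms (suc r) (suc b)) m) (chainSum-∧ d (under r) (r <ᵇ b) τ m)) m)
          (shs-ι (r <ᵇ b) s (chainSum d (under r) τ) m)
        compare : ∀ {w} (G : _) r s → peeled d (under z) m (lowered {w} G , suc r , s) ℤ.+ markedAt d z m (lowered G , suc r , s) ≡ peeled d (under (suc z)) m (lowered G , suc r , s)
        compare G r s = trans (cong (ℤ._+ markedAt d z m (lowered G , suc r , s)) (capped (lowered G) r s z)) (trans by-order (sym (capped (lowered G) r s (suc z))))
          where
            X : ℤ
            X = shs s (chainSum d (under r) (lowered G)) m
            by-order : ι (r <ᵇ z) X ℤ.+ markedAt d z m (lowered G , suc r , s) ≡ ι (r <ᵇ suc z) X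
            by-order with <-cmp r z
            ... | tri< a ¬b _ rewrite <ᵇ-true a | ≡ᵇ-false ¬b | <ᵇ-true (m<n⇒m<1+n a) = ℤ.+-identityʳ X
            ... | tri> _ ¬b c rewrite <ᵇ-false (<⇒≤ c) | ≡ᵇ-false ¬b | <ᵇ-false c = refl
            ... | tri≈ _ refl _ rewrite <ᵇ-false (≤-refl {r}) | ≡ᵇ-true r | <ᵇ-true (n<1+n r) = trans (ℤ.+-identityˡ _)
              (shs-cong s (vertical d z (<⇒≤ p) (lowered G) (Lowered.lowered-isCore G) (lowered-length G)) m)

  e-perp-kschur : ∀ x d κ → T (isCoreB (suc k) κ) → length κ ≤ ℓ → ∀ m → ⟪ kschurCoeff k (pad ℓ (𝔭 k κ)) m , eSym d ⊗ x ⟫ ≡ chainSum x d strictlyIncB κ m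
  e-perp-kschur x d κ core len m = trans (padded-series (eSym d ⊗ x) κ core len m) (trans (Hl-φ (φ-eSym ℓ d x) (roots (bottom k (nth (𝔭 k κ)))) (λ i → + nth (𝔭 k κ) i) m)
    (trans (vertical x d ℓ ≤-refl κ core len m) (uncap d)))
    where
      open AtCore x κ core len
      uncap : ∀ d → chainSum x d (under x ℓ) κ m ≡ chainSum x d strictlyIncB κ m
      uncap zero    = refl
      uncap (suc d) = trans (chainSum-suc x d (under x ℓ) κ m) (trans (∑-covers-cong (λ G r s p → shs-cong s (λ m → chainSum-cong x d (lowered G)
        (λ ms → trans (strictlyInc-snoc ms (suc r) (suc ℓ)) (trans (cong (strictlyIncB (ms ++ suc r ∷ []) ∧_) (<ᵇ-true (s≤s p))) (∧-identityʳ _))) m) m))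
        (sym (chainSum-suc x d strictlyIncB κ m)))

-- From the vertical rule to the horizontal rule

pairing-unit : ∀ f u y → (∀ F → ev u F ≡ F []) → ⟪ f , u ⊗ y ⟫ ≡ ⟪ f , y ⟫
pairing-unit f u y h = trans (pairing≡ev f (u ⊗ y)) (trans (ev-cong f (λ p → trans (ev-⊗ u y (mc p)) (h _))) (sym (pairing≡ev f y)))

ev-h₀ : ∀ F → ev (hh (+ 0)) F ≡ F []
ev-h₀ F = trans (ℤ.+-identityʳ _) (ℤ.*-identityˡ (F []))

ev-e₀ : ∀ F → ev (eSym 0) F ≡ F []
ev-e₀ F = trans (ev-lit (+ 1) F) (ℤ.*-identityˡ (F []))

take-++ : ∀ (ms ns : List ℕ) → take (length ms) (ms ++ ns) ≡ ms
take-++ []       ns = refl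
take-++ (a ∷ ms) ns = cong (a ∷_) (take-++ ms ns)

drop-++ : ∀ (ms ns : List ℕ) → List.drop (length ms) (ms ++ ns) ≡ ns
drop-++ []       ns = refl
drop-++ (a ∷ ms) ns = drop-++ ms ns

≤ᵇ-not-<ᵇ : ∀ a b → (b ≤ᵇ a) ≡ not (a <ᵇ b)
≤ᵇ-not-<ᵇ a b = by (a <? b)
  where
    by : Dec (a < b) → (b ≤ᵇ a) ≡ not (a <ᵇ b)
    by (yes p) = trans (≤ᵇ-false p) (sym (cong not (<ᵇ-true p)))
    by (no ¬p) = trans (≤ᵇ-true (≮⇒≥ ¬p)) (sym (cong not (<ᵇ-false (≮⇒≥ ¬p))))

-- A word that decreases weakly up to position s + 1 and increases strictly after it.
hookWord : ℕ → ℕ → List ℕ → Bool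
hookWord a b ms = weaklyDecB (take a ms) ∧ strictlyIncB (List.drop b ms)

bend : ∀ s ms → suc (suc s) ≤ length ms → ∃ λ q →
  weaklyDecB (take (suc (suc s)) ms) ≡ weaklyDecB (take (suc s) ms) ∧ not q × strictlyIncB (List.drop s ms) ≡ q ∧ strictlyIncB (List.drop (suc s) ms)
bend zero    (a ∷ b ∷ ms) p = (a <ᵇ b) , trans (∧-identityʳ (b ≤ᵇ a)) (≤ᵇ-not-<ᵇ a b) , refl
bend zero    (a ∷ [])     (s≤s ())
bend (suc s) (c ∷ [])     (s≤s ())
bend (suc s) (c ∷ a ∷ ms) (s≤s p) with bend s (a ∷ ms) p
... | q , e , e' = q , trans (cong ((a ≤ᵇ c) ∧_) e) (sym (∧-assoc (a ≤ᵇ c) _ (not q))) , e'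

-- Either the word bends up or it bends down at the entry s + 1.
hookWord-bend : ∀ s ms t → suc (suc s) ≤ length ms →
  ι (hookWord (suc s) (suc s) ms) t ≡ ι (hookWord (suc s) s ms) t ℤ.+ ι (hookWord (suc (suc s)) (suc s) ms) t
hookWord-bend s ms t p with bend s ms p
... | q , e , e' = trans (cases (weaklyDecB (take (suc s) ms)) q (strictlyIncB (List.drop (suc s) ms)))
        (cong₂ (λ a b → ι (weaklyDecB (take (suc s) ms) ∧ a) t ℤ.+ ι (b ∧ strictlyIncB (List.drop (suc s) ms)) t) (sym e') (sym e))
  where
    cases : ∀ w q i → ι (w ∧ i) t ≡ ι (w ∧ (q ∧ i)) t ℤ.+ ι ((w ∧ not q) ∧ i) t
    cases false q     i     = refl
    cases true  true  true  = sym (ℤ.+-identityʳ t)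
    cases true  true  false = refl
    cases true  false true  = sym (ℤ.+-identityˡ t)
    cases true  false false = refl

signed : ℕ → ℤ → ℤ
signed zero    a = a
signed (suc j) a = ℤ.- signed j a

signed-injective : ∀ j a → signed j a ≡ + 0 → a ≡ + 0
signed-injective zero    a e = e
signed-injective (suc j) a e = signed-injective j a (ℤ.neg-injective e)

hookWord-full : ∀ s ms → length ms ≡ suc s → hookWord (suc s) s ms ≡ weaklyDecB ms
hookWord-full zero    (a ∷ [])     e = refl
hookWord-full (suc s) (c ∷ a ∷ ms) e = trans (∧-assoc (a ≤ᵇ c) _ _) (cong ((a ≤ᵇ c) ∧_) (hookWord-full s (a ∷ ms) (suc-injective e)))

hookWord-start : ∀ ms → hookWord 1 0 ms ≡ strictlyIncB ms
hookWord-start []       = refl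
hookWord-start (a ∷ ms) = refl

module Horizontal (ℓ k : ℕ) where
  open Pieri ℓ k

  IsCore : List ℕ → Set
  IsCore κ = T (isCoreB (suc k) κ) × length κ ≤ ℓ

  markedCovers-core : ∀ κ {c} → IsCore κ → c ∈ markedCovers k κ → IsCore (proj₁ c)
  markedCovers-core κ (_ , len) m with find (∈-concatMap⁻ (λ τ → map (λ C → τ , topRow C , spin κ τ (topRow C)) (components κ τ)) {xs = filterB (λ τ → isStrongCoverB k τ κ) (subPartitions κ)} m)
  ... | τ , τ∈ , m' with ∈-map⁻ _ m'
  ...   | _ , _ , refl = let (sub , t) = filterB-∈⁻ (λ τ → isStrongCoverB k τ κ) (subPartitions κ) τ∈ in
    ∧-fst t , ≤-trans (proj₁ (proj₂ (subPartitions-∈⁻ κ sub))) len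

  extend : List ℕ × ℕ × ℕ → Tableau → Tableau
  extend c T = proj₁ T , marks T ++ (proj₁ (proj₂ c) ∷ []) , spinT T + proj₂ (proj₂ c)

  chains-∈⁻ : ∀ d κ {T} → T ∈ chains k (suc d) κ → ∃ λ c → ∃ λ T' → c ∈ markedCovers k κ × T' ∈ chains k d (proj₁ c) × T ≡ extend c T'
  chains-∈⁻ d κ m with find (∈-concatMap⁻ (λ c → map (extend c) (chains k d (proj₁ c))) {xs = markedCovers k κ} m)
  ... | c , c∈ , m' with ∈-map⁻ (extend c) m'
  ...   | T' , T'∈ , e = c , T' , c∈ , T'∈ , e

  chains-core : ∀ d κ {T} → IsCore κ → T ∈ chains k d κ → IsCore (proj₁ T)
  chains-core zero    κ I (here refl) = I
  chains-core (suc d) κ I m with chains-∈⁻ d κ m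
  ... | c , T' , c∈ , T'∈ , refl = chains-core d (proj₁ c) (markedCovers-core κ I c∈) T'∈

  chains-length : ∀ d κ {T} → T ∈ chains k d κ → length (marks T) ≡ d
  chains-length zero    κ (here refl) = refl
  chains-length (suc d) κ m with chains-∈⁻ d κ m
  ... | c , T' , _ , T'∈ , refl = trans (length-++ (marks T')) (trans (+-comm _ 1) (cong suc (chains-length d (proj₁ c) T'∈)))

  join : Tableau → Tableau → Tableau
  join T' T = proj₁ T' , marks T' ++ marks T , spinT T' + spinT T

  ∑-chains-suc : ∀ d κ (g : Tableau → ℤ) → ∑ (chains k (suc d) κ) g ≡ ∑ (markedCovers k κ) (λ c → ∑ (chains k d (proj₁ c)) (λ T → g (extend c T)))
  ∑-chains-suc d κ g = trans (∑-concatMap (λ c → map (extend c) (chains k d (proj₁ c))) (markedCovers k κ) g)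
    (∑-cong (markedCovers k κ) (λ c → ∑-map (extend c) (chains k d (proj₁ c)) g))

  ∑-chains-+ : ∀ a b κ (g : Tableau → ℤ) → ∑ (chains k (b + a) κ) g ≡ ∑ (chains k b κ) (λ T → ∑ (chains k a (proj₁ T)) (λ T' → g (join T' T)))
  ∑-chains-+ a zero    κ g = trans (∑-cong (chains k a κ) (λ T' → cong g (cong₂ (λ u v → proj₁ T' , u , v) (sym (++-identityʳ (marks T'))) (sym (+-identityʳ (spinT T'))))))
    (sym (ℤ.+-identityʳ _))
  ∑-chains-+ a (suc b) κ g = trans (∑-chains-suc (b + a) κ g) (trans (∑-cong (markedCovers k κ) (λ c → trans (∑-chains-+ a b (proj₁ c) (λ T → g (extend c T)))
    (∑-cong (chains k b (proj₁ c)) (λ T → ∑-cong (chains k a (proj₁ T)) (λ T' → cong g (cong₂ (λ u v → proj₁ T' , u , v)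
      (++-assoc (marks T') (marks T) (proj₁ (proj₂ c) ∷ [])) (+-assoc (spinT T') (spinT T) (proj₂ (proj₂ c)))))))))
    (sym (∑-chains-suc b κ (λ T → ∑ (chains k a (proj₁ T)) (λ T' → g (join T' T))))))

  kschur : List ℕ → ℕ → Sym
  kschur κ m = kschurCoeff k (pad ℓ (𝔭 k κ)) m

  HPieri : ℕ → Set
  HPieri d = ∀ x κ → IsCore κ → ∀ m → ⟪ kschur κ m , hh (+ d) ⊗ x ⟫ ≡ chainSum x d weaklyDecB κ m

  -- e_b^⊥ acts before h_a^⊥ and accounts for the outer covers. Marks are listed from the inside
  -- out, so the weakly decreasing part of the word precedes the strictly increasing one.
  mixed : ∀ a b → HPieri a → ∀ x κ → IsCore κ → ∀ m →
    ⟪ kschur κ m , eSym b ⊗ (hh (+ a) ⊗ x) ⟫ ≡ ∑ (chains k (b + a) κ) (λ T → ι (hookWord a a (marks T)) (term x T m))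
  mixed a b H x κ I m = trans (e-perp-kschur (hh (+ a) ⊗ x) b κ (proj₁ I) (proj₂ I) m)
    (trans (∑-cong-∈ (chains k b κ) (λ {T} T∈ → step T (chains-core b κ I T∈))) (sym (∑-chains-+ a b κ _)))
    where
      step : ∀ T → IsCore (proj₁ T) → ι (strictlyIncB (marks T)) (term (hh (+ a) ⊗ x) T m) ≡
        ∑ (chains k a (proj₁ T)) (λ T' → ι (hookWord a a (marks T' ++ marks T)) (term x (join T' T) m))
      step T I' = trans (cong (ι (strictlyIncB (marks T))) (trans (shs-cong (spinT T) (H x (proj₁ T) I') m) (shs-∑ (spinT T) (λ T' m → ι (weaklyDecB (marks T')) (term x T' m)) (chains k a (proj₁ T)) m)))
        (trans (sym (ι-∑ (strictlyIncB (marks T)) _ (chains k a (proj₁ T)))) (∑-cong-∈ (chains k a (proj₁ T)) (λ {T'} T'∈ →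
          trans (cong (ι (strictlyIncB (marks T))) (trans (shs-ι (weaklyDecB (marks T')) (spinT T) (term x T') m) (cong (ι (weaklyDecB (marks T'))) (sym (shs-+ (spinT T') (spinT T) _ m)))))
            (trans (sym (ι-∧ (weaklyDecB (marks T')) (strictlyIncB (marks T)) _)) (cong₂ (λ u v → ι (weaklyDecB u ∧ strictlyIncB v) (term x (join T' T) m))
              (sym (subst (λ n → take n (marks T' ++ marks T) ≡ marks T') (chains-length a (proj₁ T) T'∈) (take-++ (marks T') (marks T))))
              (sym (subst (λ n → List.drop n (marks T' ++ marks T) ≡ marks T) (chains-length a (proj₁ T) T'∈) (drop-++ (marks T') (marks T)))))))))

  module Invert (d : ℕ) (H : ∀ s → s ≤ d → HPieri s) (x : Sym) (κ : List ℕ) (I : IsCore κ) (m : ℕ) where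
    hooks : ℕ → ℕ → ℤ
    hooks a b = ∑ (chains k (suc d) κ) (λ T → ι (hookWord a b (marks T)) (term x T m))

    defect : ℤ
    defect = ⟪ kschur κ m , hh (+ suc d) ⊗ x ⟫ ℤ.- chainSum x (suc d) weaklyDecB κ m

    -- By `hookWord-bend` every product e_{j} h_{s+1} counts two kinds of hook words, and one of
    -- them cancels against the next product. The last product, e_0 h_{d+1}, is the one not covered
    -- by the induction hypothesis and leaves the signed `defect`.
    alternating-sum : ∀ s j → j + s ≡ d → altHE (kschur κ m) x s j ≡ hooks (suc s) s ℤ.+ signed j defect
    alternating-sum s zero    refl = trans (pairing-unit (kschur κ m) (eSym 0) (hh (+ suc d) ⊗ x) ev-e₀)
      (lia 0 3 (λ u w h → h := w ⇒ u := h :+ (u :- w)) ⟪ kschur κ m , hh (+ suc d) ⊗ x ⟫ (chainSum x (suc d) weaklyDecB κ m) (hooks (suc d) d)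
        (∑-cong-∈ (chains k (suc d) κ) (λ {T} T∈ → cong (λ b → ι b (term x T m)) (hookWord-full d (marks T) (chains-length (suc d) κ T∈)))))
    alternating-sum s (suc j) e = lia 0 6 (λ u v p q r h → u := r ⇒ r := p :+ q ⇒ v := q :+ h ⇒ u :- v := p :+ (:- h))
      ⟪ kschur κ m , eSym (suc j) ⊗ (hh (+ suc s) ⊗ x) ⟫ (altHE (kschur κ m) x (suc s) j) (hooks (suc s) s) (hooks (suc (suc s)) (suc s)) (hooks (suc s) (suc s)) (signed j defect)
      (trans (mixed (suc s) (suc j) (H (suc s) (≤-trans (m≤n+m (suc s) j) (≤-reflexive e'))) x κ I m)
        (cong (λ n → ∑ (chains k n κ) (λ T → ι (hookWord (suc s) (suc s) (marks T)) (term x T m))) (cong suc e')))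
      (trans (∑-cong-∈ (chains k (suc d) κ) (λ {T} T∈ → hookWord-bend s (marks T) (term x T m)
          (≤-trans (s≤s (≤-trans (m≤n+m (suc s) j) (≤-reflexive e'))) (≤-reflexive (sym (chains-length (suc d) κ T∈))))))
        (∑-+ (λ T → ι (hookWord (suc s) s (marks T)) (term x T m)) (λ T → ι (hookWord (suc (suc s)) (suc s) (marks T)) (term x T m)) (chains k (suc d) κ)))
      (alternating-sum (suc s) j e')
      where
        e' : j + suc s ≡ d
        e' = trans (+-suc j s) e

    -- At s = 0 the alternating sum is e_{d+1}, and the remaining hook words are the strictly
    -- increasing ones; so the vertical rule forces the defect to vanish.
    no-defect : ⟪ kschur κ m , hh (+ suc d) ⊗ x ⟫ ≡ chainSum x (suc d) weaklyDecB κ m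
    no-defect = ℤ.i-j≡0⇒i≡j _ _ (signed-injective d defect (lia 0 4 (λ u v h e → v := u ⇒ u := h :+ e ⇒ v := h ⇒ e := (:- h) :+ h)
      (altHE (kschur κ m) x 0 d) ⟪ kschur κ m , eSym (suc d) ⊗ x ⟫ (hooks 1 0) (signed d defect)
      (e-by-h x (kschur κ m) d) (alternating-sum 0 d (+-identityʳ d))
      (trans (e-perp-kschur x (suc d) κ (proj₁ I) (proj₂ I) m) (∑-cong (chains k (suc d) κ) (λ T → cong (λ b → ι b (term x T m)) (sym (hookWord-start (marks T))))))
      ⟨ trans ⟩ ℤ.+-inverseˡ (hooks 1 0)))

  horizontal : ∀ N d → d ≤ N → HPieri d
  horizontal N       zero    p x κ I m = trans (pairing-unit (kschur κ m) (hh (+ 0)) x ev-h₀) (sym (ℤ.+-identityʳ _))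
  horizontal (suc N) (suc d) p x κ I m = Invert.no-defect d (λ s q → horizontal N s (≤-trans q (≤-pred p))) x κ I m

  pieriRHS-chainSum : ∀ P d κ m x → pieriRHS ℓ k (filterB (λ T → P (marks T)) (chains k d κ)) m x ≡ chainSum x d P κ m
  pieriRHS-chainSum P d κ m x = trans (sumℤ-map _ (filterB (λ T → P (marks T)) (chains k d κ))) (trans (∑-filterB (λ T → P (marks T)) (chains k d κ) _)
    (∑-cong (chains k d κ) (λ T → cong (ι (P (marks T))) (sym (shs-if (spinT T) _ m)))))

inPar⁻ : ∀ k ℓ μ → T (InParB k ℓ μ) → length μ ≡ ℓ × Antitone (nth μ) × (∀ i → nth μ i ≤ k)
inPar⁻ k ℓ μ t = ≡ᵇ⇒≡ (length μ) ℓ (∧-fst t) , weaklyDec⁻ μ (∧-fst t') , bounded-by μ (∧-snd {weaklyDecB μ} t')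
  where
    t' : T (weaklyDecB μ ∧ all (λ a → a ≤ᵇ k) μ)
    t' = ∧-snd {length μ ≡ᵇ ℓ} t
    bounded-by : ∀ xs → T (all (λ a → a ≤ᵇ k) xs) → ∀ i → nth xs i ≤ k
    bounded-by []       t i       = z≤n
    bounded-by (x ∷ xs) t zero    = ≤ᵇ⇒≤ x k (∧-fst t)
    bounded-by (x ∷ xs) t (suc i) = bounded-by xs (∧-snd {x ≤ᵇ k} t) i

length-pad : ∀ ℓ xs → length (pad ℓ xs) ≡ ℓ → length xs ≤ ℓ
length-pad ℓ xs e = ≤-trans (m≤m+n (length xs) (length (replicate (ℓ ∸ length xs) 0))) (≤-reflexive (trans (sym (length-++ xs)) e))

theorem2p3 : (ℓ : ℕ) → 1 ≤ ℓ → (k : ℕ) → 1 ≤ k → (μ : List ℕ) → T (InParB k ℓ μ) →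
    -- (1) horizontal dual Pieri rule (κ is the (k+1)-core with 𝔭(κ) = μ)
    ((κ : List ℕ) → T (isCoreB (suc k) κ) → pad ℓ (𝔭 k κ) ≡ μ →
      (d m : ℕ) (x : Sym) →
        ⟪ kschurCoeff k μ m , hh (+ d) ⊗ x ⟫ ≡ pieriRHS ℓ k (SMT k d κ) m x)
    ×
    -- (2) vertical dual Pieri rule
    ((κ : List ℕ) → T (isCoreB (suc k) κ) → pad ℓ (𝔭 k κ) ≡ μ →
      (d m : ℕ) (x : Sym) →
        ⟪ kschurCoeff k μ m , eSym d ⊗ x ⟫ ≡ pieriRHS ℓ k (VSMT k d κ) m x)
    ×
    -- (3) shift invariance  𝔰^{(k)}_μ = e_ℓ^⊥ 𝔰^{(k+1)}_{μ + 1^ℓ}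
    ((m : ℕ) (x : Sym) →
        ⟪ kschurCoeff k μ m , x ⟫ ≡ ⟪ kschurCoeff (suc k) (map suc μ) m , eSym ℓ ⊗ x ⟫)
    ×
    -- (4) Schur function stability
    (size μ ≤ k →
        ((x : Sym) → ⟪ kschurCoeff k μ 0 , x ⟫ ≡ ⟪ schur (map +_ μ) , x ⟫)
      × ((m : ℕ) (x : Sym) → ⟪ kschurCoeff k μ (suc m) , x ⟫ ≡ + 0))
theorem2p3 ℓ _ k _ μ t = let (len , A , bound) = inPar⁻ k ℓ μ t in
  (λ { κ core refl d m x → trans (horizontal d d ≤-refl x κ (core , core-length κ len) m) (sym (pieriRHS-chainSum weaklyDecB d κ m x)) }) ,
  (λ { κ core refl d m x → trans (e-perp-kschur x d κ core (core-length κ len) m) (sym (pieriRHS-chainSum strictlyIncB d κ m x)) }) ,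
  shift-invariance k μ len bound ,
  λ small → (λ x → proj₁ (stability k μ len bound A small x)) , (λ m x → proj₂ (stability k μ len bound A small x) m)
  where
    open Horizontal ℓ k
    open Pieri ℓ k using (e-perp-kschur)
    open Coefficients ℓ using (shift-invariance; stability)
    core-length : ∀ κ → length (pad ℓ (𝔭 k κ)) ≡ ℓ → length κ ≤ ℓ
    core-length κ e = ≤-trans (≤-reflexive (sym (length-𝔭 k κ))) (length-pad ℓ (𝔭 k κ) e)
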